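{- Let $p$ be a prime, $n\geq 2$, $1\leq k\leq n-1$, and $t\geq 1$ an integer with $t\leq \frac38p+1$. Let $\mathcal{B}$ be a minimal weighted $t$-fold $k$-blocking set of $\mathrm{PG}(n,p)$ with $|\mathcal{B}|\leq (t+\frac12)p^k-\frac12$. Then $\mathcal{B}$ is the weighted union of $t$ not necessarily distinct $k$-dimensional subspaces, i.e., there are $k$-dimensional subspaces $S_1,\dots,S_t$ (repetitions allowed) such that the weight of every point $P$ equals the number of indices $i$ with $P\in S_i$.
   Context: A weighted point set of $\mathrm{PG}(n,p)$ is a function $w$ from the points to the nonnegative integers; its size is $|\mathcal{B}|=\sum_P w(P)$, and for a subspace $U$, $|U\cap\mathcal{B}|=\sum_{P\in U}w(P)$. A weighted $t$-fold $k$-blocking set is a weighted point set such that every $(n-k)$-dimensional subspace $U$ satisfies $|U\cap\mathcal{B}|\geq t$. It is minimal if decreasing the weight of any point of positive weight yields a weighted point set that is no longer a weighted $t$-fold $k$-blocking set. Dimensions are projective. -}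

module Defs where

open import Data.Nat using (ℕ; zero; suc; _+_; _*_; _∸_; _^_; _≤_; _<_; NonZero)
open import Data.Nat.DivMod using (_mod_)
open import Data.Fin using (Fin; toℕ)
open import Data.Fin.Properties using () renaming (_≟_ to _≟ᶠ_)
open import Data.Vec using (Vec; []; _∷_; replicate)
open import Data.Vec.Properties using (≡-dec)
open import Data.List using (List; []; _∷_; map; concatMap; allFin; _++_)
open import Data.Nat.ListAction using (sum)
open import Data.List.Relation.Unary.Any using (Any; any?)
open import Data.Product using (_×_)
open import Data.Sum using (_⊎_)
open import Relation.Binary.PropositionalEquality using (_≡_)
open import Relation.Nullary using (¬_; does; Dec)
open import Data.Bool using (if_then_else_)

module _ (p : ℕ) .{{_ : NonZero p}} where

  F : Set
  F = Fin p

  0F : F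
  0F = 0 mod p

  1F : F
  1F = 1 mod p

  _+F_ : F → F → F
  a +F b = (toℕ a + toℕ b) mod p

  _*F_ : F → F → F
  a *F b = (toℕ a * toℕ b) mod p

  vadd : ∀ {m} → Vec F m → Vec F m → Vec F m
  vadd [] [] = []
  vadd (x ∷ xs) (y ∷ ys) = (x +F y) ∷ vadd xs ys

  vscale : ∀ {m} → F → Vec F m → Vec F m
  vscale c [] = []
  vscale c (x ∷ xs) = (c *F x) ∷ vscale c xs

  lincomb : ∀ {m d} → Vec (Vec F m) d → Vec F d → Vec F m
  lincomb [] [] = replicate _ 0F
  lincomb (g ∷ gs) (c ∷ cs) = vadd (vscale c g) (lincomb gs cs)

  allVecs : (m : ℕ) → List (Vec F m)
  allVecs zero = [] ∷ []
  allVecs (suc m) = concatMap (λ x → map (x ∷_) (allVecs m)) (allFin p)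

  -- Points of PG(m-1,p) are represented by their normalised coordinate
  -- vectors in F^m: nonzero, with first nonzero coordinate equal to 1.
  Normalised : ∀ {m} → Vec F m → Set
  Normalised [] = ⊥'
    where open import Data.Empty renaming (⊥ to ⊥')
  Normalised (x ∷ v) = (x ≡ 1F) ⊎ ((x ≡ 0F) × Normalised v)

  points : (m : ℕ) → List (Vec F m)
  points zero = []
  points (suc m) = map (1F ∷_) (allVecs m) ++ map (0F ∷_) (points m)

  LinIndep : ∀ {m d} → Vec (Vec F m) d → Set
  LinIndep {m} {d} gs = ∀ (c : Vec F d) → lincomb gs c ≡ replicate m 0F → c ≡ replicate d 0F

  -- a projective subspace of projective dimension d in PG(n,p) is given by
  -- d+1 linearly independent generators in F^(n+1); membership = in the span
  InSpan : ∀ {m d} → Vec (Vec F m) d → Vec F m → Set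
  InSpan {m} {d} gs P = Any (λ c → lincomb gs c ≡ P) (allVecs d)

  inSpan? : ∀ {m d} (gs : Vec (Vec F m) d) (P : Vec F m) → Dec (InSpan gs P)
  inSpan? {m} {d} gs P = any? (λ c → ≡-dec _≟ᶠ_ (lincomb gs c) P) (allVecs d)

  -- weighted point sets of PG(n,p): weights on (normalised) coordinate vectors
  WPS : ℕ → Set
  WPS n = Vec F (suc n) → ℕ

  size : ∀ n → WPS n → ℕ
  size n w = sum (map w (points (suc n)))

  weightIn : ∀ n {d} → WPS n → Vec (Vec F (suc n)) d → ℕ
  weightIn n w U = sum (map (λ P → if does (inSpan? U P) then w P else 0) (points (suc n)))

  IsBlocking : ∀ n (k t : ℕ) → WPS n → Set
  IsBlocking n k t w = ∀ (U : Vec (Vec F (suc n)) (suc (n ∸ k))) → LinIndep U → t ≤ weightIn n w U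

  decrease : ∀ n → WPS n → Vec F (suc n) → WPS n
  decrease n w P Q = if does (≡-dec _≟ᶠ_ P Q) then w Q ∸ 1 else w Q

  IsMinimalBlocking : ∀ n (k t : ℕ) → WPS n → Set
  IsMinimalBlocking n k t w =
    IsBlocking n k t w ×
    (∀ P → Normalised P → 0 < w P → ¬ IsBlocking n k t (decrease n w P))

  multiplicity : ∀ {m d t} → Vec (Vec (Vec F m) d) t → Vec F m → ℕ
  multiplicity [] P = 0
  multiplicity (S ∷ Ss) P = (if does (inSpan? S P) then 1 else 0) + multiplicity Ss P

-- Proof idea. If 2t < p fails, the trivial lower bound t (p^(k+1) - 1)/(p - 1) already contradicts the size,
-- so let 2t < p. Consider first n = k + 1, where lines have to be blocked. Embed F_p^k into the domain
-- K = F_p[Z]; the product of the linear polynomials over K dual to the points vanishes to order t on a grid, so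
-- by the punctured Nullstellensatz of Ball and Serra it is a sum of terms L(X)^i L(Y)^j G_i, i + j = t, with
-- G_i of low degree. What the product has beyond multiplicity t along a fibre divides its own derivative, so
-- these multiplicities vanish modulo p, and a counting argument of Kakeya type extends this to all lines:
-- each meets B in t points modulo p. The excesses of the lines through a point of B form a
-- blocking set of the quotient space; by induction on k it contains a subspace, which lifts to a hyperplane
-- contained in B. Removing it lowers t by one. For larger n, hyperplanes and projections from points off B
-- reduce to this case: the number of subspaces contained in a subspace X has to be the integer part of
-- |B ∩ X| / p^k, so the pieces found in different hyperplanes fit together. The resulting sum of t
-- subspaces is dominated by B and is itself a t-fold blocking set, so by minimality it is B.
module Submission where

open import Algebra.Bundles using (CommutativeRing)
open import Algebra.Structures using (IsCommutativeRing)
import Algebra.Properties.Monoid.Mult as Mult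
open import Data.Empty using (⊥-elim)
import Data.Fin as Fin
open import Data.List as List using (List; []; _∷_; map; length; _++_; filter)
open import Data.List.Membership.Propositional using (_∈_)
open import Data.List.Membership.Propositional.Properties using (∈-filter⁺; ∈-filter⁻)
open import Data.List.Properties using (length-map)
open import Data.List.Relation.Binary.Permutation.Propositional as ↭ using (_↭_; ↭-sym)
open import Data.List.Relation.Binary.Permutation.Propositional.Properties using (shift; ∈-resp-↭)
open import Data.List.Relation.Unary.All as All using ([]; _∷_)
import Data.List.Relation.Unary.All.Properties as All
open import Data.List.Relation.Unary.AllPairs as AllPairs using (AllPairs; []; _∷_)
import Data.List.Relation.Unary.AllPairs.Properties as AllPairs
open import Data.List.Relation.Unary.Any using (Any; here; there)
open import Data.List.Relation.Unary.Unique.Propositional using (Unique)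
open import Data.Nat as ℕ using (ℕ; zero; suc; _≤_; _<_; z≤n; s≤s)
open import Data.Nat.Divisibility using (_∣_; divides)
import Data.Nat.Properties as ℕₚ
open import Data.Product using (_,_; Σ; ∃; ∃₂; _×_; proj₁; proj₂; uncurry)
open import Data.Sum using (_⊎_; inj₁; inj₂)
open import Data.Unit using (⊤; tt)
open import Data.Vec as Vec using (Vec; []; _∷_)
open import Data.Vec.Properties using (lookup-map)
open import Data.Vec.Relation.Unary.All using ([]; _∷_) renaming (All to VAll)
open import Level using (0ℓ)
open import Relation.Nullary using (¬_; Dec; yes; no; ¬?; _×-dec_)
open import Relation.Unary using (Pred; Decidable)
import Relation.Binary.PropositionalEquality as ≡
open ≡ using (_≡_)

-- Write `q = p ^ k`. The bound on the size says that the excess of `B` over `t q` is below `q / 2`.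
-- This half is used twice: fewer than half of the `q` lines of a family through a point are
-- exceptional, so two exceptional sets never cover the family; and a remainder whose degree is at
-- most twice the excess has more fibres to vanish on than its degree. The slopes of the lines stay
-- in F_p, so an F_p-linear embedding of F_p^k into a domain is enough: polynomials in Z of degree
-- below k serve, and no field of order q has to be constructed. The derivative only sees
-- multiplicities modulo p. This suffices because a line contained in `B` has at least p + 1 > t
-- elements, hence at least t + p, and losing its p + 1 points leaves t - 1. Subsets, quotients and
-- hyperplane sections of a minimal set need not be minimal. All intermediate statements therefore
-- claim only that a sum of subspaces is dominated by `B`; where tangents are needed, one passes to
-- a subset in which every element lies in a blocked subspace of weight exactly t.

-- Ring homomorphisms and univariate polynomials

record Hom (R S : CommutativeRing 0ℓ 0ℓ) : Set where
  private
    module R = CommutativeRing R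
    module S = CommutativeRing S
  field
    ⟦_⟧ : R.Carrier → S.Carrier
    ⟦⟧-cong : ∀ {x y} → x R.≈ y → ⟦ x ⟧ S.≈ ⟦ y ⟧
    +-hom : ∀ x y → ⟦ x R.+ y ⟧ S.≈ ⟦ x ⟧ S.+ ⟦ y ⟧
    *-hom : ∀ x y → ⟦ x R.* y ⟧ S.≈ ⟦ x ⟧ S.* ⟦ y ⟧
    0-hom : ⟦ R.0# ⟧ S.≈ S.0#
    1-hom : ⟦ R.1# ⟧ S.≈ S.1#

module Polynomials (R : CommutativeRing 0ℓ 0ℓ) where

  open CommutativeRing R renaming (Carrier to A)
  open import Algebra.Properties.Ring ring using (-0#≈0#)
  open import Algebra.Solver.Ring.NaturalCoefficients.Default commutativeSemiring
    using (solve; _:=_; _:+_; _:*_; con)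
  open import Relation.Binary.Reasoning.Setoid setoid

  Poly : Set
  Poly = List A

  coeff : Poly → ℕ → A
  coeff [] _ = 0#
  coeff (a ∷ f) zero = a
  coeff (a ∷ f) (suc i) = coeff f i

  infix 4 _≋_
  -- Lists may end in zeros, so polynomials are compared coefficient by coefficient.
  record _≋_ (f g : Poly) : Set where
    constructor mk
    field at : ∀ i → coeff f i ≈ coeff g i
  open _≋_ public

  ≋-refl : ∀ {f} → f ≋ f
  ≋-refl .at i = refl

  ≋-sym : ∀ {f g} → f ≋ g → g ≋ f
  ≋-sym e .at i = sym (e .at i)

  ≋-trans : ∀ {f g h} → f ≋ g → g ≋ h → f ≋ h
  ≋-trans e e' .at i = trans (e .at i) (e' .at i)

  infixl 6 _⊞_
  infixl 7 _⊠_

  _⊞_ : Poly → Poly → Poly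
  [] ⊞ g = g
  (a ∷ f) ⊞ [] = a ∷ f
  (a ∷ f) ⊞ (b ∷ g) = (a + b) ∷ (f ⊞ g)

  scal : A → Poly → Poly
  scal a = map (a *_)

  neg : Poly → Poly
  neg = map (-_)

  _⊠_ : Poly → Poly → Poly
  [] ⊠ g = []
  (a ∷ f) ⊠ g = scal a g ⊞ (0# ∷ (f ⊠ g))

  coeff-⊞ : ∀ f g i → coeff (f ⊞ g) i ≈ coeff f i + coeff g i
  coeff-⊞ [] g i = sym (+-identityˡ _)
  coeff-⊞ (a ∷ f) [] i = sym (+-identityʳ _)
  coeff-⊞ (a ∷ f) (b ∷ g) zero = refl
  coeff-⊞ (a ∷ f) (b ∷ g) (suc i) = coeff-⊞ f g i

  coeff-scal : ∀ a f i → coeff (scal a f) i ≈ a * coeff f i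
  coeff-scal a [] i = sym (zeroʳ a)
  coeff-scal a (b ∷ f) zero = refl
  coeff-scal a (b ∷ f) (suc i) = coeff-scal a f i

  coeff-neg : ∀ f i → coeff (neg f) i ≈ - coeff f i
  coeff-neg [] i = sym -0#≈0#
  coeff-neg (b ∷ f) zero = refl
  coeff-neg (b ∷ f) (suc i) = coeff-neg f i

  ⊞-cong : ∀ {f f' g g'} → f ≋ f' → g ≋ g' → f ⊞ g ≋ f' ⊞ g'
  ⊞-cong {f} {f'} {g} {g'} e e' .at i =
    trans (coeff-⊞ f g i) (trans (+-cong (e .at i) (e' .at i)) (sym (coeff-⊞ f' g' i)))

  ⊞-assoc : ∀ f g h → (f ⊞ g) ⊞ h ≋ f ⊞ (g ⊞ h)
  ⊞-assoc f g h .at i = begin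
    coeff ((f ⊞ g) ⊞ h) i ≈⟨ coeff-⊞ (f ⊞ g) h i ⟩
    coeff (f ⊞ g) i + coeff h i ≈⟨ +-congʳ (coeff-⊞ f g i) ⟩
    (coeff f i + coeff g i) + coeff h i ≈⟨ +-assoc _ _ _ ⟩
    coeff f i + (coeff g i + coeff h i) ≈⟨ +-congˡ (coeff-⊞ g h i) ⟨
    coeff f i + coeff (g ⊞ h) i ≈⟨ coeff-⊞ f (g ⊞ h) i ⟨
    coeff (f ⊞ (g ⊞ h)) i ∎

  ⊞-comm : ∀ f g → f ⊞ g ≋ g ⊞ f
  ⊞-comm f g .at i = trans (coeff-⊞ f g i) (trans (+-comm _ _) (sym (coeff-⊞ g f i)))

  ⊞-identityʳ : ∀ f → f ⊞ [] ≋ f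
  ⊞-identityʳ f .at i = trans (coeff-⊞ f [] i) (+-identityʳ _)

  ⊞-neg : ∀ f → f ⊞ neg f ≋ []
  ⊞-neg f .at i = trans (coeff-⊞ f (neg f) i) (trans (+-congˡ (coeff-neg f i)) (-‿inverseʳ _))

  neg-cong : ∀ {f g} → f ≋ g → neg f ≋ neg g
  neg-cong {f} {g} e .at i = trans (coeff-neg f i) (trans (-‿cong (e .at i)) (sym (coeff-neg g i)))

  scal-cong : ∀ {a b f g} → a ≈ b → f ≋ g → scal a f ≋ scal b g
  scal-cong {a} {b} {f} {g} e e' .at i =
    trans (coeff-scal a f i) (trans (*-cong e (e' .at i)) (sym (coeff-scal b g i)))

  ∷-cong : ∀ {a b f g} → a ≈ b → f ≋ g → (a ∷ f) ≋ (b ∷ g)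
  ∷-cong e e' .at zero = e
  ∷-cong e e' .at (suc i) = e' .at i

  scal-⊞ : ∀ a f g → scal a (f ⊞ g) ≋ scal a f ⊞ scal a g
  scal-⊞ a f g .at i = begin
    coeff (scal a (f ⊞ g)) i ≈⟨ coeff-scal a (f ⊞ g) i ⟩
    a * coeff (f ⊞ g) i ≈⟨ *-congˡ (coeff-⊞ f g i) ⟩
    a * (coeff f i + coeff g i) ≈⟨ distribˡ _ _ _ ⟩
    a * coeff f i + a * coeff g i ≈⟨ +-cong (coeff-scal a f i) (coeff-scal a g i) ⟨
    coeff (scal a f) i + coeff (scal a g) i ≈⟨ coeff-⊞ (scal a f) (scal a g) i ⟨
    coeff (scal a f ⊞ scal a g) i ∎

  scal-scal : ∀ a b f → scal a (scal b f) ≋ scal (a * b) f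
  scal-scal a b f .at i = begin
    coeff (scal a (scal b f)) i ≈⟨ coeff-scal a (scal b f) i ⟩
    a * coeff (scal b f) i ≈⟨ *-congˡ (coeff-scal b f i) ⟩
    a * (b * coeff f i) ≈⟨ *-assoc _ _ _ ⟨
    (a * b) * coeff f i ≈⟨ coeff-scal (a * b) f i ⟨
    coeff (scal (a * b) f) i ∎

  scal-0 : ∀ f → scal 0# f ≋ []
  scal-0 f .at i = trans (coeff-scal 0# f i) (zeroˡ _)

  scal-1 : ∀ f → scal 1# f ≋ f
  scal-1 f .at i = trans (coeff-scal 1# f i) (*-identityˡ _)

  0∷[] : (0# ∷ []) ≋ []
  0∷[] .at zero = refl
  0∷[] .at (suc i) = refl

  0∷-⊞ : ∀ f g → (0# ∷ (f ⊞ g)) ≋ (0# ∷ f) ⊞ (0# ∷ g)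
  0∷-⊞ f g = ∷-cong (sym (+-identityˡ _)) ≋-refl

  private
    interchange : ∀ f g h k → (f ⊞ g) ⊞ (h ⊞ k) ≋ (f ⊞ h) ⊞ (g ⊞ k)
    interchange f g h k .at i = begin
      coeff ((f ⊞ g) ⊞ (h ⊞ k)) i ≈⟨ c4 f g h k ⟩
      (coeff f i + coeff g i) + (coeff h i + coeff k i)
        ≈⟨ solve 4 (λ a b c d → (a :+ b) :+ (c :+ d) := (a :+ c) :+ (b :+ d)) refl _ _ _ _ ⟩
      (coeff f i + coeff h i) + (coeff g i + coeff k i) ≈⟨ c4 f h g k ⟨
      coeff ((f ⊞ h) ⊞ (g ⊞ k)) i ∎
      where
        c4 : ∀ f g h k → coeff ((f ⊞ g) ⊞ (h ⊞ k)) i ≈ (coeff f i + coeff g i) + (coeff h i + coeff k i)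
        c4 f g h k = trans (coeff-⊞ (f ⊞ g) (h ⊞ k) i) (+-cong (coeff-⊞ f g i) (coeff-⊞ h k i))

  ⊠-congʳ : ∀ f {g h} → g ≋ h → f ⊠ g ≋ f ⊠ h
  ⊠-congʳ [] e = ≋-refl
  ⊠-congʳ (a ∷ f) e = ⊞-cong (scal-cong refl e) (∷-cong refl (⊠-congʳ f e))

  ⊠-zeroʳ : ∀ f → f ⊠ [] ≋ []
  ⊠-zeroʳ [] = ≋-refl
  ⊠-zeroʳ (a ∷ f) = ≋-trans (∷-cong refl (⊠-zeroʳ f)) 0∷[]

  -- The recursion of the product read in its second argument; commutativity is the agreement of the
  -- two recursions.
  ⊠-∷ : ∀ f b g → f ⊠ (b ∷ g) ≋ scal b f ⊞ (0# ∷ (f ⊠ g))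
  ⊠-∷ [] b g = ≋-sym 0∷[]
  ⊠-∷ (a ∷ f) b g = ∷-cong (+-congʳ (*-comm a b))
    (≋-trans (⊞-cong (≋-refl {scal a g}) (⊠-∷ f b g))
      (≋-trans (≋-sym (⊞-assoc (scal a g) (scal b f) _))
        (≋-trans (⊞-cong (⊞-comm (scal a g) (scal b f)) ≋-refl) (⊞-assoc (scal b f) (scal a g) _))))

  ⊠-comm : ∀ f g → f ⊠ g ≋ g ⊠ f
  ⊠-comm [] g = ≋-sym (⊠-zeroʳ g)
  ⊠-comm (a ∷ f) g =
    ≋-trans (⊞-cong (≋-refl {scal a g}) (∷-cong refl (⊠-comm f g))) (≋-sym (⊠-∷ g a f))

  ⊠-cong : ∀ {f f' g g'} → f ≋ f' → g ≋ g' → f ⊠ g ≋ f' ⊠ g'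
  ⊠-cong {f} {f'} {g} {g'} e e' =
    ≋-trans (⊠-congʳ f e') (≋-trans (⊠-comm f g') (≋-trans (⊠-congʳ g' e) (⊠-comm g' f')))

  ⊠-distribˡ : ∀ f g h → f ⊠ (g ⊞ h) ≋ f ⊠ g ⊞ f ⊠ h
  ⊠-distribˡ [] g h = ≋-refl
  ⊠-distribˡ (a ∷ f) g h = ≋-trans
    (⊞-cong (scal-⊞ a g h) (≋-trans (∷-cong refl (⊠-distribˡ f g h)) (0∷-⊞ (f ⊠ g) (f ⊠ h))))
    (interchange (scal a g) (scal a h) (0# ∷ (f ⊠ g)) (0# ∷ (f ⊠ h)))

  ⊠-distribʳ : ∀ f g h → (g ⊞ h) ⊠ f ≋ g ⊠ f ⊞ h ⊠ f
  ⊠-distribʳ f g h = ≋-trans (⊠-comm (g ⊞ h) f)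
    (≋-trans (⊠-distribˡ f g h) (⊞-cong (⊠-comm f g) (⊠-comm f h)))

  scal-⊠ : ∀ a f g → scal a f ⊠ g ≋ scal a (f ⊠ g)
  scal-⊠ a [] g = ≋-refl
  scal-⊠ a (b ∷ f) g = ≋-trans
    (⊞-cong (≋-sym (scal-scal a b g)) (∷-cong (sym (zeroʳ a)) (scal-⊠ a f g)))
    (≋-sym (scal-⊞ a (scal b g) (0# ∷ (f ⊠ g))))

  0∷-⊠ : ∀ f g → (0# ∷ f) ⊠ g ≋ (0# ∷ (f ⊠ g))
  0∷-⊠ f g = ⊞-cong (scal-0 g) ≋-refl

  ⊠-assoc : ∀ f g h → (f ⊠ g) ⊠ h ≋ f ⊠ (g ⊠ h)
  ⊠-assoc [] g h = ≋-refl
  ⊠-assoc (a ∷ f) g h = ≋-trans (⊠-distribʳ h (scal a g) (0# ∷ (f ⊠ g)))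
    (⊞-cong (scal-⊠ a g h) (≋-trans (0∷-⊠ (f ⊠ g) h) (∷-cong refl (⊠-assoc f g h))))

  ⊠-identityˡ : ∀ f → (1# ∷ []) ⊠ f ≋ f
  ⊠-identityˡ f = ≋-trans (⊞-cong (scal-1 f) 0∷[]) (⊞-identityʳ f)

  -- Abstract, so that iterated polynomial rings are compared by name and not by their proofs.
  abstract
    isCommutativeRing-poly : IsCommutativeRing _≋_ _⊞_ _⊠_ neg [] (1# ∷ [])
    isCommutativeRing-poly = record
      { isRing = record
        { +-isAbelianGroup = record
          { isGroup = record
            { isMonoid = record
              { isSemigroup = record
                { isMagma = record
                  { isEquivalence = record { refl = ≋-refl ; sym = ≋-sym ; trans = ≋-trans }
                  ; ∙-cong = ⊞-cong }
                ; assoc = ⊞-assoc }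
              ; identity = (λ f → ≋-refl) , ⊞-identityʳ }
            ; inverse = (λ f → ≋-trans (⊞-comm (neg f) f) (⊞-neg f)) , ⊞-neg
            ; ⁻¹-cong = neg-cong }
          ; comm = ⊞-comm }
        ; *-cong = ⊠-cong
        ; *-assoc = ⊠-assoc
        ; *-identity = ⊠-identityˡ , λ f → ≋-trans (⊠-comm f _) (⊠-identityˡ f)
        ; distrib = ⊠-distribˡ , ⊠-distribʳ }
      ; *-comm = ⊠-comm }

  polyRing : CommutativeRing 0ℓ 0ℓ
  polyRing = record
    { Carrier = Poly ; _≈_ = _≋_ ; _+_ = _⊞_ ; _*_ = _⊠_ ; -_ = neg ; 0# = [] ; 1# = 1# ∷ []
    ; isCommutativeRing = isCommutativeRing-poly }

  const : A → Poly
  const a = a ∷ []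

  X : Poly
  X = 0# ∷ 1# ∷ []

  constHom : Hom R polyRing
  constHom = record
    { ⟦_⟧ = const
    ; ⟦⟧-cong = λ e → ∷-cong e ≋-refl
    ; +-hom = λ x y → ≋-refl
    ; *-hom = λ x y → ∷-cong (sym (+-identityʳ _)) ≋-refl
    ; 0-hom = 0∷[]
    ; 1-hom = ≋-refl }

  const-⊠ : ∀ a f → const a ⊠ f ≋ scal a f
  const-⊠ a f = ≋-trans (⊞-cong ≋-refl 0∷[]) (⊞-identityʳ (scal a f))

-- Coefficients travel along `φ` while the variable goes to `s`. Nested twice, this gives every
-- substitution into polynomials in two variables.
module Evaluation {R S : CommutativeRing 0ℓ 0ℓ} (φ : Hom R S)
                  (s : CommutativeRing.Carrier S) where

  open Polynomials R
  private module R = CommutativeRing R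
  open CommutativeRing S
  open Hom φ
  open import Algebra.Solver.Ring.NaturalCoefficients.Default commutativeSemiring
    using (solve; _:=_; _:+_; _:*_; con)
  open import Relation.Binary.Reasoning.Setoid setoid

  ev : Poly → Carrier
  ev [] = 0#
  ev (a ∷ f) = ⟦ a ⟧ + s * ev f

  private
    ev-zero : ∀ f → f ≋ [] → ev f ≈ 0#
    ev-zero [] e = refl
    ev-zero (a ∷ f) e = begin
      ⟦ a ⟧ + s * ev f ≈⟨ +-cong (trans (⟦⟧-cong (e .at 0)) 0-hom) (*-congˡ (ev-zero f (mk λ i → e .at (suc i)))) ⟩
      0# + s * 0# ≈⟨ trans (+-identityˡ _) (zeroʳ s) ⟩
      0# ∎

  ev-cong : ∀ {f g} → f ≋ g → ev f ≈ ev g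
  ev-cong {[]} {g} e = sym (ev-zero g (≋-sym e))
  ev-cong {a ∷ f} {[]} e = ev-zero (a ∷ f) e
  ev-cong {a ∷ f} {b ∷ g} e =
    +-cong (⟦⟧-cong (e .at 0)) (*-congˡ (ev-cong {f} {g} (mk λ i → e .at (suc i))))

  ev-⊞ : ∀ f g → ev (f ⊞ g) ≈ ev f + ev g
  ev-⊞ [] g = sym (+-identityˡ _)
  ev-⊞ (a ∷ f) [] = sym (+-identityʳ _)
  ev-⊞ (a ∷ f) (b ∷ g) = begin
    ⟦ a R.+ b ⟧ + s * ev (f ⊞ g) ≈⟨ +-cong (+-hom a b) (*-congˡ (ev-⊞ f g)) ⟩
    (⟦ a ⟧ + ⟦ b ⟧) + s * (ev f + ev g)
      ≈⟨ solve 5 (λ a b s f g → (a :+ b) :+ s :* (f :+ g) := (a :+ s :* f) :+ (b :+ s :* g)) refl _ _ _ _ _ ⟩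
    (⟦ a ⟧ + s * ev f) + (⟦ b ⟧ + s * ev g) ∎

  ev-scal : ∀ a f → ev (scal a f) ≈ ⟦ a ⟧ * ev f
  ev-scal a [] = sym (zeroʳ _)
  ev-scal a (b ∷ f) = begin
    ⟦ a R.* b ⟧ + s * ev (scal a f) ≈⟨ +-cong (*-hom a b) (*-congˡ (ev-scal a f)) ⟩
    ⟦ a ⟧ * ⟦ b ⟧ + s * (⟦ a ⟧ * ev f)
      ≈⟨ solve 4 (λ a b s f → a :* b :+ s :* (a :* f) := a :* (b :+ s :* f)) refl _ _ _ _ ⟩
    ⟦ a ⟧ * (⟦ b ⟧ + s * ev f) ∎

  ev-⊠ : ∀ f g → ev (f ⊠ g) ≈ ev f * ev g
  ev-⊠ [] g = sym (zeroˡ _)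
  ev-⊠ (a ∷ f) g = begin
    ev (scal a g ⊞ (R.0# ∷ (f ⊠ g))) ≈⟨ ev-⊞ (scal a g) _ ⟩
    ev (scal a g) + (⟦ R.0# ⟧ + s * ev (f ⊠ g))
      ≈⟨ +-cong (ev-scal a g) (trans (+-congʳ 0-hom) (trans (+-identityˡ _) (*-congˡ (ev-⊠ f g)))) ⟩
    ⟦ a ⟧ * ev g + s * (ev f * ev g)
      ≈⟨ solve 4 (λ a s f g → a :* g :+ s :* (f :* g) := (a :+ s :* f) :* g) refl _ _ _ _ ⟩
    (⟦ a ⟧ + s * ev f) * ev g ∎

  ev-const : ∀ a → ev (const a) ≈ ⟦ a ⟧
  ev-const a = trans (+-congˡ (zeroʳ s)) (+-identityʳ _)

  evHom : Hom polyRing S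
  evHom = record
    { ⟦_⟧ = ev ; ⟦⟧-cong = ev-cong ; +-hom = ev-⊞ ; *-hom = ev-⊠ ; 0-hom = refl
    ; 1-hom = trans (ev-const R.1#) 1-hom }

idHom : (R : CommutativeRing 0ℓ 0ℓ) → Hom R R
idHom R = record { ⟦_⟧ = λ x → x ; ⟦⟧-cong = λ e → e ; +-hom = λ _ _ → refl ; *-hom = λ _ _ → refl
                 ; 0-hom = refl ; 1-hom = refl }
  where open CommutativeRing R

-- Domains, degrees, division with remainder, derivatives and roots

record IsDomain (R : CommutativeRing 0ℓ 0ℓ) : Set where
  open CommutativeRing R
  field
    zero? : ∀ x → Dec (x ≈ 0#)
    no-zero-divisors : ∀ x y → x * y ≈ 0# → x ≈ 0# ⊎ y ≈ 0#
    1≉0 : ¬ (1# ≈ 0#)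

-- P s N a stands for s + deg a ≤ N; carrying s avoids truncated subtraction in quotients.
record Filtration (R : CommutativeRing 0ℓ 0ℓ) : Set₁ where
  open CommutativeRing R
  field
    P : ℕ → ℕ → Carrier → Set
    P-cong : ∀ {s N a b} → a ≈ b → P s N a → P s N b
    P-0 : ∀ {s N} → P s N 0#
    P-1 : P 0 0 1#
    P-+ : ∀ {s N a b} → P s N a → P s N b → P s N (a + b)
    P-neg : ∀ {s N a} → P s N a → P s N (- a)
    P-* : ∀ {s N s' N' a b} → P s N a → P s' N' b → P (s ℕ.+ s') (N ℕ.+ N') (a * b)
    P-up : ∀ {s N a} → P s N a → P (suc s) (suc N) a
    P-down : ∀ {s N a} → P (suc s) (suc N) a → P s N a
    P-weaken : ∀ {s N a} → P (suc s) N a → P s N a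

  P-down* : ∀ n {s N a} → P (n ℕ.+ s) (N ℕ.+ n) a → P s N a
  P-down* zero {s} {N} {a} p = ≡.subst (λ M → P s M a) (ℕₚ.+-identityʳ N) p
  P-down* (suc n) {s} {N} {a} p =
    P-down* n (P-down (≡.subst (λ M → P (suc (n ℕ.+ s)) M a) (ℕₚ.+-suc N n) p))

module Degrees (R : CommutativeRing 0ℓ 0ℓ) where

  open Polynomials R
  open CommutativeRing R renaming (Carrier to A)
  open import Algebra.Properties.Monoid.Mult +-monoid using () renaming (_×_ to _·_; ×-congʳ to ·-congʳ)
  open import Relation.Binary.Reasoning.Setoid setoid

  module PR = CommutativeRing polyRing

  record Deg< (n : ℕ) (f : Poly) : Set where
    constructor mkDeg
    field vanish : ∀ i → n ≤ i → coeff f i ≈ 0#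
  open Deg< public

  deg-cong : ∀ {n f g} → f ≋ g → Deg< n f → Deg< n g
  deg-cong e d .vanish i n≤i = trans (sym (e .at i)) (d .vanish i n≤i)

  deg0 : ∀ {f} → Deg< 0 f → f ≋ []
  deg0 d .at i = d .vanish i z≤n

  deg-length : ∀ f → Deg< (length f) f
  deg-length [] .vanish i _ = refl
  deg-length (a ∷ f) .vanish (suc i) (s≤s l) = deg-length f .vanish i l

  deg-⊞ : ∀ {n f g} → Deg< n f → Deg< n g → Deg< n (f ⊞ g)
  deg-⊞ {n} {f} {g} d e .vanish i l = trans (coeff-⊞ f g i) (trans (+-cong (d .vanish i l) (e .vanish i l)) (+-identityˡ _))

  deg-neg : ∀ {n f} → Deg< n f → Deg< n (neg f)
  deg-neg {n} {f} d .vanish i l = trans (coeff-neg f i) (trans (-‿cong (d .vanish i l)) -0#≈0#)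
    where open import Algebra.Properties.Ring ring using (-0#≈0#)

  deg-mono : ∀ {m n f} → m ≤ n → Deg< m f → Deg< n f
  deg-mono m≤n d .vanish i l = d .vanish i (ℕₚ.≤-trans m≤n l)

  deg-tail : ∀ {n a f} → Deg< (suc n) (a ∷ f) → Deg< n f
  deg-tail d .vanish i l = d .vanish (suc i) (s≤s l)

  deg-∷ : ∀ {n a f} → Deg< n f → Deg< (suc n) (a ∷ f)
  deg-∷ d .vanish (suc i) (s≤s l) = d .vanish i l

  deg-⊠ : ∀ m n f g → Deg< m f → Deg< (suc n) g → Deg< (m ℕ.+ n) (f ⊠ g)
  deg-⊠ zero n f g d e .vanish i l = ⊠-cong {f} {[]} {g} {g} (deg0 d) ≋-refl .at i
  deg-⊠ (suc m) n [] g d e .vanish i l = refl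
  deg-⊠ (suc m) n (a ∷ f) g d e .vanish (suc i) (s≤s l) = begin
    coeff (scal a g ⊞ (0# ∷ (f ⊠ g))) (suc i) ≈⟨ coeff-⊞ (scal a g) _ (suc i) ⟩
    coeff (scal a g) (suc i) + coeff (f ⊠ g) i
      ≈⟨ +-cong (trans (coeff-scal a g (suc i)) (trans (*-congˡ (e .vanish (suc i) (s≤s (ℕₚ.≤-trans (ℕₚ.m≤n+m n m) l)))) (zeroʳ a)))
                (deg-⊠ m n f g (deg-tail d) e .vanish i l) ⟩
    0# + 0# ≈⟨ +-identityˡ _ ⟩
    0# ∎

  coeff-top : ∀ m n f g → Deg< (suc m) f → Deg< (suc n) g →
              coeff (f ⊠ g) (m ℕ.+ n) ≈ coeff f m * coeff g n
  coeff-top m n [] g d e = sym (zeroˡ _)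
  coeff-top zero n (a ∷ f) g d e = begin
    coeff (scal a g ⊞ (0# ∷ (f ⊠ g))) n ≈⟨ coeff-⊞ (scal a g) _ n ⟩
    coeff (scal a g) n + coeff (0# ∷ (f ⊠ g)) n
      ≈⟨ +-cong (coeff-scal a g n) (≋-trans (∷-cong refl (⊠-cong {f} {[]} {g} {g} (deg0 (deg-tail d)) ≋-refl)) 0∷[] .at n) ⟩
    a * coeff g n + 0# ≈⟨ +-identityʳ _ ⟩
    a * coeff g n ∎
  coeff-top (suc m) n (a ∷ f) g d e = begin
    coeff (scal a g ⊞ (0# ∷ (f ⊠ g))) (suc m ℕ.+ n) ≈⟨ coeff-⊞ (scal a g) _ (suc m ℕ.+ n) ⟩
    coeff (scal a g) (suc m ℕ.+ n) + coeff (f ⊠ g) (m ℕ.+ n)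
      ≈⟨ +-cong (trans (coeff-scal a g _) (trans (*-congˡ (e .vanish _ (s≤s (ℕₚ.m≤n+m n m)))) (zeroʳ a)))
                (coeff-top m n f g (deg-tail d) e) ⟩
    0# + coeff f m * coeff g n ≈⟨ +-identityˡ _ ⟩
    coeff f m * coeff g n ∎

  record Monic (n : ℕ) (f : Poly) : Set where
    constructor mkMonic
    field
      lead : coeff f n ≈ 1#
      bound : Deg< (suc n) f
  open Monic public

  abstract
    root : A → Poly
    root a = (- a) ∷ 1# ∷ []

    root-def : ∀ a → root a ≋ (- a) ∷ 1# ∷ []
    root-def a = ≋-refl

    root-monic : ∀ a → Monic 1 (root a)
    root-monic a = mkMonic refl (deg-length (root a))

  monic-1 : Monic 0 (1# ∷ [])
  monic-1 = mkMonic refl (deg-length (1# ∷ []))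

  monic-⊠ : ∀ {m n f g} → Monic m f → Monic n g → Monic (m ℕ.+ n) (f ⊠ g)
  monic-⊠ {m} {n} {f} {g} (mkMonic c d) (mkMonic c' d') = mkMonic
    (trans (coeff-top m n f g d d') (trans (*-cong c c') (*-identityˡ _))) (deg-⊠ (suc m) n f g d d')

  -- A monic factor contributes its full degree over any commutative ring: a top coefficient of `q`
  -- reappears unchanged in `g ⊠ q`, so the possible top coefficients of `q` can be struck out one
  -- after the other.
  monic-deg : ∀ {n g} → Monic n g → ∀ {m} q → Deg< (n ℕ.+ m) (g ⊠ q) → Deg< m q
  monic-deg {n} {g} (mkMonic c d) {m} q e = go (length q) (deg-mono (ℕₚ.m≤n+m (length q) m) (deg-length q))
    where
      go : ∀ k → Deg< (m ℕ.+ k) q → Deg< m q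
      go zero h = ≡.subst (λ j → Deg< j q) (ℕₚ.+-identityʳ m) h
      go (suc k) h = go k (mkDeg case)
        where
          h' : Deg< (suc (m ℕ.+ k)) q
          h' = ≡.subst (λ j → Deg< j q) (ℕₚ.+-suc m k) h
          top : coeff q (m ℕ.+ k) ≈ 0#
          top = begin
            coeff q (m ℕ.+ k) ≈⟨ *-identityˡ _ ⟨
            1# * coeff q (m ℕ.+ k) ≈⟨ *-congʳ c ⟨
            coeff g n * coeff q (m ℕ.+ k) ≈⟨ coeff-top n (m ℕ.+ k) g q d h' ⟨
            coeff (g ⊠ q) (n ℕ.+ (m ℕ.+ k)) ≈⟨ e .vanish _ (ℕₚ.+-monoʳ-≤ n (ℕₚ.m≤m+n m k)) ⟩
            0# ∎
          case : ∀ i → m ℕ.+ k ≤ i → coeff q i ≈ 0#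
          case i l with ℕₚ.m≤n⇒m<n∨m≡n l
          ... | inj₁ lt = h' .vanish i lt
          ... | inj₂ ≡.refl = top

  -- Uniqueness of quotient and remainder, stated for the difference of two divisions: `g ⊠ q` would
  -- reach degree `n` unless `q` is zero.
  monic-unique : ∀ {n g} → Monic n g → ∀ q r → g ⊠ q ⊞ r ≋ [] → Deg< n r → q ≋ [] × r ≋ []
  monic-unique {n} {g} mg q r e d = q≋0 , ≋-trans (≋-sym (≋-trans (⊞-cong (≋-trans (⊠-congʳ g q≋0) (⊠-zeroʳ g)) (≋-refl {r})) ≋-refl)) e
    where
      q≋0 : q ≋ []
      q≋0 = deg0 (monic-deg mg q (mkDeg λ i l → begin
        coeff (g ⊠ q) i ≈⟨ +-identityʳ _ ⟨
        coeff (g ⊠ q) i + 0# ≈⟨ +-congˡ (d .vanish i (≡.subst (_≤ i) (ℕₚ.+-identityʳ n) l)) ⟨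
        coeff (g ⊠ q) i + coeff r i ≈⟨ coeff-⊞ (g ⊠ q) r i ⟨
        coeff (g ⊠ q ⊞ r) i ≈⟨ e .at i ⟩
        0# ∎))

  monic-cancel : ∀ {n g} → Monic n g → ∀ q → g ⊠ q ≋ [] → q ≋ []
  monic-cancel {g = g} mg q e =
    proj₁ (monic-unique mg q [] (≋-trans (⊞-identityʳ (g ⊠ q)) e) (mkDeg λ i _ → refl))

  module _ (F : Filtration R) where
    open Filtration F

    -- Total degree on iterated polynomial rings: the coefficient of `X ^ i` carries the offset
    -- `s + i`.
    Q : ℕ → ℕ → Poly → Set
    Q s N [] = ⊤
    Q s N (a ∷ f) = P s N a × Q (suc s) N f

    Q-zero : ∀ {s N} f → f ≋ [] → Q s N f
    Q-zero [] e = tt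
    Q-zero (a ∷ f) e = P-cong (sym (e .at 0)) P-0 , Q-zero f (mk λ i → e .at (suc i))

    Q-cong : ∀ {s N f g} → f ≋ g → Q s N f → Q s N g
    Q-cong {f = []} {g} e q = Q-zero g (≋-sym e)
    Q-cong {f = a ∷ f} {[]} e q = tt
    Q-cong {f = a ∷ f} {b ∷ g} e (p , q) = P-cong (e .at 0) p , Q-cong {f = f} {g} (mk λ i → e .at (suc i)) q

    Q-+ : ∀ {s N} f g → Q s N f → Q s N g → Q s N (f ⊞ g)
    Q-+ [] g _ q = q
    Q-+ (a ∷ f) [] p _ = p
    Q-+ (a ∷ f) (b ∷ g) (p , q) (p' , q') = P-+ p p' , Q-+ f g q q'

    Q-neg : ∀ {s N} f → Q s N f → Q s N (neg f)
    Q-neg [] _ = tt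
    Q-neg (a ∷ f) (p , q) = P-neg p , Q-neg f q

    Q-up : ∀ {s N} f → Q s N f → Q (suc s) (suc N) f
    Q-up [] _ = tt
    Q-up (a ∷ f) (p , q) = P-up p , Q-up f q

    Q-down : ∀ {s N} f → Q (suc s) (suc N) f → Q s N f
    Q-down [] _ = tt
    Q-down (a ∷ f) (p , q) = P-down p , Q-down f q

    Q-weaken : ∀ {s N} f → Q (suc s) N f → Q s N f
    Q-weaken [] _ = tt
    Q-weaken (a ∷ f) (p , q) = P-weaken p , Q-weaken f q

    Q-scal : ∀ {s N s' N'} a g → P s N a → Q s' N' g → Q (s ℕ.+ s') (N ℕ.+ N') (scal a g)
    Q-scal a [] p _ = tt
    Q-scal {s} {N} {s'} {N'} a (b ∷ g) p (p' , q) = P-* p p' ,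
      ≡.subst (λ m → Q m (N ℕ.+ N') (scal a g)) (ℕₚ.+-suc s s') (Q-scal a g p q)

    Q-* : ∀ {s N s' N'} f g → Q s N f → Q s' N' g → Q (s ℕ.+ s') (N ℕ.+ N') (f ⊠ g)
    Q-* [] g _ _ = tt
    Q-* (a ∷ f) g (p , q) q' = Q-+ (scal a g) _ (Q-scal a g p q') (P-0 , Q-* f g q q')

    polyFiltration : Filtration polyRing
    polyFiltration = record
      { P = Q ; P-cong = Q-cong ; P-0 = tt ; P-1 = P-1 , tt
      ; P-+ = λ {s} {N} {f} {g} → Q-+ f g ; P-neg = λ {s} {N} {f} → Q-neg f
      ; P-* = λ {s} {N} {s'} {N'} {f} {g} → Q-* f g ; P-up = λ {s} {N} {f} → Q-up f
      ; P-down = λ {s} {N} {f} → Q-down f ; P-weaken = λ {s} {N} {f} → Q-weaken f }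

    Q-coeff : ∀ {s N} f i → Q s N f → P (i ℕ.+ s) N (coeff f i)
    Q-coeff [] i _ = P-0
    Q-coeff (a ∷ f) zero (p , _) = p
    Q-coeff {s} {N} (a ∷ f) (suc i) (_ , q) =
      ≡.subst (λ m → P m N (coeff f i)) (ℕₚ.+-suc i s) (Q-coeff f i q)

    Q-root : ∀ a → P 0 1 a → Q 0 1 (root a)
    Q-root a p = Q-cong (≋-sym (root-def a)) (P-neg p , P-up P-1 , tt)

    Q-ev : ∀ {s N} b f → P 0 1 b → Q s N f → P s N (Evaluation.ev (idHom R) b f)
    Q-ev b [] _ _ = P-0
    Q-ev {s} {N} b (a ∷ f) pb (p , q) = P-+ p (P-down (P-* pb (Q-ev b f pb q)))

    -- Horner's scheme: divide the tail, and the new remainder `a + X r'` has degree at most `n`, so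
    -- one multiple of `g` removes its top coefficient `ℓ`. Since `ℓ` has offset `n + s` and `g` has
    -- total degree at most `n`, the remainder keeps the bound of `f` and the quotient loses `n`.
    divMod′ : ∀ {n g} → Monic n g → Q 0 n g → ∀ {s N} f → Q s N f →
             ∃₂ λ q r → f ≋ g ⊠ q ⊞ r × Deg< n r × Q (n ℕ.+ s) N q × Q s N r
    divMod′ {n} {g} mg qg [] _ =
      [] , [] , ≋-sym (≋-trans (⊞-identityʳ (g ⊠ [])) (⊠-zeroʳ g)) , mkDeg (λ _ _ → refl) , tt , tt
    divMod′ {n} {g} mg qg {s} {N} (a ∷ f) (p , q)
      with divMod′ mg qg f q
    ... | q' , r' , e , d , Qq , Qr = ℓ ∷ q' , r″ ⊞ neg (scal ℓ g) , eq , deg ,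
        (pℓ , ≡.subst (λ m → Q m N q') (ℕₚ.+-suc n s) Qq) ,
        Q-+ r″ _ (p , Qr) (Q-neg (scal ℓ g) (Filtration.P-down* polyFiltration n (≡.subst (λ m → Q m (N ℕ.+ n) (scal ℓ g)) (ℕₚ.+-identityʳ _) (Q-scal ℓ g pℓ qg))))
      where
        r″ = a ∷ r'
        ℓ = coeff r″ n
        pℓ : P (n ℕ.+ s) N ℓ
        pℓ = Q-coeff {s} {N} r″ n (p , Qr)
        deg : Deg< n (r″ ⊞ neg (scal ℓ g))
        deg .vanish i l with ℕₚ.m≤n⇒m<n∨m≡n l
        ... | inj₁ lt = deg-⊞ {suc n} {r″} {neg (scal ℓ g)} (deg-∷ d)
                (deg-neg {suc n} {scal ℓ g} (mkDeg λ j k → trans (coeff-scal ℓ g j) (trans (*-congˡ (bound mg .vanish j k)) (zeroʳ ℓ))))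
                .vanish i lt
        ... | inj₂ ≡.refl = begin
                coeff (r″ ⊞ neg (scal ℓ g)) n ≈⟨ coeff-⊞ r″ (neg (scal ℓ g)) n ⟩
                ℓ + coeff (neg (scal ℓ g)) n ≈⟨ +-congˡ (trans (coeff-neg (scal ℓ g) n) (-‿cong (trans (coeff-scal ℓ g n) (trans (*-congˡ (lead mg)) (*-identityʳ ℓ))))) ⟩
                ℓ + - ℓ ≈⟨ -‿inverseʳ ℓ ⟩
                0# ∎
        eq : (a ∷ f) ≋ g ⊠ (ℓ ∷ q') ⊞ (r″ ⊞ neg (scal ℓ g))
        eq = ≋-sym (PR.trans (⊞-cong (⊠-∷ g ℓ q') (≋-refl {r″ ⊞ neg (scal ℓ g)}))
               (PR.trans (⊞-cong (⊞-comm (scal ℓ g) (0# ∷ (g ⊠ q'))) (⊞-comm r″ (neg (scal ℓ g))))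
               (PR.trans (⊞-assoc (0# ∷ (g ⊠ q')) (scal ℓ g) (neg (scal ℓ g) ⊞ r″))
               (PR.trans (⊞-cong (≋-refl {0# ∷ (g ⊠ q')}) (PR.trans (≋-sym (⊞-assoc (scal ℓ g) (neg (scal ℓ g)) r″)) (⊞-cong (⊞-neg (scal ℓ g)) (≋-refl {r″}))))
                 (∷-cong (+-identityˡ a) (≋-sym e))))))

    abstract
      divMod : ∀ {n g} → Monic n g → Q 0 n g → ∀ {s N} f → Q s N f →
               ∃₂ λ q r → f ≋ g ⊠ q ⊞ r × Deg< n r × Q (n ℕ.+ s) N q × Q s N r
      divMod = divMod′

  -- The product rule for `a + X f`.
  D : Poly → Poly
  D [] = []
  D (a ∷ f) = f ⊞ (0# ∷ D f)

  coeff-D : ∀ f i → coeff (D f) i ≈ suc i · coeff f (suc i)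
  coeff-D [] i = sym (zeros (suc i))
    where
      zeros : ∀ n → n · 0# ≈ 0#
      zeros zero = refl
      zeros (suc n) = trans (+-identityˡ _) (zeros n)
  coeff-D (a ∷ f) zero = coeff-⊞ f (0# ∷ D f) 0
  coeff-D (a ∷ f) (suc i) = trans (coeff-⊞ f (0# ∷ D f) (suc i)) (+-congˡ (coeff-D f i))

  D-cong : ∀ {f g} → f ≋ g → D f ≋ D g
  D-cong {f} {g} e .at i = trans (coeff-D f i) (trans (·-congʳ (suc i) (e .at (suc i))) (sym (coeff-D g i)))

  D-deg : ∀ {n f} → Deg< (suc n) f → Deg< n (D f)
  D-deg {n} {f} d .vanish i l = trans (coeff-D f i) (trans (·-congʳ (suc i) (d .vanish (suc i) (s≤s l))) (sym (coeff-D [] i)))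

  private
    exch : ∀ f g h k → (f ⊞ g) ⊞ (h ⊞ k) ≋ (f ⊞ h) ⊞ (g ⊞ k)
    exch f g h k = PR.trans (⊞-assoc f g (h ⊞ k)) (PR.trans (⊞-cong (≋-refl {f})
      (PR.trans (≋-sym (⊞-assoc g h k)) (PR.trans (⊞-cong (⊞-comm g h) (≋-refl {k})) (⊞-assoc h g k)))) (≋-sym (⊞-assoc f h (g ⊞ k))))

  D-⊞ : ∀ f g → D (f ⊞ g) ≋ D f ⊞ D g
  D-⊞ [] g = ≋-refl
  D-⊞ (a ∷ f) [] = ≋-sym (⊞-identityʳ _)
  D-⊞ (a ∷ f) (b ∷ g) = PR.trans
    (⊞-cong (≋-refl {f ⊞ g}) (PR.trans (∷-cong refl (D-⊞ f g)) (0∷-⊞ (D f) (D g))))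
    (exch f g (0# ∷ D f) (0# ∷ D g))

  D-scal : ∀ a f → D (scal a f) ≋ scal a (D f)
  D-scal a [] = ≋-refl
  D-scal a (b ∷ f) = PR.trans (⊞-cong ≋-refl (∷-cong (sym (zeroʳ a)) (D-scal a f)))
    (≋-sym (scal-⊞ a f (0# ∷ D f)))

  D-⊠ : ∀ f g → D (f ⊠ g) ≋ D f ⊠ g ⊞ f ⊠ D g
  D-⊠ [] g = ≋-refl
  D-⊠ (a ∷ f) g = PR.trans (D-⊞ (scal a g) (0# ∷ (f ⊠ g)))
    (PR.trans (⊞-cong (D-scal a g) (⊞-cong (≋-refl {f ⊠ g}) (PR.trans (∷-cong refl (D-⊠ f g)) (0∷-⊞ (D f ⊠ g) (f ⊠ D g)))))
    (PR.trans (⊞-cong (≋-refl {scal a (D g)}) (≋-sym (⊞-assoc (f ⊠ g) (0# ∷ (D f ⊠ g)) (0# ∷ (f ⊠ D g)))))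
    (PR.trans (≋-sym (⊞-assoc (scal a (D g)) (f ⊠ g ⊞ (0# ∷ (D f ⊠ g))) (0# ∷ (f ⊠ D g))))
    (PR.trans (⊞-cong (⊞-comm (scal a (D g)) (f ⊠ g ⊞ (0# ∷ (D f ⊠ g)))) (≋-refl {0# ∷ (f ⊠ D g)}))
    (PR.trans (⊞-assoc (f ⊠ g ⊞ (0# ∷ (D f ⊠ g))) (scal a (D g)) (0# ∷ (f ⊠ D g)))
      (⊞-cong (PR.trans (⊞-cong (≋-refl {f ⊠ g}) (≋-sym (0∷-⊠ (D f) g))) (≋-sym (⊠-distribʳ g f (0# ∷ D f)))) ≋-refl))))))

  D-Q : (F : Filtration R) → ∀ {s N} f → Q F s N f → Q F s N (D f)
  D-Q F [] _ = tt
  D-Q F (a ∷ f) (p , q) = Q-+ F f _ (Q-weaken F f q) (Filtration.P-0 F , D-Q F f q)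

  module _ (dom : IsDomain R) where
    open IsDomain dom

    -- A list may carry zeros on top, so its degree is found by testing for zero.
    leading : ∀ f → f ≋ [] ⊎ ∃ λ m → Deg< (suc m) f × ¬ (coeff f m ≈ 0#)
    leading [] = inj₁ ≋-refl
    leading (a ∷ f) with leading f
    ... | inj₂ (m , d , ne) = inj₂ (suc m , deg-∷ d , ne)
    ... | inj₁ e with zero? a
    ...   | yes a≈0 = inj₁ (≋-trans (∷-cong a≈0 e) 0∷[])
    ...   | no a≉0 = inj₂ (0 , deg-∷ (mkDeg λ i _ → e .at i) , a≉0)

    polyDomain : IsDomain polyRing
    polyDomain = record
      { zero? = zr
      ; no-zero-divisors = nzd
      ; 1≉0 = λ e → 1≉0 (e .at 0) }
      where
        zr : ∀ f → Dec (f ≋ [])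
        zr f with leading f
        ... | inj₁ e = yes e
        ... | inj₂ (m , _ , ne) = no λ e → ne (e .at m)
        nzd : ∀ f g → f ⊠ g ≋ [] → f ≋ [] ⊎ g ≋ []
        nzd f g e with leading f | leading g
        ... | inj₁ z | _ = inj₁ z
        ... | inj₂ _ | inj₁ z = inj₂ z
        ... | inj₂ (m , d , ne) | inj₂ (n , d' , ne')
          with no-zero-divisors _ _ (trans (sym (coeff-top m n f g d d')) (e .at (m ℕ.+ n)))
        ...   | inj₁ z = ⊥-elim (ne z)
        ...   | inj₂ z = ⊥-elim (ne' z)

  module Ev (x : A) where
    open Evaluation (idHom R) x public
    ev-root : ∀ a → ev (root a) ≈ x + - a
    ev-root a = begin
      ev (root a) ≈⟨ ev-cong (root-def a) ⟩
      - a + x * (1# + x * 0#) ≈⟨ +-congˡ (trans (*-congˡ (trans (+-congˡ (zeroʳ x)) (+-identityʳ _))) (*-identityʳ x)) ⟩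
      - a + x ≈⟨ +-comm _ _ ⟩
      x + - a ∎

    ev-root-self : ev (root x) ≈ 0#
    ev-root-self = trans (ev-root x) (-‿inverseʳ x)

  open Ev using (ev) public

  -- For divisions in which the degrees of the coefficients do not matter.
  trivialFiltration : Filtration R
  trivialFiltration = record
    { P = λ _ _ _ → ⊤ ; P-cong = λ _ _ → tt ; P-0 = tt ; P-1 = tt ; P-+ = λ _ _ → tt ; P-neg = λ _ → tt
    ; P-* = λ _ _ → tt ; P-up = λ _ → tt ; P-down = λ _ → tt ; P-weaken = λ _ → tt }

  Q-trivial : ∀ {s N} f → Q trivialFiltration s N f
  Q-trivial [] = tt
  Q-trivial (a ∷ f) = tt , Q-trivial f

  factor′ : ∀ x f → ev x f ≈ 0# → ∃ λ q → f ≋ root x ⊠ q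
  factor′ x f e with divMod trivialFiltration (root-monic x) (Q-trivial {0} {1} (root x)) {0} {0} f (Q-trivial {0} {0} f)
  ... | q , r , eq , d , _ = q , ≋-trans eq (≋-trans (⊞-cong (≋-refl {root x ⊠ q}) r≋0) (⊞-identityʳ (root x ⊠ q)))
    where
      open Ev x hiding (ev)
      r≋ : r ≋ const (coeff r 0)
      r≋ .at zero = refl
      r≋ .at (suc i) = d .vanish (suc i) (s≤s z≤n)
      r0 : coeff r 0 ≈ 0#
      r0 = begin
        coeff r 0  ≈⟨ ev-const _ ⟨
        ev x (const (coeff r 0)) ≈⟨ ev-cong r≋ ⟨
        ev x r ≈⟨ +-identityˡ _ ⟨
        0# + ev x r ≈⟨ +-congʳ (trans (ev-⊠ (root x) q) (trans (*-congʳ ev-root-self) (zeroˡ _))) ⟨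
        ev x (root x ⊠ q) + ev x r ≈⟨ ev-⊞ (root x ⊠ q) r ⟨
        ev x (root x ⊠ q ⊞ r) ≈⟨ ev-cong eq ⟨
        ev x f ≈⟨ e ⟩
        0# ∎
      r≋0 : r ≋ []
      r≋0 = ≋-trans r≋ (≋-trans (∷-cong r0 ≋-refl) 0∷[])

  abstract
    factor : ∀ x f → ev x f ≈ 0# → ∃ λ q → f ≋ root x ⊠ q
    factor = factor′

  Distinct : List A → Set
  Distinct = AllPairs (λ x y → ¬ (x ≈ y))

  sub-zero : ∀ {x y} → x + - y ≈ 0# → x ≈ y
  sub-zero {x} {y} e = begin
    x ≈⟨ +-identityʳ x ⟨
    x + 0# ≈⟨ +-congˡ (-‿inverseˡ y) ⟨
    x + (- y + y) ≈⟨ +-assoc _ _ _ ⟨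
    (x + - y) + y ≈⟨ +-congʳ e ⟩
    0# + y ≈⟨ +-identityˡ y ⟩
    y ∎

  roots-zero : IsDomain R → ∀ xs f → Distinct xs → All.All (λ x → ev x f ≈ 0#) xs → Deg< (length xs) f → f ≋ []
  roots-zero dom [] f _ _ d = deg0 d
  roots-zero dom (x ∷ xs) f (x≉ ∷ ds) (e ∷ es) d with factor x f e
  ... | q , eq = ≋-trans eq (≋-trans (⊠-congʳ (root x) q≋0) (⊠-zeroʳ (root x)))
    where
      open IsDomain dom
      root-q : ∀ {y} → ¬ (x ≈ y) → ev y f ≈ 0# → ev y q ≈ 0#
      root-q {y} ne ey with no-zero-divisors (y + - x) (ev y q)
        (begin
          (y + - x) * ev y q ≈⟨ *-congʳ (Ev.ev-root y x) ⟨
          ev y (root x) * ev y q ≈⟨ Ev.ev-⊠ y (root x) q ⟨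
          ev y (root x ⊠ q) ≈⟨ Ev.ev-cong y {f} {root x ⊠ q} eq ⟨
          ev y f ≈⟨ ey ⟩
          0# ∎)
      ... | inj₁ z = ⊥-elim (ne (sym (sub-zero z)))
      ... | inj₂ z = z
      q≋0 : q ≋ []
      q≋0 = roots-zero dom xs q ds (All.zipWith (λ (a , b) → root-q a b) (x≉ , es))
              (monic-deg {1} {root x} (root-monic x) {length xs} q (deg-cong {suc (length xs)} {f} {root x ⊠ q} eq d))

module MapHom {R S : CommutativeRing 0ℓ 0ℓ} (φ : Hom R S) where
  private
    module R = CommutativeRing R
    module PR = Polynomials R
    module DR = Degrees R
  open Polynomials S
  open Degrees S
  open CommutativeRing S
  open Hom φ

  mapP : PR.Poly → Poly
  mapP = map ⟦_⟧

  coeff-mapP : ∀ f i → coeff (mapP f) i ≈ ⟦ PR.coeff f i ⟧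
  coeff-mapP [] i = sym 0-hom
  coeff-mapP (a ∷ f) zero = refl
  coeff-mapP (a ∷ f) (suc i) = coeff-mapP f i

  mapP-cong : ∀ {f g} → f PR.≋ g → mapP f ≋ mapP g
  mapP-cong {f} {g} e .at i = trans (coeff-mapP f i) (trans (⟦⟧-cong (e .PR.at i)) (sym (coeff-mapP g i)))

  mapP-⊞ : ∀ f g → mapP (f PR.⊞ g) ≋ mapP f ⊞ mapP g
  mapP-⊞ f g .at i = trans (coeff-mapP (f PR.⊞ g) i) (trans (⟦⟧-cong (PR.coeff-⊞ f g i))
    (trans (+-hom _ _) (trans (+-cong (sym (coeff-mapP f i)) (sym (coeff-mapP g i))) (sym (coeff-⊞ (mapP f) (mapP g) i)))))

  mapP-scal : ∀ a f → mapP (PR.scal a f) ≋ scal ⟦ a ⟧ (mapP f)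
  mapP-scal a f .at i = trans (coeff-mapP (PR.scal a f) i) (trans (⟦⟧-cong (PR.coeff-scal a f i))
    (trans (*-hom _ _) (trans (*-congˡ (sym (coeff-mapP f i))) (sym (coeff-scal ⟦ a ⟧ (mapP f) i)))))

  mapP-⊠ : ∀ f g → mapP (f PR.⊠ g) ≋ mapP f ⊠ mapP g
  mapP-⊠ [] g = ≋-refl
  mapP-⊠ (a ∷ f) g = ≋-trans (mapP-⊞ (PR.scal a g) (R.0# ∷ (f PR.⊠ g)))
    (⊞-cong (mapP-scal a g) (∷-cong 0-hom (mapP-⊠ f g)))

  mapHom : Hom PR.polyRing polyRing
  mapHom = record { ⟦_⟧ = mapP ; ⟦⟧-cong = mapP-cong ; +-hom = mapP-⊞ ; *-hom = mapP-⊠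
                  ; 0-hom = ≋-refl ; 1-hom = ∷-cong 1-hom ≋-refl }

  mapP-root : ∀ a → mapP (DR.root a) ≋ root ⟦ a ⟧
  mapP-root a = ≋-trans (mapP-cong (DR.root-def a))
    (≋-trans (∷-cong ⟦-⟧ (∷-cong 1-hom ≋-refl)) (≋-sym (root-def ⟦ a ⟧)))
    where
      ⟦-⟧ : ⟦ R.- a ⟧ ≈ - ⟦ a ⟧
      ⟦-⟧ = inverseʳ-unique _ _ (trans (sym (+-hom a (R.- a))) (trans (⟦⟧-cong (R.-‿inverseʳ a)) 0-hom))
        where open import Algebra.Properties.Group +-group using (inverseʳ-unique)

  mapP-D : ∀ f → mapP (DR.D f) ≋ D (mapP f)
  mapP-D [] = ≋-refl
  mapP-D (a ∷ f) = ≋-trans (mapP-⊞ f (R.0# ∷ DR.D f)) (⊞-cong ≋-refl (∷-cong 0-hom (mapP-D f)))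

  mapP-deg : ∀ {n f} → DR.Deg< n f → Deg< n (mapP f)
  mapP-deg {n} {f} d .vanish i l = trans (coeff-mapP f i) (trans (⟦⟧-cong (d .DR.vanish i l)) 0-hom)

  mapP-monic : ∀ {n f} → DR.Monic n f → Monic n (mapP f)
  mapP-monic {n} {f} m = mkMonic (trans (coeff-mapP f n) (trans (⟦⟧-cong (DR.lead m)) 1-hom)) (mapP-deg (DR.bound m))

-- Finite sums and counting over lists

module Counting where

  open import Data.Nat using (_+_; _*_)
  open import Data.Nat.Properties
  open import Data.List using (concatMap; replicate)
  open import Data.List.Membership.Propositional.Properties using (∈-∃++)
  open import Data.List.Relation.Binary.Permutation.Propositional using (refl; prep; swap; trans; ↭-trans; ↭-refl)
  open import Function using (_∘_)
  open import Relation.Binary.Definitions using (DecidableEquality)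
  open import Relation.Binary.PropositionalEquality using (cong; cong₂; module ≡-Reasoning)

  private variable
    A B : Set
    P Q : Pred A 0ℓ

  ind : {X : Set} → Dec X → ℕ
  ind (yes _) = 1
  ind (no _) = 0

  ind-yes : {X : Set} (d : Dec X) → X → ind d ≡ 1
  ind-yes (yes _) _ = ≡.refl
  ind-yes (no n) x = ⊥-elim (n x)

  ind-no : {X : Set} (d : Dec X) → ¬ X → ind d ≡ 0
  ind-no (yes x) n = ⊥-elim (n x)
  ind-no (no _) _ = ≡.refl

  ind-mono : {X Y : Set} (d : Dec X) (e : Dec Y) → (X → Y) → ind d ≤ ind e
  ind-mono (no _) e f = z≤n
  ind-mono (yes x) e f = ≤-reflexive (≡.sym (ind-yes e (f x)))

  ind-cong : {X Y : Set} (d : Dec X) (e : Dec Y) → (X → Y) → (Y → X) → ind d ≡ ind e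
  ind-cong d e f g = ≤-antisym (ind-mono d e f) (ind-mono e d g)

  ind-≤1 : {X : Set} (d : Dec X) → ind d ≤ 1
  ind-≤1 (yes _) = ≤-refl
  ind-≤1 (no _) = z≤n

  ind-× : {X Y : Set} (d : Dec X) (e : Dec Y) → ind (d ×-dec e) ≡ ind d * ind e
  ind-× (yes _) (yes _) = ≡.refl
  ind-× (yes _) (no _) = ≡.refl
  ind-× (no _) e = ≡.refl

  ∑ : List A → (A → ℕ) → ℕ
  ∑ [] f = 0
  ∑ (x ∷ xs) f = f x + ∑ xs f

  # : {P : Pred A 0ℓ} → Decidable P → List A → ℕ
  # P? xs = ∑ xs (λ x → ind (P? x))

  ∑-mono : ∀ (xs : List A) {f g} → (∀ x → x ∈ xs → f x ≤ g x) → ∑ xs f ≤ ∑ xs g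
  ∑-mono [] h = z≤n
  ∑-mono (x ∷ xs) h = +-mono-≤ (h x (here ≡.refl)) (∑-mono xs (λ y m → h y (there m)))

  ∑-cong : ∀ (xs : List A) {f g} → (∀ x → x ∈ xs → f x ≡ g x) → ∑ xs f ≡ ∑ xs g
  ∑-cong [] h = ≡.refl
  ∑-cong (x ∷ xs) h = cong₂ _+_ (h x (here ≡.refl)) (∑-cong xs (λ y m → h y (there m)))

  ∑-zero : ∀ (xs : List A) {f} → (∀ x → x ∈ xs → f x ≡ 0) → ∑ xs f ≡ 0
  ∑-zero [] h = ≡.refl
  ∑-zero (x ∷ xs) h = cong₂ _+_ (h x (here ≡.refl)) (∑-zero xs (λ y m → h y (there m)))

  ∑-const : ∀ (xs : List A) c → ∑ xs (λ _ → c) ≡ length xs * c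
  ∑-const [] c = ≡.refl
  ∑-const (x ∷ xs) c = cong (c +_) (∑-const xs c)

  private
    exchange : ∀ a b c d → (a + b) + (c + d) ≡ (a + c) + (b + d)
    exchange a b c d = ≡.trans (+-assoc a b (c + d)) (≡.trans
      (cong (a +_) (≡.trans (≡.sym (+-assoc b c d)) (≡.trans (cong (_+ d) (+-comm b c)) (+-assoc c b d))))
      (≡.sym (+-assoc a c (b + d))))

  ∑-+ : ∀ (xs : List A) f g → ∑ xs (λ x → f x + g x) ≡ ∑ xs f + ∑ xs g
  ∑-+ [] f g = ≡.refl
  ∑-+ (x ∷ xs) f g = ≡.trans (cong (f x + g x +_) (∑-+ xs f g)) (exchange (f x) (g x) _ _)

  ∑-*ˡ : ∀ (xs : List A) c f → ∑ xs (λ x → c * f x) ≡ c * ∑ xs f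
  ∑-*ˡ [] c f = ≡.sym (*-zeroʳ c)
  ∑-*ˡ (x ∷ xs) c f = ≡.trans (cong (c * f x +_) (∑-*ˡ xs c f)) (≡.sym (*-distribˡ-+ c (f x) _))

  ∑-++ : ∀ (xs ys : List A) f → ∑ (xs ++ ys) f ≡ ∑ xs f + ∑ ys f
  ∑-++ [] ys f = ≡.refl
  ∑-++ (x ∷ xs) ys f = ≡.trans (cong (f x +_) (∑-++ xs ys f)) (≡.sym (+-assoc (f x) _ _))

  ∑-map : ∀ (g : A → B) xs f → ∑ (map g xs) f ≡ ∑ xs (f ∘ g)
  ∑-map g [] f = ≡.refl
  ∑-map g (x ∷ xs) f = cong (f (g x) +_) (∑-map g xs f)

  ∑-concatMap : ∀ (g : A → List B) xs f → ∑ (concatMap g xs) f ≡ ∑ xs (λ x → ∑ (g x) f)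
  ∑-concatMap g [] f = ≡.refl
  ∑-concatMap g (x ∷ xs) f = ≡.trans (∑-++ (g x) (concatMap g xs) f) (cong (∑ (g x) f +_) (∑-concatMap g xs f))

  ∑-replicate : ∀ n (x : A) f → ∑ (replicate n x) f ≡ n * f x
  ∑-replicate zero x f = ≡.refl
  ∑-replicate (suc n) x f = cong (f x +_) (∑-replicate n x f)

  ∑-swap : ∀ (xs : List A) (ys : List B) (f : A → B → ℕ) → ∑ xs (λ x → ∑ ys (f x)) ≡ ∑ ys (λ y → ∑ xs (λ x → f x y))
  ∑-swap [] ys f = ≡.sym (∑-zero ys (λ _ _ → ≡.refl))
  ∑-swap (x ∷ xs) ys f = ≡.trans (cong (∑ ys (f x) +_) (∑-swap xs ys f)) (≡.sym (∑-+ ys (f x) _))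

  ∑-↭ : ∀ {xs ys : List A} f → xs ↭ ys → ∑ xs f ≡ ∑ ys f
  ∑-↭ f refl = ≡.refl
  ∑-↭ f (prep x p) = cong (f x +_) (∑-↭ f p)
  ∑-↭ f (swap x y p) = ≡.trans (≡.sym (+-assoc (f x) (f y) _))
    (≡.trans (cong₂ _+_ (+-comm (f x) (f y)) (∑-↭ f p)) (+-assoc (f y) (f x) _))
  ∑-↭ f (trans p q) = ≡.trans (∑-↭ f p) (∑-↭ f q)

  length-∑ : ∀ (xs : List A) → length xs ≡ ∑ xs (λ _ → 1)
  length-∑ xs = ≡.sym (≡.trans (∑-const xs 1) (*-identityʳ _))

  ∑-filter : {P : Pred A 0ℓ} (P? : Decidable P) → ∀ xs f → ∑ (filter P? xs) f ≡ ∑ xs (λ x → ind (P? x) * f x)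
  ∑-filter P? [] f = ≡.refl
  ∑-filter P? (x ∷ xs) f with P? x
  ... | yes _ = cong₂ _+_ (≡.sym (+-identityʳ (f x))) (∑-filter P? xs f)
  ... | no _ = ∑-filter P? xs f

  ∑-≤-member : ∀ (xs : List A) f {x} → x ∈ xs → f x ≤ ∑ xs f
  ∑-≤-member (x ∷ xs) f (here ≡.refl) = m≤m+n _ _
  ∑-≤-member (y ∷ xs) f (there m) = ≤-trans (∑-≤-member xs f m) (m≤n+m _ (f y))

  ∑-positive : ∀ (xs : List A) f → 0 < ∑ xs f → ∃ λ x → x ∈ xs × 0 < f x
  ∑-positive (x ∷ xs) f h with f x in eq
  ... | suc n = x , here ≡.refl , ≡.subst (0 <_) (≡.sym eq) (s≤s z≤n)
  ... | zero with ∑-positive xs f h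
  ...   | y , m , l = y , there m , l

  ∑-<-witness : ∀ (xs : List A) f g → ∑ xs f < ∑ xs g → ∃ λ x → x ∈ xs × f x < g x
  ∑-<-witness (x ∷ xs) f g h with <-≤-connex (f x) (g x)
  ... | inj₁ l = x , here ≡.refl , l
  ... | inj₂ l with ∑-<-witness xs f g (+-cancelˡ-< (g x) _ _ (<-≤-trans (s≤s (+-monoˡ-≤ _ l)) h))
  ...   | y , m , k = y , there m , k

  module _ {P : Pred A 0ℓ} (P? : Decidable P) where

    #-≤-length : ∀ xs → # P? xs ≤ length xs
    #-≤-length [] = z≤n
    #-≤-length (x ∷ xs) = +-mono-≤ (ind-≤1 (P? x)) (#-≤-length xs)

    #-witness : ∀ xs → 0 < # P? xs → ∃ λ x → x ∈ xs × P x
    #-witness xs h with ∑-positive xs _ h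
    ... | x , m , l with P? x
    ...   | yes p = x , m , p

    #-member : ∀ {xs x} → x ∈ xs → P x → 1 ≤ # P? xs
    #-member {xs} {x} m p = ≤-trans (≤-reflexive (≡.sym (ind-yes (P? x) p))) (∑-≤-member xs _ m)

    #-none : ∀ xs → (∀ x → x ∈ xs → ¬ P x) → # P? xs ≡ 0
    #-none xs h = ∑-zero xs (λ x m → ind-no (P? x) (h x m))

    #-all : ∀ xs → (∀ x → x ∈ xs → P x) → # P? xs ≡ length xs
    #-all xs h = ≡.trans (∑-cong xs (λ x m → ind-yes (P? x) (h x m))) (≡.sym (length-∑ xs))

    #-compl : ∀ xs → # P? xs + # (λ x → ¬? (P? x)) xs ≡ length xs
    #-compl xs = ≡.trans (≡.sym (∑-+ xs _ _)) (≡.trans (∑-cong xs (λ x _ → one x)) (≡.sym (length-∑ xs)))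
      where
        one : ∀ x → ind (P? x) + ind (¬? (P? x)) ≡ 1
        one x with P? x
        ... | yes _ = ≡.refl
        ... | no _ = ≡.refl

    length-filter : ∀ xs → length (filter P? xs) ≡ # P? xs
    length-filter xs = ≡.trans (length-∑ (filter P? xs))
      (≡.trans (∑-filter P? xs _) (∑-cong xs (λ x _ → *-identityʳ _)))

  module _ {P Q : Pred A 0ℓ} (P? : Decidable P) (Q? : Decidable Q) where

    #-mono : ∀ xs → (∀ x → x ∈ xs → P x → Q x) → # P? xs ≤ # Q? xs
    #-mono xs h = ∑-mono xs (λ x m → ind-mono (P? x) (Q? x) (h x m))

    #-cong : ∀ xs → (∀ x → x ∈ xs → P x → Q x) → (∀ x → x ∈ xs → Q x → P x) → # P? xs ≡ # Q? xs
    #-cong xs h k = ∑-cong xs (λ x m → ind-cong (P? x) (Q? x) (h x m) (k x m))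

    #-avoid₂ : ∀ xs → # P? xs + # Q? xs < length xs → ∃ λ x → x ∈ xs × ¬ P x × ¬ Q x
    #-avoid₂ xs h with ∑-<-witness xs (λ x → ind (P? x) + ind (Q? x)) (λ _ → 1)
      (≡.subst₂ _<_ (≡.sym (∑-+ xs _ _)) (length-∑ xs) h)
    ... | x , m , l with P? x | Q? x
    ...   | no np | no nq = x , m , np , nq
    ...   | no _ | yes _ = ⊥-elim (<-irrefl ≡.refl l)
    ...   | yes _ | no _ = ⊥-elim (<-irrefl ≡.refl l)
    ...   | yes _ | yes _ = ⊥-elim (<-asym l (s≤s (s≤s z≤n)))

  Unique⇒↭ : ∀ {us xs : List A} → Unique us → (∀ u → u ∈ us → u ∈ xs) → ∃ λ ys → xs ↭ us ++ ys
  Unique⇒↭ {us = []} {xs} _ _ = xs , ↭-refl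
  Unique⇒↭ {us = u ∷ us} {xs} (u≢ ∷ uniq) h with ∈-∃++ (h u (here ≡.refl))
  ... | as , bs , ≡.refl with Unique⇒↭ {us = us} {as ++ bs} uniq inside
    where
      inside : ∀ v → v ∈ us → v ∈ as ++ bs
      inside v m with ∈-resp-↭ (shift u as bs) (h v (there m))
      ... | here v≡u = ⊥-elim (All.lookup u≢ m (≡.sym v≡u))
      ... | there k = k
  ...   | ys , p = ys , ↭-trans (shift u as bs) (prep u p)

  module _ (_≟_ : DecidableEquality A) where

    multiplicity-unique : ∀ (xs : List A) → (∀ x → # (_≟ x) xs ≤ 1) → Unique xs
    multiplicity-unique [] h = []
    multiplicity-unique (x ∷ xs) h = All.tabulate fresh ∷ multiplicity-unique xs (λ y → ≤-trans (m≤n+m _ _) (h y))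
      where
        fresh : ∀ {y} → y ∈ xs → ¬ x ≡ y
        fresh m ≡.refl = <-irrefl ≡.refl (≤-trans
          (+-mono-≤ (≤-reflexive (≡.sym (ind-yes (x ≟ x) ≡.refl))) (#-member (_≟ x) m ≡.refl)) (h x))

    unique-multiplicity : ∀ {xs : List A} → Unique xs → ∀ {x} → x ∈ xs → # (_≟ x) xs ≡ 1
    unique-multiplicity {x ∷ xs} (x≢ ∷ u) (here ≡.refl) = cong₂ _+_ (ind-yes (x ≟ x) ≡.refl)
      (#-none (_≟ x) xs (λ y m e → All.lookup x≢ m (≡.sym e)))
    unique-multiplicity {y ∷ xs} (y≢ ∷ u) {x} (there m) = cong₂ _+_ (ind-no (y ≟ x) (All.lookup y≢ m))
      (unique-multiplicity u m)

    ∑-point : ∀ {xs : List A} → Unique xs → ∀ {x} (f : A → ℕ) → x ∈ xs → ∑ xs (λ y → ind (y ≟ x) * f y) ≡ f x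
    ∑-point {xs} u {x} f m = begin
      ∑ xs (λ y → ind (y ≟ x) * f y) ≡⟨ ∑-cong xs (λ y _ → same y) ⟩
      ∑ xs (λ y → f x * ind (y ≟ x)) ≡⟨ ∑-*ˡ xs (f x) _ ⟩
      f x * # (_≟ x) xs ≡⟨ cong (f x *_) (unique-multiplicity u m) ⟩
      f x * 1 ≡⟨ *-identityʳ _ ⟩
      f x ∎
      where
        open ≡-Reasoning
        same : ∀ y → ind (y ≟ x) * f y ≡ f x * ind (y ≟ x)
        same y with y ≟ x
        ... | yes ≡.refl = *-comm 1 (f y)
        ... | no _ = ≡.sym (*-zeroʳ (f x))

    unique-length : ∀ {us xs : List A} → Unique us → (∀ u → u ∈ us → u ∈ xs) → length us ≤ length xs
    unique-length {us} {xs} u h with Unique⇒↭ u h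
    ... | ys , p = begin
      length us ≡⟨ length-∑ us ⟩
      ∑ us (λ _ → 1) ≤⟨ m≤m+n _ _ ⟩
      ∑ us (λ _ → 1) + ∑ ys (λ _ → 1) ≡⟨ ∑-++ us ys _ ⟨
      ∑ (us ++ ys) (λ _ → 1) ≡⟨ ∑-↭ _ p ⟨
      ∑ xs (λ _ → 1) ≡⟨ length-∑ xs ⟨
      length xs ∎
      where open ≤-Reasoning

  #-at-most-one : {P : Pred A 0ℓ} (P? : Decidable P) → ∀ {xs} → Unique xs →
                  (∀ a b → P a → P b → a ≡ b) → # P? xs ≤ 1
  #-at-most-one P? {[]} u h = z≤n
  #-at-most-one P? {x ∷ xs} (x≢ ∷ u) h with P? x
  ... | no _ = #-at-most-one P? u h
  ... | yes p = ≤-reflexive (cong suc (#-none P? xs (λ y m q → All.lookup x≢ m (h x y p q))))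

  ∑-bijection : ∀ {xs : List A} → DecidableEquality A → Unique xs → (∀ a → a ∈ xs) → (f g : A → A) →
                (∀ a → g (f a) ≡ a) → (∀ a → f (g a) ≡ a) → ∀ (h : A → ℕ) → ∑ xs (λ a → h (f a)) ≡ ∑ xs h
  ∑-bijection {xs = xs} _≟_ u c f g gf fg h = begin
    ∑ xs (λ a → h (f a)) ≡⟨ ∑-cong xs (λ a _ → ≡.sym (∑-point _≟_ u h (c (f a)))) ⟩
    ∑ xs (λ a → ∑ xs (λ b → ind (b ≟ f a) * h b)) ≡⟨ ∑-swap xs xs _ ⟩
    ∑ xs (λ b → ∑ xs (λ a → ind (b ≟ f a) * h b)) ≡⟨ ∑-cong xs (λ b _ → ∑-cong xs (λ a _ →
         cong (_* h b) (ind-cong (b ≟ f a) (a ≟ g b) (λ e → ≡.trans (≡.sym (gf a)) (cong g (≡.sym e))) (λ e → ≡.trans (≡.sym (fg b)) (cong f (≡.sym e)))))) ⟩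
    ∑ xs (λ b → ∑ xs (λ a → ind (a ≟ g b) * h b)) ≡⟨ ∑-cong xs (λ b _ → ∑-point _≟_ u (λ _ → h b) (c (g b))) ⟩
    ∑ xs h ∎
    where open ≡-Reasoning

  #-sequential-avoid : {U : Set} {D : Pred A 0ℓ} (D? : Decidable D) {Rel : U → A → Set} (Rel? : ∀ u a → Dec (Rel u a)) →
    ∀ (us : List U) (xs : List A) N → (∀ u → u ∈ us → # (Rel? u) xs ≤ N) → # D? xs + length us * N < length xs →
    ∃ λ x → x ∈ xs × ¬ D x × (∀ u → u ∈ us → ¬ Rel u x)
  #-sequential-avoid D? Rel? us xs N h lt with ∑-<-witness xs (λ x → ind (D? x) + ∑ us (λ u → ind (Rel? u x))) (λ _ → 1) (begin-strict
      -- Union bound: the average number of obstructions per entry is below one, so some entry has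
      -- none.
      ∑ xs (λ x → ind (D? x) + ∑ us (λ u → ind (Rel? u x))) ≡⟨ ∑-+ xs _ _ ⟩
      # D? xs + ∑ xs (λ x → ∑ us (λ u → ind (Rel? u x))) ≡⟨ cong (# D? xs +_) (∑-swap xs us _) ⟩
      # D? xs + ∑ us (λ u → # (Rel? u) xs) ≤⟨ +-monoʳ-≤ (# D? xs) (∑-mono us h) ⟩
      # D? xs + ∑ us (λ _ → N) ≡⟨ cong (# D? xs +_) (∑-const us N) ⟩
      # D? xs + length us * N <⟨ lt ⟩
      length xs ≡⟨ length-∑ xs ⟩
      ∑ xs (λ _ → 1) ∎)
    where open ≤-Reasoning
  ... | x , m , s≤s k with n≤0⇒n≡0 k
  ...   | z = x , m , (λ d → case (m+n≡0⇒m≡0 (ind (D? x)) z) (ind-yes (D? x) d)) ,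
              (λ u j r → <-irrefl ≡.refl (≤-trans (≤-reflexive (≡.sym (ind-yes (Rel? u x) r)))
                (≤-trans (∑-≤-member us (λ u → ind (Rel? u x)) j) (≤-reflexive (m+n≡0⇒n≡0 (ind (D? x)) z)))))
    where
      case : ∀ {n} → n ≡ 0 → ¬ (n ≡ 1)
      case ≡.refl ()

  ∑-≤1-* : ∀ (xs : List A) (f g : A → ℕ) → (∀ x → x ∈ xs → f x ≤ 1) → ∑ xs (λ x → g x * f x) ≤ ∑ xs g
  ∑-≤1-* xs f g h = ∑-mono xs (λ x m → ≤-trans (*-monoʳ-≤ (g x) (h x m)) (≤-reflexive (*-identityʳ (g x))))

  module _ {_≈_ : A → A → Set} (_≈?_ : ∀ x y → Dec (x ≈ y)) (≈-refl : ∀ {x} → x ≈ x)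
           (≈-sym : ∀ {x y} → x ≈ y → y ≈ x) (≈-trans : ∀ {x y z} → x ≈ y → y ≈ z → x ≈ z) where

    #-classwise : {P : Pred A 0ℓ} (P? : Decidable P) → (∀ {x y} → x ≈ y → P x → P y) → ∀ n xs ys → length xs ≤ n →
                  (∀ x → x ∈ xs → # (_≈? x) xs ≤ # (_≈? x) ys) → # P? xs ≤ # P? ys
    #-classwise P? resp n [] ys l h = z≤n
    #-classwise {P} P? resp (suc n) (x ∷ xs) ys (s≤s l) h = begin
      # P? (x ∷ xs) ≡⟨ split (x ∷ xs) ⟩
      -- `P` is constant on classes, so the class of `x` contributes its size or nothing. It is
      -- struck out of both lists, and the sizes of the other classes stay the same. The purpose is
      -- to compare two lists of embeddings that describe the same subspaces by different maps.
      ind (P? x) * # (_≈? x) (x ∷ xs) + # P? (rest (x ∷ xs)) ≤⟨ +-mono-≤ (*-monoʳ-≤ (ind (P? x)) (h x (here ≡.refl))) (#-classwise P? resp n (rest (x ∷ xs)) (rest ys) shorter smaller) ⟩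
      ind (P? x) * # (_≈? x) ys + # P? (rest ys) ≡⟨ split ys ⟨
      # P? ys ∎
      where
        open ≤-Reasoning
        rest : List A → List A
        rest = filter (λ y → ¬? (y ≈? x))
        split : ∀ zs → # P? zs ≡ ind (P? x) * # (_≈? x) zs + # P? (rest zs)
        split zs = ≡.trans (∑-cong zs (λ z _ → cell z (z ≈? x))) (≡.trans (∑-+ zs _ _) (cong₂ _+_ (∑-*ˡ zs (ind (P? x)) _) (≡.sym (∑-filter (λ y → ¬? (y ≈? x)) zs _))))
          where
            cell : ∀ z (d : Dec (z ≈ x)) → ind (P? z) ≡ ind (P? x) * ind d + ind (¬? d) * ind (P? z)
            cell z (yes e) = ≡.trans (ind-cong (P? z) (P? x) (resp e) (resp (≈-sym e))) (≡.trans (≡.sym (*-identityʳ _)) (≡.sym (+-identityʳ _)))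
            cell z (no _) = ≡.sym (≡.trans (cong (_+ (ind (P? z) + 0)) (*-zeroʳ (ind (P? x)))) (+-identityʳ _))
        shorter : length (rest (x ∷ xs)) ≤ n
        shorter = ≤-trans (≤-reflexive (≡.trans (length-filter (λ y → ¬? (y ≈? x)) (x ∷ xs)) (cong (_+ # (λ y → ¬? (y ≈? x)) xs) (ind-no (¬? (x ≈? x)) (λ ne → ne ≈-refl))))) (≤-trans (#-≤-length (λ y → ¬? (y ≈? x)) xs) l)
        same : ∀ z zs → ¬ (z ≈ x) → # (_≈? z) (rest zs) ≡ # (_≈? z) zs
        same z zs ne = ≡.trans (∑-filter (λ y → ¬? (y ≈? x)) zs _) (∑-cong zs (λ y _ → cell y (y ≈? z) (y ≈? x)))
          where
            cell : ∀ y (d : Dec (y ≈ z)) (e : Dec (y ≈ x)) → ind (¬? e) * ind d ≡ ind d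
            cell y d (no _) = +-identityʳ _
            cell y (no _) (yes _) = ≡.refl
            cell y (yes a) (yes b) = ⊥-elim (ne (≈-trans (≈-sym a) b))
        smaller : ∀ z → z ∈ rest (x ∷ xs) → # (_≈? z) (rest (x ∷ xs)) ≤ # (_≈? z) (rest ys)
        smaller z m with ∈-filter⁻ (λ y → ¬? (y ≈? x)) {xs = x ∷ xs} m
        ... | m' , ne = ≤-trans (≤-reflexive (same z (x ∷ xs) ne)) (≤-trans (h z m') (≤-reflexive (≡.sym (same z ys ne))))

open Counting

-- Products, powers and binary forms over a ring

module Products (R : CommutativeRing 0ℓ 0ℓ) where
  open CommutativeRing R renaming (Carrier to A)
  open import Algebra.Solver.Ring.NaturalCoefficients.Default commutativeSemiring
    using (solve; _:=_; _:+_; _:*_; con)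
  open import Relation.Binary.Reasoning.Setoid setoid

  ∏ : {I : Set} → List I → (I → A) → A
  ∏ [] f = 1#
  ∏ (x ∷ xs) f = f x * ∏ xs f

  infixr 8 _^_
  _^_ : A → ℕ → A
  x ^ zero = 1#
  x ^ suc n = x * x ^ n

  ∏-cong : ∀ {I : Set} (xs : List I) {f g : I → A} → (∀ x → f x ≈ g x) → ∏ xs f ≈ ∏ xs g
  ∏-cong [] h = refl
  ∏-cong (x ∷ xs) h = *-cong (h x) (∏-cong xs h)

  ∏-++ : ∀ {I : Set} (xs ys : List I) f → ∏ (xs ++ ys) f ≈ ∏ xs f * ∏ ys f
  ∏-++ [] ys f = sym (*-identityˡ _)
  ∏-++ (x ∷ xs) ys f = trans (*-congˡ (∏-++ xs ys f)) (sym (*-assoc _ _ _))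

  ∏-map : ∀ {I J : Set} (g : I → J) xs f → ∏ (map g xs) f ≈ ∏ xs (λ x → f (g x))
  ∏-map g [] f = refl
  ∏-map g (x ∷ xs) f = *-congˡ (∏-map g xs f)

  ∏-↭ : ∀ {I : Set} {xs ys : List I} f → xs ↭ ys → ∏ xs f ≈ ∏ ys f
  ∏-↭ f ↭.refl = refl
  ∏-↭ f (↭.prep x p) = *-congˡ (∏-↭ f p)
  ∏-↭ f (↭.swap x y p) = trans (*-congˡ (*-congˡ (∏-↭ f p)))
    (trans (sym (*-assoc _ _ _)) (trans (*-congʳ (*-comm _ _)) (*-assoc _ _ _)))
  ∏-↭ f (↭.trans p q) = trans (∏-↭ f p) (∏-↭ f q)

  ^-+ : ∀ x m n → x ^ (m ℕ.+ n) ≈ x ^ m * x ^ n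
  ^-+ x zero n = sym (*-identityˡ _)
  ^-+ x (suc m) n = trans (*-congˡ (^-+ x m n)) (sym (*-assoc _ _ _))

  ^-* : ∀ x y n → (x * y) ^ n ≈ x ^ n * y ^ n
  ^-* x y zero = sym (*-identityˡ _)
  ^-* x y (suc n) = trans (*-congˡ (^-* x y n))
    (solve 4 (λ a b c d → (a :* b) :* (c :* d) := (a :* c) :* (b :* d)) refl _ _ _ _)

  ^-cong : ∀ {x y} n → x ≈ y → x ^ n ≈ y ^ n
  ^-cong zero e = refl
  ^-cong (suc n) e = *-cong e (^-cong n e)

  -- Order of vanishing of a product of linear factors: each factor divisible by `T` contributes one
  -- power.
  ∏-marked : ∀ {I : Set} {P : Pred I 0ℓ} (P? : Decidable P) T f →
             (∀ i → P i → ∃ λ g → f i ≈ T * g) → ∀ xs → ∃ λ g → ∏ xs f ≈ T ^ # P? xs * g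
  ∏-marked P? T f h [] = 1# , sym (*-identityˡ _)
  ∏-marked P? T f h (x ∷ xs) with P? x | ∏-marked P? T f h xs
  ... | no _ | g , e = f x * g , trans (*-congˡ e)
          (solve 3 (λ a b c → a :* (b :* c) := b :* (a :* c)) refl _ _ _)
  ... | yes p | g , e with h x p
  ...   | k , e' = k * g , trans (*-cong e' e)
          (solve 4 (λ a b c d → (a :* b) :* (c :* d) := (a :* c) :* (b :* d)) refl _ _ _ _)

  -- The binary form of degree `r` in `L` and `M`, with `g_i` as the coefficient of
  -- `L ^ i M ^ (r - i)`.
  comb : A → A → ∀ r → Vec A (suc r) → A
  comb L M zero (g ∷ []) = g
  comb L M (suc r) (g ∷ gs) = M ^ suc r * g + L * comb L M r gs

  comb-cong : ∀ {L L' M M'} → L ≈ L' → M ≈ M' → ∀ r gs → comb L M r gs ≈ comb L' M' r gs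
  comb-cong e e' zero (g ∷ []) = refl
  comb-cong e e' (suc r) (g ∷ gs) = +-cong (*-congʳ (^-cong (suc r) e')) (*-cong e (comb-cong e e' r gs))

  comb-scale : ∀ T u w r gs → comb (T * u) (T * w) r gs ≈ T ^ r * comb u w r gs
  comb-scale T u w zero (g ∷ []) = sym (*-identityˡ _)
  comb-scale T u w (suc r) (g ∷ gs) = begin
    (T * w) ^ suc r * g + (T * u) * comb (T * u) (T * w) r gs
      ≈⟨ +-cong (*-congʳ (^-* T w (suc r))) (*-congˡ (comb-scale T u w r gs)) ⟩
    (T ^ suc r * w ^ suc r) * g + (T * u) * (T ^ r * comb u w r gs)
      ≈⟨ solve 6 (λ t tr wr g u c → (t :* tr) :* wr :* g :+ (t :* u) :* (tr :* c) := (t :* tr) :* (wr :* g :+ u :* c)) refl T (T ^ r) (w ^ suc r) g u _ ⟩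
    T ^ suc r * (w ^ suc r * g + u * comb u w r gs) ∎

  -- The coefficients of the form of degree one more that arises when every coefficient `g` is
  -- replaced by `L a + M b`; `e` carries the `a` of the preceding entry.
  merge : A → ∀ {n} → Vec A n → Vec A n → Vec A (suc n)
  merge e [] [] = e ∷ []
  merge e (a ∷ as) (b ∷ bs) = (e + b) ∷ merge a as bs

  Decomposes : A → A → ∀ {n} → Vec A n → Vec A n → Vec A n → Set
  Decomposes L M gs as bs = ∀ i → Vec.lookup gs i ≈ L * Vec.lookup as i + M * Vec.lookup bs i

  comb-merge : ∀ L M e r gs as bs → Decomposes L M gs as bs →
               comb L M (suc r) (merge e as bs) ≈ M ^ suc r * e + comb L M r gs
  comb-merge L M e zero (g ∷ []) (a ∷ []) (b ∷ []) h = begin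
    M * 1# * (e + b) + L * a
      ≈⟨ solve 6 (λ L M e b a o → (M :* o) :* (e :+ b) :+ L :* a := (M :* o) :* e :+ (L :* a :+ (M :* o) :* b)) refl L M e b a 1# ⟩
    M * 1# * e + (L * a + M * 1# * b) ≈⟨ +-congˡ (trans (+-congˡ (*-congʳ (*-identityʳ M))) (sym (h Fin.zero))) ⟩
    M * 1# * e + g ∎
  comb-merge L M e (suc r) (g ∷ gs) (a ∷ as) (b ∷ bs) h = begin
    M ^ suc (suc r) * (e + b) + L * comb L M (suc r) (merge a as bs)
      ≈⟨ +-congˡ (*-congˡ (comb-merge L M a r gs as bs (λ i → h (Fin.suc i)))) ⟩
    M * M ^ suc r * (e + b) + L * (M ^ suc r * a + comb L M r gs)
      ≈⟨ solve 7 (λ L M Mr e b a c → (M :* Mr) :* (e :+ b) :+ L :* (Mr :* a :+ c) :=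
           (M :* Mr) :* e :+ (Mr :* (L :* a :+ M :* b) :+ L :* c)) refl L M (M ^ suc r) e b a _ ⟩
    M * M ^ suc r * e + (M ^ suc r * (L * a + M * b) + L * comb L M r gs)
      ≈⟨ +-congˡ (+-congʳ (*-congˡ (h Fin.zero))) ⟨
    M * M ^ suc r * e + (M ^ suc r * g + L * comb L M r gs) ∎

  comb-regroup : ∀ L M r gs as bs → Decomposes L M gs as bs →
                 comb L M r gs ≈ comb L M (suc r) (merge 0# as bs)
  comb-regroup L M r gs as bs h = sym (trans (comb-merge L M 0# r gs as bs h)
    (trans (+-congʳ (zeroʳ _)) (+-identityˡ _)))

  comb-divides : ∀ L M c q r (gs : Vec A (suc r)) → (∀ i → ∃ λ k → c * Vec.lookup gs i ≈ q * k) →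
                 ∃ λ k → c * comb L M r gs ≈ q * k
  comb-divides L M c q zero (g ∷ []) h = h Fin.zero
  comb-divides L M c q (suc r) (g ∷ gs) h with h Fin.zero | comb-divides L M c q r gs (λ i → h (Fin.suc i))
  ... | k , e | ks , es = M ^ suc r * k + L * ks , (begin
    c * (M ^ suc r * g + L * comb L M r gs)
      ≈⟨ solve 5 (λ c m g l x → c :* (m :* g :+ l :* x) := m :* (c :* g) :+ l :* (c :* x)) refl c _ g L _ ⟩
    M ^ suc r * (c * g) + L * (c * comb L M r gs) ≈⟨ +-cong (*-congˡ e) (*-congˡ es) ⟩
    M ^ suc r * (q * k) + L * (q * ks)
      ≈⟨ solve 5 (λ c m g l x → c :* (m :* g :+ l :* x) := m :* (c :* g) :+ l :* (c :* x)) refl q _ k L _ ⟨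
    q * (M ^ suc r * k + L * ks) ∎)

  module _ (dom : IsDomain R) where
    open IsDomain dom

    cancelˡ : ∀ {x y z} → ¬ (x ≈ 0#) → x * y ≈ x * z → y ≈ z
    cancelˡ {x} {y} {z} ne e with no-zero-divisors x (y + - z) (begin
        x * (y + - z) ≈⟨ distribˡ _ _ _ ⟩
        x * y + x * - z ≈⟨ +-congʳ e ⟩
        x * z + x * - z ≈⟨ distribˡ _ _ _ ⟨
        x * (z + - z) ≈⟨ *-congˡ (-‿inverseʳ z) ⟩
        x * 0# ≈⟨ zeroʳ x ⟩
        0# ∎)
    ... | inj₁ z = ⊥-elim (ne z)
    ... | inj₂ z = Degrees.sub-zero R z

    cancel-0 : ∀ {x y} → ¬ (x ≈ 0#) → x * y ≈ 0# → y ≈ 0#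
    cancel-0 {x} {y} ne e = cancelˡ ne (trans e (sym (zeroʳ x)))

    ^-nonzero : ∀ {x} n → ¬ (x ≈ 0#) → ¬ (x ^ n ≈ 0#)
    ^-nonzero zero ne e = 1≉0 e
    ^-nonzero {x} (suc n) ne e with no-zero-divisors x (x ^ n) e
    ... | inj₁ z = ne z
    ... | inj₂ z = ^-nonzero n ne z

    ∏-nonzero : ∀ {I : Set} (xs : List I) f → (∀ x → x ∈ xs → ¬ (f x ≈ 0#)) → ¬ (∏ xs f ≈ 0#)
    ∏-nonzero [] f h e = 1≉0 e
    ∏-nonzero (x ∷ xs) f h e with no-zero-divisors _ _ e
    ... | inj₁ z = h x (here ≡.refl) z
    ... | inj₂ z = ∏-nonzero xs f (λ y m → h y (there m)) z

  ∏-zero : ∀ {I : Set} {xs : List I} f {x} → x ∈ xs → f x ≈ 0# → ∏ xs f ≈ 0#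
  ∏-zero f (here ≡.refl) e = trans (*-congʳ e) (zeroˡ _)
  ∏-zero f (there m) e = trans (*-congˡ (∏-zero f m e)) (zeroʳ _)

module HomLemmas {R S : CommutativeRing 0ℓ 0ℓ} (φ : Hom R S) where
  private
    module R = CommutativeRing R
    module PR = Products R
    module PS = Products S
  open CommutativeRing S
  open Hom φ

  hom-∏ : ∀ {I : Set} (xs : List I) f → ⟦ PR.∏ xs f ⟧ ≈ PS.∏ xs (λ x → ⟦ f x ⟧)
  hom-∏ [] f = 1-hom
  hom-∏ (x ∷ xs) f = trans (*-hom _ _) (*-congˡ (hom-∏ xs f))

  hom-^ : ∀ x n → ⟦ x PR.^ n ⟧ ≈ ⟦ x ⟧ PS.^ n
  hom-^ x zero = 1-hom
  hom-^ x (suc n) = trans (*-hom _ _) (*-congˡ (hom-^ x n))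

  hom-neg : ∀ x → ⟦ R.- x ⟧ ≈ - ⟦ x ⟧
  hom-neg x = inverseʳ-unique _ _ (trans (sym (+-hom x (R.- x))) (trans (⟦⟧-cong (R.-‿inverseʳ x)) 0-hom))
    where open import Algebra.Properties.Group +-group using (inverseʳ-unique)

  hom-comb : ∀ L M r gs → ⟦ PR.comb L M r gs ⟧ ≈ PS.comb ⟦ L ⟧ ⟦ M ⟧ r (Vec.map ⟦_⟧ gs)
  hom-comb L M zero (g ∷ []) = refl
  hom-comb L M (suc r) (g ∷ gs) = trans (+-hom _ _) (+-cong
    (trans (*-hom _ _) (*-congʳ (hom-^ M (suc r))))
    (trans (*-hom _ _) (*-congˡ (hom-comb L M r gs))))

composeHom : {R S T : CommutativeRing 0ℓ 0ℓ} → Hom S T → Hom R S → Hom R T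
composeHom {T = T} ψ φ = record
  { ⟦_⟧ = λ x → ψ.⟦ φ.⟦ x ⟧ ⟧ ; ⟦⟧-cong = λ e → ψ.⟦⟧-cong (φ.⟦⟧-cong e)
  ; +-hom = λ x y → trans (ψ.⟦⟧-cong (φ.+-hom x y)) (ψ.+-hom _ _)
  ; *-hom = λ x y → trans (ψ.⟦⟧-cong (φ.*-hom x y)) (ψ.*-hom _ _)
  ; 0-hom = trans (ψ.⟦⟧-cong φ.0-hom) ψ.0-hom
  ; 1-hom = trans (ψ.⟦⟧-cong φ.1-hom) ψ.1-hom }
  where
    module φ = Hom φ
    module ψ = Hom ψ
    open CommutativeRing T using (trans)

module MorePoly (R : CommutativeRing 0ℓ 0ℓ) where
  open CommutativeRing R renaming (Carrier to A)
  open Polynomials R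
  open Degrees R
  open Products R using (comb; comb-cong) renaming (_^_ to _^ᴿ_)
  open Products polyRing using (∏; _^_)
  open import Relation.Binary.Reasoning.Setoid setoid

  monic-∏ : ∀ {I : Set} (xs : List I) (f : I → A) → Monic (length xs) (∏ xs (λ x → root (f x)))
  monic-∏ [] f = monic-1
  monic-∏ (x ∷ xs) f = monic-⊠ (root-monic (f x)) (monic-∏ xs f)

  monic-^ : ∀ {n f} t → Monic n f → Monic (t ℕ.* n) (f ^ t)
  monic-^ zero m = monic-1
  monic-^ (suc t) m = monic-⊠ m (monic-^ t m)

  monic-quotient : ∀ {n c f g q r} → Monic (n ℕ.+ c) f → Monic n g → f ≋ g ⊠ q ⊞ r → Deg< n r → Monic c q
  monic-quotient {n} {c} {f} {g} {q} {r} mf mg e d = mkMonic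
    (begin
      coeff q c ≈⟨ *-identityˡ _ ⟨
      1# * coeff q c ≈⟨ *-congʳ (lead mg) ⟨
      coeff g n * coeff q c ≈⟨ coeff-top n c g q (bound mg) dq ⟨
      coeff (g ⊠ q) (n ℕ.+ c) ≈⟨ +-identityʳ _ ⟨
      coeff (g ⊠ q) (n ℕ.+ c) + 0# ≈⟨ +-congˡ (d .vanish _ (ℕₚ.m≤m+n n c)) ⟨
      coeff (g ⊠ q) (n ℕ.+ c) + coeff r (n ℕ.+ c) ≈⟨ coeff-⊞ (g ⊠ q) r _ ⟨
      coeff (g ⊠ q ⊞ r) (n ℕ.+ c) ≈⟨ e .at _ ⟨
      coeff f (n ℕ.+ c) ≈⟨ lead mf ⟩
      1# ∎)
    dq
    where
      dq : Deg< (suc c) q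
      dq = monic-deg mg {suc c} q (mkDeg λ i l → begin
        coeff (g ⊠ q) i ≈⟨ +-identityʳ _ ⟨
        coeff (g ⊠ q) i + 0# ≈⟨ +-congˡ (d .vanish i (ℕₚ.≤-trans (ℕₚ.m≤m+n n (suc c)) l)) ⟨
        coeff (g ⊠ q) i + coeff r i ≈⟨ coeff-⊞ (g ⊠ q) r i ⟨
        coeff (g ⊠ q ⊞ r) i ≈⟨ e .at i ⟨
        coeff f i ≈⟨ bound mf .vanish i (≡.subst (ℕ._≤ i) (ℕₚ.+-suc n c) l) ⟩
        0# ∎)

  module _ (F : Filtration R) where
    open Filtration F
    Q-∏ : ∀ {I : Set} (xs : List I) (f : I → A) → (∀ x → P 0 1 (f x)) → Q F 0 (length xs) (∏ xs (λ x → root (f x)))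
    Q-∏ [] f h = Filtration.P-1 (polyFiltration F)
    Q-∏ (x ∷ xs) f h = Q-* F (root (f x)) _ (Q-root F (f x) (h x)) (Q-∏ xs f h)

    Q-^ : ∀ {n f} t → Q F 0 n f → Q F 0 (t ℕ.* n) (f ^ t)
    Q-^ zero q = Filtration.P-1 (polyFiltration F)
    Q-^ {n} {f} (suc t) q = Q-* F f (f ^ t) q (Q-^ t q)

  -- The form `comb` at `L = e d`, `M = w` as a polynomial in `e`. Over a domain and for nonzero `d`
  -- and `w` it is zero only if all `gs` are, and otherwise it has at most `r` roots.
  combPoly : A → A → ∀ r → Vec A (suc r) → Poly
  combPoly d w zero (g ∷ []) = g ∷ []
  combPoly d w (suc r) (g ∷ gs) = (w ^ᴿ suc r * g) ∷ scal d (combPoly d w r gs)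

  combPoly-ev : ∀ e d w r gs → ev e (combPoly d w r gs) ≈ comb (e * d) w r gs
  combPoly-ev e d w zero (g ∷ []) = Ev.ev-const e g
  combPoly-ev e d w (suc r) (g ∷ gs) = +-congˡ (begin
    e * ev e (scal d (combPoly d w r gs)) ≈⟨ *-congˡ (Ev.ev-scal e d (combPoly d w r gs)) ⟩
    e * (d * ev e (combPoly d w r gs)) ≈⟨ *-assoc _ _ _ ⟨
    (e * d) * ev e (combPoly d w r gs) ≈⟨ *-congˡ (combPoly-ev e d w r gs) ⟩
    (e * d) * comb (e * d) w r gs ∎)

  combPoly-length : ∀ d w r gs → length (combPoly d w r gs) ≡ suc r
  combPoly-length d w zero (g ∷ []) = ≡.refl
  combPoly-length d w (suc r) (g ∷ gs) = ≡.cong suc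
    (≡.trans (length-map (d *_) (combPoly d w r gs)) (combPoly-length d w r gs))

  combPoly-zero : IsDomain R → ∀ {d w} → ¬ (d ≈ 0#) → ¬ (w ≈ 0#) → ∀ r gs →
                  combPoly d w r gs ≋ [] → ∀ i → Vec.lookup gs i ≈ 0#
  combPoly-zero dom nd nw zero (g ∷ []) e Fin.zero = e .at 0
  combPoly-zero dom nd nw (suc r) (g ∷ gs) e Fin.zero =
    Products.cancel-0 R dom (Products.^-nonzero R dom (suc r) nw) (e .at 0)
  combPoly-zero dom {d} {w} nd nw (suc r) (g ∷ gs) e (Fin.suc i) =
    combPoly-zero dom {d} {w} nd nw r gs (mk λ j → Products.cancel-0 R dom nd
      (trans (sym (coeff-scal d (combPoly d w r gs) j)) (e .at (suc j)))) i

module DerivativeOfProduct (R : CommutativeRing 0ℓ 0ℓ) where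
  open CommutativeRing R using (0#; 1#; _≈_; +-identityʳ)
  open Polynomials R
  open Degrees R
  open Products polyRing using (∏; _^_)
  open import Relation.Binary.Reasoning.Setoid PR.setoid

  D-root : ∀ x → D (root x) ≋ 1# ∷ []
  D-root x = PR.trans (D-cong (root-def x)) (∷-cong (+-identityʳ 1#) 0∷[])

  D-const1 : D (1# ∷ []) ≋ []
  D-const1 = 0∷[]

  -- For g vanishing at all roots xs of f = ∏ (X - x), every term f/(X - x) of D f becomes divisible by f
  -- after multiplication by g.
  ∏-divides-D′ : ∀ xs g → (∀ x → x ∈ xs → ev x g ≈ 0#) →
                ∃ λ q → D (∏ xs root) ⊠ g ≋ ∏ xs root ⊠ q
  ∏-divides-D′ [] g h = [] , PR.trans (⊠-cong {D (∏ [] root)} {[]} {g} {g} D-const1 ≋-refl) (≋-sym (⊠-zeroʳ (∏ [] root)))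
  ∏-divides-D′ (x ∷ xs) g h with factor x g (h x (here ≡.refl)) | ∏-divides-D′ xs g (λ y m → h y (there m))
  ... | k , e | q , e' = k ⊞ q , (begin
      D (rx ⊠ f) ⊠ g ≈⟨ ⊠-cong {D (rx ⊠ f)} {D rx ⊠ f ⊞ rx ⊠ D f} {g} {g} (D-⊠ rx f) ≋-refl ⟩
      (D rx ⊠ f ⊞ rx ⊠ D f) ⊠ g ≈⟨ ⊠-distribʳ g (D rx ⊠ f) (rx ⊠ D f) ⟩
      (D rx ⊠ f) ⊠ g ⊞ (rx ⊠ D f) ⊠ g ≈⟨ ⊞-cong
          (⊠-cong {D rx ⊠ f} {f} {g} {rx ⊠ k} (PR.trans (⊠-cong {D rx} {1# ∷ []} {f} {f} (D-root x) ≋-refl) (⊠-identityˡ f)) e)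
          (PR.trans (⊠-assoc rx (D f) g) (⊠-cong {rx} {rx} ≋-refl e')) ⟩
      f ⊠ (rx ⊠ k) ⊞ rx ⊠ (f ⊠ q) ≈⟨ ⊞-cong
          (PR.trans (≋-sym (⊠-assoc f rx k)) (⊠-cong {f ⊠ rx} {rx ⊠ f} {k} {k} (⊠-comm f rx) ≋-refl))
          (≋-sym (⊠-assoc rx f q)) ⟩
      (rx ⊠ f) ⊠ k ⊞ (rx ⊠ f) ⊠ q ≈⟨ ⊠-distribˡ (rx ⊠ f) k q ⟨
      (rx ⊠ f) ⊠ (k ⊞ q) ∎)
    where
      rx = root x
      f = ∏ xs root

  abstract
    ∏-divides-D : ∀ xs g → (∀ x → x ∈ xs → ev x g ≈ 0#) →
                  ∃ λ q → D (∏ xs root) ⊠ g ≋ ∏ xs root ⊠ q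
    ∏-divides-D = ∏-divides-D′

module _ {R S : CommutativeRing 0ℓ 0ℓ} where
  private module S = CommutativeRing S

  ev-ext : ∀ (φ ψ : Hom R S) {s s'} → (∀ a → Hom.⟦_⟧ φ a S.≈ Hom.⟦_⟧ ψ a) → s S.≈ s' →
           ∀ f → Evaluation.ev φ s f S.≈ Evaluation.ev ψ s' f
  ev-ext φ ψ e e' [] = S.refl
  ev-ext φ ψ e e' (a ∷ f) = S.+-cong (e a) (S.*-cong e' (ev-ext φ ψ e e' f))

  ev-natural : ∀ {T} (χ : Hom S T) (φ : Hom R S) s f →
               let open CommutativeRing T in
               Hom.⟦_⟧ χ (Evaluation.ev φ s f) ≈ Evaluation.ev (composeHom χ φ) (Hom.⟦_⟧ χ s) f
  ev-natural χ φ s [] = Hom.0-hom χ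
  ev-natural {T} χ φ s (a ∷ f) = trans (Hom.+-hom χ _ _) (+-congˡ (trans (Hom.*-hom χ _ _) (*-congˡ (ev-natural χ φ s f))))
    where open CommutativeRing T

  ev-map : ∀ {T} (χ : Hom S T) (φ : Hom R S) s f →
           let open CommutativeRing T in
           Evaluation.ev χ s (MapHom.mapP φ f) ≈ Evaluation.ev (composeHom χ φ) s f
  ev-map {T} χ φ s [] = CommutativeRing.refl T
  ev-map {T} χ φ s (a ∷ f) = +-congˡ (*-congˡ (ev-map χ φ s f))
    where open CommutativeRing T

-- P s N a says that a ≈ 0 or s ≤ N: nonzero scalars have degree 0.
scalarFiltration : (R : CommutativeRing 0ℓ 0ℓ) → Filtration R
scalarFiltration R = record
  { P = λ s N a → N < s → a ≈ 0#
  ; P-cong = λ e h l → trans (sym e) (h l)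
  ; P-0 = λ _ → refl
  ; P-1 = λ ()
  ; P-+ = λ h k l → trans (+-cong (h l) (k l)) (+-identityˡ _)
  ; P-neg = λ h l → trans (-‿cong (h l)) -0#≈0#
  ; P-* = mul
  ; P-up = λ { h (s≤s l) → h l }
  ; P-down = λ h l → h (s≤s l)
  ; P-weaken = λ h l → h (ℕₚ.m≤n⇒m≤1+n l) }
  where
    open CommutativeRing R
    open import Algebra.Properties.Ring ring using (-0#≈0#)
    mul : ∀ {s N s' N' a b} → (N < s → a ≈ 0#) → (N' < s' → b ≈ 0#) → N ℕ.+ N' < s ℕ.+ s' → a * b ≈ 0#
    mul {s} {N} {s'} {N'} h k l with ℕₚ.<-≤-connex N s
    ... | inj₁ lt = trans (*-congʳ (h lt)) (zeroˡ _)
    ... | inj₂ ge with ℕₚ.<-≤-connex N' s'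
    ...   | inj₁ lt = trans (*-congˡ (k lt)) (zeroʳ _)
    ...   | inj₂ ge' = ⊥-elim (ℕₚ.<⇒≱ l (ℕₚ.+-mono-≤ ge ge'))

-- The punctured Nullstellensatz on a grid

module Grid (K : CommutativeRing 0ℓ 0ℓ) (dom : IsDomain K)
            (I : Set) (_≟_ : (i j : I) → Dec (i ≡ j)) (all : List I) (unique : Unique all) (complete : ∀ i → i ∈ all)
            (ρ : I → CommutativeRing.Carrier K)
            (ρ-injective : ∀ i j → CommutativeRing._≈_ K (ρ i) (ρ j) → i ≡ j) where

  open CommutativeRing K renaming (Carrier to A) using (_≈_; 0#; 1#; -_)
  module K = CommutativeRing K

  module PY = Polynomials K
  module DY = Degrees K
  module MY = MorePoly K
  KY = PY.polyRing
  module KY = CommutativeRing KY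
  domY : IsDomain KY
  domY = DY.polyDomain dom

  module PX = Polynomials KY
  module DX = Degrees KY
  module MX = MorePoly KY
  KYX = PX.polyRing
  module KYX = CommutativeRing KYX

  module ΠK = Products K
  module ΠY = Products KY
  module ΠX = Products KYX

  q : ℕ
  q = length all

  F₀ : Filtration K
  F₀ = scalarFiltration K
  FY : Filtration KY
  FY = DY.polyFiltration F₀
  QY : ℕ → ℕ → PY.Poly → Set
  QY = DY.Q F₀
  QX : ℕ → ℕ → PX.Poly → Set
  QX = DX.Q FY

  QY-deg : ∀ {N} f → QY 0 N f → DY.Deg< (suc N) f
  QY-deg {N} f h .DY.vanish i l = DY.Q-coeff F₀ f i h (≡.subst (N <_) (≡.sym (ℕₚ.+-identityʳ i)) l)

  grid-distinct : DY.Distinct (map ρ all)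
  grid-distinct = AllPairs.map⁺ (AllPairs.map (λ ne e → ne (ρ-injective _ _ e)) unique)

  zero-on-grid : ∀ f → (∀ i → DY.ev (ρ i) f ≈ 0#) → ∀ {n} → n ≤ q → DY.Deg< n f → f PY.≋ []
  zero-on-grid f h {n} l d = DY.roots-zero dom (map ρ all) f grid-distinct
    (All.map⁺ (All.universal h all)) (DY.deg-mono (≡.subst (n ≤_) (≡.sym (length-map ρ all)) l) d)

  evY : I → Hom KY K
  evY y = Evaluation.evHom (idHom K) (ρ y)

  ev₂ : I → I → Hom KYX K
  ev₂ x y = Evaluation.evHom (evY y) (ρ x)

  open Hom using (⟦_⟧; ⟦⟧-cong; +-hom; *-hom; 0-hom; 1-hom)

  fibre : I → Hom KYX KY
  fibre y = MapHom.mapHom (evY y)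

  ev-fibre : ∀ x y f → DY.ev (ρ x) (⟦ fibre y ⟧ f) ≈ ⟦ ev₂ x y ⟧ f
  ev-fibre x y f = K.trans (ev-map (idHom K) (evY y) (ρ x) f)
    (ev-ext (composeHom (idHom K) (evY y)) (evY y) (λ _ → K.refl) K.refl f)

  line : A → A → PY.Poly
  line a e = a ∷ e ∷ []

  shiftY : I → Hom KY KY
  shiftY y = Evaluation.evHom PY.constHom (line (ρ y) 1#)

  -- X ↦ ρ x + e T, Y ↦ ρ y + T
  τ : I → I → A → Hom KYX KY
  τ x y e = Evaluation.evHom (shiftY y) (line (ρ x) e)

  at0 : Hom KY K
  at0 = Evaluation.evHom (idHom K) 0#

  -- The variable, written as `X - 0` so that divisibility by it is `factor` at zero.
  T : PY.Poly
  T = DY.root 0#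

  at0-const : ∀ a → ⟦ at0 ⟧ (PY.const a) ≈ a
  at0-const a = K.trans (K.+-congˡ (K.zeroˡ 0#)) (K.+-identityʳ a)

  at0-line : ∀ a e → ⟦ at0 ⟧ (line a e) ≈ a
  at0-line a e = K.trans (K.+-congˡ (K.zeroˡ _)) (K.+-identityʳ a)

  at0-shift : ∀ y f → ⟦ at0 ⟧ (⟦ shiftY y ⟧ f) ≈ ⟦ evY y ⟧ f
  at0-shift y f = K.trans (ev-natural at0 PY.constHom (line (ρ y) 1#) f)
    (ev-ext (composeHom at0 PY.constHom) (idHom K) at0-const (at0-line (ρ y) 1#) f)

  at0-τ : ∀ x y e f → ⟦ at0 ⟧ (⟦ τ x y e ⟧ f) ≈ ⟦ ev₂ x y ⟧ f
  at0-τ x y e f = K.trans (ev-natural at0 (shiftY y) (line (ρ x) e) f)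
    (ev-ext (composeHom at0 (shiftY y)) (evY y) (at0-shift y) (at0-line (ρ x) e) f)

  at0-T : ⟦ at0 ⟧ T ≈ 0#
  at0-T = DY.Ev.ev-root-self 0#

  T≉0 : ¬ (T PY.≋ [])
  T≉0 e = IsDomain.1≉0 dom (K.trans (K.sym (DY.lead (DY.root-monic 0#))) (e .PY.at 1))

  T-factor : ∀ f → ⟦ at0 ⟧ f ≈ 0# → ∃ λ g → f PY.≋ T PY.⊠ g
  T-factor = DY.factor 0#

  others : I → List I
  others x = proj₁ (Unique⇒↭ {us = x ∷ []} {all} ([] ∷ []) (λ u _ → complete u))

  others-↭ : ∀ x → all ↭ x ∷ others x
  others-↭ x = proj₂ (Unique⇒↭ {us = x ∷ []} {all} ([] ∷ []) (λ u _ → complete u))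

  others-≢ : ∀ {x ξ} → ξ ∈ others x → ¬ x ≡ ξ
  others-≢ {x} m ≡.refl = ℕₚ.<-irrefl ≡.refl (begin-strict
    1 <⟨ s≤s (#-member (_≟ x) m ≡.refl) ⟩
    1 ℕ.+ # (_≟ x) (others x) ≡⟨ ≡.cong (ℕ._+ # (_≟ x) (others x)) (ind-yes (x ≟ x) ≡.refl) ⟨
    # (_≟ x) (x ∷ others x) ≡⟨ ∑-↭ _ (others-↭ x) ⟨
    # (_≟ x) all ≡⟨ unique-multiplicity _≟_ unique (complete x) ⟩
    1 ∎)
    where open ℕₚ.≤-Reasoning

  LY : PY.Poly
  LY = ΠY.∏ all (λ ξ → DY.root (ρ ξ))

  M : PX.Poly
  M = PX.const LY

  L : PX.Poly
  L = ΠX.∏ all (λ ξ → DX.root (PY.const (ρ ξ)))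

  -- `LY`, and in `UX` likewise `L`, without the root at the grid point. Their values at that point
  -- are nonzero, which allows the lowest terms of a form in `L` and `M` to be read off.
  UY : I → PY.Poly
  UY y = ΠY.∏ (others y) (λ ξ → DY.root (ρ ξ))

  UX : I → PX.Poly
  UX x = ΠX.∏ (others x) (λ ξ → DX.root (PY.const (ρ ξ)))

  hom-rootX : ∀ (φ : Hom KY KY) s b → Evaluation.ev φ s (DX.root b) PY.≋ s PY.⊞ PY.neg (⟦ φ ⟧ b)
  hom-rootX φ s b = KY.trans (Evaluation.ev-cong φ s (DX.root-def b))
    (KY.trans (KY.+-cong (HomLemmas.hom-neg φ b) (KY.trans (KY.*-congˡ {s} (KY.trans (KY.+-cong (1-hom φ) (KY.zeroʳ s)) (KY.+-identityʳ _))) (KY.*-identityʳ s)))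
      (KY.+-comm (PY.neg (⟦ φ ⟧ b)) s))

  hom-rootY : ∀ {S} (φ : Hom K S) s a → let module S = CommutativeRing S in
              Evaluation.ev φ s (DY.root a) S.≈ s S.+ S.- (⟦ φ ⟧ a)
  hom-rootY {S} φ s a = S.trans (Evaluation.ev-cong φ s (DY.root-def a))
    (S.trans (S.+-cong (HomLemmas.hom-neg φ a) (S.trans (S.*-congˡ (S.trans (S.+-cong (1-hom φ) (S.zeroʳ s)) (S.+-identityʳ _))) (S.*-identityʳ s)))
      (S.+-comm _ _))
    where module S = CommutativeRing S

  hom-rootX' : ∀ (φ : Hom KY K) s b → Evaluation.ev φ s (DX.root b) ≈ s K.+ - (⟦ φ ⟧ b)
  hom-rootX' φ s b = K.trans (Evaluation.ev-cong φ s (DX.root-def b))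
    (K.trans (K.+-cong (HomLemmas.hom-neg φ b) (K.trans (K.*-congˡ (K.trans (K.+-cong (1-hom φ) (K.zeroʳ s)) (K.+-identityʳ _))) (K.*-identityʳ s)))
      (K.+-comm _ _))

  line-sub : ∀ a e → line a e PY.⊞ PY.neg (PY.const a) PY.≋ T PY.⊠ PY.const e
  line-sub a e = KY.trans {_} {0# ∷ e ∷ []} (PY.mk co) (KY.sym (KY.trans (KY.*-congʳ {PY.const e} (DY.root-def 0#)) (PY.mk co')))
    where
      co : ∀ i → PY.coeff (line a e PY.⊞ PY.neg (PY.const a)) i ≈ PY.coeff (0# ∷ e ∷ []) i
      co 0 = K.-‿inverseʳ a
      co (suc i) = K.refl
      co' : ∀ i → PY.coeff ((- 0# ∷ 1# ∷ []) PY.⊠ PY.const e) i ≈ PY.coeff (0# ∷ e ∷ []) i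
      co' 0 = K.trans (K.+-identityʳ _) (K.trans (K.*-congʳ -0#≈0#) (K.zeroˡ e))
        where open import Algebra.Properties.Ring K.ring using (-0#≈0#)
      co' 1 = K.trans (K.+-identityʳ _) (K.*-identityˡ e)
      co' (suc (suc i)) = K.refl

  shiftY-const : ∀ y a → ⟦ shiftY y ⟧ (PY.const a) PY.≋ PY.const a
  shiftY-const y a = Evaluation.ev-const PY.constHom (line (ρ y) 1#) a

  τ-const : ∀ x y e b → ⟦ τ x y e ⟧ (PX.const b) PY.≋ ⟦ shiftY y ⟧ b
  τ-const x y e b = Evaluation.ev-const (shiftY y) (line (ρ x) e) b

  evY-const : ∀ y a → ⟦ evY y ⟧ (PY.const a) ≈ a
  evY-const y a = Evaluation.ev-const (idHom K) (ρ y) a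

  τ-L : ∀ x y e → ⟦ τ x y e ⟧ L PY.≋ T PY.⊠ (PY.const e PY.⊠ ⟦ τ x y e ⟧ (UX x))
  τ-L x y e = begin
    ⟦ τ x y e ⟧ L ≈⟨ ⟦⟧-cong (τ x y e) (ΠX.∏-↭ (λ ξ → DX.root (PY.const (ρ ξ))) (others-↭ x)) ⟩
    ⟦ τ x y e ⟧ (DX.root (PY.const (ρ x)) PX.⊠ UX x) ≈⟨ *-hom (τ x y e) (DX.root (PY.const (ρ x))) (UX x) ⟩
    ⟦ τ x y e ⟧ (DX.root (PY.const (ρ x))) PY.⊠ u ≈⟨ KY.*-congʳ {u} (KY.trans (hom-rootX (shiftY y) (line (ρ x) e) (PY.const (ρ x)))
        (KY.trans (KY.+-congˡ {line (ρ x) e} (PY.neg-cong (shiftY-const y (ρ x)))) (line-sub (ρ x) e))) ⟩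
    (T PY.⊠ PY.const e) PY.⊠ u ≈⟨ KY.*-assoc T (PY.const e) u ⟩
    T PY.⊠ (PY.const e PY.⊠ u) ∎
    where
      open import Relation.Binary.Reasoning.Setoid KY.setoid
      u = ⟦ τ x y e ⟧ (UX x)

  τ-M : ∀ x y e → ⟦ τ x y e ⟧ M PY.≋ T PY.⊠ ⟦ shiftY y ⟧ (UY y)
  τ-M x y e = begin
    ⟦ τ x y e ⟧ M ≈⟨ τ-const x y e LY ⟩
    ⟦ shiftY y ⟧ LY ≈⟨ ⟦⟧-cong (shiftY y) (ΠY.∏-↭ (λ ξ → DY.root (ρ ξ)) (others-↭ y)) ⟩
    ⟦ shiftY y ⟧ (DY.root (ρ y) PY.⊠ UY y) ≈⟨ *-hom (shiftY y) (DY.root (ρ y)) (UY y) ⟩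
    ⟦ shiftY y ⟧ (DY.root (ρ y)) PY.⊠ w ≈⟨ KY.*-congʳ {w} (KY.trans (hom-rootY PY.constHom (line (ρ y) 1#) (ρ y))
        (KY.trans (line-sub (ρ y) 1#) (KY.*-identityʳ T))) ⟩
    T PY.⊠ w ∎
    where
      open import Relation.Binary.Reasoning.Setoid KY.setoid
      w = ⟦ shiftY y ⟧ (UY y)

  evY-root : ∀ y a → ⟦ evY y ⟧ (DY.root a) ≈ ρ y K.+ - a
  evY-root y a = hom-rootY (idHom K) (ρ y) a

  ev₂-root : ∀ x y b → ⟦ ev₂ x y ⟧ (DX.root b) ≈ ρ x K.+ - (⟦ evY y ⟧ b)
  ev₂-root x y b = hom-rootX' (evY y) (ρ x) b

  UY≉0 : ∀ y → ¬ (⟦ evY y ⟧ (UY y) ≈ 0#)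
  UY≉0 y e = ΠK.∏-nonzero dom (others y) (λ ξ → ⟦ evY y ⟧ (DY.root (ρ ξ)))
    (λ ξ m z → others-≢ m (ρ-injective _ _ (DY.sub-zero (K.trans (K.sym (evY-root y (ρ ξ))) z))))
    (K.trans (K.sym (HomLemmas.hom-∏ (evY y) (others y) (λ ξ → DY.root (ρ ξ)))) e)

  UX≉0 : ∀ x y → ¬ (⟦ ev₂ x y ⟧ (UX x) ≈ 0#)
  UX≉0 x y e = ΠK.∏-nonzero dom (others x) (λ ξ → ⟦ ev₂ x y ⟧ (DX.root (PY.const (ρ ξ))))
    (λ ξ m z → others-≢ m (ρ-injective _ _ (DY.sub-zero (K.trans (K.sym
      (K.trans (ev₂-root x y (PY.const (ρ ξ))) (K.+-congˡ (K.-‿cong (evY-const y (ρ ξ)))))) z))))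
    (K.trans (K.sym (HomLemmas.hom-∏ (ev₂ x y) (others x) (λ ξ → DX.root (PY.const (ρ ξ))))) e)

  -- Multiplicity is tested along the lines with direction `(e , 1)` only. This separates the
  -- coefficients of a form in `L` and `M` of degree below `q`, as there are enough values of `e`.
  VanishesTo : ℕ → I → I → PX.Poly → Set
  VanishesTo n x y f = ∀ e → ∃ λ g → ⟦ τ x y e ⟧ f PY.≋ T ΠY.^ n PY.⊠ g

  vanishes-weaken : ∀ {f x y n} t → n ≤ t → VanishesTo t x y f → VanishesTo n x y f
  vanishes-weaken {f} {x} {y} {n} t l h e = T ΠY.^ (t ℕ.∸ n) PY.⊠ g , (begin
    ⟦ τ x y e ⟧ f ≈⟨ proj₂ (h e) ⟩
    T ΠY.^ t PY.⊠ g ≈⟨ KY.*-congʳ {g} {T ΠY.^ t} {T ΠY.^ n PY.⊠ T ΠY.^ (t ℕ.∸ n)} split ⟩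
    (T ΠY.^ n PY.⊠ T ΠY.^ (t ℕ.∸ n)) PY.⊠ g ≈⟨ KY.*-assoc (T ΠY.^ n) (T ΠY.^ (t ℕ.∸ n)) g ⟩
    T ΠY.^ n PY.⊠ (T ΠY.^ (t ℕ.∸ n) PY.⊠ g) ∎)
    where
      open import Relation.Binary.Reasoning.Setoid KY.setoid
      g = proj₁ (h e)
      split : T ΠY.^ t PY.≋ T ΠY.^ n PY.⊠ T ΠY.^ (t ℕ.∸ n)
      split = KY.trans (KY.reflexive (≡.cong (T ΠY.^_) (≡.sym (ℕₚ.m+[n∸m]≡n l)))) (ΠY.^-+ T n (t ℕ.∸ n))

  vanishes-cong : ∀ {n x y f g} → f PX.≋ g → VanishesTo n x y f → VanishesTo n x y g
  vanishes-cong {n} {x} {y} {f} {g} eq h e = proj₁ (h e) ,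
    KY.trans (⟦⟧-cong (τ x y e) {g} {f} (KYX.sym eq)) (proj₂ (h e))

  -- The coefficient of T ^ r of comb L M r gs along all directions (e , 1) at (x , y) is a
  -- polynomial in e with the values of the gs, up to units, as coefficients.
  lowest-terms-vanish : ∀ x y r gs → r < q → VanishesTo (suc r) x y (ΠX.comb L M r gs) →
                        ∀ i → ⟦ ev₂ x y ⟧ (Vec.lookup gs i) ≈ 0#
  lowest-terms-vanish x y r gs r<q h i = K.trans (K.reflexive (≡.sym (lookup-map i ⟦ ev₂ x y ⟧ gs)))
    (MY.combPoly-zero dom (UX≉0 x y) (UY≉0 y) r vals
      (zero-on-grid (MY.combPoly d w r vals) (λ ξ → K.trans (MY.combPoly-ev (ρ ξ) d w r vals) (value (ρ ξ))) r<q
        (≡.subst (λ n → DY.Deg< n (MY.combPoly d w r vals)) (MY.combPoly-length d w r vals) (DY.deg-length _))) i)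
    where
      d = ⟦ ev₂ x y ⟧ (UX x)
      w = ⟦ evY y ⟧ (UY y)
      vals = Vec.map ⟦ ev₂ x y ⟧ gs
      value : ∀ e → ΠK.comb (e K.* d) w r vals ≈ 0#
      value e = begin
        ΠK.comb (e K.* d) w r vals ≈⟨ ΠK.comb-cong (K.sym u0) (K.sym (at0-shift y (UY y))) r vals ⟩
        ΠK.comb (⟦ at0 ⟧ u) (⟦ at0 ⟧ w') r vals ≈⟨ same r gs ⟩
        ΠK.comb (⟦ at0 ⟧ u) (⟦ at0 ⟧ w') r (Vec.map ⟦ at0 ⟧ (Vec.map ⟦ τ x y e ⟧ gs))
          ≈⟨ HomLemmas.hom-comb at0 u w' r (Vec.map ⟦ τ x y e ⟧ gs) ⟨
        ⟦ at0 ⟧ (ΠY.comb u w' r (Vec.map ⟦ τ x y e ⟧ gs)) ≈⟨ ⟦⟧-cong at0 reduced ⟩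
        ⟦ at0 ⟧ (T PY.⊠ k) ≈⟨ *-hom at0 T k ⟩
        ⟦ at0 ⟧ T K.* ⟦ at0 ⟧ k ≈⟨ K.trans (K.*-congʳ at0-T) (K.zeroˡ _) ⟩
        0# ∎
        where
          open import Relation.Binary.Reasoning.Setoid K.setoid
          u = PY.const e PY.⊠ ⟦ τ x y e ⟧ (UX x)
          w' = ⟦ shiftY y ⟧ (UY y)
          k = proj₁ (h e)
          u0 : ⟦ at0 ⟧ u ≈ e K.* d
          u0 = K.trans (*-hom at0 (PY.const e) (⟦ τ x y e ⟧ (UX x))) (K.*-cong (at0-const e) (at0-τ x y e (UX x)))
          same : ∀ r (gs : Vec PX.Poly (suc r)) → ΠK.comb (⟦ at0 ⟧ u) (⟦ at0 ⟧ w') r (Vec.map ⟦ ev₂ x y ⟧ gs) ≈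
                 ΠK.comb (⟦ at0 ⟧ u) (⟦ at0 ⟧ w') r (Vec.map ⟦ at0 ⟧ (Vec.map ⟦ τ x y e ⟧ gs))
          same zero (g ∷ []) = K.sym (at0-τ x y e g)
          same (suc r) (g ∷ gs) = K.+-cong (K.*-congˡ (K.sym (at0-τ x y e g))) (K.*-congˡ (same r gs))
          τgs = Vec.map ⟦ τ x y e ⟧ gs
          -- Along the line, `L` is `T u` and `M` is `T w'`. The form is therefore `T ^ r` times the
          -- same form in `u` and `w'`, and one factor `T` of `T ^ suc r` is left.
          reduced : ΠY.comb u w' r τgs PY.≋ T PY.⊠ k
          reduced = ΠY.cancelˡ domY (ΠY.^-nonzero domY r T≉0) (KY.trans (KY.sym (ΠY.comb-scale T u w' r τgs))
            (KY.trans (ΠY.comb-cong (KY.sym (τ-L x y e)) (KY.sym (τ-M x y e)) r τgs)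
            (KY.trans (KY.sym (HomLemmas.hom-comb (τ x y e) L M r gs))
            (KY.trans (proj₂ (h e)) (KY.trans (KY.*-congʳ {k} (KY.*-comm T (T ΠY.^ r))) (KY.*-assoc (T ΠY.^ r) T k))))))

  monic-L : DX.Monic q L
  monic-L = MX.monic-∏ all (λ ξ → PY.const (ρ ξ))

  monic-LY : DY.Monic q LY
  monic-LY = MY.monic-∏ all ρ

  Q-LY : QY 0 q LY
  Q-LY = MY.Q-∏ F₀ all ρ (λ _ ())

  Q-L : QX 0 q L
  Q-L = MX.Q-∏ FY all (λ ξ → PY.const (ρ ξ)) (λ _ → (λ ()) , tt)

  LY-zero : ∀ y → ⟦ evY y ⟧ LY ≈ 0#
  LY-zero y = K.trans (HomLemmas.hom-∏ (evY y) all (λ ξ → DY.root (ρ ξ)))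
    (ΠK.∏-zero _ (complete y) (DY.Ev.ev-root-self (ρ y)))

  L-zero : ∀ x y → ⟦ ev₂ x y ⟧ L ≈ 0#
  L-zero x y = K.trans (HomLemmas.hom-∏ (ev₂ x y) all (λ ξ → DX.root (PY.const (ρ ξ))))
    (ΠK.∏-zero _ (complete x) (K.trans (ev₂-root x y (PY.const (ρ x)))
      (K.trans (K.+-congˡ (K.-‿cong (evY-const y (ρ x)))) (K.-‿inverseʳ (ρ x)))))

  private
    divide-coefficient : ∀ {s N} f → (∀ y → ⟦ evY y ⟧ f ≈ 0#) → QY s N f → ∃ λ b → f PY.≋ LY PY.⊠ b × QY (q ℕ.+ s) N b
    divide-coefficient f h Qf with DY.divMod F₀ monic-LY Q-LY f Qf
    ... | b , r , e , d , Qb , _ = b , KY.trans e (KY.trans (KY.+-congˡ {LY PY.⊠ b} r≋0) (KY.+-identityʳ _)) , Qb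
      where
        r≋0 : r PY.≋ []
        r≋0 = zero-on-grid r (λ y → begin
          DY.ev (ρ y) r ≈⟨ K.+-identityˡ _ ⟨
          0# K.+ DY.ev (ρ y) r ≈⟨ K.+-congʳ (K.trans (*-hom (evY y) LY b) (K.trans (K.*-congʳ (LY-zero y)) (K.zeroˡ _))) ⟨
          DY.ev (ρ y) (LY PY.⊠ b) K.+ DY.ev (ρ y) r ≈⟨ +-hom (evY y) (LY PY.⊠ b) r ⟨
          DY.ev (ρ y) (LY PY.⊠ b PY.⊞ r) ≈⟨ ⟦⟧-cong (evY y) e ⟨
          DY.ev (ρ y) f ≈⟨ h y ⟩
          0# ∎) ℕₚ.≤-refl d
          where open import Relation.Binary.Reasoning.Setoid K.setoid

    divide-coefficients : ∀ {s N} f → (∀ y i → ⟦ evY y ⟧ (PX.coeff f i) ≈ 0#) → QX s N f →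
                          ∃ λ b → f PX.≋ PX.scal LY b × QX (q ℕ.+ s) N b
    divide-coefficients [] h _ = [] , PX.≋-refl , tt
    divide-coefficients {s} {N} (a ∷ f) h (Qa , Qf)
      with divide-coefficient a (λ y → h y 0) Qa | divide-coefficients f (λ y i → h y (suc i)) Qf
    ... | b , e , Qb | bs , es , Qbs = b ∷ bs , PX.∷-cong e es , Qb , ≡.subst (λ n → QX n N bs) (ℕₚ.+-suc q s) Qbs

  -- Division by `L` leaves a remainder of degree below `q` in `X`. It vanishes at the `q` grid
  -- points of each fibre, hence identically there, so its coefficients vanish on the grid in `Y`
  -- and are multiples of `LY`. The offset `q + s` records that both cofactors have degree lower by
  -- `q`.
  grid-division : ∀ {s N} f → (∀ x y → ⟦ ev₂ x y ⟧ f ≈ 0#) → QX s N f →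
                  ∃₂ λ a b → f PX.≋ L PX.⊠ a PX.⊞ M PX.⊠ b × QX (q ℕ.+ s) N a × QX (q ℕ.+ s) N b
  grid-division f h Qf with DX.divMod FY monic-L Q-L f Qf
  ... | a , r , e , d , Qa , Qr
    with divide-coefficients r (λ y i → K.trans (K.sym (MapHom.coeff-mapP (evY y) r i)) (r-fibre y .PY.at i)) Qr
    where
      r-fibre : ∀ y → ⟦ fibre y ⟧ r PY.≋ []
      r-fibre y = zero-on-grid (⟦ fibre y ⟧ r) (λ x → begin
        DY.ev (ρ x) (⟦ fibre y ⟧ r) ≈⟨ ev-fibre x y r ⟩
        ⟦ ev₂ x y ⟧ r ≈⟨ K.+-identityˡ _ ⟨
        0# K.+ ⟦ ev₂ x y ⟧ r ≈⟨ K.+-congʳ (K.trans (*-hom (ev₂ x y) L a) (K.trans (K.*-congʳ (L-zero x y)) (K.zeroˡ _))) ⟨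
        ⟦ ev₂ x y ⟧ (L PX.⊠ a) K.+ ⟦ ev₂ x y ⟧ r ≈⟨ +-hom (ev₂ x y) (L PX.⊠ a) r ⟨
        ⟦ ev₂ x y ⟧ (L PX.⊠ a PX.⊞ r) ≈⟨ ⟦⟧-cong (ev₂ x y) e ⟨
        ⟦ ev₂ x y ⟧ f ≈⟨ h x y ⟩
        0# ∎) ℕₚ.≤-refl (MapHom.mapP-deg (evY y) d)
        where open import Relation.Binary.Reasoning.Setoid K.setoid
  ...   | b , e' , Qb = a , b ,
          KYX.trans e (KYX.+-congˡ {L PX.⊠ a} (KYX.trans e' (KYX.sym (PX.const-⊠ LY b)))) , Qa , Qb

  private
    merge-Q : ∀ {s N e n} (as bs : Vec PX.Poly n) → QX s N e → (∀ i → QX s N (Vec.lookup as i)) →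
              (∀ i → QX s N (Vec.lookup bs i)) → ∀ i → QX s N (Vec.lookup (ΠX.merge e as bs) i)
    merge-Q [] [] h _ _ Fin.zero = h
    merge-Q {e = e} (a ∷ as) (b ∷ bs) h ha hb Fin.zero = DX.Q-+ FY e b h (hb Fin.zero)
    merge-Q (a ∷ as) (b ∷ bs) h ha hb (Fin.suc i) =
      merge-Q as bs (ha Fin.zero) (λ j → ha (Fin.suc j)) (λ j → hb (Fin.suc j)) i

    Division : ℕ → ℕ → PX.Poly → Set
    Division s N g = ∃₂ λ a b → g PX.≋ L PX.⊠ a PX.⊞ M PX.⊠ b × QX s N a × QX s N b

    collect : ∀ {s N n} (gs : Vec PX.Poly n) → (∀ i → Division s N (Vec.lookup gs i)) →
              ∃₂ λ as bs → ΠX.Decomposes L M gs as bs × (∀ i → QX s N (Vec.lookup as i)) × (∀ i → QX s N (Vec.lookup bs i))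
    collect [] h = [] , [] , (λ ()) , (λ ()) , (λ ())
    collect {s} {N} (g ∷ gs) h with h Fin.zero | collect {s} {N} gs (λ i → h (Fin.suc i))
    ... | a , b , e , qa , qb | as , bs , es , qas , qbs = a ∷ as , b ∷ bs ,
      (λ { Fin.zero → e ; (Fin.suc i) → es i }) ,
      (λ { Fin.zero → qa ; (Fin.suc i) → qas i }) , (λ { Fin.zero → qb ; (Fin.suc i) → qbs i })

    Expansion : ℕ → ℕ → PX.Poly → Set
    Expansion N t f = ∃ λ (gs : Vec PX.Poly (suc t)) → f PX.≋ ΠX.comb L M t gs × (∀ i → QX (t ℕ.* q) N (Vec.lookup gs i))

    regrouped : ∀ {N n f} gs → f PX.≋ ΠX.comb L M n gs → (∃₂ λ as bs → ΠX.Decomposes L M gs as bs ×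
                (∀ i → QX (suc n ℕ.* q) N (Vec.lookup as i)) × (∀ i → QX (suc n ℕ.* q) N (Vec.lookup bs i))) →
                Expansion N (suc n) f
    regrouped {N} {n} {f} gs e (as , bs , dec , Qas , Qbs) = ΠX.merge [] as bs ,
      KYX.trans {f} {ΠX.comb L M n gs} {ΠX.comb L M (suc n) (ΠX.merge [] as bs)} e (ΠX.comb-regroup L M n gs as bs dec) ,
      merge-Q {suc n ℕ.* q} {N} {[]} as bs tt Qas Qbs

    -- The order of vanishing exceeds the degree `n` of the form by one, so its coefficients vanish
    -- on the grid. Splitting each by `grid-division` and regrouping gives a form of degree `suc n`
    -- with coefficients of degree lower by `q`.
    expansion-step : ∀ {N n f} → n < q → (∀ x y → VanishesTo (suc n) x y f) → Expansion N n f → Expansion N (suc n) f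
    expansion-step {N} {n} {f} n<q h (gs , e , Qgs) = regrouped {N} {n} {f} gs e
      (collect {suc n ℕ.* q} {N} gs (λ i → grid-division {n ℕ.* q} {N} (Vec.lookup gs i)
        (λ x y → lowest-terms-vanish x y n gs n<q (vanishes-cong {suc n} {x} {y} {f} {ΠX.comb L M n gs} e (h x y)) i) (Qgs i)))

  punctured-nullstellensatz′ : ∀ t {N} f → t ≤ q → QX 0 N f → (∀ x y → VanishesTo t x y f) →
    ∃ λ (gs : Vec PX.Poly (suc t)) → f PX.≋ ΠX.comb L M t gs × (∀ i → QX (t ℕ.* q) N (Vec.lookup gs i))
  punctured-nullstellensatz′ t {N} f t≤q Qf h = go t ℕₚ.≤-refl
    where
      go : ∀ n → n ≤ t → Expansion N n f
      go zero _ = f ∷ [] , PX.≋-refl , λ { Fin.zero → Qf }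
      go (suc n) l = expansion-step {N} {n} {f} (ℕₚ.<-≤-trans l t≤q)
        (λ x y → vanishes-weaken {f} {x} {y} {suc n} t l (h x y)) (go n (ℕₚ.<⇒≤ l))

  abstract
    punctured-nullstellensatz : ∀ t {N} f → t ≤ q → QX 0 N f → (∀ x y → VanishesTo t x y f) →
      ∃ λ (gs : Vec PX.Poly (suc t)) → f PX.≋ ΠX.comb L M t gs × (∀ i → QX (t ℕ.* q) N (Vec.lookup gs i))
    punctured-nullstellensatz = punctured-nullstellensatz′

-- Multiplicities of roots and the derivative

module RootMultiplicity (K : CommutativeRing 0ℓ 0ℓ) (dom : IsDomain K) where
  open CommutativeRing K renaming (Carrier to A)
  open Polynomials K
  open Degrees K
  open Products polyRing
  open Mult +-monoid using () renaming (_×_ to _·_)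

  ∏-multiplicity : ∀ {I : Set} (f : I → A) {P : I → Set} (P? : ∀ i → Dec (P i)) x →
    (∀ i → P i → f i ≈ x) → (∀ i → ¬ P i → ¬ (f i ≈ x)) →
    ∀ is → ∃ λ h → ∏ is (λ i → root (f i)) ≋ root x ^ # P? is ⊠ h × ¬ (ev x h ≈ 0#)
  ∏-multiplicity f P? x yes' no' [] = 1# ∷ [] , ≋-sym (⊠-identityˡ _) ,
    λ e → IsDomain.1≉0 dom (trans (sym (Ev.ev-const x 1#)) e)
  ∏-multiplicity f P? x yes' no' (i ∷ is) with P? i | ∏-multiplicity f P? x yes' no' is
  ... | yes p | h , e , ne = h , (begin
          root (f i) ⊠ ∏ is (λ i → root (f i)) ≈⟨ ⊠-cong {root (f i)} {root x} (PR.trans (root-def (f i)) (PR.trans (∷-cong (-‿cong (yes' i p)) ≋-refl) (≋-sym (root-def x)))) e ⟩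
          root x ⊠ (root x ^ # P? is ⊠ h) ≈⟨ ⊠-assoc (root x) (root x ^ # P? is) h ⟨
          (root x ⊠ root x ^ # P? is) ⊠ h ∎) , ne
    where open import Relation.Binary.Reasoning.Setoid PR.setoid
  ... | no np | h , e , ne = root (f i) ⊠ h , (begin
          root (f i) ⊠ ∏ is (λ i → root (f i)) ≈⟨ ⊠-cong {root (f i)} {root (f i)} ≋-refl e ⟩
          root (f i) ⊠ (rx ⊠ h) ≈⟨ ⊠-assoc (root (f i)) rx h ⟨
          (root (f i) ⊠ rx) ⊠ h ≈⟨ ⊠-cong {root (f i) ⊠ rx} {rx ⊠ root (f i)} {h} {h} (⊠-comm (root (f i)) rx) ≋-refl ⟩
          (rx ⊠ root (f i)) ⊠ h ≈⟨ ⊠-assoc rx (root (f i)) h ⟩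
          rx ⊠ (root (f i) ⊠ h) ∎) , nz
    where
      open import Relation.Binary.Reasoning.Setoid PR.setoid
      rx = root x ^ # P? is
      nz : ¬ (ev x (root (f i) ⊠ h) ≈ 0#)
      nz z with IsDomain.no-zero-divisors dom _ _ (trans (sym (Ev.ev-⊠ x (root (f i)) h)) z)
      ... | inj₁ z' = no' i np (sym (sub-zero (trans (sym (Ev.ev-root x (f i))) z')))
      ... | inj₂ z' = ne z'

  D-power : ∀ x n → D (root x ^ suc n) ≋ root x ^ n ⊠ const (suc n · 1#)
  D-power x zero = begin
    D (root x ⊠ (1# ∷ [])) ≈⟨ D-cong (PR.*-identityʳ (root x)) ⟩
    D (root x) ≈⟨ DerivativeOfProduct.D-root K x ⟩
    1# ∷ [] ≈⟨ ∷-cong (+-identityʳ 1#) ≋-refl ⟨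
    const (1 · 1#) ≈⟨ ⊠-identityˡ (const (1 · 1#)) ⟨
    (1# ∷ []) ⊠ const (1 · 1#) ∎
    where open import Relation.Binary.Reasoning.Setoid PR.setoid
  D-power x (suc n) = begin
    D (r ⊠ r ^ suc n) ≈⟨ D-⊠ r (r ^ suc n) ⟩
    D r ⊠ r ^ suc n ⊞ r ⊠ D (r ^ suc n)
      ≈⟨ ⊞-cong (PR.*-cong {D r} {1# ∷ []} {r ^ suc n} {r ^ suc n} (DerivativeOfProduct.D-root K x) ≋-refl) (PR.*-cong {r} {r} ≋-refl (D-power x n)) ⟩
    (1# ∷ []) ⊠ r ^ suc n ⊞ r ⊠ (r ^ n ⊠ c)
      ≈⟨ ⊞-cong (⊠-comm (1# ∷ []) (r ^ suc n)) (≋-sym (⊠-assoc r (r ^ n) c)) ⟩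
    r ^ suc n ⊠ const 1# ⊞ r ^ suc n ⊠ c ≈⟨ ⊠-distribˡ (r ^ suc n) (const 1#) c ⟨
    r ^ suc n ⊠ const (1# + suc n · 1#) ∎
    where
      open import Relation.Binary.Reasoning.Setoid PR.setoid
      r = root x
      c = const (suc n · 1#)

  -- For `e = suc n` the derivative is `(X - x) ^ n` times `e h + (X - x) D h`. If it vanishes, so
  -- does the cofactor, whose value at `x` is `e h(x)`.
  multiplicity-zero : ∀ x e h → D (root x ^ e ⊠ h) ≋ [] → ¬ (ev x h ≈ 0#) → e · 1# ≈ 0#
  multiplicity-zero x zero h d ne = refl
  multiplicity-zero x (suc n) h d ne with IsDomain.no-zero-divisors dom (suc n · 1#) (ev x h) (begin
      suc n · 1# * ev x h ≈⟨ *-congʳ (Ev.ev-const x (suc n · 1#)) ⟨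
      ev x c * ev x h ≈⟨ +-identityʳ _ ⟨
      ev x c * ev x h + 0# ≈⟨ +-cong (Ev.ev-⊠ x c h) (trans (Ev.ev-⊠ x r (D h)) (trans (*-congʳ (Ev.ev-root-self x)) (zeroˡ _))) ⟨
      ev x (c ⊠ h) + ev x (r ⊠ D h) ≈⟨ Ev.ev-⊞ x (c ⊠ h) (r ⊠ D h) ⟨
      ev x (c ⊠ h ⊞ r ⊠ D h) ≈⟨ Ev.ev-cong x cofactor ⟩
      0# ∎)
    where
      open import Relation.Binary.Reasoning.Setoid setoid
      r = root x
      c = const (suc n · 1#)
      cofactor : c ⊠ h ⊞ r ⊠ D h ≋ []
      cofactor = monic-cancel (MorePoly.monic-^ K n (root-monic x)) (c ⊠ h ⊞ r ⊠ D h) (PR.trans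
        (⊠-distribˡ (r ^ n) (c ⊠ h) (r ⊠ D h)) (PR.trans (⊞-cong
          (PR.trans (≋-sym (⊠-assoc (r ^ n) c h)) (PR.*-congʳ {h} (≋-sym (D-power x n))))
          (PR.trans (≋-sym (⊠-assoc (r ^ n) r (D h))) (PR.*-congʳ {D h} (⊠-comm (r ^ n) r))))
        (PR.trans (≋-sym (D-⊠ (r ^ suc n) h)) d)))
  ... | inj₁ z = z
  ... | inj₂ z = ⊥-elim (ne z)

-- The product of the dual linear polynomials and its surplus beyond multiplicity t

-- A pair (s , a) is the affine point dual to the line X + σ s Y = ρ a, and x = bk s a y solves this equation
-- on the grid; inf collects the points dual to the lines Y = ρ b.
module Lines (K : CommutativeRing 0ℓ 0ℓ) (dom : IsDomain K)
             (I : Set) (_≟_ : (i j : I) → Dec (i ≡ j)) (all : List I) (unique : Unique all) (complete : ∀ i → i ∈ all)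
             (ρ : I → CommutativeRing.Carrier K)
             (ρ-injective : ∀ i j → CommutativeRing._≈_ K (ρ i) (ρ j) → i ≡ j)
             (S : Set) (σ : S → CommutativeRing.Carrier K) (bk : S → I → I → I)
             (bk-ρ : ∀ s a y → CommutativeRing._≈_ K (ρ (bk s a y))
               (CommutativeRing._+_ K (ρ a) (CommutativeRing.-_ K (CommutativeRing._*_ K (σ s) (ρ y)))))
             (aff : List (S × I)) (inf : List I) where

  open Grid K dom I _≟_ all unique complete ρ ρ-injective
  open CommutativeRing K using (_≈_; 0#; 1#; -_)
  open Hom using (⟦_⟧; ⟦⟧-cong; +-hom; *-hom; 0-hom; 1-hom)
  open import Data.List.Membership.DecPropositional _≟_ using (_∈?_)

  back : I → S × I → I
  back y (s , a) = bk s a y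

  fib : I → List I
  fib y = map (back y) aff

  -- The number of linear factors of `H` that vanish at the grid point `(x , y)`.
  Z : I → I → ℕ
  Z x y = # (_≟ x) (fib y) ℕ.+ # (_≟ y) inf

  private
    m = length inf
    N = length aff ℕ.+ m

  b : S × I → PY.Poly
  b (s , a) = ρ a ∷ - σ s ∷ []

  evY-b : ∀ y v → ⟦ evY y ⟧ (b v) ≈ ρ (back y v)
  evY-b y (s , a) = K.trans (K.+-congˡ (K.trans (K.*-congˡ (K.trans (K.+-congˡ (K.zeroʳ _)) (K.+-identityʳ _)))
    (K.trans (K.*-comm _ _) (K.sym (-‿distribˡ-* (σ s) (ρ y)))))) (K.sym (bk-ρ s a y))
    where open import Algebra.Properties.Ring K.ring using (-‿distribˡ-*)

  λ' : S × I → PX.Poly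
  λ' v = DX.root (b v)

  A : PX.Poly
  A = ΠX.∏ aff λ'

  J : PY.Poly
  J = ΠY.∏ inf (λ i → DY.root (ρ i))

  H : PX.Poly
  H = A PX.⊠ PX.const J

  H-vanishes : ∀ x y → VanishesTo (Z x y) x y H
  H-vanishes x y e = proj₁ partA PY.⊠ proj₁ partJ , (begin
    ⟦ τ x y e ⟧ H ≈⟨ *-hom (τ x y e) A (PX.const J) ⟩
    ⟦ τ x y e ⟧ A PY.⊠ ⟦ τ x y e ⟧ (PX.const J)
      ≈⟨ KY.*-cong (KY.trans (HomLemmas.hom-∏ (τ x y e) aff λ') (proj₂ partA))
           (KY.trans (τ-const x y e J) (KY.trans (HomLemmas.hom-∏ (shiftY y) inf (λ i → DY.root (ρ i))) (proj₂ partJ))) ⟩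
    (T ΠY.^ i PY.⊠ g) PY.⊠ (T ΠY.^ j PY.⊠ h) ≈⟨ exch (T ΠY.^ i) g (T ΠY.^ j) h ⟩
    (T ΠY.^ i PY.⊠ T ΠY.^ j) PY.⊠ (g PY.⊠ h) ≈⟨ KY.*-congʳ {g PY.⊠ h} (KY.trans (KY.sym (ΠY.^-+ T i j))
         (KY.reflexive (≡.cong (λ n → T ΠY.^ (n ℕ.+ j)) (≡.sym (∑-map (back y) aff _))))) ⟩
    T ΠY.^ Z x y PY.⊠ (g PY.⊠ h) ∎)
    where
      open import Relation.Binary.Reasoning.Setoid KY.setoid
      open import Algebra.Properties.CommutativeSemigroup KY.*-commutativeSemigroup using () renaming (interchange to exch)
      partA = ΠY.∏-marked (λ v → back y v ≟ x) T (λ v → ⟦ τ x y e ⟧ (λ' v))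
        (λ v eq → T-factor _ (K.trans (at0-τ x y e (λ' v)) (K.trans (ev₂-root x y (b v))
          (K.trans (K.+-congˡ (K.-‿cong (K.trans (evY-b y v) (K.reflexive (≡.cong ρ eq))))) (K.-‿inverseʳ _))))) aff
      partJ = ΠY.∏-marked (_≟ y) T (λ i → ⟦ shiftY y ⟧ (DY.root (ρ i)))
        (λ { i ≡.refl → T-factor _ (K.trans (at0-shift y (DY.root (ρ y))) (DY.Ev.ev-root-self (ρ y))) }) inf
      i = # (λ v → back y v ≟ x) aff
      j = # (_≟ y) inf
      g = proj₁ partA
      h = proj₁ partJ

  QA : QX 0 (length aff) A
  QA = MX.Q-∏ FY aff b (λ v → (λ ()) , (λ { (s≤s ()) }) , tt)

  QH : QX 0 N H
  QH = DX.Q-* FY A (PX.const J) QA (MY.Q-∏ F₀ inf ρ (λ _ ()) , tt)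

  inf-rare : # (_∈? inf) all ≤ m
  inf-rare = begin
    # (_∈? inf) all ≤⟨ ∑-mono all (λ y _ → bnd y) ⟩
    ∑ all (λ y → # (_≟ y) inf) ≡⟨ ∑-swap all inf _ ⟩
    ∑ inf (λ i → ∑ all (λ y → ind (i ≟ y)))
      ≡⟨ ∑-cong inf (λ i _ → ≡.trans (∑-cong all (λ y _ → ind-cong (i ≟ y) (y ≟ i) ≡.sym ≡.sym)) (unique-multiplicity _≟_ unique (complete i))) ⟩
    ∑ inf (λ _ → 1) ≡⟨ length-∑ inf ⟨
    m ∎
    where
      open ℕₚ.≤-Reasoning
      bnd : ∀ y → ind (y ∈? inf) ≤ # (_≟ y) inf
      bnd y with y ∈? inf
      ... | yes k = #-member (_≟ y) k ≡.refl
      ... | no _ = z≤n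

  -- Applied to the roots of a fibre, among which every grid value occurs at least `t` times: the
  -- corresponding product is then divisible by `LY ^ t`.
  peel′ : ∀ n xs → (∀ x → n ≤ # (_≟ x) xs) → ∃ λ ys → (∀ x → # (_≟ x) xs ≡ n ℕ.+ # (_≟ x) ys) ×
         ΠY.∏ xs (λ i → DY.root (ρ i)) PY.≋ LY ΠY.^ n PY.⊠ ΠY.∏ ys (λ i → DY.root (ρ i))
  peel′ zero xs h = xs , (λ _ → ≡.refl) , KY.sym (KY.*-identityˡ (ΠY.∏ xs (λ i → DY.root (ρ i))))
  peel′ (suc n) xs h with Unique⇒↭ {us = all} {xs} unique (λ u _ → uncurry (λ v k → ≡.subst (_∈ xs) (proj₂ k) (proj₁ k)) (#-witness (_≟ u) xs (ℕₚ.<-≤-trans (s≤s z≤n) (h u))))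
  ... | zs , perm = ys , count' , (begin
        ΠY.∏ xs f ≈⟨ ΠY.∏-↭ f perm ⟩
        ΠY.∏ (all ++ zs) f ≈⟨ ΠY.∏-++ all zs f ⟩
        LY PY.⊠ ΠY.∏ zs f ≈⟨ KY.*-congˡ {LY} (proj₂ (proj₂ ih)) ⟩
        LY PY.⊠ (LY ΠY.^ n PY.⊠ ΠY.∏ ys f) ≈⟨ KY.*-assoc LY (LY ΠY.^ n) (ΠY.∏ ys f) ⟨
        LY ΠY.^ suc n PY.⊠ ΠY.∏ ys f ∎)
    where
      open import Relation.Binary.Reasoning.Setoid KY.setoid
      f = λ i → DY.root (ρ i)
      one-more : ∀ x → # (_≟ x) xs ≡ suc (# (_≟ x) zs)
      one-more x = ≡.trans (∑-↭ _ perm) (≡.trans (∑-++ all zs _) (≡.cong (ℕ._+ # (_≟ x) zs) (unique-multiplicity _≟_ unique (complete x))))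
      ih = peel′ n zs (λ x → ℕₚ.≤-pred (≡.subst (suc n ≤_) (one-more x) (h x)))
      ys = proj₁ ih
      count' : ∀ x → # (_≟ x) xs ≡ suc n ℕ.+ # (_≟ x) ys
      count' x = ≡.trans (one-more x) (≡.cong suc (proj₁ (proj₂ ih) x))

  abstract
    peel : ∀ n xs → (∀ x → n ≤ # (_≟ x) xs) → ∃ λ ys → (∀ x → # (_≟ x) xs ≡ n ℕ.+ # (_≟ x) ys) ×
           ΠY.∏ xs (λ i → DY.root (ρ i)) PY.≋ LY ΠY.^ n PY.⊠ ΠY.∏ ys (λ i → DY.root (ρ i))
    peel = peel′

  -- `c + m` is the excess of the number of points over `t * q`, and `few` says that it is less than
  -- half of `q`.
  module _ (t c : ℕ) (aff-length : length aff ≡ t ℕ.* q ℕ.+ c) (t<q : t < q)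
           (few : 2 ℕ.* (c ℕ.+ m) < q) (blocking : ∀ x y → t ≤ Z x y) where

    private
      expansion = punctured-nullstellensatz t {N} H (ℕₚ.<⇒≤ t<q) QH (λ x y → vanishes-weaken {H} {x} {y} (Z x y) (blocking x y) (H-vanishes x y))
      Gs = proj₁ expansion

      lower : ∀ {M'} f → QX (t ℕ.* q) (t ℕ.* q ℕ.+ M') f → QX 0 M' f
      lower {M'} f h = Filtration.P-down* (DX.polyFiltration FY) (t ℕ.* q)
        (≡.subst₂ (λ s n → QX s n f) (≡.sym (ℕₚ.+-identityʳ (t ℕ.* q))) (ℕₚ.+-comm (t ℕ.* q) M') h)

      QGs : ∀ i → QX 0 (c ℕ.+ m) (Vec.lookup Gs i)
      QGs i = lower (Vec.lookup Gs i) (≡.subst (λ n → QX (t ℕ.* q) n (Vec.lookup Gs i))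
        (≡.trans (≡.cong (ℕ._+ m) aff-length) (ℕₚ.+-assoc (t ℕ.* q) c m)) (proj₂ (proj₂ expansion) i))

      Lᵗ = L ΠX.^ t
      monic-Lᵗ = MX.monic-^ t monic-L
      division = DX.divMod FY monic-Lᵗ (MX.Q-^ FY t Q-L) A QA

    -- What `A` has beyond `L ^ t`. On a fibre that avoids `inf` its roots are the surplus
    -- incidences, those in excess of `t`.
    G : PX.Poly
    G = proj₁ division

    private
      Rem = proj₁ (proj₂ division)
      A-eq : A PX.≋ Lᵗ PX.⊠ G PX.⊞ Rem
      A-eq = proj₁ (proj₂ (proj₂ division))
      deg-Rem : DX.Deg< (t ℕ.* q) Rem
      deg-Rem = proj₁ (proj₂ (proj₂ (proj₂ division)))

    monic-G : DX.Monic c G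
    monic-G = MX.monic-quotient (≡.subst (λ n → DX.Monic n A) aff-length (MX.monic-∏ aff b)) monic-Lᵗ A-eq deg-Rem

    QG : QX 0 c G
    QG = lower G (≡.subst₂ (λ s n → QX s n G) (ℕₚ.+-identityʳ (t ℕ.* q)) aff-length (proj₁ (proj₂ (proj₂ (proj₂ (proj₂ division))))))

    module Fibre (y : I) (y∉ : ¬ y ∈ inf) where
      no-inf : # (_≟ y) inf ≡ 0
      no-inf = #-none (_≟ y) inf (λ { i k ≡.refl → y∉ k })

      Z≡ : ∀ x → Z x y ≡ # (_≟ x) (fib y)
      Z≡ x = ≡.trans (≡.cong (# (_≟ x) (fib y) ℕ.+_) no-inf) (ℕₚ.+-identityʳ _)

      private peeled = peel t (fib y) (λ x → ≡.subst (t ≤_) (Z≡ x) (blocking x y))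

      rest : List I
      rest = proj₁ peeled

      fib-rest : ∀ x → # (_≟ x) (fib y) ≡ t ℕ.+ # (_≟ x) rest
      fib-rest = proj₁ (proj₂ peeled)

      Pr : PY.Poly
      Pr = ΠY.∏ rest (λ i → DY.root (ρ i))

      fibre-root : ∀ β {a} → ⟦ evY y ⟧ β ≈ a → ⟦ fibre y ⟧ (DX.root β) PY.≋ DY.root a
      fibre-root β e = KY.trans (MapHom.mapP-root (evY y) β) (KY.trans (DY.root-def _)
        (KY.trans (PY.∷-cong (K.-‿cong e) PY.≋-refl) (KY.sym (DY.root-def _))))

      fibre-A : ⟦ fibre y ⟧ A PY.≋ ΠY.∏ (fib y) (λ i → DY.root (ρ i))
      fibre-A = KY.trans (HomLemmas.hom-∏ (fibre y) aff λ') (KY.trans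
        (ΠY.∏-cong aff (λ v → fibre-root (b v) (evY-b y v))) (KY.sym (ΠY.∏-map (back y) aff _)))

      fibre-L : ⟦ fibre y ⟧ L PY.≋ LY
      fibre-L = KY.trans (HomLemmas.hom-∏ (fibre y) all (λ ξ → DX.root (PY.const (ρ ξ))))
        (ΠY.∏-cong all (λ ξ → fibre-root (PY.const (ρ ξ)) (evY-const y (ρ ξ))))

      monic-fibre-G : DY.Monic c (⟦ fibre y ⟧ G)
      monic-fibre-G = MapHom.mapP-monic (evY y) monic-G

      -- On the fibre, the division of `A` by `L ^ t` becomes one by `LY ^ t`. By `peel` this power
      -- divides the fibre of `A`, so uniqueness of division identifies the quotient.
      fibre-G : ⟦ fibre y ⟧ G PY.≋ Pr
      fibre-G = ≋-from-difference (proj₁ (DY.monic-unique (MY.monic-^ t monic-LY) (fG PY.⊞ PY.neg Pr) (⟦ fibre y ⟧ Rem) (begin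
          Lt PY.⊠ (fG PY.⊞ PY.neg Pr) PY.⊞ fR ≈⟨ KY.+-congʳ {fR} (KY.distribˡ Lt fG (PY.neg Pr)) ⟩
          (Lt PY.⊠ fG PY.⊞ Lt PY.⊠ PY.neg Pr) PY.⊞ fR ≈⟨ swap³ (Lt PY.⊠ fG) (Lt PY.⊠ PY.neg Pr) fR ⟩
          (Lt PY.⊠ fG PY.⊞ fR) PY.⊞ Lt PY.⊠ PY.neg Pr ≈⟨ KY.+-congʳ {Lt PY.⊠ PY.neg Pr} (KY.trans (KY.sym image) (KY.trans fibre-A (proj₂ (proj₂ peeled)))) ⟩
          Lt PY.⊠ Pr PY.⊞ Lt PY.⊠ PY.neg Pr ≈⟨ KY.distribˡ Lt Pr (PY.neg Pr) ⟨
          Lt PY.⊠ (Pr PY.⊞ PY.neg Pr) ≈⟨ KY.*-congˡ {Lt} (KY.-‿inverseʳ Pr) ⟩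
          Lt PY.⊠ [] ≈⟨ KY.zeroʳ Lt ⟩
          [] ∎) (MapHom.mapP-deg (evY y) deg-Rem)))
        where
          open import Relation.Binary.Reasoning.Setoid KY.setoid
          Lt = LY ΠY.^ t
          fG = ⟦ fibre y ⟧ G
          fR = ⟦ fibre y ⟧ Rem
          ≋-from-difference : ∀ {f g} → f PY.⊞ PY.neg g PY.≋ [] → f PY.≋ g
          ≋-from-difference = Degrees.sub-zero KY
          swap³ : ∀ f g h → (f PY.⊞ g) PY.⊞ h PY.≋ (f PY.⊞ h) PY.⊞ g
          swap³ f g h = KY.trans (KY.+-assoc f g h) (KY.trans (KY.+-congˡ {f} (KY.+-comm g h)) (KY.sym (KY.+-assoc f h g)))
          image : ⟦ fibre y ⟧ A PY.≋ Lt PY.⊠ fG PY.⊞ fR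
          image = KY.trans (⟦⟧-cong (fibre y) A-eq) (KY.trans (+-hom (fibre y) (Lᵗ PX.⊠ G) Rem)
            (KY.+-congʳ {fR} (KY.trans (*-hom (fibre y) Lᵗ G) (KY.*-congʳ {fG} (KY.trans (HomLemmas.hom-^ (fibre y) L t) (ΠY.^-cong t fibre-L))))))

      -- At a surplus root `H` vanishes to order at least `suc t`, one more than the degree of the
      -- form that expresses it.
      rest-kills : ∀ {x} → x ∈ rest → ∀ i → ⟦ ev₂ x y ⟧ (Vec.lookup Gs i) ≈ 0#
      rest-kills {x} k = lowest-terms-vanish x y t Gs t<q (vanishes-cong {suc t} {x} {y} {H} {ΠX.comb L M t Gs} (proj₁ (proj₂ expansion))
        (vanishes-weaken {H} {x} {y} (Z x y) (ℕₚ.≤-trans (ℕₚ.≤-trans (≡.subst (ℕ._≤ t ℕ.+ # (_≟ x) rest) (ℕₚ.+-comm t 1) (ℕₚ.+-monoʳ-≤ t (#-member (_≟ x) k ≡.refl)))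
          (ℕₚ.≤-reflexive (≡.sym (fib-rest x)))) (ℕₚ.m≤m+n _ _)) (H-vanishes x y)))

      -- The remainder of D G * Gᵢ modulo G vanishes on this fibre, where G becomes the product over rest.
      fibre-remainder : ∀ i k r → DX.D G PX.⊠ Vec.lookup Gs i PX.≋ G PX.⊠ k PX.⊞ r → DX.Deg< c r → ⟦ fibre y ⟧ r PY.≋ []
      fibre-remainder i k r e d = proj₂ (DY.monic-unique monic-fibre-G (fk PY.⊞ PY.neg l) fr (begin
          fG PY.⊠ (fk PY.⊞ PY.neg l) PY.⊞ fr ≈⟨ KY.+-congʳ {fr} (KY.distribˡ fG fk (PY.neg l)) ⟩
          (fG PY.⊠ fk PY.⊞ fG PY.⊠ PY.neg l) PY.⊞ fr ≈⟨ swap³ (fG PY.⊠ fk) (fG PY.⊠ PY.neg l) fr ⟩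
          (fG PY.⊠ fk PY.⊞ fr) PY.⊞ fG PY.⊠ PY.neg l ≈⟨ KY.+-congʳ {fG PY.⊠ PY.neg l} (KY.trans (KY.sym image) divisible) ⟩
          fG PY.⊠ l PY.⊞ fG PY.⊠ PY.neg l ≈⟨ KY.distribˡ fG l (PY.neg l) ⟨
          fG PY.⊠ (l PY.⊞ PY.neg l) ≈⟨ KY.*-congˡ {fG} (KY.-‿inverseʳ l) ⟩
          fG PY.⊠ [] ≈⟨ KY.zeroʳ fG ⟩
          [] ∎) (MapHom.mapP-deg (evY y) d))
        where
          open import Relation.Binary.Reasoning.Setoid KY.setoid
          fG = ⟦ fibre y ⟧ G
          fk = ⟦ fibre y ⟧ k
          fr = ⟦ fibre y ⟧ r
          g = ⟦ fibre y ⟧ (Vec.lookup Gs i)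
          swap³ : ∀ f g h → (f PY.⊞ g) PY.⊞ h PY.≋ (f PY.⊞ h) PY.⊞ g
          swap³ f g h = KY.trans (KY.+-assoc f g h) (KY.trans (KY.+-congˡ {f} (KY.+-comm g h)) (KY.sym (KY.+-assoc f h g)))
          image : ⟦ fibre y ⟧ (DX.D G PX.⊠ Vec.lookup Gs i) PY.≋ fG PY.⊠ fk PY.⊞ fr
          image = KY.trans (⟦⟧-cong (fibre y) e) (KY.trans (+-hom (fibre y) (G PX.⊠ k) r) (KY.+-congʳ {fr} (*-hom (fibre y) G k)))
          roots = map ρ rest
          Pr' = ΠY.∏ roots DY.root
          Pr≋ : Pr' PY.≋ fG
          Pr≋ = KY.trans (ΠY.∏-map ρ rest DY.root) (KY.sym fibre-G)
          kills : ∀ x → x ∈ roots → DY.ev x g ≈ 0#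
          kills x k = ≡.subst (λ x → DY.ev x g ≈ 0#) (≡.sym (proj₂ (proj₂ pre)))
              (K.trans (ev-fibre (proj₁ pre) y (Vec.lookup Gs i)) (rest-kills (proj₁ (proj₂ pre)) i))
            where
              open import Data.List.Membership.Propositional.Properties using (∈-map⁻)
              pre = ∈-map⁻ ρ k
          dd = DerivativeOfProduct.∏-divides-D K roots g kills
          l = proj₁ dd
          divisible : ⟦ fibre y ⟧ (DX.D G PX.⊠ Vec.lookup Gs i) PY.≋ fG PY.⊠ l
          divisible = begin
            ⟦ fibre y ⟧ (DX.D G PX.⊠ Vec.lookup Gs i) ≈⟨ *-hom (fibre y) (DX.D G) (Vec.lookup Gs i) ⟩
            ⟦ fibre y ⟧ (DX.D G) PY.⊠ g ≈⟨ KY.*-congʳ {g} (KY.trans (MapHom.mapP-D (evY y) G) (DY.D-cong (KY.sym Pr≋))) ⟩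
            DY.D Pr' PY.⊠ g ≈⟨ proj₂ dd ⟩
            Pr' PY.⊠ l ≈⟨ KY.*-congʳ {l} Pr≋ ⟩
            fG PY.⊠ l ∎

    private
      -- Bounds the total degree of `D G` times a coefficient of the form: `c` for the first factor,
      -- `c + m` for the second.
      D' = c ℕ.+ (c ℕ.+ m)

      Y₀ : List I
      Y₀ = filter (λ y → ¬? (y ∈? inf)) all

      Y₀-large : suc D' ≤ length Y₀
      Y₀-large = ℕₚ.+-cancelʳ-≤ m _ _ (begin
        suc (c ℕ.+ (c ℕ.+ m)) ℕ.+ m ≡⟨ ≡.cong suc (≡.trans (ℕₚ.+-assoc c (c ℕ.+ m) m) (≡.trans (≡.cong (c ℕ.+_) (ℕₚ.+-comm (c ℕ.+ m) m)) (≡.sym (ℕₚ.+-assoc c m (c ℕ.+ m))))) ⟩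
        suc ((c ℕ.+ m) ℕ.+ (c ℕ.+ m)) ≡⟨ ≡.cong (λ n → suc ((c ℕ.+ m) ℕ.+ n)) (ℕₚ.+-identityʳ (c ℕ.+ m)) ⟨
        suc (2 ℕ.* (c ℕ.+ m)) ≤⟨ few ⟩
        q ≡⟨ #-compl (_∈? inf) all ⟨
        # (_∈? inf) all ℕ.+ # (λ y → ¬? (y ∈? inf)) all ≤⟨ ℕₚ.+-monoˡ-≤ _ inf-rare ⟩
        m ℕ.+ # (λ y → ¬? (y ∈? inf)) all ≡⟨ ≡.cong (m ℕ.+_) (length-filter (λ y → ¬? (y ∈? inf)) all) ⟨
        m ℕ.+ length Y₀ ≡⟨ ℕₚ.+-comm m _ ⟩
        length Y₀ ℕ.+ m ∎)
        where open ℕₚ.≤-Reasoning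

      distinct-roots : ∀ {ys} → Unique ys → DY.Distinct (map ρ ys)
      distinct-roots u = AllPairs.map⁺ (AllPairs.map (λ ne e → ne (ρ-injective _ _ e)) u)

      zero-on-Y₀ : ∀ f → QY 0 D' f → (∀ y → ¬ y ∈ inf → ⟦ evY y ⟧ f ≈ 0#) → f PY.≋ []
      zero-on-Y₀ f Qf h = DY.roots-zero dom (map ρ Y₀) f (distinct-roots (AllPairs.filter⁺ (λ y → ¬? (y ∈? inf)) unique))
        (All.map⁺ (All.tabulate (λ {y} k → h y (proj₂ (∈-filter⁻ (λ y → ¬? (y ∈? inf)) {xs = all} k)))))
        (DY.deg-mono (≡.subst (suc D' ≤_) (≡.sym (length-map ρ Y₀)) Y₀-large) (QY-deg f Qf))

      weaken-QY : ∀ s {n} f → QY s n f → QY 0 n f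
      weaken-QY zero f h = h
      weaken-QY (suc s) f h = weaken-QY s f (DY.Q-weaken F₀ f h)

      -- The coefficients of the remainder have degree at most `D'` in `Y` and vanish on every fibre
      -- off `inf`. There are more than `D'` such fibres because `2 (c + m) < q`.
      remainder-zero : ∀ i → ∃ λ k → DX.D G PX.⊠ Vec.lookup Gs i PX.≋ G PX.⊠ k
      remainder-zero i = k , KYX.trans e (KYX.trans (KYX.+-congˡ {G PX.⊠ k} r≋0) (KYX.+-identityʳ _))
        where
          g = Vec.lookup Gs i
          dv = DX.divMod FY monic-G QG (DX.D G PX.⊠ g) (DX.Q-* FY (DX.D G) g (DX.D-Q FY G QG) (QGs i))
          k = proj₁ dv
          r = proj₁ (proj₂ dv)
          e = proj₁ (proj₂ (proj₂ dv))
          d = proj₁ (proj₂ (proj₂ (proj₂ dv)))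
          Qr = proj₂ (proj₂ (proj₂ (proj₂ (proj₂ dv))))
          r≋0 : r PX.≋ []
          r≋0 .PX.at j = zero-on-Y₀ (PX.coeff r j) (weaken-QY (j ℕ.+ 0) (PX.coeff r j) (DX.Q-coeff FY r j Qr))
            (λ y y∉ → K.trans (K.sym (MapHom.coeff-mapP (evY y) r j)) (Fibre.fibre-remainder y y∉ i k r e d .PY.at j))

    G-divides : ∃ λ k → DX.D G PX.⊠ H PX.≋ G PX.⊠ k
    G-divides = proj₁ w , KYX.trans (KYX.*-congˡ {DX.D G} (proj₁ (proj₂ expansion))) (proj₂ w)
      where w = ΠX.comb-divides L M (DX.D G) G t Gs remainder-zero

    restrict : S × I → PY.Poly
    restrict v = DX.ev (b v) G

    ev-restrict : ∀ y v → ⟦ evY y ⟧ (restrict v) ≈ DY.ev (ρ (back y v)) (⟦ fibre y ⟧ G)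
    ev-restrict y v = K.trans (ev-natural (evY y) (idHom KY) (b v) G) (K.trans
      (ev-ext (composeHom (evY y) (idHom KY)) (evY y) (λ _ → K.refl) (evY-b y v) G)
      (K.sym (ev-fibre (back y v) y G)))

    Tangent : S × I → I → Set
    Tangent v y = ¬ y ∈ inf × Z (back y v) y ≡ t

    Tangent? : ∀ v y → Dec (Tangent v y)
    Tangent? v y = ¬? (y ∈? inf) ×-dec (Z (back y v) y ℕ.≟ t)

    private
      ev-Pr : ∀ y (y∉ : ¬ y ∈ inf) x → DY.ev (ρ x) (⟦ fibre y ⟧ G) ≈ ΠK.∏ (Fibre.rest y y∉) (λ ξ → ρ x K.+ - ρ ξ)
      ev-Pr y y∉ x = K.trans (DY.Ev.ev-cong (ρ x) (Fibre.fibre-G y y∉))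
        (K.trans (HomLemmas.hom-∏ (evY x) (Fibre.rest y y∉) (λ i → DY.root (ρ i))) (ΠK.∏-cong (Fibre.rest y y∉) (λ ξ → DY.Ev.ev-root (ρ x) (ρ ξ))))

      -- Where the dual line of `v` crosses the fibre of a tangent direction there is no surplus
      -- root, so the value of `G` is a product of nonzero differences.
      tangent-nonzero : ∀ v y → Tangent v y → ¬ (restrict v PY.≋ [])
      tangent-nonzero v y (y∉ , eq) z = ΠK.∏-nonzero dom (Fibre.rest y y∉) _ ne
          (K.trans (K.sym (ev-Pr y y∉ x)) (K.trans (K.sym (ev-restrict y v)) (⟦⟧-cong (evY y) z)))
        where
          x = back y v
          none : # (_≟ x) (Fibre.rest y y∉) ≡ 0
          none = ℕₚ.+-cancelˡ-≡ t _ _ (≡.trans (≡.sym (Fibre.fib-rest y y∉ x)) (≡.trans (≡.sym (Fibre.Z≡ y y∉ x)) (≡.trans eq (≡.sym (ℕₚ.+-identityʳ t)))))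
          ne : ∀ ξ → ξ ∈ Fibre.rest y y∉ → ¬ (ρ x K.+ - ρ ξ ≈ 0#)
          ne ξ k e = ℕₚ.<-irrefl ≡.refl (≡.subst (1 ≤_) none (#-member (_≟ x) k (≡.sym (ρ-injective x ξ (DY.sub-zero e)))))

      secant-zero : ∀ v y → ¬ y ∈ inf → ¬ (Z (back y v) y ≡ t) → ⟦ evY y ⟧ (restrict v) ≈ 0#
      secant-zero v y y∉ ne = K.trans (ev-restrict y v) (K.trans (ev-Pr y y∉ x) (ΠK.∏-zero _ (proj₁ (proj₂ found)) (K.trans (K.+-congˡ (K.-‿cong (K.reflexive (≡.cong ρ (proj₂ (proj₂ found)))))) (K.-‿inverseʳ _))))
        where
          x = back y v
          pos : 0 < # (_≟ x) (Fibre.rest y y∉)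
          pos = ℕₚ.n≢0⇒n>0 λ eq → (ne (≡.trans (Fibre.Z≡ y y∉ x) (≡.trans (Fibre.fib-rest y y∉ x) (≡.trans (≡.cong (t ℕ.+_) eq) (ℕₚ.+-identityʳ t)))))
          found = #-witness (_≟ x) (Fibre.rest y y∉) pos

    -- G restricted to the dual of v is a nonzero polynomial of degree at most c with a root at each
    -- secant direction.
    few-secants : ∀ v y → Tangent v y → # (λ η → ¬? (Tangent? v η)) all ≤ c ℕ.+ m
    few-secants v y tan = begin
      # (λ η → ¬? (Tangent? v η)) all ≤⟨ ∑-mono all (λ η _ → split η) ⟩
      ∑ all (λ η → ind (Sec? η) ℕ.+ ind (η ∈? inf)) ≡⟨ ∑-+ all _ _ ⟩
      # Sec? all ℕ.+ # (_∈? inf) all ≤⟨ ℕₚ.+-mono-≤ secants inf-rare ⟩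
      c ℕ.+ m ∎
      where
        open ℕₚ.≤-Reasoning
        Sec? : ∀ η → Dec (¬ η ∈ inf × ¬ (Z (back η v) η ≡ t))
        Sec? η = ¬? (η ∈? inf) ×-dec ¬? (Z (back η v) η ℕ.≟ t)
        split : ∀ η → ind (¬? (Tangent? v η)) ≤ ind (Sec? η) ℕ.+ ind (η ∈? inf)
        split η with η ∈? inf | Z (back η v) η ℕ.≟ t
        ... | yes _ | _ = s≤s z≤n
        ... | no _ | yes _ = z≤n
        ... | no _ | no _ = s≤s z≤n
        Q-restrict : QY 0 c (restrict v)
        Q-restrict = DX.Q-ev FY (b v) G ((λ ()) , (λ { (s≤s ()) }) , tt) QG
        secs = filter Sec? all
        secants : # Sec? all ≤ c
        secants = ℕₚ.≮⇒≥ λ lt → (tangent-nonzero v y tan (DY.roots-zero dom (map ρ secs) (restrict v)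
              (distinct-roots (AllPairs.filter⁺ Sec? unique))
              (All.map⁺ (All.tabulate (λ {η} k → uncurry (secant-zero v η) (proj₂ (∈-filter⁻ Sec? {xs = all} k)))))
              (DY.deg-mono (≡.subst (suc c ≤_) (≡.sym (≡.trans (length-map ρ secs) (length-filter Sec? all))) lt) (QY-deg (restrict v) Q-restrict))))

    private
      -- The factor `λ' v` divides the left side, and `G` does not vanish identically on its zero
      -- line. So it divides `k`, and being monic it can be cancelled.
      cancel-lines : ∀ vs → (∀ v → v ∈ vs → ¬ (restrict v PY.≋ [])) → ∀ W k →
                     W PX.⊠ ΠX.∏ vs λ' PX.≋ G PX.⊠ k → ∃ λ k' → W PX.≋ G PX.⊠ k'
      cancel-lines [] h W k e = k , KYX.trans (KYX.sym (KYX.*-identityʳ W)) e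
      cancel-lines (v ∷ vs) h W k e = cancel-lines vs (λ u j → h u (there j)) W k₁
          (Degrees.sub-zero KYX (DX.monic-cancel (DX.root-monic (b v)) (W PX.⊠ P PX.⊞ PX.neg (G PX.⊠ k₁)) (begin
            λ' v PX.⊠ (W PX.⊠ P PX.⊞ PX.neg (G PX.⊠ k₁)) ≈⟨ KYX.distribˡ (λ' v) (W PX.⊠ P) (PX.neg (G PX.⊠ k₁)) ⟩
            λ' v PX.⊠ (W PX.⊠ P) PX.⊞ λ' v PX.⊠ PX.neg (G PX.⊠ k₁)
              ≈⟨ KYX.+-congʳ {λ' v PX.⊠ PX.neg (G PX.⊠ k₁)} (KYX.trans (swap (λ' v) W P) (KYX.trans e (KYX.trans (KYX.*-congˡ {G} (proj₂ fac)) (swap G (λ' v) k₁)))) ⟩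
            λ' v PX.⊠ (G PX.⊠ k₁) PX.⊞ λ' v PX.⊠ PX.neg (G PX.⊠ k₁) ≈⟨ KYX.distribˡ (λ' v) (G PX.⊠ k₁) (PX.neg (G PX.⊠ k₁)) ⟨
            λ' v PX.⊠ (G PX.⊠ k₁ PX.⊞ PX.neg (G PX.⊠ k₁)) ≈⟨ KYX.*-congˡ {λ' v} (KYX.-‿inverseʳ (G PX.⊠ k₁)) ⟩
            λ' v PX.⊠ [] ≈⟨ KYX.zeroʳ (λ' v) ⟩
            [] ∎)))
        where
          open import Relation.Binary.Reasoning.Setoid KYX.setoid
          P = ΠX.∏ vs λ'
          swap : ∀ f g h → f PX.⊠ (g PX.⊠ h) PX.≋ g PX.⊠ (f PX.⊠ h)
          swap f g h = KYX.trans (KYX.sym (KYX.*-assoc f g h)) (KYX.trans (KYX.*-congʳ {h} (KYX.*-comm f g)) (KYX.*-assoc g f h))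
          E = DX.ev (b v)
          Ev⊠ = DX.Ev.ev-⊠ (b v)
          k-root : E k PY.≋ []
          k-root = ΠY.cancel-0 domY (h v (here ≡.refl)) (KY.trans (KY.sym (Ev⊠ G k)) (KY.trans (DX.Ev.ev-cong (b v) (KYX.sym e))
            (KY.trans (Ev⊠ W (λ' v PX.⊠ P)) (KY.trans (KY.*-congˡ {E W} (KY.trans (Ev⊠ (λ' v) P)
              (KY.trans (KY.*-congʳ {E P} (DX.Ev.ev-root-self (b v))) (KY.zeroˡ (E P))))) (KY.zeroʳ (E W))))))
          fac = DX.factor (b v) k k-root
          k₁ = proj₁ fac

    -- Once all lines are cancelled, `G` divides `D G` times `J`. In `X` this product has degree
    -- below that of the monic `G`, so it is zero, and `J` is a nonzero polynomial in `Y` alone.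
    derivative-zero : (∀ v → v ∈ aff → ∃ λ y → Tangent v y) → DX.D G PX.≋ []
    derivative-zero tan .PX.at i = ΠY.cancel-0 domY J≉0 (KY.trans (KY.sym (PX.coeff-scal J (DX.D G) i))
        (KY.trans (KY.sym (PX.const-⊠ J (DX.D G) .PX.at i)) (W≋0 .PX.at i)))
      where
        W = DX.D G PX.⊠ PX.const J
        cancelled : ∃ λ k → W PX.≋ G PX.⊠ k
        cancelled = cancel-lines aff (λ v j → tangent-nonzero v (proj₁ (tan v j)) (proj₂ (tan v j))) W (proj₁ G-divides)
          (KYX.trans (KYX.*-assoc (DX.D G) (PX.const J) A) (KYX.trans (KYX.*-congˡ {DX.D G} (KYX.*-comm (PX.const J) A)) (proj₂ G-divides)))
        deg-W : DX.Deg< c W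
        deg-W = ≡.subst (λ n → DX.Deg< n W) (ℕₚ.+-identityʳ c) (DX.deg-⊠ c 0 (DX.D G) (PX.const J) (DX.D-deg (DX.bound monic-G)) (DX.deg-length (PX.const J)))
        k = proj₁ cancelled
        W≋0 : PX.const J PX.⊠ DX.D G PX.≋ []
        W≋0 = KYX.trans (KYX.*-comm (PX.const J) (DX.D G)) (KYX.trans (proj₂ cancelled) (KYX.trans (KYX.*-congˡ {G} (proj₁ (DX.monic-unique monic-G k (PX.neg W)
          (KYX.trans (KYX.+-congʳ {PX.neg W} (KYX.sym (proj₂ cancelled))) (KYX.-‿inverseʳ W)) (DX.deg-neg deg-W)))) (KYX.zeroʳ G)))
        J≉0 : ¬ (J PY.≋ [])
        J≉0 z = IsDomain.1≉0 dom (K.trans (K.sym (DY.lead (MY.monic-∏ inf ρ))) (z .PY.at m))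

    open Mult (CommutativeRing.+-monoid K) using () renaming (_×_ to _·_)

    congruence : ∀ p → (∀ n → n · 1# ≈ 0# → p ∣ n) → (∀ v → v ∈ aff → ∃ λ y → Tangent v y) →
                 ∀ x y → ¬ y ∈ inf → ∃ λ j → Z x y ≡ t ℕ.+ j ℕ.* p
    congruence p char tan x y y∉ = conclude (char e (RootMultiplicity.multiplicity-zero K dom (ρ x) e h D-zero (proj₂ (proj₂ split))))
      where
        split = RootMultiplicity.∏-multiplicity K dom ρ (_≟ x) (ρ x) (λ i eq → K.reflexive (≡.cong ρ eq)) (λ i ne eq → ne (ρ-injective i x eq)) (Fibre.rest y y∉)
        e = # (_≟ x) (Fibre.rest y y∉)
        h = proj₁ split
        D-zero : DY.D (DY.root (ρ x) ΠY.^ e PY.⊠ h) PY.≋ []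
        D-zero = KY.trans (DY.D-cong (KY.trans (KY.sym (proj₁ (proj₂ split))) (KY.sym (Fibre.fibre-G y y∉))))
          (KY.trans (KY.sym (MapHom.mapP-D (evY y) G)) (⟦⟧-cong (fibre y) (derivative-zero tan)))
        conclude : p ∣ e → ∃ λ j → Z x y ≡ t ℕ.+ j ℕ.* p
        conclude (divides j eq) = j , ≡.trans (Fibre.Z≡ y y∉ x) (≡.trans (Fibre.fib-rest y y∉ x) (≡.cong (t ℕ.+_) eq))

open import Defs using (F; 0F; 1F; _+F_; _*F_)
import Defs as D
open import Data.Bool using (if_then_else_)
open import Data.Fin using (Fin; toℕ)
open import Data.Fin.Properties using (toℕ-injective; toℕ-fromℕ<; toℕ<n) renaming (_≟_ to _≟ᶠ_)
open import Data.List using (allFin; concatMap; replicate)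
open import Data.List.Membership.Propositional using (find; lose)
open import Data.List.Membership.Propositional.Properties using (∈-allFin; ∈-map⁺; ∈-++⁺ˡ; ∈-++⁺ʳ; ∈-map⁻; ∈-++⁻; ∈-concatMap⁺; ∈-concatMap⁻; ∈-∃++)
open import Data.List.Properties using (length-tabulate; length-++; length-replicate)
open import Data.List.Relation.Binary.Permutation.Propositional using (prep; ↭-trans; ↭-refl)
open import Data.List.Relation.Binary.Permutation.Propositional.Properties using (↭-length; ++-comm)
open import Data.List.Relation.Unary.Any using (any?)
open import Data.List.Relation.Unary.Unique.Propositional.Properties using (allFin⁺)
open import Data.Nat using (NonZero; _+_; _*_; _^_; _∸_)
open import Data.Nat.Coprimality using (prime⇒coprime; coprime-Bézout)
open import Data.Nat.Divisibility using (m%n≡0⇒n∣m; _∣?_)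
open import Data.Nat.DivMod
open import Data.Nat.GCD using (module Bézout)
open import Data.Nat.ListAction using (sum)
open import Data.Nat.Primality using (Prime; prime⇒nonTrivial)
open import Data.Nat.Solver using (module +-*-Solver)
open import Data.Vec.Properties using (≡-dec)
open import Relation.Binary.PropositionalEquality using (refl; sym; trans; cong; cong₂; subst; module ≡-Reasoning)
open import Relation.Nullary using (does)
open import Relation.Nullary.Decidable using (map′; decidable-stable)

-- Finite fields and the field of order p

record FiniteField : Set₁ where
  infixl 6 _⊕_
  infixl 7 _⊗_
  field
    𝔽 : Set
    _⊕_ _⊗_ : 𝔽 → 𝔽 → 𝔽
    -f_ : 𝔽 → 𝔽
    0f 1f : 𝔽
    isCommutativeRingF : IsCommutativeRing _≡_ _⊕_ _⊗_ -f_ 0f 1f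

  ring𝔽 : CommutativeRing 0ℓ 0ℓ
  ring𝔽 = record { isCommutativeRing = isCommutativeRingF }

  open Mult (CommutativeRing.+-monoid ring𝔽) using () renaming (_×_ to _·_)

  field
    _≟_ : (x y : 𝔽) → Dec (x ≡ y)
    inv : 𝔽 → 𝔽
    inv-law : ∀ {a} → ¬ (a ≡ 0f) → a ⊗ inv a ≡ 1f
    1≢0 : ¬ (1f ≡ 0f)
    elements : List 𝔽
    elements-unique : Unique elements
    elements-complete : ∀ a → a ∈ elements
    -- The characteristic is the number of elements, so only prime fields qualify.
    characteristic : ∀ n → n · 1f ≡ 0f → length elements ∣ n

module PrimeFieldOf (p : ℕ) .{{nz : NonZero p}} (pr : Prime p) where

  𝔽 : Set
  𝔽 = F p

  0f 1f : 𝔽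
  0f = 0F p
  1f = 1F p

  infixl 6 _⊕_
  infixl 7 _⊗_
  _⊕_ _⊗_ : 𝔽 → 𝔽 → 𝔽
  _⊕_ = _+F_ p
  _⊗_ = _*F_ p

  toF : ℕ → 𝔽
  toF n = n mod p

  toℕ-toF : ∀ n → toℕ (toF n) ≡ n % p
  toℕ-toF n = toℕ-fromℕ< (m%n<n n p)

  toF-cong : ∀ {m n} → m % p ≡ n % p → toF m ≡ toF n
  toF-cong {m} {n} e = toℕ-injective (trans (toℕ-toF m) (trans e (sym (toℕ-toF n))))

  toF-toℕ : ∀ a → toF (toℕ a) ≡ a
  toF-toℕ a = toℕ-injective (trans (toℕ-toF (toℕ a)) (m<n⇒m%n≡m (toℕ<n a)))

  toF-+ : ∀ m n → toF (m ℕ.+ n) ≡ toF m ⊕ toF n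
  toF-+ m n = toF-cong (trans (%-distribˡ-+ m n p)
    (cong (_% p) (sym (cong₂ ℕ._+_ (toℕ-toF m) (toℕ-toF n)))))

  toF-* : ∀ m n → toF (m ℕ.* n) ≡ toF m ⊗ toF n
  toF-* m n = toF-cong (trans (%-distribˡ-* m n p)
    (cong (_% p) (sym (cong₂ ℕ._*_ (toℕ-toF m) (toℕ-toF n)))))

  1<p : 1 < p
  1<p = ℕ.nonTrivial⇒n>1 p {{prime⇒nonTrivial pr}}

  -f_ : 𝔽 → 𝔽
  -f a = toF (p ℕ.∸ toℕ a)

  private
    +-assocF : ∀ a b c → (a ⊕ b) ⊕ c ≡ a ⊕ (b ⊕ c)
    +-assocF a b c = begin
      toF (x ℕ.+ y) ⊕ c ≡⟨ cong (toF (x ℕ.+ y) ⊕_) (toF-toℕ c) ⟨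
      toF (x ℕ.+ y) ⊕ toF z ≡⟨ toF-+ (x ℕ.+ y) z ⟨
      toF (x ℕ.+ y ℕ.+ z) ≡⟨ cong toF (ℕₚ.+-assoc x y z) ⟩
      toF (x ℕ.+ (y ℕ.+ z)) ≡⟨ toF-+ x (y ℕ.+ z) ⟩
      toF x ⊕ (b ⊕ c) ≡⟨ cong (_⊕ (b ⊕ c)) (toF-toℕ a) ⟩
      a ⊕ (b ⊕ c) ∎
      where
        open ≡-Reasoning
        x = toℕ a
        y = toℕ b
        z = toℕ c

    *-assocF : ∀ a b c → (a ⊗ b) ⊗ c ≡ a ⊗ (b ⊗ c)
    *-assocF a b c = begin
      toF (x ℕ.* y) ⊗ c ≡⟨ cong (toF (x ℕ.* y) ⊗_) (toF-toℕ c) ⟨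
      toF (x ℕ.* y) ⊗ toF z ≡⟨ toF-* (x ℕ.* y) z ⟨
      toF (x ℕ.* y ℕ.* z) ≡⟨ cong toF (ℕₚ.*-assoc x y z) ⟩
      toF (x ℕ.* (y ℕ.* z)) ≡⟨ toF-* x (y ℕ.* z) ⟩
      toF x ⊗ (b ⊗ c) ≡⟨ cong (_⊗ (b ⊗ c)) (toF-toℕ a) ⟩
      a ⊗ (b ⊗ c) ∎
      where
        open ≡-Reasoning
        x = toℕ a
        y = toℕ b
        z = toℕ c

    distribF : ∀ a b c → a ⊗ (b ⊕ c) ≡ a ⊗ b ⊕ a ⊗ c
    distribF a b c = begin
      a ⊗ toF (y ℕ.+ z) ≡⟨ cong (_⊗ toF (y ℕ.+ z)) (toF-toℕ a) ⟨
      toF x ⊗ toF (y ℕ.+ z) ≡⟨ toF-* x (y ℕ.+ z) ⟨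
      toF (x ℕ.* (y ℕ.+ z)) ≡⟨ cong toF (ℕₚ.*-distribˡ-+ x y z) ⟩
      toF (x ℕ.* y ℕ.+ x ℕ.* z) ≡⟨ toF-+ (x ℕ.* y) (x ℕ.* z) ⟩
      a ⊗ b ⊕ a ⊗ c ∎
      where
        open ≡-Reasoning
        x = toℕ a
        y = toℕ b
        z = toℕ c

    +-commF : ∀ a b → a ⊕ b ≡ b ⊕ a
    +-commF a b = cong toF (ℕₚ.+-comm (toℕ a) (toℕ b))

    *-commF : ∀ a b → a ⊗ b ≡ b ⊗ a
    *-commF a b = cong toF (ℕₚ.*-comm (toℕ a) (toℕ b))

    +-idˡF : ∀ a → 0f ⊕ a ≡ a
    +-idˡF a = trans (cong (0f ⊕_) (sym (toF-toℕ a))) (trans (sym (toF-+ 0 (toℕ a))) (toF-toℕ a))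

    *-idˡF : ∀ a → 1f ⊗ a ≡ a
    *-idˡF a = trans (cong (1f ⊗_) (sym (toF-toℕ a))) (trans (sym (toF-* 1 (toℕ a))) (trans (cong toF (ℕₚ.*-identityˡ (toℕ a))) (toF-toℕ a)))

    inverseʳF : ∀ a → a ⊕ (-f a) ≡ 0f
    inverseʳF a = begin
      a ⊕ (-f a) ≡⟨ cong (_⊕ (-f a)) (toF-toℕ a) ⟨
      toF (toℕ a) ⊕ toF (p ℕ.∸ toℕ a) ≡⟨ toF-+ (toℕ a) _ ⟨
      toF (toℕ a ℕ.+ (p ℕ.∸ toℕ a)) ≡⟨ cong toF (ℕₚ.m+[n∸m]≡n (ℕₚ.<⇒≤ (toℕ<n a))) ⟩
      toF p ≡⟨ toF-cong (trans (n%n≡0 p) (sym (m<n⇒m%n≡m (ℕₚ.<-trans (s≤s z≤n) 1<p)))) ⟩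
      0f ∎
      where open ≡-Reasoning

  abstract
    isCommutativeRingF : IsCommutativeRing _≡_ _⊕_ _⊗_ -f_ 0f 1f
    isCommutativeRingF = record
      { isRing = record
        { +-isAbelianGroup = record
          { isGroup = record
            { isMonoid = record
              { isSemigroup = record
                { isMagma = record { isEquivalence = ≡.isEquivalence ; ∙-cong = cong₂ _⊕_ }
                ; assoc = +-assocF }
              ; identity = +-idˡF , λ a → trans (+-commF a 0f) (+-idˡF a) }
            ; inverse = (λ a → trans (+-commF (-f a) a) (inverseʳF a)) , inverseʳF
            ; ⁻¹-cong = cong -f_ }
          ; comm = +-commF }
        ; *-cong = cong₂ _⊗_
        ; *-assoc = *-assocF
        ; *-identity = *-idˡF , λ a → trans (*-commF a 1f) (*-idˡF a)
        ; distrib = distribF , λ a b c → trans (*-commF (b ⊕ c) a) (trans (distribF a b c) (cong₂ _⊕_ (*-commF a b) (*-commF a c))) }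
      ; *-comm = *-commF }

  ring𝔽 : CommutativeRing 0ℓ 0ℓ
  ring𝔽 = record
    { Carrier = 𝔽 ; _≈_ = _≡_ ; _+_ = _⊕_ ; _*_ = _⊗_ ; -_ = -f_ ; 0# = 0f ; 1# = 1f
    ; isCommutativeRing = isCommutativeRingF }

  1≢0 : ¬ (1f ≡ 0f)
  1≢0 e = ℕₚ.1+n≢0 (trans (sym (m<n⇒m%n≡m 1<p)) (trans (trans (sym (toℕ-toF 1)) (trans (cong toℕ e) (toℕ-toF 0)))
    (m<n⇒m%n≡m (ℕₚ.<-trans (s≤s z≤n) 1<p))))

  private
    toF-multiple : ∀ n → toF (n ℕ.* p) ≡ 0f
    toF-multiple n = toF-cong (trans (m*n%n≡0 n p) (sym (m<n⇒m%n≡m (ℕₚ.<-trans (s≤s z≤n) 1<p))))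

    module R = CommutativeRing ring𝔽

    inverse-exists : ∀ a → ¬ (a ≡ 0f) → ∃ λ b → a ⊗ b ≡ 1f
    inverse-exists a a≢0 = fromBézout (coprime-Bézout (prime⇒coprime pr {{ℕ.>-nonZero 0<a}} (toℕ<n a)))
      where
        0<a : 0 < toℕ a
        0<a = ℕₚ.n≢0⇒n>0 λ e → a≢0 (trans (sym (toF-toℕ a)) (cong toF e))
        fromBézout : Bézout.Identity 1 p (toℕ a) → ∃ λ b → a ⊗ b ≡ 1f
        fromBézout (Bézout.-+ x y eq) = toF y , (begin
          a ⊗ toF y ≡⟨ cong (_⊗ toF y) (toF-toℕ a) ⟨
          toF (toℕ a) ⊗ toF y ≡⟨ toF-* (toℕ a) y ⟨
          toF (toℕ a ℕ.* y) ≡⟨ cong toF (trans (ℕₚ.*-comm (toℕ a) y) (sym eq)) ⟩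
          toF (1 ℕ.+ x ℕ.* p) ≡⟨ toF-+ 1 (x ℕ.* p) ⟩
          1f ⊕ toF (x ℕ.* p) ≡⟨ cong (1f ⊕_) (toF-multiple x) ⟩
          1f ⊕ 0f ≡⟨ R.+-identityʳ 1f ⟩
          1f ∎)
          where open ≡-Reasoning
        -- In this case `1 + y a = x p`, so the inverse of `a` is `- y`.
        fromBézout (Bézout.+- x y eq) = -f toF y , (begin
          a ⊗ (-f toF y) ≡⟨ -‿distribʳ-* a (toF y) ⟨
          -f (a ⊗ toF y) ≡⟨ R.+-identityʳ _ ⟨
          -f (a ⊗ toF y) ⊕ 0f ≡⟨ cong (-f (a ⊗ toF y) ⊕_) total ⟨
          -f (a ⊗ toF y) ⊕ (a ⊗ toF y ⊕ 1f) ≡⟨ R.+-assoc _ _ _ ⟨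
          (-f (a ⊗ toF y) ⊕ a ⊗ toF y) ⊕ 1f ≡⟨ cong (_⊕ 1f) (R.-‿inverseˡ _) ⟩
          0f ⊕ 1f ≡⟨ R.+-identityˡ 1f ⟩
          1f ∎)
          where
            open ≡-Reasoning
            open import Algebra.Properties.Ring R.ring using (-‿distribʳ-*)
            total : a ⊗ toF y ⊕ 1f ≡ 0f
            total = begin
              a ⊗ toF y ⊕ 1f ≡⟨ cong (λ b → b ⊗ toF y ⊕ 1f) (toF-toℕ a) ⟨
              toF (toℕ a) ⊗ toF y ⊕ 1f ≡⟨ cong (_⊕ 1f) (toF-* (toℕ a) y) ⟨
              toF (toℕ a ℕ.* y) ⊕ toF 1 ≡⟨ toF-+ (toℕ a ℕ.* y) 1 ⟨
              toF (toℕ a ℕ.* y ℕ.+ 1) ≡⟨ cong toF (trans (ℕₚ.+-comm _ 1) (trans (cong suc (ℕₚ.*-comm (toℕ a) y)) eq)) ⟩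
              toF (x ℕ.* p) ≡⟨ toF-multiple x ⟩
              0f ∎

  -- 0f is a junk value at 0f.
  inv : 𝔽 → 𝔽
  inv a with a ≟ᶠ 0f
  ... | yes _ = 0f
  ... | no ne = proj₁ (inverse-exists a ne)

  inv-law : ∀ {a} → ¬ (a ≡ 0f) → a ⊗ inv a ≡ 1f
  inv-law {a} ne with a ≟ᶠ 0f
  ... | yes e = ⊥-elim (ne e)
  ... | no ne' = proj₂ (inverse-exists a ne')

  open Mult R.+-monoid using () renaming (_×_ to _·_)

  characteristic : ∀ n → n · 1f ≡ 0f → p ∣ n
  characteristic n e = m%n≡0⇒n∣m n p (trans (sym (toℕ-toF n)) (trans (cong toℕ (trans (sym (multiple n)) e)) (trans (toℕ-toF 0) (m<n⇒m%n≡m (ℕₚ.<-trans (s≤s z≤n) 1<p)))))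
    where
      multiple : ∀ n → n · 1f ≡ toF n
      multiple zero = refl
      multiple (suc n) = trans (cong (1f ⊕_) (multiple n)) (sym (toF-+ 1 n))

  primeField : FiniteField
  primeField = record
    { isCommutativeRingF = isCommutativeRingF ; _≟_ = _≟ᶠ_ ; inv = inv ; inv-law = inv-law ; 1≢0 = 1≢0
    ; elements = allFin p ; elements-unique = allFin⁺ p ; elements-complete = ∈-allFin
    ; characteristic = λ n e → ≡.subst (_∣ n) (sym (length-tabulate (λ (i : Fin p) → i))) (characteristic n e) }

halves : ∀ {a b q} → 2 * a < q → 2 * b < q → a + b < q
halves {a} {b} {q} ha hb = ℕₚ.*-cancelˡ-< 2 (a + b) q (begin-strict
  2 * (a + b) ≡⟨ ℕₚ.*-distribˡ-+ 2 a b ⟩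
  2 * a + 2 * b <⟨ ℕₚ.+-mono-< ha hb ⟩
  q + q ≡⟨ cong (q +_) (ℕₚ.+-identityʳ q) ⟨
  2 * q ∎)
  where open ℕₚ.≤-Reasoning

∈-split : ∀ {A : Set} {x : A} {xs} → x ∈ xs → ∃ λ ys → xs ↭ x ∷ ys
∈-split {x = x} j with ∈-∃++ j
... | as , bs , refl = as ++ bs , shift x as bs

-- Linear algebra over a finite field

module FiniteGeometry (FF : FiniteField) where

  open FiniteField FF public
  module R = CommutativeRing ring𝔽
  open import Algebra.Properties.Ring R.ring public using (-‿distribˡ-*; -‿distribʳ-*; -0#≈0#)
  open import Algebra.Properties.CommutativeSemigroup R.+-commutativeSemigroup public using () renaming (interchange to ⊕-exchange)

  no-zero-divisors : ∀ x y → x ⊗ y ≡ 0f → x ≡ 0f ⊎ y ≡ 0f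
  no-zero-divisors x y e with x ≟ 0f
  ... | yes z = inj₁ z
  ... | no nx = inj₂ (begin
    y ≡⟨ R.*-identityˡ y ⟨
    1f ⊗ y ≡⟨ cong (_⊗ y) (trans (R.*-comm (inv x) x) (inv-law nx)) ⟨
    (inv x ⊗ x) ⊗ y ≡⟨ R.*-assoc _ _ _ ⟩
    inv x ⊗ (x ⊗ y) ≡⟨ cong (inv x ⊗_) e ⟩
    inv x ⊗ 0f ≡⟨ R.zeroʳ _ ⟩
    0f ∎)
    where open ≡-Reasoning

  domain𝔽 : IsDomain ring𝔽
  domain𝔽 = record { zero? = _≟ 0f ; no-zero-divisors = no-zero-divisors ; 1≉0 = 1≢0 }

  inv-lawˡ : ∀ {a} → ¬ (a ≡ 0f) → inv a ⊗ a ≡ 1f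
  inv-lawˡ ne = trans (R.*-comm _ _) (inv-law ne)

  inv≢0 : ∀ {a} → ¬ (a ≡ 0f) → ¬ (inv a ≡ 0f)
  inv≢0 {a} ne e = 1≢0 (trans (sym (inv-law ne)) (trans (cong (a ⊗_) e) (R.zeroʳ a)))

  p : ℕ
  p = length elements

  V : ℕ → Set
  V m = Vec 𝔽 m

  0v : ∀ {m} → V m
  0v {m} = Vec.replicate m 0f

  infixl 6 _+v_
  infixr 7 _*v_
  _+v_ : ∀ {m} → V m → V m → V m
  [] +v [] = []
  (x ∷ u) +v (y ∷ v) = (x ⊕ y) ∷ (u +v v)

  _*v_ : ∀ {m} → 𝔽 → V m → V m
  c *v [] = []
  c *v (x ∷ u) = (c ⊗ x) ∷ (c *v u)

  -v_ : ∀ {m} → V m → V m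
  -v u = (-f 1f) *v u

  infix 4 _≟v_
  _≟v_ : ∀ {m} (u v : V m) → Dec (u ≡ v)
  _≟v_ = ≡-dec _≟_

  +v-comm : ∀ {m} (u v : V m) → u +v v ≡ v +v u
  +v-comm [] [] = refl
  +v-comm (x ∷ u) (y ∷ v) = cong₂ _∷_ (R.+-comm x y) (+v-comm u v)

  +v-assoc : ∀ {m} (u v w : V m) → (u +v v) +v w ≡ u +v (v +v w)
  +v-assoc [] [] [] = refl
  +v-assoc (x ∷ u) (y ∷ v) (z ∷ w) = cong₂ _∷_ (R.+-assoc x y z) (+v-assoc u v w)

  +v-0 : ∀ {m} (u : V m) → u +v 0v ≡ u
  +v-0 [] = refl
  +v-0 (x ∷ u) = cong₂ _∷_ (R.+-identityʳ x) (+v-0 u)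

  0-+v : ∀ {m} (u : V m) → 0v +v u ≡ u
  0-+v u = trans (+v-comm 0v u) (+v-0 u)

  *v-+v : ∀ {m} c (u v : V m) → c *v (u +v v) ≡ c *v u +v c *v v
  *v-+v c [] [] = refl
  *v-+v c (x ∷ u) (y ∷ v) = cong₂ _∷_ (R.distribˡ c x y) (*v-+v c u v)

  ⊕-*v : ∀ {m} c d (u : V m) → (c ⊕ d) *v u ≡ c *v u +v d *v u
  ⊕-*v c d [] = refl
  ⊕-*v c d (x ∷ u) = cong₂ _∷_ (R.distribʳ x c d) (⊕-*v c d u)

  ⊗-*v : ∀ {m} c d (u : V m) → c *v (d *v u) ≡ (c ⊗ d) *v u
  ⊗-*v c d [] = refl
  ⊗-*v c d (x ∷ u) = cong₂ _∷_ (sym (R.*-assoc c d x)) (⊗-*v c d u)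

  1-*v : ∀ {m} (u : V m) → 1f *v u ≡ u
  1-*v [] = refl
  1-*v (x ∷ u) = cong₂ _∷_ (R.*-identityˡ x) (1-*v u)

  0-*v : ∀ {m} (u : V m) → 0f *v u ≡ 0v
  0-*v [] = refl
  0-*v (x ∷ u) = cong₂ _∷_ (R.zeroˡ x) (0-*v u)

  *v-0 : ∀ {m} c → c *v 0v {m} ≡ 0v
  *v-0 {zero} c = refl
  *v-0 {suc m} c = cong₂ _∷_ (R.zeroʳ c) (*v-0 {m} c)

  *v-comm : ∀ {m} c d (u : V m) → c *v (d *v u) ≡ d *v (c *v u)
  *v-comm c d u = trans (⊗-*v c d u) (trans (cong (_*v u) (R.*-comm c d)) (sym (⊗-*v d c u)))

  neg-*v : ∀ {m} c (u : V m) → c *v u +v (-f c) *v u ≡ 0v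
  neg-*v c u = trans (sym (⊕-*v c (-f c) u)) (trans (cong (_*v u) (R.-‿inverseʳ c)) (0-*v u))

  -v-inverse : ∀ {m} (u : V m) → u +v (-v u) ≡ 0v
  -v-inverse u = trans (cong (_+v (-v u)) (sym (1-*v u))) (neg-*v 1f u)

  +v-exchange : ∀ {m} (a b c d : V m) → (a +v b) +v (c +v d) ≡ (a +v c) +v (b +v d)
  +v-exchange a b c d = trans (+v-assoc a b (c +v d)) (trans (cong (a +v_)
    (trans (sym (+v-assoc b c d)) (trans (cong (_+v d) (+v-comm b c)) (+v-assoc c b d)))) (sym (+v-assoc a c (b +v d))))

  +v-cancelˡ : ∀ {m} (u : V m) {v w} → u +v v ≡ u +v w → v ≡ w
  +v-cancelˡ u {v} {w} e = trans (lem v) (trans (cong ((-v u) +v_) e) (sym (lem w)))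
    where
      lem : ∀ v → v ≡ (-v u) +v (u +v v)
      lem v = trans (sym (0-+v v)) (trans (cong (_+v v) (trans (sym (-v-inverse u)) (+v-comm u (-v u)))) (+v-assoc (-v u) u v))

  difference-zero : ∀ {m} {u v : V m} → u +v (-v v) ≡ 0v → u ≡ v
  difference-zero {u = u} {v} e = +v-cancelˡ (-v v) (trans (+v-comm (-v v) u) (trans e (trans (sym (-v-inverse v)) (+v-comm v (-v v)))))

  unscale : ∀ {m} {c} → ¬ (c ≡ 0f) → {u v : V m} → u ≡ c *v v → v ≡ inv c *v u
  unscale {c = c} ne {u} {v} e = sym (trans (cong (inv c *v_) e) (trans (⊗-*v (inv c) c v) (trans (cong (_*v v) (inv-lawˡ ne)) (1-*v v))))

  *v-inv : ∀ {m} {c} → ¬ (c ≡ 0f) → (u : V m) → c *v (inv c *v u) ≡ u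
  *v-inv {c = c} ne u = trans (⊗-*v c (inv c) u) (trans (cong (_*v u) (inv-law ne)) (1-*v u))

  inv-*v : ∀ {m} {c} → ¬ (c ≡ 0f) → (u : V m) → inv c *v (c *v u) ≡ u
  inv-*v {c = c} ne u = trans (⊗-*v (inv c) c u) (trans (cong (_*v u) (inv-lawˡ ne)) (1-*v u))

  *v-nonzero : ∀ {m} {c} {u : V m} → ¬ (c *v u ≡ 0v) → ¬ (c ≡ 0f) × ¬ (u ≡ 0v)
  *v-nonzero {c = c} {u} ne = (λ e → ne (trans (cong (_*v u) e) (0-*v u))) , (λ e → ne (trans (cong (c *v_) e) (*v-0 c)))

  *v-≢0 : ∀ {m} {c} {u : V m} → ¬ (c ≡ 0f) → ¬ (u ≡ 0v) → ¬ (c *v u ≡ 0v)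
  *v-≢0 {c = c} {u} nc nu e = nu (trans (unscale nc (sym e)) (*v-0 (inv c)))

  *v-cancelʳ : ∀ {m} {c d} {u : V m} → ¬ (u ≡ 0v) → c *v u ≡ d *v u → c ≡ d
  *v-cancelʳ {c = c} {d} {u} ne e with (c ⊕ (-f d)) ≟ 0f
  ... | yes z = begin
      c ≡⟨ R.+-identityʳ c ⟨
      c ⊕ 0f ≡⟨ cong (c ⊕_) (R.-‿inverseˡ d) ⟨
      c ⊕ ((-f d) ⊕ d) ≡⟨ R.+-assoc _ _ _ ⟨
      (c ⊕ (-f d)) ⊕ d ≡⟨ cong (_⊕ d) z ⟩
      0f ⊕ d ≡⟨ R.+-identityˡ d ⟩
      d ∎
      where open ≡-Reasoning
  ... | no nz = ⊥-elim (*v-≢0 nz ne (trans (⊕-*v c (-f d) u) (trans (cong (_+v (-f d) *v u) e) (neg-*v d u))))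

  record Lin (a b : ℕ) : Set where
    field
      ap : V a → V b
      ap-+ : ∀ u v → ap (u +v v) ≡ ap u +v ap v
      ap-* : ∀ c u → ap (c *v u) ≡ c *v ap u

    ap-0 : ap 0v ≡ 0v
    ap-0 = trans (cong ap (sym (0-*v 0v))) (trans (ap-* 0f 0v) (0-*v _))
  open Lin public

  infixr 9 _∘L_
  _∘L_ : ∀ {a b c} → Lin b c → Lin a b → Lin a c
  (φ ∘L ψ) .ap u = ap φ (ap ψ u)
  (φ ∘L ψ) .ap-+ u v = trans (cong (ap φ) (ap-+ ψ u v)) (ap-+ φ _ _)
  (φ ∘L ψ) .ap-* c u = trans (cong (ap φ) (ap-* ψ c u)) (ap-* φ c _)

  record Fun (a : ℕ) : Set where
    field
      fn : V a → 𝔽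
      fn-+ : ∀ u v → fn (u +v v) ≡ fn u ⊕ fn v
      fn-* : ∀ c u → fn (c *v u) ≡ c ⊗ fn u

    fn-0 : fn 0v ≡ 0f
    fn-0 = trans (cong fn (sym (0-*v 0v))) (trans (fn-* 0f 0v) (R.zeroˡ _))
  open Fun public

  infixr 9 _∘F_
  _∘F_ : ∀ {a b} → Fun b → Lin a b → Fun a
  (f ∘F ψ) .fn u = fn f (ap ψ u)
  (f ∘F ψ) .fn-+ u v = trans (cong (fn f) (ap-+ ψ u v)) (fn-+ f _ _)
  (f ∘F ψ) .fn-* c u = trans (cong (fn f) (ap-* ψ c u)) (fn-* f c _)

  consL : ∀ {a b} → Fun a → Lin a b → Lin a (suc b)
  consL f φ .ap u = fn f u ∷ ap φ u
  consL f φ .ap-+ u v = cong₂ _∷_ (fn-+ f u v) (ap-+ φ u v)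
  consL f φ .ap-* c u = cong₂ _∷_ (fn-* f c u) (ap-* φ c u)

  headF : ∀ {a} → Fun (suc a)
  headF .fn (x ∷ u) = x
  headF .fn-+ (x ∷ u) (y ∷ v) = refl
  headF .fn-* c (x ∷ u) = refl

  hd : ∀ {a} → V (suc a) → 𝔽
  hd = fn headF

  tailL : ∀ {a} → Lin (suc a) a
  tailL .ap (x ∷ u) = u
  tailL .ap-+ (x ∷ u) (y ∷ v) = refl
  tailL .ap-* c (x ∷ u) = refl

  idL : ∀ {a} → Lin a a
  idL .ap u = u
  idL .ap-+ u v = refl
  idL .ap-* c u = refl

  zeroL : ∀ {a b} → Lin a b
  zeroL .ap u = 0v
  zeroL .ap-+ u v = sym (+v-0 0v)
  zeroL .ap-* c u = sym (*v-0 c)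

  infixl 6 _+L_
  _+L_ : ∀ {a b} → Lin a b → Lin a b → Lin a b
  (φ +L ψ) .ap u = ap φ u +v ap ψ u
  (φ +L ψ) .ap-+ u v = trans (cong₂ _+v_ (ap-+ φ u v) (ap-+ ψ u v)) (+v-exchange _ _ _ _)
  (φ +L ψ) .ap-* c u = trans (cong₂ _+v_ (ap-* φ c u) (ap-* ψ c u)) (sym (*v-+v c _ _))

  outer : ∀ {a b} → Fun a → V b → Lin a b
  outer f w .ap u = fn f u *v w
  outer f w .ap-+ u v = trans (cong (_*v w) (fn-+ f u v)) (⊕-*v _ _ w)
  outer f w .ap-* c u = trans (cong (_*v w) (fn-* f c u)) (sym (⊗-*v c _ w))

  zeroF : ∀ {a} → Fun a
  zeroF .fn u = 0f
  zeroF .fn-+ u v = sym (R.+-identityʳ 0f)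
  zeroF .fn-* c u = sym (R.zeroʳ c)

  infixl 6 _+Fn_
  _+Fn_ : ∀ {a} → Fun a → Fun a → Fun a
  (f +Fn g) .fn u = fn f u ⊕ fn g u
  (f +Fn g) .fn-+ u v = trans (cong₂ _⊕_ (fn-+ f u v) (fn-+ g u v)) (⊕-exchange _ _ _ _)
  (f +Fn g) .fn-* c u = trans (cong₂ _⊕_ (fn-* f c u) (fn-* g c u)) (sym (R.distribˡ c _ _))

  infixr 7 _*Fn_
  _*Fn_ : ∀ {a} → 𝔽 → Fun a → Fun a
  (d *Fn f) .fn u = d ⊗ fn f u
  (d *Fn f) .fn-+ u v = trans (cong (d ⊗_) (fn-+ f u v)) (R.distribˡ d _ _)
  (d *Fn f) .fn-* c u = trans (cong (d ⊗_) (fn-* f c u)) (trans (sym (R.*-assoc d c _)) (trans (cong (_⊗ fn f u) (R.*-comm d c)) (R.*-assoc c d _)))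

  dotF : ∀ {m} → V m → Fun m
  dotF [] = zeroF
  dotF (x ∷ c) = (x *Fn headF) +Fn (dotF c ∘F tailL)

  -- Subspaces of vector dimension `a` are given as images of injective linear maps; one subspace
  -- has many such descriptions.
  record Emb (a b : ℕ) : Set where
    field
      lin : Lin a b
      injective : ∀ u → ap lin u ≡ 0v → u ≡ 0v
  open Emb public

  em : ∀ {a b} → Emb a b → V a → V b
  em ι = ap (lin ι)

  em-injective : ∀ {a b} (ι : Emb a b) {u v} → em ι u ≡ em ι v → u ≡ v
  em-injective ι {u} {v} e = difference-zero (injective ι _ (trans (ap-+ (lin ι) u (-v v))
    (trans (cong₂ _+v_ e (ap-* (lin ι) (-f 1f) v)) (-v-inverse _))))

  infixr 9 _∘E_
  _∘E_ : ∀ {a b c} → Emb b c → Emb a b → Emb a c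
  (ι ∘E κ) .lin = lin ι ∘L lin κ
  (ι ∘E κ) .injective u e = injective κ u (injective ι _ e)

  consE : ∀ {a} → Emb a (suc a)
  consE .lin .ap u = 0f ∷ u
  consE .lin .ap-+ u v = cong (_∷ (u +v v)) (sym (R.+-identityʳ 0f))
  consE .lin .ap-* c u = cong (_∷ (c *v u)) (sym (R.zeroʳ c))
  consE .injective u refl = refl

  record Iso (m : ℕ) : Set where
    field
      to from : Lin m m
      to-from : ∀ u → ap to (ap from u) ≡ u
      from-to : ∀ u → ap from (ap to u) ≡ u
  open Iso public

  infixr 9 _∘I_
  _∘I_ : ∀ {m} → Iso m → Iso m → Iso m
  M ∘I N = record { to = to M ∘L to N ; from = from N ∘L from M
                  ; to-from = λ u → trans (cong (ap (to M)) (to-from N _)) (to-from M u)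
                  ; from-to = λ u → trans (cong (ap (from N)) (from-to M _)) (from-to N u) }

  flip : ∀ {m} → Iso m → Iso m
  flip M = record { to = from M ; from = to M ; to-from = from-to M ; from-to = to-from M }

  isoE : ∀ {m} → Iso m → Emb m m
  isoE M .lin = to M
  isoE M .injective u e = trans (sym (from-to M u)) (trans (cong (ap (from M)) e) (ap-0 (from M)))

  iso-≢0 : ∀ {m} (M : Iso m) {u} → ¬ (u ≡ 0v) → ¬ (ap (to M) u ≡ 0v)
  iso-≢0 M ne e = ne (injective (isoE M) _ e)

  liftI : ∀ {m} → Iso m → Iso (suc m)
  liftI M = record { to = consL headF (to M ∘L tailL) ; from = consL headF (from M ∘L tailL)
                   ; to-from = λ { (x ∷ u) → cong (x ∷_) (to-from M u) }
                   ; from-to = λ { (x ∷ u) → cong (x ∷_) (from-to M u) } }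

  swapI : ∀ {m} → Iso (suc (suc m))
  swapI = record { to = sw ; from = sw ; to-from = λ { (x ∷ y ∷ u) → refl } ; from-to = λ { (x ∷ y ∷ u) → refl } }
    where
      sw = consL (headF ∘F tailL) (consL headF (tailL ∘L tailL))

  scaleI : ∀ {m} a → ¬ (a ≡ 0f) → Iso (suc m)
  scaleI a ne = record { to = consL (a *Fn headF) tailL ; from = consL (inv a *Fn headF) tailL
    ; to-from = λ { (x ∷ u) → cong (_∷ u) (trans (sym (R.*-assoc a (inv a) x)) (trans (cong (_⊗ x) (inv-law ne)) (R.*-identityˡ x))) }
    ; from-to = λ { (x ∷ u) → cong (_∷ u) (trans (sym (R.*-assoc (inv a) a x)) (trans (cong (_⊗ x) (inv-lawˡ ne)) (R.*-identityˡ x))) } }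

  shearI : ∀ {m} → V m → Iso (suc m)
  shearI w = record { to = consL headF (tailL +L outer headF w) ; from = consL headF (tailL +L outer headF (-v w))
    ; to-from = λ { (x ∷ u) → cong (x ∷_) (trans (+v-assoc u _ _) (trans (cong (u +v_) (trans (+v-comm _ _) (cancel x))) (+v-0 u))) }
    ; from-to = λ { (x ∷ u) → cong (x ∷_) (trans (+v-assoc u _ _) (trans (cong (u +v_) (cancel x)) (+v-0 u))) } }
    where
      cancel : ∀ x → x *v w +v x *v (-v w) ≡ 0v
      cancel x = trans (sym (*v-+v x w (-v w))) (trans (cong (x *v_) (-v-inverse w)) (*v-0 x))

  coshearI : ∀ {m} → Fun m → Iso (suc m)
  coshearI g = record { to = consL (headF +Fn (g ∘F tailL)) tailL ; from = consL (headF +Fn (((-f 1f) *Fn g) ∘F tailL)) tailL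
    ; to-from = λ { (x ∷ u) → cong (_∷ u) (trans (R.+-assoc x _ _) (trans (cong (x ⊕_) (trans (R.+-comm _ _) (cancel u))) (R.+-identityʳ x))) }
    ; from-to = λ { (x ∷ u) → cong (_∷ u) (trans (R.+-assoc x _ _) (trans (cong (x ⊕_) (cancel u)) (R.+-identityʳ x))) } }
    where
      cancel : ∀ u → fn g u ⊕ (-f 1f) ⊗ fn g u ≡ 0f
      cancel u = trans (cong (fn g u ⊕_) (trans (sym (-‿distribˡ-* 1f (fn g u))) (cong -f_ (R.*-identityˡ _)))) (R.-‿inverseʳ _)

  e₀ : ∀ {m} → V (suc m)
  e₀ = 1f ∷ 0v

  e₁ : ∀ {m} → V (suc (suc m))
  e₁ = 0f ∷ 1f ∷ 0v

  -- Coordinate changes like this one bring given vectors or functionals into standard position;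
  -- they take the place of arguments about bases and ranks.
  isoVec : ∀ {m} (P : V (suc m)) → ¬ (P ≡ 0v) → ∃ λ (M : Iso (suc m)) → ap (to M) P ≡ e₀
  isoVec {m} (a ∷ P) ne with a ≟ 0f
  ... | no a≢0 = shearI (-v P) ∘I scaleI (inv a) (inv≢0 a≢0) ,
        cong₂ _∷_ (inv-lawˡ a≢0) (trans (cong (λ x → P +v x *v (-v P)) (inv-lawˡ a≢0)) (trans (cong (P +v_) (1-*v _)) (-v-inverse P)))
  isoVec {zero} (a ∷ []) ne | yes refl = ⊥-elim (ne refl)
  isoVec {suc m} (a ∷ P) ne | yes refl with isoVec P (λ e → ne (cong (0f ∷_) e))
  ... | M , e = swapI ∘I liftI M , cong (ap (to swapI)) (cong (0f ∷_) e)

  zero-or-not : ∀ {m} (f : Fun m) → (∃ λ u → ¬ (fn f u ≡ 0f)) ⊎ (∀ u → fn f u ≡ 0f)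
  zero-or-not {zero} f = inj₂ λ { [] → fn-0 f }
  zero-or-not {suc m} f with fn f e₀ ≟ 0f
  ... | no ne = inj₁ (e₀ , ne)
  ... | yes z with zero-or-not (f ∘F lin consE)
  ...   | inj₁ (u , ne) = inj₁ (0f ∷ u , ne)
  ...   | inj₂ h = inj₂ λ { (x ∷ u) → begin
          fn f (x ∷ u) ≡⟨ cong (fn f) (cong₂ _∷_ (trans (sym (R.+-identityʳ x)) (cong (_⊕ 0f) (sym (R.*-identityʳ x)))) (trans (sym (0-+v u)) (cong (_+v u) (sym (*v-0 x))))) ⟩
          fn f (x *v e₀ +v (0f ∷ u)) ≡⟨ fn-+ f _ _ ⟩
          fn f (x *v e₀) ⊕ fn f (0f ∷ u) ≡⟨ cong₂ _⊕_ (trans (fn-* f x e₀) (trans (cong (x ⊗_) z) (R.zeroʳ x))) (h u) ⟩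
          0f ⊕ 0f ≡⟨ R.+-identityʳ 0f ⟩
          0f ∎ }
          where open ≡-Reasoning

  split-vec : ∀ {m} x (u : V m) → x ∷ u ≡ x *v e₀ +v (0f ∷ u)
  split-vec x u = cong₂ _∷_ (trans (sym (R.+-identityʳ x)) (cong (_⊕ 0f) (sym (R.*-identityʳ x)))) (trans (sym (0-+v u)) (cong (_+v u) (sym (*v-0 x))))

  isoFun : ∀ {m} (f : Fun (suc m)) → (∃ λ u → ¬ (fn f u ≡ 0f)) → ∃ λ (M : Iso (suc m)) → ∀ u → hd (ap (to M) u) ≡ fn f u
  isoFun {m} f (w , ne) with fn f e₀ ≟ 0f
  ... | no a≢0 = coshearI (f ∘F lin consE) ∘I scaleI (fn f e₀) a≢0 , λ { (x ∷ u) → sym (trans (cong (fn f) (split-vec x u))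
        (trans (fn-+ f _ _) (cong (_⊕ fn f (0f ∷ u)) (trans (fn-* f x e₀) (R.*-comm x _))))) }
  ... | yes z with w
  isoFun {zero} f (_ , ne) | yes z | x ∷ [] = ⊥-elim (ne (trans (cong (fn f) (trans (split-vec x []) (trans (cong (x *v e₀ +v_) refl) (+v-0 _))))
      (trans (fn-* f x e₀) (trans (cong (x ⊗_) z) (R.zeroʳ x)))))
  isoFun {suc m} f (_ , ne) | yes z | x ∷ w' with isoFun (f ∘F lin consE) (w' , λ e → ne (trans (restrict x w') e))
    where
      restrict : ∀ x u → fn f (x ∷ u) ≡ fn f (0f ∷ u)
      restrict x u = trans (cong (fn f) (split-vec x u)) (trans (fn-+ f _ _) (trans (cong (_⊕ fn f (0f ∷ u)) (trans (fn-* f x e₀) (trans (cong (x ⊗_) z) (R.zeroʳ x)))) (R.+-identityˡ _)))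
  ... | M , e = swapI ∘I liftI M , λ { (x ∷ u) → trans (head-swap x (ap (to M) u)) (trans (e u) (sym (restrict x u))) }
    where
      restrict : ∀ x u → fn f (x ∷ u) ≡ fn f (0f ∷ u)
      restrict x u = trans (cong (fn f) (split-vec x u)) (trans (fn-+ f _ _) (trans (cong (_⊕ fn f (0f ∷ u)) (trans (fn-* f x e₀) (trans (cong (x ⊗_) z) (R.zeroʳ x)))) (R.+-identityˡ _)))
      head-swap : ∀ x (v : V (suc m)) → hd (ap (to swapI) (x ∷ v)) ≡ hd v
      head-swap x (y ∷ v) = refl

  record Hyperplane {m} (f : Fun (suc m)) : Set where
    field
      incl : Emb m (suc m)
      retr : Lin (suc m) m
      in-kernel : ∀ x → fn f (em incl x) ≡ 0f
      retr-incl : ∀ x → ap retr (em incl x) ≡ x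
      incl-retr : ∀ u → fn f u ≡ 0f → em incl (ap retr u) ≡ u

  hyperplane : ∀ {m} (f : Fun (suc m)) → (∃ λ u → ¬ (fn f u ≡ 0f)) → Hyperplane f
  hyperplane f ne with isoFun f ne
  ... | M , e = record
    { incl = isoE (flip M) ∘E consE
    ; retr = tailL ∘L to M
    ; in-kernel = λ x → trans (sym (e _)) (cong hd (to-from M (0f ∷ x)))
    ; retr-incl = λ x → cong (ap tailL) (to-from M (0f ∷ x))
    ; incl-retr = λ u z → trans (cong (ap (from M)) (split (ap (to M) u) (trans (e u) z))) (from-to M u) }
    where
      split : ∀ {m} (v : V (suc m)) → hd v ≡ 0f → 0f ∷ ap tailL v ≡ v
      split (x ∷ v) refl = refl

  hyperplane-emb : ∀ {m} (f : Fun (suc m)) → ∃ λ (ι : Emb m (suc m)) → ∀ x → fn f (em ι x) ≡ 0f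
  hyperplane-emb f with zero-or-not f
  ... | inj₁ ne = Hyperplane.incl (hyperplane f ne) , Hyperplane.in-kernel (hyperplane f ne)
  ... | inj₂ z = consE , λ x → z _

  -- Rank and nullity: each coordinate of `φ` cuts the dimension by one. If a coordinate vanishes
  -- identically, a hyperplane is chosen nevertheless, so that the dimension found is always `s`.
  kernel-emb : ∀ {s} k (φ : Lin (k ℕ.+ s) k) → ∃ λ (ι : Emb s (k ℕ.+ s)) → ∀ x → ap φ (em ι x) ≡ 0v
  kernel-emb zero φ = record { lin = idL ; injective = λ u e → e } , λ x → empty (ap φ x)
    where
      empty : (v : V 0) → v ≡ []
      empty [] = refl
  kernel-emb (suc k) φ with hyperplane-emb (headF ∘F φ)
  ... | ι , e with kernel-emb k (tailL ∘L φ ∘L lin ι)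
  ...   | κ , e' = ι ∘E κ , λ x → join (ap φ (em ι (em κ x))) (e (em κ x)) (e' x)
    where
      join : ∀ {n} (v : V (suc n)) → fn headF v ≡ 0f → ap tailL v ≡ 0v → v ≡ 0v
      join (x ∷ v) refl refl = refl

  frame₂ : ∀ {m} (P R : V (suc (suc m))) → ¬ (P ≡ 0v) → (∀ c → ¬ (R ≡ c *v P)) →
           ∃ λ (M : Iso (suc (suc m))) → ap (to M) P ≡ e₀ × ap (to M) R ≡ e₁
  frame₂ P R nP nR with isoVec P nP
  ... | M , e with ap (to M) R in eqR
  ...   | r ∷ R' with isoVec R' (λ z → nR r (begin
            R ≡⟨ from-to M R ⟨
            ap (from M) (ap (to M) R) ≡⟨ cong (ap (from M)) (trans eqR (cong (r ∷_) z)) ⟩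
            ap (from M) (r ∷ 0v) ≡⟨ cong (ap (from M)) (cong₂ _∷_ (sym (R.*-identityʳ r)) (sym (*v-0 r))) ⟩
            ap (from M) (r *v e₀) ≡⟨ ap-* (from M) r e₀ ⟩
            r *v ap (from M) e₀ ≡⟨ cong (λ w → r *v ap (from M) w) e ⟨
            r *v ap (from M) (ap (to M) P) ≡⟨ cong (r *v_) (from-to M P) ⟩
            r *v P ∎))
          where open ≡-Reasoning
  ...     | N , e' = coshearI g ∘I liftI N ∘I M ,
            trans (cong (λ w → ap (to (coshearI g ∘I liftI N)) w) e)
              (cong₂ _∷_ (trans (cong (λ z → 1f ⊕ (-f r) ⊗ hd z) (ap-0 (to N))) (trans (cong (1f ⊕_) (R.zeroʳ _)) (R.+-identityʳ 1f))) (ap-0 (to N))) ,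
            trans (cong (λ w → ap (to (coshearI g ∘I liftI N)) w) eqR)
              (cong₂ _∷_ (trans (cong (λ z → r ⊕ (-f r) ⊗ hd z) e') (trans (cong (r ⊕_) (R.*-identityʳ _)) (R.-‿inverseʳ r))) e')
    where
      g = (-f r) *Fn headF

  frame-hyperplane : ∀ {m} (f : Fun (suc (suc m))) (R : V (suc (suc m))) → (∃ λ u → ¬ (fn f u ≡ 0f)) → ¬ (R ≡ 0v) → fn f R ≡ 0f →
                     ∃ λ (M : Iso (suc (suc m))) → (∀ u → hd (ap (to M) u) ≡ fn f u) × ap (to M) R ≡ e₁
  frame-hyperplane f R ne nR z with isoFun f ne
  ... | M , e with ap (to M) R in eqR
  ...   | r ∷ R' with trans (sym (trans (sym (e R)) (cong hd eqR))) z
  ...     | refl with isoVec R' (λ z' → nR (injective (isoE M) R (trans eqR (cong (0f ∷_) z'))))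
  ...       | N , e' = liftI N ∘I M , (λ u → trans (head-lift (ap (to M) u)) (e u)) , trans (cong (ap (to (liftI N))) eqR) (cong (0f ∷_) e')
    where
      head-lift : ∀ v → hd (ap (to (liftI N)) v) ≡ hd v
      head-lift (x ∷ v) = refl

  -- Points of projective space and counting

  ∃𝔽? : {P : 𝔽 → Set} → (∀ c → Dec (P c)) → Dec (∃ P)
  ∃𝔽? P? = map′ (λ a → let (c , _ , q) = find a in c , q) (λ (c , q) → lose (elements-complete c) q) (any? P? elements)

  vecs : ∀ m → List (V m)
  vecs zero = [] ∷ []
  vecs (suc m) = concatMap (λ x → map (x ∷_) (vecs m)) elements

  vecs-count : ∀ {m} (u : V m) → # (_≟v u) (vecs m) ≡ 1
  vecs-count [] = refl
  vecs-count {suc m} (x ∷ u) = begin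
    # (_≟v (x ∷ u)) (vecs (suc m)) ≡⟨ ∑-concatMap (λ y → map (y ∷_) (vecs m)) elements _ ⟩
    ∑ elements (λ y → ∑ (map (y ∷_) (vecs m)) (λ v → ind (v ≟v (x ∷ u)))) ≡⟨ ∑-cong elements (λ y _ → row y) ⟩
    ∑ elements (λ y → ind (y ≟ x) * 1) ≡⟨ ∑-point _≟_ elements-unique (λ _ → 1) (elements-complete x) ⟩
    1 ∎
    where
      open ≡-Reasoning
      cell : ∀ y v → ind ((y ∷ v) ≟v (x ∷ u)) ≡ ind (y ≟ x) * ind (v ≟v u)
      cell y v = trans (ind-cong ((y ∷ v) ≟v (x ∷ u)) ((y ≟ x) ×-dec (v ≟v u)) (λ { refl → refl , refl }) (λ { (refl , refl) → refl })) (ind-× (y ≟ x) (v ≟v u))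
      row : ∀ y → ∑ (map (y ∷_) (vecs m)) (λ v → ind (v ≟v (x ∷ u))) ≡ ind (y ≟ x) * 1
      row y = begin
        ∑ (map (y ∷_) (vecs m)) (λ v → ind (v ≟v (x ∷ u))) ≡⟨ ∑-map (y ∷_) (vecs m) _ ⟩
        ∑ (vecs m) (λ v → ind ((y ∷ v) ≟v (x ∷ u))) ≡⟨ ∑-cong (vecs m) (λ v _ → cell y v) ⟩
        ∑ (vecs m) (λ v → ind (y ≟ x) * ind (v ≟v u)) ≡⟨ ∑-*ˡ (vecs m) (ind (y ≟ x)) _ ⟩
        ind (y ≟ x) * # (_≟v u) (vecs m) ≡⟨ cong (ind (y ≟ x) *_) (vecs-count u) ⟩
        ind (y ≟ x) * 1 ∎

  vecs-unique : ∀ m → Unique (vecs m)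
  vecs-unique m = multiplicity-unique _≟v_ (vecs m) (λ u → ℕₚ.≤-reflexive (vecs-count u))

  vecs-complete : ∀ {m} (u : V m) → u ∈ vecs m
  vecs-complete {m} u with #-witness (_≟v u) (vecs m) (ℕₚ.≤-reflexive (sym (vecs-count u)))
  ... | v , k , refl = k

  vecs-length : ∀ m → length (vecs m) ≡ p ^ m
  vecs-length zero = refl
  vecs-length (suc m) = begin
    length (vecs (suc m)) ≡⟨ length-∑ (vecs (suc m)) ⟩
    ∑ (vecs (suc m)) (λ _ → 1) ≡⟨ ∑-concatMap (λ y → map (y ∷_) (vecs m)) elements _ ⟩
    ∑ elements (λ y → ∑ (map (y ∷_) (vecs m)) (λ _ → 1))
      ≡⟨ ∑-cong elements (λ y _ → trans (sym (length-∑ (map (y ∷_) (vecs m)))) (trans (length-map (y ∷_) (vecs m)) (vecs-length m))) ⟩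
    ∑ elements (λ y → p ^ m) ≡⟨ ∑-const elements (p ^ m) ⟩
    p ^ suc m ∎
    where open ≡-Reasoning

  ∃V? : ∀ {m} {P : V m → Set} → (∀ c → Dec (P c)) → Dec (∃ P)
  ∃V? {m} P? = map′ (λ a → let (c , _ , q) = find a in c , q) (λ (c , q) → lose (vecs-complete c) q) (any? P? (vecs m))

  ∑-vecs : ∀ {m} (f g : V m → V m) → (∀ a → g (f a) ≡ a) → (∀ a → f (g a) ≡ a) → ∀ h →
           ∑ (vecs m) (λ a → h (f a)) ≡ ∑ (vecs m) h
  ∑-vecs {m} = ∑-bijection _≟v_ (vecs-unique m) vecs-complete

  1<p : 1 < p
  1<p = unique-length _≟_ {us = 0f ∷ 1f ∷ []} (((λ e → 1≢0 (sym e)) All.∷ All.[]) AllPairs.∷ All.[] AllPairs.∷ AllPairs.[]) (λ u _ → elements-complete u)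

  0<p : 0 < p
  0<p = ℕₚ.<-trans (s≤s z≤n) 1<p

  infix 4 _∼_ _∼?_
  -- The factor zero is allowed, so `0v ∼ P` always holds and symmetry needs a nonzero vector. In a
  -- quotient this makes an element at the centre count on each line through the centre.
  _∼_ : ∀ {m} → V m → V m → Set
  u ∼ P = ∃ λ c → u ≡ c *v P

  _∼?_ : ∀ {m} (u P : V m) → Dec (u ∼ P)
  u ∼? P = ∃𝔽? (λ c → u ≟v (c *v P))

  ∼-refl : ∀ {m} {u : V m} → u ∼ u
  ∼-refl {u = u} = 1f , sym (1-*v u)

  ∼-trans : ∀ {m} {u v w : V m} → u ∼ v → v ∼ w → u ∼ w
  ∼-trans {w = w} (c , e) (d , e') = c ⊗ d , trans e (trans (cong (c *v_) e') (⊗-*v c d w))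

  ∼-sym : ∀ {m} {u v : V m} → ¬ (u ≡ 0v) → u ∼ v → v ∼ u
  ∼-sym ne (c , refl) = inv c , unscale (proj₁ (*v-nonzero ne)) refl

  ∼-ap : ∀ {a b} (φ : Lin a b) {u v : V a} → u ∼ v → ap φ u ∼ ap φ v
  ∼-ap φ {v = v} (c , refl) = c , ap-* φ c v

  ∼-em : ∀ {a b} (ι : Emb a b) {u v : V a} → em ι u ∼ em ι v → u ∼ v
  ∼-em ι {v = v} (c , e) = c , em-injective ι (trans e (sym (ap-* (lin ι) c v)))

  points : ∀ m → List (V m)
  points zero = []
  points (suc m) = map (1f ∷_) (vecs m) ++ map (0f ∷_) (points m)

  -- The number `(p ^ m - 1) / (p - 1)` of points of a projective space of vector dimension `m`.
  Θ : ℕ → ℕ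
  Θ m = length (points m)

  Θ-suc : ∀ m → Θ (suc m) ≡ p ^ m + Θ m
  Θ-suc m = trans (length-++ (map (1f ∷_) (vecs m))) (cong₂ _+_ (trans (length-map (1f ∷_) (vecs m)) (vecs-length m)) (length-map (0f ∷_) (points m)))

  points-≢0 : ∀ {m} {P : V m} → P ∈ points m → ¬ (P ≡ 0v)
  points-≢0 {suc m} k e with ∈-++⁻ (map (1f ∷_) (vecs m)) k
  ... | inj₁ k' with ∈-map⁻ (1f ∷_) k'
  ...   | v , _ , refl = 1≢0 (cong hd e)
  points-≢0 {suc m} k e | inj₂ k' with ∈-map⁻ (0f ∷_) k'
  ...   | v , j , refl = points-≢0 j (cong (ap tailL) e)

  point-count : ∀ {m} (u : V m) → ¬ (u ≡ 0v) → # (u ∼?_) (points m) ≡ 1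
  point-count {zero} [] ne = ⊥-elim (ne refl)
  point-count {suc m} (x ∷ u) ne = trans (∑-++ (map (1f ∷_) (vecs m)) (map (0f ∷_) (points m)) _)
      (trans (cong₂ _+_ (∑-map (1f ∷_) (vecs m) _) (∑-map (0f ∷_) (points m) _)) (cases (x ≟ 0f)))
    where
      cases : Dec (x ≡ 0f) → # (λ v → (x ∷ u) ∼? (1f ∷ v)) (vecs m) + # (λ v → (x ∷ u) ∼? (0f ∷ v)) (points m) ≡ 1
      cases (no nx) = cong₂ _+_ (trans (#-cong (λ v → (x ∷ u) ∼? (1f ∷ v)) (_≟v (inv x *v u)) (vecs m)
            (λ { v _ (c , e) → trans (unscale nx (trans (cong (ap tailL) e) (cong (_*v v) (trans (sym (R.*-identityʳ c)) (sym (cong hd e)))))) refl })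
            (λ { v _ refl → x , cong₂ _∷_ (sym (R.*-identityʳ x)) (sym (trans (⊗-*v x (inv x) u) (trans (cong (_*v u) (inv-law nx)) (1-*v u)))) }))
          (vecs-count (inv x *v u)))
        (#-none (λ v → (x ∷ u) ∼? (0f ∷ v)) (points m) (λ { v _ (c , e) → nx (trans (cong hd e) (R.zeroʳ c)) }))
      cases (yes refl) = cong₂ _+_
        (#-none (λ v → (0f ∷ u) ∼? (1f ∷ v)) (vecs m) (λ { v _ (c , e) → ne (cong (0f ∷_) (trans (cong (ap tailL) e)
          (trans (cong (_*v v) (trans (sym (R.*-identityʳ c)) (sym (cong hd e)))) (0-*v v)))) }))
        (trans (#-cong (λ v → (0f ∷ u) ∼? (0f ∷ v)) (u ∼?_) (points m)
            (λ { v _ (c , e) → c , cong (ap tailL) e }) (λ { v _ (c , e) → c , cong₂ _∷_ (sym (R.zeroʳ c)) e }))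
          (point-count u (λ e → ne (cong (0f ∷_) e))))

  normalise : ∀ {m} (u : V m) → ¬ (u ≡ 0v) → ∃ λ P → P ∈ points m × u ∼ P
  normalise {m} u ne = #-witness (u ∼?_) (points m) (ℕₚ.≤-reflexive (sym (point-count u ne)))

  Nonzero : ∀ {m} → List (V m) → Set
  Nonzero B = ∀ u → u ∈ B → ¬ (u ≡ 0v)

  ScaleInvariant : ∀ {m} → (V m → Set) → Set
  ScaleInvariant Y = ∀ {u P} → ¬ (u ≡ 0v) → u ∼ P → Y P → Y u

  module _ {m} (B : List (V m)) (nz : Nonzero B) {Y : V m → Set} (Y? : ∀ u → Dec (Y u)) where

    ∑-points : ScaleInvariant Y → ∑ (points m) (λ P → ind (Y? P) * # (_∼? P) B) ≡ # Y? B
    ∑-points inv-Y = begin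
      ∑ (points m) (λ P → ind (Y? P) * # (_∼? P) B) ≡⟨ ∑-cong (points m) (λ P _ → sym (∑-*ˡ B (ind (Y? P)) _)) ⟩
      ∑ (points m) (λ P → ∑ B (λ u → ind (Y? P) * ind (u ∼? P))) ≡⟨ ∑-swap (points m) B _ ⟩
      ∑ B (λ u → ∑ (points m) (λ P → ind (Y? P) * ind (u ∼? P))) ≡⟨ ∑-cong B (λ u k → ∑-cong (points m) (λ P _ → move u k P)) ⟩
      ∑ B (λ u → ∑ (points m) (λ P → ind (Y? u) * ind (u ∼? P))) ≡⟨ ∑-cong B (λ u k → trans (∑-*ˡ (points m) (ind (Y? u)) _) (trans (cong (ind (Y? u) *_) (point-count u (nz u k))) (ℕₚ.*-identityʳ _))) ⟩
      # Y? B ∎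
      where
        open ≡-Reasoning
        move : ∀ u → u ∈ B → ∀ P → ind (Y? P) * ind (u ∼? P) ≡ ind (Y? u) * ind (u ∼? P)
        move u k P with u ∼? P
        ... | no _ = trans (ℕₚ.*-zeroʳ (ind (Y? P))) (sym (ℕₚ.*-zeroʳ (ind (Y? u))))
        ... | yes s = cong (_* 1) (ind-cong (Y? P) (Y? u) (inv-Y (nz u k) s)
            (λ y → inv-Y (λ e → nz u k (trans (proj₂ s) (trans (cong (proj₁ s *v_) e) (*v-0 (proj₁ s))))) (∼-sym (nz u k) s) y))

    -- Double counting inside `Y`: every marked subspace brings at least `N` points, and domination
    -- turns incidences at a point into elements of `B` at that point.
    dominated-count : ScaleInvariant Y → {X : Set} (is : List X) {mem : X → V m → Set} (mem? : ∀ i P → Dec (mem i P)) →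
      (∀ P → P ∈ points m → # (λ i → mem? i P) is ≤ # (_∼? P) B) →
      {J : X → Set} (J? : ∀ i → Dec (J i)) → ∀ N →
      (∀ i → i ∈ is → J i → N ≤ # (λ P → mem? i P ×-dec Y? P) (points m)) → # J? is * N ≤ # Y? B
    dominated-count inv-Y is mem? dom J? N h = begin
      # J? is * N ≡⟨ trans (ℕₚ.*-comm (# J? is) N) (sym (∑-*ˡ is N _)) ⟩
      ∑ is (λ i → N * ind (J? i)) ≤⟨ ∑-mono is (λ i k → marked i k) ⟩
      ∑ is (λ i → # (λ P → mem? i P ×-dec Y? P) (points m)) ≡⟨ ∑-swap is (points m) _ ⟩
      ∑ (points m) (λ P → ∑ is (λ i → ind (mem? i P ×-dec Y? P)))
        ≡⟨ ∑-cong (points m) (λ P _ → trans (∑-cong is (λ i _ → trans (ind-× (mem? i P) (Y? P)) (ℕₚ.*-comm _ (ind (Y? P))))) (∑-*ˡ is (ind (Y? P)) _)) ⟩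
      ∑ (points m) (λ P → ind (Y? P) * # (λ i → mem? i P) is) ≤⟨ ∑-mono (points m) (λ P k → ℕₚ.*-monoʳ-≤ (ind (Y? P)) (dom P k)) ⟩
      ∑ (points m) (λ P → ind (Y? P) * # (_∼? P) B) ≡⟨ ∑-points inv-Y ⟩
      # Y? B ∎
      where
        open ℕₚ.≤-Reasoning
        marked : ∀ i → i ∈ is → N * ind (J? i) ≤ # (λ P → mem? i P ×-dec Y? P) (points m)
        marked i k with J? i
        ... | yes j = ℕₚ.≤-trans (ℕₚ.≤-reflexive (ℕₚ.*-identityʳ N)) (h i k j)
        ... | no _ = ℕₚ.≤-trans (ℕₚ.≤-reflexive (ℕₚ.*-zeroʳ N)) z≤n

  im? : ∀ {a b} (S : Emb a b) (P : V b) → Dec (∃ λ z → em S z ≡ P)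
  im? S P = ∃V? (λ z → em S z ≟v P)

  module _ {a b} (S : Emb a b) where

    dir-count : ∀ P → P ∈ points b → # (λ z → em S z ∼? P) (points a) ≤ ind (im? S P)
    dir-count P k with im? S P
    ... | no ne = ℕₚ.≤-reflexive (#-none (λ z → em S z ∼? P) (points a) (λ { z j (c , e) → ne (inv c *v z ,
            trans (ap-* (lin S) (inv c) z) (sym (unscale (λ z0 → points-≢0 j (injective S z (trans e (trans (cong (_*v P) z0) (0-*v P))))) e))) }))
    ... | yes (z₀ , refl) = ℕₚ.≤-trans (#-mono (λ z → em S z ∼? em S z₀) (z₀ ∼?_) (points a)
            (λ z j s → ∼-sym (points-≢0 j) (∼-em S s))) (ℕₚ.≤-reflexive (point-count z₀ (λ e → points-≢0 k (trans (cong (em S) e) (ap-0 (lin S))))))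

    image-points : {Y : V b → Set} (Y? : ∀ u → Dec (Y u)) → ScaleInvariant Y →
                   # (λ z → Y? (em S z)) (points a) ≤ # (λ P → im? S P ×-dec Y? P) (points b)
    image-points Y? inv-Y = begin
      # (λ z → Y? (em S z)) (points a) ≡⟨ ∑-cong (points a) (λ z j → sym (trans (∑-*ˡ (points b) (ind (Y? (em S z))) _)
           (trans (cong (ind (Y? (em S z)) *_) (point-count (em S z) (λ e → points-≢0 j (injective S z e)))) (ℕₚ.*-identityʳ _)))) ⟩
      ∑ (points a) (λ z → ∑ (points b) (λ P → ind (Y? (em S z)) * ind (em S z ∼? P))) ≡⟨ ∑-swap (points a) (points b) _ ⟩
      ∑ (points b) (λ P → ∑ (points a) (λ z → ind (Y? (em S z)) * ind (em S z ∼? P))) ≤⟨ ∑-mono (points b) (λ P _ → ∑-mono (points a) (λ z j → move z j P)) ⟩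
      ∑ (points b) (λ P → ∑ (points a) (λ z → ind (Y? P) * ind (em S z ∼? P))) ≡⟨ ∑-cong (points b) (λ P _ → ∑-*ˡ (points a) (ind (Y? P)) _) ⟩
      ∑ (points b) (λ P → ind (Y? P) * # (λ z → em S z ∼? P) (points a)) ≤⟨ ∑-mono (points b) (λ P k → ℕₚ.*-monoʳ-≤ (ind (Y? P)) (dir-count P k)) ⟩
      ∑ (points b) (λ P → ind (Y? P) * ind (im? S P)) ≡⟨ ∑-cong (points b) (λ P _ → trans (ℕₚ.*-comm (ind (Y? P)) _) (sym (ind-× (im? S P) (Y? P)))) ⟩
      # (λ P → im? S P ×-dec Y? P) (points b) ∎
      where
        open ℕₚ.≤-Reasoning
        move : ∀ z → z ∈ points a → ∀ P → ind (Y? (em S z)) * ind (em S z ∼? P) ≤ ind (Y? P) * ind (em S z ∼? P)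
        move z j P with em S z ∼? P
        ... | no _ = ℕₚ.≤-trans (ℕₚ.≤-reflexive (ℕₚ.*-zeroʳ (ind (Y? (em S z))))) z≤n
        ... | yes s = ℕₚ.*-monoˡ-≤ 1 (ind-mono (Y? (em S z)) (Y? P) (λ y → inv-Y nP (∼-sym nS s) y))
          where
            nS = λ e → points-≢0 j (injective S z e)
            nP : ¬ (P ≡ 0v)
            nP e = nS (trans (proj₂ s) (trans (cong (proj₁ s *v_) e) (*v-0 (proj₁ s))))

  record Subspace {m} (D : V m → Set) : Set where
    field
      D-0 : D 0v
      D-+ : ∀ {u v} → D u → D v → D (u +v v)
      D-* : ∀ c {u} → D u → D (c *v u)
  open Subspace public

  subspace-invariant : ∀ {m} {D : V m → Set} → Subspace D → ScaleInvariant D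
  subspace-invariant sub _ (c , refl) d = D-* sub c d

  complement-invariant : ∀ {m} {D : V m → Set} → Subspace D → ScaleInvariant (λ u → ¬ D u)
  complement-invariant {D = D} sub ne s nd d with ∼-sym ne s
  ... | c , refl = nd (D-* sub c d)

  vectors-on-point : ∀ {m} (P : V m) → # (λ v → (v ∼? P) ×-dec ¬? (v ≟v 0v)) (vecs m) ≤ ℕ.pred p
  vectors-on-point {m} P = begin
    # (λ v → (v ∼? P) ×-dec ¬? (v ≟v 0v)) (vecs m) ≤⟨ ∑-mono (vecs m) (λ v _ → cover v) ⟩
    ∑ (vecs m) (λ v → ∑ elements (λ c → ind (¬? (c ≟ 0f)) * ind (v ≟v (c *v P)))) ≡⟨ ∑-swap (vecs m) elements _ ⟩
    ∑ elements (λ c → ∑ (vecs m) (λ v → ind (¬? (c ≟ 0f)) * ind (v ≟v (c *v P))))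
      ≡⟨ ∑-cong elements (λ c _ → trans (∑-*ˡ (vecs m) (ind (¬? (c ≟ 0f))) _) (trans (cong (ind (¬? (c ≟ 0f)) *_) (vecs-count (c *v P))) (ℕₚ.*-identityʳ _))) ⟩
    # (λ c → ¬? (c ≟ 0f)) elements ≡⟨ cong ℕ.pred (trans (cong (_+ # (λ c → ¬? (c ≟ 0f)) elements) (sym (unique-multiplicity _≟_ elements-unique (elements-complete 0f)))) (#-compl (_≟ 0f) elements)) ⟩
    ℕ.pred p ∎
    where
      open ℕₚ.≤-Reasoning
      cover : ∀ v → ind ((v ∼? P) ×-dec ¬? (v ≟v 0v)) ≤ ∑ elements (λ c → ind (¬? (c ≟ 0f)) * ind (v ≟v (c *v P)))
      cover v with (v ∼? P) ×-dec ¬? (v ≟v 0v)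
      ... | no _ = z≤n
      ... | yes ((c , e) , ne) = ℕₚ.≤-trans (ℕₚ.≤-reflexive (sym (cong₂ _*_ (ind-yes (¬? (c ≟ 0f)) (λ z → ne (trans e (trans (cong (_*v P) z) (0-*v P))))) (ind-yes (v ≟v (c *v P)) e))))
          (∑-≤-member elements _ (elements-complete c))

  pred-p : suc (ℕ.pred p) ≡ p
  pred-p = ℕₚ.suc-pred p {{ℕ.>-nonZero 0<p}}

  private
    instance
      pred-p≢0 : ℕ.NonZero (ℕ.pred p)
      pred-p≢0 = ℕ.>-nonZero (ℕₚ.≤-pred (subst (2 ≤_) (sym pred-p) 1<p))

  module _ {m} {D : V (suc m) → Set} (sub : Subspace D) (D? : ∀ u → Dec (D u)) {x₀ : V (suc m)} (x₀∉ : ¬ D x₀) where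

    private
      translate : ∀ c (h : V (suc m) → ℕ) → ∑ (vecs (suc m)) (λ v → h (v +v c *v x₀)) ≡ ∑ (vecs (suc m)) h
      translate c = ∑-vecs (λ v → v +v c *v x₀) (λ v → v +v (-f c) *v x₀)
        (λ v → trans (+v-assoc v _ _) (trans (cong (v +v_) (neg-*v c x₀)) (+v-0 v)))
        (λ v → trans (+v-assoc v _ _) (trans (cong (v +v_) (trans (+v-comm _ _) (neg-*v c x₀))) (+v-0 v)))

      one-translate : ∀ v → # (λ c → D? (v +v c *v x₀)) elements ≤ 1
      one-translate v = #-at-most-one (λ c → D? (v +v c *v x₀)) elements-unique same
        where
          same : ∀ c d → D (v +v c *v x₀) → D (v +v d *v x₀) → c ≡ d
          same c d dc dd with (c ⊕ (-f d)) ≟ 0f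
          ... | yes z = trans (sym (R.+-identityʳ c)) (trans (cong (c ⊕_) (sym (R.-‿inverseˡ d))) (trans (sym (R.+-assoc c (-f d) d)) (trans (cong (_⊕ d) z) (R.+-identityˡ d))))
          ... | no nz = ⊥-elim (x₀∉ (subst D (trans (⊗-*v _ _ x₀) (trans (cong (_*v x₀) (inv-lawˡ nz)) (1-*v x₀))) (D-* sub (inv (c ⊕ (-f d)))
                (subst D diff (D-+ sub dc (D-* sub (-f 1f) dd))))))
            where
              diff : (v +v c *v x₀) +v (-f 1f) *v (v +v d *v x₀) ≡ (c ⊕ (-f d)) *v x₀
              diff = begin
                (v +v c *v x₀) +v (-f 1f) *v (v +v d *v x₀) ≡⟨ cong ((v +v c *v x₀) +v_) (*v-+v (-f 1f) v _) ⟩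
                (v +v c *v x₀) +v ((-v v) +v (-f 1f) *v (d *v x₀)) ≡⟨ +v-exchange v _ (-v v) _ ⟩
                (v +v (-v v)) +v (c *v x₀ +v (-f 1f) *v (d *v x₀)) ≡⟨ cong₂ _+v_ (-v-inverse v) (cong (c *v x₀ +v_) (trans (⊗-*v (-f 1f) d x₀) (cong (_*v x₀) (trans (sym (-‿distribˡ-* 1f d)) (cong -f_ (R.*-identityˡ d)))))) ⟩
                0v +v (c *v x₀ +v (-f d) *v x₀) ≡⟨ 0-+v _ ⟩
                c *v x₀ +v (-f d) *v x₀ ≡⟨ ⊕-*v c (-f d) x₀ ⟨
                (c ⊕ (-f d)) *v x₀ ∎
                where open ≡-Reasoning

    -- The `p` translates of `D` by multiples of `x₀` are disjoint.
    subspace-size : p * # D? (vecs (suc m)) ≤ p ^ suc m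
    subspace-size = begin
      p * # D? (vecs (suc m)) ≡⟨ ∑-const elements _ ⟨
      ∑ elements (λ c → # D? (vecs (suc m))) ≡⟨ ∑-cong elements (λ c _ → translate c (λ v → ind (D? v))) ⟨
      ∑ elements (λ c → ∑ (vecs (suc m)) (λ v → ind (D? (v +v c *v x₀)))) ≡⟨ ∑-swap elements (vecs (suc m)) _ ⟩
      ∑ (vecs (suc m)) (λ v → # (λ c → D? (v +v c *v x₀)) elements) ≤⟨ ∑-mono (vecs (suc m)) (λ v _ → one-translate v) ⟩
      ∑ (vecs (suc m)) (λ _ → 1) ≡⟨ length-∑ (vecs (suc m)) ⟨
      length (vecs (suc m)) ≡⟨ vecs-length (suc m) ⟩
      p ^ suc m ∎
      where open ℕₚ.≤-Reasoning

    -- By `subspace-size` at least `(p - 1) p ^ m` vectors lie outside `D`, and each point accounts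
    -- for at most `p - 1` of them.
    points-outside : p ^ m ≤ # (λ P → ¬? (D? P)) (points (suc m))
    points-outside = ℕₚ.*-cancelˡ-≤ (ℕ.pred p) (ℕₚ.+-cancelˡ-≤ (p ^ m) _ _ (begin
      p ^ m + ℕ.pred p * p ^ m ≡⟨ cong (_* p ^ m) pred-p ⟩
      p ^ suc m ≡⟨ trans (#-compl D? (vecs (suc m))) (vecs-length (suc m)) ⟨
      # D? (vecs (suc m)) + # (λ v → ¬? (D? v)) (vecs (suc m)) ≤⟨ ℕₚ.+-mono-≤ (ℕₚ.*-cancelˡ-≤ p {{ℕ.>-nonZero 0<p}} subspace-size) outside ⟩
      p ^ m + ℕ.pred p * # (λ P → ¬? (D? P)) (points (suc m)) ∎))
      where
        open ℕₚ.≤-Reasoning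
        cover : ∀ v → ind (¬? (D? v)) ≤ ∑ (points (suc m)) (λ P → ind (¬? (D? P)) * ind ((v ∼? P) ×-dec ¬? (v ≟v 0v)))
        cover v with D? v
        ... | yes _ = z≤n
        ... | no nd with normalise v (λ { refl → nd (D-0 sub) })
        ...   | P , k , s = ℕₚ.≤-trans (ℕₚ.≤-reflexive (sym (cong₂ _*_
                (ind-yes (¬? (D? P)) (λ d → nd (subspace-invariant sub (λ { refl → nd (D-0 sub) }) s d)))
                (ind-yes ((v ∼? P) ×-dec ¬? (v ≟v 0v)) (s , λ { refl → nd (D-0 sub) })))))
              (∑-≤-member (points (suc m)) _ k)
        outside : # (λ v → ¬? (D? v)) (vecs (suc m)) ≤ ℕ.pred p * # (λ P → ¬? (D? P)) (points (suc m))
        outside = begin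
          # (λ v → ¬? (D? v)) (vecs (suc m)) ≤⟨ ∑-mono (vecs (suc m)) (λ v _ → cover v) ⟩
          ∑ (vecs (suc m)) (λ v → ∑ (points (suc m)) (λ P → ind (¬? (D? P)) * ind ((v ∼? P) ×-dec ¬? (v ≟v 0v)))) ≡⟨ ∑-swap (vecs (suc m)) (points (suc m)) _ ⟩
          ∑ (points (suc m)) (λ P → ∑ (vecs (suc m)) (λ v → ind (¬? (D? P)) * ind ((v ∼? P) ×-dec ¬? (v ≟v 0v))))
            ≤⟨ ∑-mono (points (suc m)) (λ P _ → ℕₚ.≤-trans (ℕₚ.≤-reflexive (∑-*ˡ (vecs (suc m)) (ind (¬? (D? P))) _)) (ℕₚ.≤-trans (ℕₚ.*-monoʳ-≤ (ind (¬? (D? P))) (vectors-on-point P)) (ℕₚ.≤-reflexive (ℕₚ.*-comm _ (ℕ.pred p))))) ⟩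
          ∑ (points (suc m)) (λ P → ℕ.pred p * ind (¬? (D? P))) ≡⟨ ∑-*ˡ (points (suc m)) (ℕ.pred p) _ ⟩
          ℕ.pred p * # (λ P → ¬? (D? P)) (points (suc m)) ∎

  kernel-subspace : ∀ {m} (f : Fun m) → Subspace (λ u → fn f u ≡ 0f)
  kernel-subspace f = record { D-0 = fn-0 f ; D-+ = λ {u} {v} e e' → trans (fn-+ f u v) (trans (cong₂ _⊕_ e e') (R.+-identityʳ 0f))
                             ; D-* = λ c {u} e → trans (fn-* f c u) (trans (cong (c ⊗_) e) (R.zeroʳ c)) }

  image-subspace : ∀ {a b} (S : Emb a b) → Subspace (λ u → ∃ λ z → em S z ≡ u)
  image-subspace S = record { D-0 = 0v , ap-0 (lin S) ; D-+ = λ { (x , refl) (y , refl) → x +v y , ap-+ (lin S) x y }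
                            ; D-* = λ { c (x , refl) → c *v x , ap-* (lin S) c x } }

  preimage-subspace : ∀ {a b} (φ : Lin a b) {D : V b → Set} → Subspace D → Subspace (λ u → D (ap φ u))
  preimage-subspace φ {D} sub = record { D-0 = subst D (sym (ap-0 φ)) (D-0 sub) ; D-+ = λ {u} {v} d e → subst D (sym (ap-+ φ u v)) (D-+ sub d e)
                                       ; D-* = λ c {u} d → subst D (sym (ap-* φ c u)) (D-* sub c d) }

  -- Blocking sets in coordinates and their dual line arrangements

  private
    module P𝔽 = Polynomials ring𝔽
    K = P𝔽.polyRing
    module K = CommutativeRing K

  domainK : IsDomain K
  domainK = Degrees.polyDomain ring𝔽 domain𝔽

  -- F_p^k as the polynomials of degree below `k` in Z. The map is additive and respects scalars
  -- from F_p, which is all that `bk` asks for.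
  ρ : ∀ {k} → V k → P𝔽.Poly
  ρ = Vec.toList

  ρ-injective : ∀ {k} (u v : V k) → ρ u P𝔽.≋ ρ v → u ≡ v
  ρ-injective [] [] e = refl
  ρ-injective (x ∷ u) (y ∷ v) e = cong₂ _∷_ (e .P𝔽.at 0) (ρ-injective u v (P𝔽.mk λ i → e .P𝔽.at (suc i)))

  bk : ∀ {k} → 𝔽 → V k → V k → V k
  bk s a y = a +v (-f s) *v y

  bk-ρ : ∀ {k} s (a y : V k) → ρ (bk s a y) P𝔽.≋ ρ a P𝔽.⊞ P𝔽.neg (P𝔽.const s P𝔽.⊠ ρ y)
  bk-ρ s a y = P𝔽.≋-trans (go a y) (P𝔽.⊞-cong P𝔽.≋-refl (P𝔽.neg-cong (P𝔽.≋-sym (P𝔽.const-⊠ s (ρ y)))))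
    where
      go : ∀ {k} (a y : V k) → ρ (bk s a y) P𝔽.≋ ρ a P𝔽.⊞ P𝔽.neg (P𝔽.scal s (ρ y))
      go [] [] = P𝔽.≋-refl
      go (x ∷ a) (z ∷ y) = P𝔽.∷-cong (cong (x ⊕_) (sym (-‿distribˡ-* s z))) (go a y)

  characteristicK : ∀ n → Mult._×_ K.+-monoid n K.1# P𝔽.≋ [] → p ∣ n
  characteristicK n e = characteristic n (trans (sym (co n)) (e .P𝔽.at 0))
    where
      co : ∀ n → P𝔽.coeff (Mult._×_ K.+-monoid n K.1#) 0 ≡ Mult._×_ R.+-monoid n 1f
      co zero = refl
      co (suc n) = trans (P𝔽.coeff-⊞ K.1# (Mult._×_ K.+-monoid n K.1#) 0) (cong (1f ⊕_) (co n))

  -- The kernel of `φ` has codimension at most `k`, so this is `t`-fold blocking of the subspaces of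
  -- codimension `k`. The list holds one vector per unit of weight, in any scaling.
  Fold : ∀ {m} → ℕ → ℕ → List (V m) → Set
  Fold {m} k t B = ∀ (φ : Lin m k) → t ≤ # (λ u → ap φ u ≟v 0v) B

  Missing : ∀ {m} → V m → List (V m) → Set
  Missing R B = ∀ u → u ∈ B → ¬ (u ∼ R)

  missing? : ∀ {m} (R : V m) B → Dec (Missing R B)
  missing? R B = map′ (λ n u k s → n (lose k s)) (λ h a → let (u , k , s) = find a in h u k s) (¬? (any? (_∼? R) B))

  -- The bound `(t + 1/2) p ^ k - 1/2` on the size, doubled.
  Thin : ∀ {m} → ℕ → ℕ → List (V m) → Set
  Thin k t B = suc (2 * length B) ≤ suc (2 * t) * p ^ k

  fold-map : ∀ {m n k t} (A : Lin m n) B → Fold k t B → Fold k t (map (ap A) B)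
  fold-map A B h φ = ℕₚ.≤-trans (h (φ ∘L A)) (ℕₚ.≤-reflexive (sym (∑-map (ap A) B _)))

  nonzero-map : ∀ {m} (M : Iso m) B → Nonzero B → Nonzero (map (ap (to M)) B)
  nonzero-map M B nz u k with ∈-map⁻ (ap (to M)) k
  ... | v , j , refl = iso-≢0 M (nz v j)

  missing-map : ∀ {m} (M : Iso m) B {R} → Missing R B → Missing (ap (to M) R) (map (ap (to M)) B)
  missing-map M B h u k s with ∈-map⁻ (ap (to M)) k
  ... | v , j , refl = h v j (∼-em (isoE M) s)

  missing-unmap : ∀ {m} (M : Iso m) B {R} → Missing (ap (to M) R) (map (ap (to M)) B) → Missing R B
  missing-unmap M B h u k s = h (ap (to M) u) (∈-map⁺ _ k) (∼-ap (to M) s)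

  missing-∼ : ∀ {m} {B : List (V m)} {R R'} → R' ∼ R → Missing R B → Missing R' B
  missing-∼ s h u k s' = h u k (∼-trans s' s)

  thin-map : ∀ {m n k t} (f : V m → V n) B → Thin k t B → Thin k t (map f B)
  thin-map f B h = ℕₚ.≤-trans (ℕₚ.≤-reflexive (cong (λ n → suc (2 * n)) (length-map f B))) h

  module _ {k : ℕ} where

    -- The lines skew to the axis `x = y = 0` are the graphs of the maps that take `(x , y)` to
    -- `x α + y β`. So `(α , β)` ranges over a grid, and points become dual lines.
    OnLine : V k → V k → V (suc (suc k)) → Set
    OnLine α β (x ∷ y ∷ a) = a ≡ x *v α +v y *v β

    onLine? : ∀ α β u → Dec (OnLine α β u)
    onLine? α β (x ∷ y ∷ a) = a ≟v (x *v α +v y *v β)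

    lineL : V k → V k → Lin (suc (suc k)) k
    lineL α β = (tailL ∘L tailL) +L (outer headF (-v α) +L outer (headF ∘F tailL) (-v β))

    private
      neg-line : ∀ x y (α β : V k) → x *v (-v α) +v y *v (-v β) ≡ -v (x *v α +v y *v β)
      neg-line x y α β = trans (cong₂ _+v_ (*v-comm x (-f 1f) α) (*v-comm y (-f 1f) β)) (sym (*v-+v (-f 1f) _ _))

    lineL-on : ∀ α β u → ap (lineL α β) u ≡ 0v → OnLine α β u
    lineL-on α β (x ∷ y ∷ a) e = difference-zero (trans (cong (a +v_) (sym (neg-line x y α β))) e)

    fold-line : ∀ {t B} → Fold k t B → ∀ α β → t ≤ # (onLine? α β) B
    fold-line {t = t} {B = B} h α β = ℕₚ.≤-trans (h (lineL α β)) (#-mono (λ u → ap (lineL α β) u ≟v 0v) (onLine? α β) B (λ u _ → lineL-on α β u))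

    -- The incidence `a = x α + y β` as an equation in `(α , β)`, divided by `x`, or in `toInf` by
    -- `y` if `x = 0`. Nonzero elements of the axis lie on none of these lines and are dropped.
    toAff : V (suc (suc k)) → List (𝔽 × V k)
    toAff (x ∷ y ∷ a) with x ≟ 0f
    ... | yes _ = []
    ... | no _ = (inv x ⊗ y , inv x *v a) ∷ []

    toInf : V (suc (suc k)) → List (V k)
    toInf (x ∷ y ∷ a) with x ≟ 0f | y ≟ 0f
    ... | yes _ | no _ = (inv y *v a) ∷ []
    ... | _ | _ = []

    OffAxis : V (suc (suc k)) → Set
    OffAxis (x ∷ y ∷ a) = ¬ (x ≡ 0f × y ≡ 0f)

    offAxis? : ∀ u → Dec (OffAxis u)
    offAxis? (x ∷ y ∷ a) = ¬? ((x ≟ 0f) ×-dec (y ≟ 0f))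

    q' : ℕ
    q' = length (vecs k)

  kernel-emb′ : ∀ {s n} k → n ≡ k + s → (φ : Lin n k) → ∃ λ (ι : Emb s n) → ∀ x → ap φ (em ι x) ≡ 0v
  kernel-emb′ k refl φ = kernel-emb k φ

  module Standard (k : ℕ) (B : List (V (suc (suc k)))) (nz : Nonzero B) where

    aff : List (𝔽 × V k)
    aff = concatMap toAff B

    inf : List (V k)
    inf = concatMap toInf B

    open Lines K domainK (V k) _≟v_ (vecs k) (vecs-unique k) vecs-complete ρ ρ-injective 𝔽 P𝔽.const bk bk-ρ aff inf
      using (Z; Tangent; few-secants; congruence; back; inf-rare)

    private
      per-element : ∀ α β u → ¬ (u ≡ 0v) →
        ∑ (toAff u) (λ v → ind (back β v ≟v α)) + ∑ (toInf u) (λ b → ind (b ≟v β)) ≡ ind (onLine? α β u)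
      per-element α β (x ∷ y ∷ a) ne with x ≟ 0f | y ≟ 0f
      ... | no nx | _ = trans (ℕₚ.+-identityʳ _) (trans (ℕₚ.+-identityʳ _) (ind-cong (bk (inv x ⊗ y) (inv x *v a) β ≟v α) (onLine? α β (x ∷ y ∷ a)) fwd bwd))
        where
          scaled : bk (inv x ⊗ y) (inv x *v a) β ≡ inv x *v (a +v (-f y) *v β)
          scaled = trans (cong (inv x *v a +v_) (trans (cong (_*v β) (-‿distribʳ-* (inv x) y)) (sym (⊗-*v (inv x) (-f y) β)))) (sym (*v-+v (inv x) a _))
          re : ∀ w → w +v (-f y) *v β +v y *v β ≡ w
          re w = trans (+v-assoc w _ _) (trans (cong (w +v_) (trans (+v-comm _ _) (neg-*v y β))) (+v-0 w))
          fwd : bk (inv x ⊗ y) (inv x *v a) β ≡ α → a ≡ x *v α +v y *v β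
          fwd e = trans (sym (re a)) (cong (_+v y *v β) (sym (trans (cong (x *v_) (trans (sym e) scaled)) (*v-inv nx (a +v (-f y) *v β)))))
          bwd : a ≡ x *v α +v y *v β → bk (inv x ⊗ y) (inv x *v a) β ≡ α
          bwd e = trans scaled (trans (cong (λ w → inv x *v (w +v (-f y) *v β)) e) (trans (cong (inv x *v_) (trans (+v-assoc _ _ _) (trans (cong (x *v α +v_) (neg-*v y β)) (+v-0 _)))) (trans (⊗-*v (inv x) x α) (trans (cong (_*v α) (inv-lawˡ nx)) (1-*v α)))))
      ... | yes refl | no ny = trans (ℕₚ.+-identityʳ _) (ind-cong (inv y *v a ≟v β) (onLine? α β (0f ∷ y ∷ a)) fwd bwd)
        where
          fwd : inv y *v a ≡ β → a ≡ 0f *v α +v y *v β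
          fwd e = trans (sym (trans (cong (y *v_) (sym e)) (trans (⊗-*v y (inv y) a) (trans (cong (_*v a) (inv-law ny)) (1-*v a))))) (trans (sym (0-+v _)) (cong (_+v y *v β) (sym (0-*v α))))
          bwd : a ≡ 0f *v α +v y *v β → inv y *v a ≡ β
          bwd e = sym (unscale ny (trans e (trans (cong (_+v y *v β) (0-*v α)) (0-+v _))))
      ... | yes refl | yes refl = sym (ind-no (onLine? α β (0f ∷ 0f ∷ a)) (λ e → ne (cong (λ w → 0f ∷ 0f ∷ w) (trans e (trans (cong₂ _+v_ (0-*v α) (0-*v β)) (+v-0 0v))))))

    Z-line : ∀ α β → Z α β ≡ # (onLine? α β) B
    Z-line α β = begin
      Z α β ≡⟨ cong₂ _+_ (trans (∑-map (back β) aff _) (∑-concatMap toAff B _)) (∑-concatMap toInf B _) ⟩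
      ∑ B (λ u → ∑ (toAff u) (λ v → ind (back β v ≟v α))) + ∑ B (λ u → ∑ (toInf u) (λ b → ind (b ≟v β))) ≡⟨ ∑-+ B _ _ ⟨
      ∑ B (λ u → ∑ (toAff u) (λ v → ind (back β v ≟v α)) + ∑ (toInf u) (λ b → ind (b ≟v β))) ≡⟨ ∑-cong B (λ u j → per-element α β u (nz u j)) ⟩
      # (onLine? α β) B ∎
      where open ≡-Reasoning

    off-axis : length aff + length inf ≡ # offAxis? B
    off-axis = begin
      length aff + length inf ≡⟨ cong₂ _+_ (trans (length-∑ aff) (∑-concatMap toAff B _)) (trans (length-∑ inf) (∑-concatMap toInf B _)) ⟩
      ∑ B (λ u → ∑ (toAff u) (λ _ → 1)) + ∑ B (λ u → ∑ (toInf u) (λ _ → 1)) ≡⟨ ∑-+ B _ _ ⟨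
      ∑ B (λ u → ∑ (toAff u) (λ _ → 1) + ∑ (toInf u) (λ _ → 1)) ≡⟨ ∑-cong B (λ u _ → one u) ⟩
      # offAxis? B ∎
      where
        open ≡-Reasoning
        one : ∀ u → ∑ (toAff u) (λ _ → 1) + ∑ (toInf u) (λ _ → 1) ≡ ind (offAxis? u)
        one (x ∷ y ∷ a) with x ≟ 0f | y ≟ 0f
        ... | no _ | _ = refl
        ... | yes _ | no _ = refl
        ... | yes _ | yes _ = refl

    toInf-spec : ∀ (u : V (suc (suc k))) (b : V k) → b ∈ toInf u → u ∼ (0f ∷ 1f ∷ b)
    toInf-spec (x ∷ y ∷ a) b k with x ≟ 0f | y ≟ 0f | k
    ... | yes refl | no ny | here refl = y , cong₂ _∷_ (sym (R.zeroʳ y)) (cong₂ _∷_ (sym (R.*-identityʳ y))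
            (sym (trans (⊗-*v y (inv y) a) (trans (cong (_*v a) (inv-law ny)) (1-*v a)))))

    toInf-spec⁻ : ∀ (u : V (suc (suc k))) (b : V k) → ¬ (u ≡ 0v) → u ∼ (0f ∷ 1f ∷ b) → b ∈ toInf u
    toInf-spec⁻ (x ∷ y ∷ a) b ne (c , e) with x ≟ 0f | y ≟ 0f
    ... | no nx | _ = ⊥-elim (nx (trans (cong hd e) (R.zeroʳ c)))
    ... | yes _ | no ny = here (trans (unscale ny (trans (cong (λ v → ap tailL (ap tailL v)) e) (cong (_*v b) (trans (sym (R.*-identityʳ c)) (sym (cong (λ v → hd (ap tailL v)) e)))))) refl)
    ... | yes zx | yes zy = ⊥-elim (ne (trans e (trans (cong (_*v (0f ∷ 1f ∷ b)) (trans (sym (R.*-identityʳ c)) (trans (sym (cong (λ v → hd (ap tailL v)) e)) zy))) (0-*v _))))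

    inf-missing : ∀ {η} → ¬ η ∈ inf → Missing (0f ∷ 1f ∷ η) B
    inf-missing h u k s = h (∈-concatMap⁺ toInf (lose k (toInf-spec⁻ u _ (nz u k) s)))

    missing-inf : ∀ {η} → Missing (0f ∷ 1f ∷ η) B → ¬ η ∈ inf
    missing-inf {η} h j with find (∈-concatMap⁻ toInf {xs = B} j)
    ... | u , k , l = h u k (toInf-spec u η l)

    infinite-rare : # (λ η → ¬? (missing? (0f ∷ 1f ∷ η) B)) (vecs k) ≤ length inf
    infinite-rare = ℕₚ.≤-trans (#-mono (λ η → ¬? (missing? (0f ∷ 1f ∷ η) B)) (_∈? inf) (vecs k) (λ η _ n → case η n (η ∈? inf))) inf-rare
      where
        open import Data.List.Membership.DecPropositional (_≟v_ {k}) using (_∈?_)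
        case : ∀ η → ¬ Missing (0f ∷ 1f ∷ η) B → Dec (η ∈ inf) → η ∈ inf
        case η n (yes j) = j
        case η n (no nj) = ⊥-elim (n (inf-missing nj))

    module _ (t : ℕ) (fold : Fold k t B) where

      -- All lines through a missing point of x = 0 are covered by affine elements.
      affine-large : ∀ {η} → Missing (0f ∷ 1f ∷ η) B → t * q' {k} ≤ length aff
      affine-large {η} miss = begin
        t * q' {k} ≡⟨ trans (ℕₚ.*-comm t (q' {k})) (sym (∑-const (vecs k) t)) ⟩
        ∑ (vecs k) (λ _ → t) ≤⟨ ∑-mono (vecs k) (λ α _ → ℕₚ.≤-trans (fold-line {t = t} {B = B} fold α η) (ℕₚ.≤-reflexive (trans (sym (Z-line α η)) (trans (cong (# (_≟v α) (map (back η) aff) +_) (#-none (_≟v η) inf (λ { b j refl → missing-inf miss j }))) (ℕₚ.+-identityʳ _))))) ⟩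
        ∑ (vecs k) (λ α → # (_≟v α) (map (back η) aff)) ≡⟨ ∑-swap (vecs k) (map (back η) aff) _ ⟩
        ∑ (map (back η) aff) (λ v → ∑ (vecs k) (λ α → ind (v ≟v α))) ≡⟨ ∑-cong (map (back η) aff) (λ v _ → trans (∑-cong (vecs k) (λ α _ → ind-cong (v ≟v α) (α ≟v v) sym sym)) (vecs-count v)) ⟩
        ∑ (map (back η) aff) (λ _ → 1) ≡⟨ length-∑ (map (back η) aff) ⟨
        length (map (back η) aff) ≡⟨ length-map (back η) aff ⟩
        length aff ∎
        where open ℕₚ.≤-Reasoning

      module _ (thin : Thin k t B) (t<q : t < p ^ k) where

        private
          q≡ : q' {k} ≡ p ^ k
          q≡ = vecs-length k

          off≤ : # offAxis? B ≤ length B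
          off≤ = #-≤-length offAxis? B

        -- The strict half of `q'` comes from the odd factor `2 t + 1` in `Thin`.
        twice-excess : ∀ {e} → t * q' {k} + e ≤ length B → 2 * e < q' {k}
        twice-excess {e} h = ℕₚ.+-cancelˡ-≤ (2 * (t * q)) _ _ (begin
          2 * (t * q) + suc (2 * e) ≡⟨ solve 2 (λ a e → con 2 :* a :+ (con 1 :+ con 2 :* e) := con 1 :+ con 2 :* (a :+ e)) refl (t * q) e ⟩
          suc (2 * (t * q + e)) ≤⟨ s≤s (ℕₚ.*-monoʳ-≤ 2 h) ⟩
          suc (2 * length B) ≤⟨ thin ⟩
          suc (2 * t) * p ^ k ≡⟨ cong (suc (2 * t) *_) q≡ ⟨
          suc (2 * t) * q ≡⟨ solve 2 (λ t q → (con 1 :+ con 2 :* t) :* q := con 2 :* (t :* q) :+ q) refl t q ⟩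
          2 * (t * q) + q ∎)
          where
            open ℕₚ.≤-Reasoning
            open +-*-Solver
            q = q' {k}

        module _ {η₀} (miss₀ : Missing (0f ∷ 1f ∷ η₀) B) where
          private
            c = length aff ∸ t * q' {k}
            aff≡ : length aff ≡ t * q' {k} + c
            aff≡ = sym (ℕₚ.m+[n∸m]≡n (affine-large miss₀))
            few : 2 * (c + length inf) < q' {k}
            few = twice-excess (begin
              t * q' {k} + (c + length inf) ≡⟨ ℕₚ.+-assoc (t * q' {k}) c _ ⟨
              t * q' {k} + c + length inf ≡⟨ cong (_+ length inf) aff≡ ⟨
              length aff + length inf ≡⟨ off-axis ⟩
              # offAxis? B ≤⟨ off≤ ⟩
              length B ∎)
              where open ℕₚ.≤-Reasoning
            t<q'' : t < q' {k}
            t<q'' = subst (t <_) (sym q≡) t<q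
            blocking : ∀ x y → t ≤ Z x y
            blocking x y = ℕₚ.≤-trans (fold-line {t = t} {B = B} fold x y) (ℕₚ.≤-reflexive (sym (Z-line x y)))

          -- `few-secants` allows at most `c + length inf` exceptional directions, and together with
          -- `t * q'` this is exactly the number of elements off the axis.
          tangents-abound : ∀ v η₁ → Missing (0f ∷ 1f ∷ η₁) B → # (onLine? (back η₁ v) η₁) B ≡ t →
            # (λ η → ¬? (missing? (0f ∷ 1f ∷ η) B ×-dec (# (onLine? (back η v) η) B ℕ.≟ t))) (vecs k) + t * q' {k} ≤ # offAxis? B
          tangents-abound v η₁ miss e = begin
            # (λ η → ¬? (missing? (0f ∷ 1f ∷ η) B ×-dec (# (onLine? (back η v) η) B ℕ.≟ t))) (vecs k) + t * q' {k}
              ≤⟨ ℕₚ.+-monoˡ-≤ (t * q' {k}) (ℕₚ.≤-trans (∑-mono (vecs k) (λ η _ → ind-mono (¬? (missing? (0f ∷ 1f ∷ η) B ×-dec (# (onLine? (back η v) η) B ℕ.≟ t))) (¬? (LTangent? v η))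
                   (λ n tan → n (inf-missing (proj₁ tan) , trans (sym (Z-line (back η v) η)) (proj₂ tan)))))
                   (few-secants t c aff≡ t<q'' few blocking v η₁ (missing-inf miss , trans (Z-line (back η₁ v) η₁) e))) ⟩
            (c + length inf) + t * q' {k} ≡⟨ trans (ℕₚ.+-comm (c + length inf) _) (sym (ℕₚ.+-assoc (t * q' {k}) c _)) ⟩
            t * q' {k} + c + length inf ≡⟨ trans (cong (_+ length inf) (sym aff≡)) off-axis ⟩
            # offAxis? B ∎
            where
              open ℕₚ.≤-Reasoning
              LTangent? = Lines.Tangent? K domainK (V k) _≟v_ (vecs k) (vecs-unique k) vecs-complete ρ ρ-injective 𝔽 P𝔽.const bk bk-ρ aff inf t c aff≡ t<q'' few blocking

          line-congruence : (∀ v → v ∈ aff → ∃ λ η → Missing (0f ∷ 1f ∷ η) B × # (onLine? (back η v) η) B ≡ t) →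
                            ∀ α η → Missing (0f ∷ 1f ∷ η) B → ∃ λ j → # (onLine? α η) B ≡ t + j * p
          line-congruence h α η miss = proj₁ cng , trans (sym (Z-line α η)) (proj₂ cng)
            where
              cng : ∃ λ j → Z α η ≡ t + j * p
              cng = congruence t c aff≡ t<q'' few blocking p characteristicK
                (λ v k → proj₁ (h v k) , missing-inf (proj₁ (proj₂ (h v k))) , trans (Z-line (back (proj₁ (h v k)) v) (proj₁ (h v k))) (proj₂ (proj₂ (h v k)))) α η (missing-inf miss)

  -- Missing points, tangents, and the congruence for lines with a missing point

  multiples-count : ∀ {m} (P : V m) → # (_∼? P) (vecs m) ≤ p
  multiples-count {m} P = begin
    # (_∼? P) (vecs m) ≤⟨ ∑-mono (vecs m) (λ v _ → cover v) ⟩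
    ∑ (vecs m) (λ v → ∑ elements (λ c → ind (v ≟v (c *v P)))) ≡⟨ ∑-swap (vecs m) elements _ ⟩
    ∑ elements (λ c → ∑ (vecs m) (λ v → ind (v ≟v (c *v P)))) ≡⟨ ∑-cong elements (λ c _ → vecs-count (c *v P)) ⟩
    ∑ elements (λ _ → 1) ≡⟨ length-∑ elements ⟨
    p ∎
    where
      open ℕₚ.≤-Reasoning
      cover : ∀ v → ind (v ∼? P) ≤ ∑ elements (λ c → ind (v ≟v (c *v P)))
      cover v with v ∼? P
      ... | no _ = z≤n
      ... | yes (c , e) = ℕₚ.≤-trans (ℕₚ.≤-reflexive (sym (ind-yes (v ≟v (c *v P)) e))) (∑-≤-member elements _ (elements-complete c))

  directions-count : ∀ {a b} (ι : Emb a b) u → ¬ (u ≡ 0v) → # (λ z → u ∼? em ι z) (vecs a) ≤ p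
  directions-count {a} ι u ne with any? (λ z → u ∼? em ι z) (vecs a)
  ... | no n = ℕₚ.≤-trans (ℕₚ.≤-reflexive (#-none (λ z → u ∼? em ι z) (vecs a) (λ z k s → n (lose k s)))) z≤n
  ... | yes an = let (z₀ , _ , s₀) = find an in ℕₚ.≤-trans
        (#-mono (λ z → u ∼? em ι z) (_∼? z₀) (vecs a) (λ z _ s → ∼-em ι (∼-trans (∼-sym ne s) s₀))) (multiples-count z₀)

  -- The kernel has vector dimension at least two. Each of its fewer than `p` elements excludes at
  -- most `p` vectors, which together with the zero vector makes less than `p ^ 2`.
  missing-in-kernel : ∀ {s n} k → n ≡ k + suc (suc s) → (φ : Lin n k) (B : List (V n)) → Nonzero B →
    # (λ u → ap φ u ≟v 0v) B < p → ∃ λ R → ap φ R ≡ 0v × ¬ (R ≡ 0v) × Missing R B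
  missing-in-kernel {s} k eq φ B nz few with kernel-emb′ k eq φ
  ... | ι , ker with #-sequential-avoid (_≟v 0v) (λ u z → u ∼? em ι z) (filter (λ u → ap φ u ≟v 0v) B) (vecs (suc (suc s))) p
         (λ u k → directions-count ι u (nz u (proj₁ (∈-filter⁻ (λ u → ap φ u ≟v 0v) {xs = B} k)))) (begin-strict
           # (_≟v 0v) (vecs (suc (suc s))) + length (filter (λ u → ap φ u ≟v 0v) B) * p ≡⟨ cong₂ _+_ (vecs-count {suc (suc s)} 0v) (cong (_* p) (length-filter (λ u → ap φ u ≟v 0v) B)) ⟩
           1 + # (λ u → ap φ u ≟v 0v) B * p <⟨ ℕₚ.+-monoˡ-< _ 1<p ⟩
           p + # (λ u → ap φ u ≟v 0v) B * p ≤⟨ ℕₚ.*-monoˡ-≤ p few ⟩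
           p * p ≡⟨ cong (p *_) (ℕₚ.*-identityʳ p) ⟨
           p ^ 2 ≤⟨ ℕₚ.^-monoʳ-≤ p {{ℕ.>-nonZero 0<p}} {2} {suc (suc s)} (s≤s (s≤s z≤n)) ⟩
           p ^ suc (suc s) ≡⟨ vecs-length (suc (suc s)) ⟨
           length (vecs (suc (suc s))) ∎)
    where open ℕₚ.≤-Reasoning
  ...   | z , _ , nz' , avoid = em ι z , ker z , (λ e → nz' (injective ι z e)) ,
          λ u k s → avoid u (∈-filter⁺ (λ u → ap φ u ≟v 0v) k (in-kernel u k s)) s
    where
      in-kernel : ∀ u → u ∈ B → u ∼ em ι z → ap φ u ≡ 0v
      in-kernel u k (c , refl) = trans (ap-* φ c _) (trans (cong (c *v_) (ker z)) (*v-0 c))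

  module Tangents (k : ℕ) (t : ℕ) (t<p : suc (2 * t) ≤ p) where

    private
      m = suc (suc (suc k))
      q = p ^ suc k

      t<p' : t < p
      t<p' = ℕₚ.≤-trans (s≤s (ℕₚ.m≤m+n t _)) t<p

      p≤q : p ≤ q
      p≤q = ℕₚ.≤-trans (ℕₚ.≤-reflexive (sym (ℕₚ.*-identityʳ p))) (ℕₚ.*-monoʳ-≤ p (ℕₚ.m^n>0 p {{ℕ.>-nonZero 0<p}} k))

      t<q : t < q
      t<q = ℕₚ.<-≤-trans t<p' p≤q

    record Good (B : List (V m)) : Set where
      field
        nz : Nonzero B
        fold : Fold (suc k) t B
        thin : Thin (suc k) t B
    open Good public

    good-map : ∀ M {B} → Good B → Good (map (ap (to M)) B)
    good-map M {B} g = record { nz = nonzero-map M B (nz g) ; fold = fold-map (to M) B (fold g) ; thin = thin-map {k = suc k} {t = t} (ap (to M)) B (thin g) }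

    onAxis-line : ∀ (η : V (suc k)) x y a → OnLine 0v η (x ∷ y ∷ a) → a ≡ y *v η
    onAxis-line η x y a e = trans e (trans (cong (_+v y *v η) (*v-0 x)) (0-+v _))

    onAxis-line⁻ : ∀ (η : V (suc k)) x y a → a ≡ y *v η → OnLine 0v η (x ∷ y ∷ a)
    onAxis-line⁻ η x y a e = trans e (sym (trans (cong (_+v y *v η) (*v-0 x)) (0-+v _)))

    -- The line joining `e₀` to `(ξ , 1 , η)` does not depend on `ξ`; this parameter only names the
    -- hyperplane `x = ξ y` in which the line has a missing point.
    TangentAt : List (V m) → 𝔽 → V (suc k) → Set
    TangentAt B ξ η = Missing (ξ ∷ 1f ∷ η) B × # (onLine? 0v η) B ≡ t

    tangentAt? : ∀ B ξ η → Dec (TangentAt B ξ η)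
    tangentAt? B ξ η = missing? (ξ ∷ 1f ∷ η) B ×-dec (# (onLine? 0v η) B ℕ.≟ t)

    private
      back0 : ∀ (η : V (suc k)) → bk 0f 0v η ≡ 0v
      back0 η = trans (0-+v _) (trans (cong (_*v η) -0#≈0#) (0-*v η))

      shear : 𝔽 → Iso m
      shear ξ = coshearI ((-f ξ) *Fn headF)

      shear-dir : ∀ ξ η → ap (to (shear ξ)) (ξ ∷ 1f ∷ η) ≡ 0f ∷ 1f ∷ η
      shear-dir ξ η = cong (_∷ 1f ∷ η) (trans (cong (ξ ⊕_) (R.*-identityʳ _)) (R.-‿inverseʳ ξ))

      shear-line : ∀ ξ B η → # (onLine? 0v η) (map (ap (to (shear ξ))) B) ≡ # (onLine? 0v η) B
      shear-line ξ B η = trans (∑-map (ap (to (shear ξ))) B _) (#-cong (λ u → onLine? 0v η (ap (to (shear ξ)) u)) (onLine? 0v η) B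
        (λ { (x ∷ y ∷ a) _ e → onAxis-line⁻ η x y a (onAxis-line η _ y a e) })
        (λ { (x ∷ y ∷ a) _ e → onAxis-line⁻ η _ y a (onAxis-line η x y a e) }))

    -- The shear that subtracts `ξ y` from `x` fixes `e₀` and every line through it, and takes the
    -- hyperplane `x = ξ y` to `x = 0`. The point `e₀` is the affine pair `(0f , 0v)`.
    tangents-abound-at : ∀ {B} → Good B → ∀ ξ η₁ → TangentAt B ξ η₁ →
      # (λ η → ¬? (tangentAt? B ξ η)) (vecs (suc k)) + t * q' {suc k} ≤ # offAxis? B
    tangents-abound-at {B} g ξ η₁ (miss , e) = begin
      # (λ η → ¬? (tangentAt? B ξ η)) (vecs (suc k)) + t * q' {suc k}
        ≤⟨ ℕₚ.+-monoˡ-≤ _ (#-mono (λ η → ¬? (tangentAt? B ξ η)) (λ η → ¬? (missing? (0f ∷ 1f ∷ η) B' ×-dec (# (onLine? (bk 0f 0v η) η) B' ℕ.≟ t))) (vecs (suc k))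
             (λ η _ n (m' , e') → n (missing-unmap (shear ξ) B (subst (λ v → Missing v B') (sym (shear-dir ξ η)) m') ,
                trans (sym (shear-line ξ B η)) (trans (cong (λ α → # (onLine? α η) B') (sym (back0 η))) e')))) ⟩
      # (λ η → ¬? (missing? (0f ∷ 1f ∷ η) B' ×-dec (# (onLine? (bk 0f 0v η) η) B' ℕ.≟ t))) (vecs (suc k)) + t * q' {suc k}
        ≤⟨ Standard.tangents-abound (suc k) B' (nz g') t (fold g') (thin g') t<q miss' (0f , 0v) η₁ miss'
             (trans (cong (λ α → # (onLine? α η₁) B') (back0 η₁)) (trans (shear-line ξ B η₁) e)) ⟩
      # offAxis? B' ≡⟨ ∑-map (ap (to (shear ξ))) B _ ⟩
      # (λ u → offAxis? (ap (to (shear ξ)) u)) B ≤⟨ #-mono (λ u → offAxis? (ap (to (shear ξ)) u)) offAxis? B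
          (λ { (x ∷ y ∷ a) _ n (refl , refl) → n (trans (R.+-identityˡ _) (R.zeroʳ _) , refl) }) ⟩
      # offAxis? B ∎
      where
        open ℕₚ.≤-Reasoning
        B' = map (ap (to (shear ξ))) B
        g' = good-map (shear ξ) g
        miss' : Missing (0f ∷ 1f ∷ η₁) B'
        miss' = subst (λ v → Missing v B') (shear-dir ξ η₁) (missing-map (shear ξ) B miss)

    tangents-majority : ∀ {B} → Good B → ∀ ξ η₁ → TangentAt B ξ η₁ →
                        2 * # (λ η → ¬? (tangentAt? B ξ η)) (vecs (suc k)) < q' {suc k}
    tangents-majority {B} g ξ η₁ tan = Standard.twice-excess (suc k) B (nz g) t (fold g) (thin g) t<q
      (ℕₚ.≤-trans (ℕₚ.≤-reflexive (ℕₚ.+-comm (t * q' {suc k}) _)) (ℕₚ.≤-trans (tangents-abound-at g ξ η₁ tan) (#-≤-length offAxis? B)))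

    -- The line joins two points of the kernel, so its weight is at most `t`, while blocking makes
    -- it at least `t`.
    kernel-tangent : ∀ {B} → Good B → ∀ (φ : Lin m (suc k)) ξ η → ap φ e₀ ≡ 0v → # (λ u → ap φ u ≟v 0v) B ≡ t →
                     ap φ (ξ ∷ 1f ∷ η) ≡ 0v → # (onLine? 0v η) B ≡ t
    kernel-tangent {B} g φ ξ η e0 e eR = ℕₚ.≤-antisym
      (ℕₚ.≤-trans (#-mono (onLine? 0v η) (λ u → ap φ u ≟v 0v) B (λ { (x ∷ y ∷ a) _ on → span x y a (onAxis-line η x y a on) })) (ℕₚ.≤-reflexive e))
      (fold-line {t = t} {B = B} (fold g) 0v η)
      where
        span : ∀ x y a → a ≡ y *v η → ap φ (x ∷ y ∷ a) ≡ 0v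
        span x y a refl = begin
          ap φ (x ∷ y ∷ y *v η) ≡⟨ cong (ap φ) decomposition ⟩
          ap φ ((x ⊕ (-f (y ⊗ ξ))) *v e₀ +v y *v (ξ ∷ 1f ∷ η)) ≡⟨ ap-+ φ _ _ ⟩
          ap φ ((x ⊕ (-f (y ⊗ ξ))) *v e₀) +v ap φ (y *v (ξ ∷ 1f ∷ η)) ≡⟨ cong₂ _+v_ (trans (ap-* φ _ e₀) (trans (cong (_ *v_) e0) (*v-0 _))) (trans (ap-* φ y _) (trans (cong (y *v_) eR) (*v-0 y))) ⟩
          0v +v 0v ≡⟨ +v-0 0v ⟩
          0v ∎
          where
            open ≡-Reasoning
            decomposition : x ∷ y ∷ y *v η ≡ (x ⊕ (-f (y ⊗ ξ))) *v e₀ +v y *v (ξ ∷ 1f ∷ η)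
            decomposition = cong₂ _∷_
              (sym (trans (cong (_⊕ y ⊗ ξ) (R.*-identityʳ _)) (trans (R.+-assoc x _ _) (trans (cong (x ⊕_) (R.-‿inverseˡ _)) (R.+-identityʳ x)))))
              (cong₂ _∷_ (sym (trans (cong₂ _⊕_ (R.zeroʳ _) (R.*-identityʳ y)) (R.+-identityˡ y)))
                (sym (trans (cong (_+v y *v η) (*v-0 _)) (0-+v _))))

    -- Lines through e₀ are parametrised independently of ξ, so the majority moves from x = ξ y to x = 0.
    move-hyperplane : ∀ {B} → Good B → Missing e₁ B → ∀ ξ η₁ → TangentAt B ξ η₁ → ∃ λ η → TangentAt B 0f η
    move-hyperplane {B} g miss₁ ξ η₁ tan = proj₁ found ,
        decidable-stable (missing? (0f ∷ 1f ∷ proj₁ found) B) (proj₂ (proj₂ (proj₂ found))) ,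
        proj₂ (decidable-stable (tangentAt? B ξ (proj₁ found)) (proj₁ (proj₂ (proj₂ found))))
      where
        open ℕₚ.≤-Reasoning
        aff = Standard.aff (suc k) B (nz g)
        inf = Standard.inf (suc k) B (nz g)
        few-infinite : 2 * length inf < q' {suc k}
        few-infinite = Standard.twice-excess (suc k) B (nz g) t (fold g) (thin g) t<q (begin
            t * q' {suc k} + length inf ≤⟨ ℕₚ.+-monoˡ-≤ (length inf) (Standard.affine-large (suc k) B (nz g) t (fold g) miss₁) ⟩
            length aff + length inf ≡⟨ Standard.off-axis (suc k) B (nz g) ⟩
            # offAxis? B ≤⟨ #-≤-length offAxis? B ⟩
            length B ∎)
        found : ∃ λ η → η ∈ vecs (suc k) × ¬ ¬ TangentAt B ξ η × ¬ ¬ Missing (0f ∷ 1f ∷ η) B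
        found = #-avoid₂ (λ η → ¬? (tangentAt? B ξ η)) (λ η → ¬? (missing? (0f ∷ 1f ∷ η) B)) (vecs (suc k))
          (halves {# (λ η → ¬? (tangentAt? B ξ η)) (vecs (suc k))} {# (λ η → ¬? (missing? (0f ∷ 1f ∷ η) B)) (vecs (suc k))} (tangents-majority g ξ η₁ tan)
            (ℕₚ.≤-<-trans (ℕₚ.*-monoʳ-≤ 2 (Standard.infinite-rare (suc k) B (nz g))) few-infinite))

    -- The translate of the affine hyperplane `g = 1` by `a` is disjoint from it.
    hyperplane-half : ∀ (g : Fun (suc k)) a → ¬ (fn g a ≡ 0f) → 2 * # (λ η → fn g η ≟ 1f) (vecs (suc k)) ≤ q' {suc k}
    hyperplane-half g a ne = begin
      2 * N ≡⟨ cong (N +_) (ℕₚ.+-identityʳ N) ⟩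
      N + N ≡⟨ cong (N +_) (∑-vecs (λ η → η +v a) (λ η → η +v (-v a)) (λ η → trans (+v-assoc η a _) (trans (cong (η +v_) (-v-inverse a)) (+v-0 η)))
          (λ η → trans (+v-assoc η _ a) (trans (cong (η +v_) (trans (+v-comm _ a) (-v-inverse a))) (+v-0 η))) (λ η → ind (fn g η ≟ 1f))) ⟨
      N + # (λ η → fn g (η +v a) ≟ 1f) (vecs (suc k)) ≡⟨ ∑-+ (vecs (suc k)) _ _ ⟨
      ∑ (vecs (suc k)) (λ η → ind (fn g η ≟ 1f) + ind (fn g (η +v a) ≟ 1f)) ≤⟨ ∑-mono (vecs (suc k)) (λ η _ → disjoint η) ⟩
      ∑ (vecs (suc k)) (λ _ → 1) ≡⟨ length-∑ (vecs (suc k)) ⟨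
      length (vecs (suc k)) ∎
      where
        open ℕₚ.≤-Reasoning
        N = # (λ η → fn g η ≟ 1f) (vecs (suc k))
        disjoint : ∀ η → ind (fn g η ≟ 1f) + ind (fn g (η +v a) ≟ 1f) ≤ 1
        disjoint η with fn g η ≟ 1f
        ... | no _ = ind-≤1 (fn g (η +v a) ≟ 1f)
        ... | yes e = ℕₚ.≤-reflexive (cong suc (ind-no (fn g (η +v a) ≟ 1f) (λ e' → ne (+-cancel (trans (cong (_⊕ fn g a) (sym e)) (trans (sym (fn-+ g η a)) e'))))))
          where
            +-cancel : ∀ {z} → 1f ⊕ z ≡ 1f → z ≡ 0f
            +-cancel {z} e = trans (sym (R.+-identityˡ z)) (trans (cong (_⊕ z) (sym (R.-‿inverseˡ 1f))) (trans (R.+-assoc _ 1f z) (trans (cong ((-f 1f) ⊕_) e) (R.-‿inverseˡ 1f))))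

    scale-dir : ∀ {ξ y} {a : V (suc k)} → ¬ (y ≡ 0f) → ξ ∷ y ∷ a ≡ y *v (inv y ⊗ ξ ∷ 1f ∷ inv y *v a)
    scale-dir {ξ} {y} {a} ne = cong₂ _∷_ (sym (trans (sym (R.*-assoc y (inv y) ξ)) (trans (cong (_⊗ ξ) (inv-law ne)) (R.*-identityˡ ξ))))
      (cong₂ _∷_ (sym (R.*-identityʳ y)) (sym (*v-inv ne a)))

    private
      scaled-missing : ∀ {B ξ y} {a : V (suc k)} → ¬ (y ≡ 0f) → Missing (ξ ∷ y ∷ a) B → Missing (inv y ⊗ ξ ∷ 1f ∷ inv y *v a) B
      scaled-missing {ξ = ξ} {y} {a} ne h = missing-∼ (inv y , unscale ne (scale-dir {ξ} {y} {a} ne)) h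

      scaled-kernel : ∀ {ξ y} {a : V (suc k)} (φ : Lin m (suc k)) → ¬ (y ≡ 0f) → ap φ (ξ ∷ y ∷ a) ≡ 0v → ap φ (inv y ⊗ ξ ∷ 1f ∷ inv y *v a) ≡ 0v
      scaled-kernel {ξ} {y} {a} φ ne e = trans (cong (ap φ) (unscale ne (scale-dir {ξ} {y} {a} ne))) (trans (ap-* φ (inv y) _) (trans (cong (inv y *v_) e) (*v-0 (inv y))))

    -- If the given tangent meets the axis x = y = 0, another axis avoiding it is used first.
    move-axis : ∀ {B} → Good B → ∀ (φ : Lin m (suc k)) → ap φ e₀ ≡ 0v → # (λ u → ap φ u ≟v 0v) B ≡ t →
                ∀ ξ (a : V (suc k)) → ¬ (a ≡ 0v) → ap φ (ξ ∷ 0f ∷ a) ≡ 0v → Missing (ξ ∷ 0f ∷ a) B → ∃₂ λ ξ' η → TangentAt B ξ' η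
    move-axis {B} g φ e0 e ξ a ne eR miss = finish avoided
      where
        M = proj₁ (isoVec a ne)
        h : Fun (suc k)
        h = headF ∘F to M
        ha : fn h a ≡ 1f
        ha = cong hd (proj₂ (isoVec a ne))
        N : Iso m
        -- `N` adds `h` to the second coordinate. It fixes `e₀` and moves the missing point to
        -- `(ξ , 1 , a)`, so that its line to `e₀` avoids the axis.
        N = liftI (coshearI h)
        B' = map (ap (to N)) B
        g' = good-map N g
        NR : ap (to N) (ξ ∷ 0f ∷ a) ≡ ξ ∷ 1f ∷ a
        NR = cong (λ y → ξ ∷ y ∷ a) (trans (R.+-identityˡ _) ha)
        Ne₀ : ap (to N) e₀ ≡ e₀
        Ne₀ = cong (λ y → 1f ∷ y ∷ 0v) (trans (R.+-identityˡ _) (fn-0 h))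
        ψ : Lin m (suc k)
        ψ = φ ∘L from N
        ψ≡ : ∀ u → ap ψ (ap (to N) u) ≡ ap φ u
        ψ≡ u = cong (ap φ) (from-to N u)
        tan' : TangentAt B' ξ a
        tan' = subst (λ v → Missing v B') NR (missing-map N B miss) ,
          kernel-tangent g' ψ ξ a (trans (cong (ap ψ) (sym Ne₀)) (trans (ψ≡ e₀) e0))
            (trans (∑-map (ap (to N)) B _) (trans (#-cong (λ u → ap ψ (ap (to N) u) ≟v 0v) (λ u → ap φ u ≟v 0v) B (λ u _ z → trans (sym (ψ≡ u)) z) (λ u _ z → trans (ψ≡ u) z)) e))
            (trans (cong (ap ψ) (sym NR)) (trans (ψ≡ _) eR))
        count : # (λ η → ¬? (tangentAt? B' ξ η)) (vecs (suc k)) + # (λ η → fn h η ≟ 1f) (vecs (suc k)) < length (vecs (suc k))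
        count = ℕₚ.*-cancelˡ-< 2 _ _ (begin-strict
          2 * (# (λ η → ¬? (tangentAt? B' ξ η)) (vecs (suc k)) + # (λ η → fn h η ≟ 1f) (vecs (suc k))) ≡⟨ ℕₚ.*-distribˡ-+ 2 (# (λ η → ¬? (tangentAt? B' ξ η)) (vecs (suc k))) _ ⟩
          2 * # (λ η → ¬? (tangentAt? B' ξ η)) (vecs (suc k)) + 2 * # (λ η → fn h η ≟ 1f) (vecs (suc k))
            <⟨ ℕₚ.+-mono-<-≤ (tangents-majority g' ξ a tan') (hyperplane-half h a (λ z → 1≢0 (trans (sym ha) z))) ⟩
          q' {suc k} + q' {suc k} ≡⟨ cong (q' {suc k} +_) (ℕₚ.+-identityʳ _) ⟨
          2 * length (vecs (suc k)) ∎)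
          where open ℕₚ.≤-Reasoning
        avoided : ∃ λ η → η ∈ vecs (suc k) × ¬ ¬ TangentAt B' ξ η × ¬ (fn h η ≡ 1f)
        avoided = #-avoid₂ (λ η → ¬? (tangentAt? B' ξ η)) (λ η → fn h η ≟ 1f) (vecs (suc k)) count
        finish : (∃ λ η → η ∈ vecs (suc k) × ¬ ¬ TangentAt B' ξ η × ¬ (fn h η ≡ 1f)) → ∃₂ λ ξ' η → TangentAt B ξ' η
        finish (η , _ , nn , nh) = inv d ⊗ ξ , inv d *v η ,
              scaled-missing {B} {ξ} {d} {η} d≢0 (missing-unmap N B (subst (λ v → Missing v B') (sym NR') miss')) ,
              trans (trans (#-cong (onLine? 0v (inv d *v η)) (λ u → onLine? 0v η (ap (to N) u)) B (λ { (x ∷ y ∷ b) _ on → onAxis-line⁻ η x _ b (fwd x y b (onAxis-line _ x y b on)) })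
                (λ { (x ∷ y ∷ b) _ on → onAxis-line⁻ _ x y b (bwd x y b (onAxis-line η x _ b on)) })) (sym (∑-map (ap (to N)) B _))) e'
          where
            miss' = proj₁ (decidable-stable (tangentAt? B' ξ η) nn)
            e' = proj₂ (decidable-stable (tangentAt? B' ξ η) nn)
            hη = fn h η
            -- The preimage of `(ξ , 1 , η)` under `N` is `(ξ , d , η)`. It can be scaled to second
            -- coordinate one since `η` was chosen with `h η` different from one.
            d = 1f ⊕ (-f hη)
            d≢0 : ¬ (d ≡ 0f)
            d≢0 z = nh (sym (trans (sym (R.+-identityʳ 1f)) (trans (cong (1f ⊕_) (sym (R.-‿inverseˡ hη))) (trans (sym (R.+-assoc 1f _ hη)) (trans (cong (_⊕ hη) z) (R.+-identityˡ hη))))))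
            dh : d ⊕ hη ≡ 1f
            dh = trans (R.+-assoc 1f _ hη) (trans (cong (1f ⊕_) (R.-‿inverseˡ hη)) (R.+-identityʳ 1f))
            NR' : ap (to N) (ξ ∷ d ∷ η) ≡ ξ ∷ 1f ∷ η
            NR' = cong (λ y → ξ ∷ y ∷ η) dh
            fwd : ∀ x y b → b ≡ y *v (inv d *v η) → b ≡ (y ⊕ fn h b) *v η
            fwd x y b eb = trans eb (trans (⊗-*v y (inv d) η) (cong (_*v η) (begin
                y ⊗ inv d ≡⟨ R.*-identityˡ _ ⟨
                1f ⊗ (y ⊗ inv d) ≡⟨ cong (_⊗ (y ⊗ inv d)) dh ⟨
                (d ⊕ hη) ⊗ (y ⊗ inv d) ≡⟨ R.distribʳ _ d hη ⟩
                d ⊗ (y ⊗ inv d) ⊕ hη ⊗ (y ⊗ inv d) ≡⟨ cong₂ _⊕_ (trans (cong (d ⊗_) (R.*-comm y (inv d))) (trans (sym (R.*-assoc d (inv d) y)) (trans (cong (_⊗ y) (inv-law d≢0)) (R.*-identityˡ y))))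
                     (trans (R.*-comm hη _) (trans (sym (fn-* h (y ⊗ inv d) η)) (cong (fn h) (trans (sym (⊗-*v y (inv d) η)) (sym eb))))) ⟩
                y ⊕ fn h b ∎)))
              where open ≡-Reasoning
            bwd : ∀ x y b → b ≡ (y ⊕ fn h b) *v η → b ≡ y *v (inv d *v η)
            bwd x y b eb = trans eb (trans (cong (_*v η) s≡) (sym (⊗-*v y (inv d) η)))
              where
                open ≡-Reasoning
                s = y ⊕ fn h b
                sd : s ⊗ d ≡ y
                sd = begin
                  s ⊗ d ≡⟨ R.distribˡ s 1f (-f hη) ⟩
                  s ⊗ 1f ⊕ s ⊗ (-f hη) ≡⟨ cong₂ _⊕_ (R.*-identityʳ s) (trans (sym (-‿distribʳ-* s hη)) (cong -f_ (trans (sym (fn-* h s η)) (cong (fn h) (sym eb))))) ⟩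
                  (y ⊕ fn h b) ⊕ (-f fn h b) ≡⟨ trans (R.+-assoc y _ _) (trans (cong (y ⊕_) (R.-‿inverseʳ _)) (R.+-identityʳ y)) ⟩
                  y ∎
                s≡ : s ≡ y ⊗ inv d
                s≡ = begin
                  s ≡⟨ R.*-identityʳ s ⟨
                  s ⊗ 1f ≡⟨ cong (s ⊗_) (inv-law d≢0) ⟨
                  s ⊗ (d ⊗ inv d) ≡⟨ R.*-assoc s d (inv d) ⟨
                  (s ⊗ d) ⊗ inv d ≡⟨ cong (_⊗ inv d) sd ⟩
                  y ⊗ inv d ∎

    -- A subspace of weight `t < p` has a missing point `(ξ , y , a)`. Scaled to `y = 1` it gives a
    -- tangent through `e₀` to start from; for `y = 0` its line to `e₀` meets the axis, which is
    -- then changed.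
    tangent-at-e₀ : ∀ {B} → Good B → Missing e₁ B → (∃ λ u → u ∈ B × u ∼ e₀) →
                    ∀ (φ : Lin m (suc k)) → ap φ e₀ ≡ 0v → # (λ u → ap φ u ≟v 0v) B ≡ t → ∃ λ η → TangentAt B 0f η
    tangent-at-e₀ {B} g miss₁ (u₀ , k₀ , s₀) φ e0 e = via (missing-in-kernel {0} (suc k) (cong suc (ℕₚ.+-comm 2 k)) φ B (nz g) (subst (_< p) (sym e) t<p'))
      where
        via : (∃ λ R → ap φ R ≡ 0v × ¬ (R ≡ 0v) × Missing R B) → ∃ λ η → TangentAt B 0f η
        via (ξ ∷ y ∷ a , eR , nR , miss) = cases y (y ≟ 0f) eR nR miss
          where
            cases : ∀ y → Dec (y ≡ 0f) → ap φ (ξ ∷ y ∷ a) ≡ 0v → ¬ (ξ ∷ y ∷ a ≡ 0v) → Missing (ξ ∷ y ∷ a) B → ∃ λ η → TangentAt B 0f η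
            cases y (no ny) eR nR miss = move-hyperplane g miss₁ (inv y ⊗ ξ) (inv y *v a) (scaled-missing {B} {ξ} {y} {a} ny miss ,
                kernel-tangent g φ (inv y ⊗ ξ) (inv y *v a) e0 e (scaled-kernel {ξ} {y} {a} φ ny eR))
            cases _ (yes refl) eR nR miss = move-hyperplane g miss₁ (proj₁ moved) (proj₁ (proj₂ moved)) (proj₂ (proj₂ moved))
              where
                -- With `a = 0` the missing point would be `e₀`, which belongs to `B`.
                a≢0 : ¬ (a ≡ 0v)
                a≢0 z = miss u₀ k₀ (∼-trans s₀ (∼-sym nR (ξ , cong₂ _∷_ (sym (R.*-identityʳ ξ)) (cong₂ _∷_ (sym (R.zeroʳ ξ)) (trans z (sym (*v-0 ξ)))))))
                moved : ∃₂ λ ξ' η → TangentAt B ξ' η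
                moved = move-axis g φ e0 e ξ a a≢0 eR miss

    -- `v` lies in a blocked subspace of weight exactly `t`, so it cannot be removed.
    Essential : List (V m) → V m → Set
    Essential B v = ∃ λ (φ : Lin m (suc k)) → ap φ v ≡ 0v × # (λ u → ap φ u ≟v 0v) B ≡ t

    -- A shear that fixes the hyperplane `x = 0` pointwise moves the element to the point `e₀`. The
    -- missing points of that hyperplane, in which the tangents have to meet it, are unaffected.
    tangent-at-affine : ∀ {B} → Good B → Missing e₁ B → ∀ x (w : V (suc (suc k))) → ¬ (x ≡ 0f) → (x ∷ w) ∈ B → Essential B (x ∷ w) →
      ∃ λ η → Missing (0f ∷ 1f ∷ η) B × # (onLine? (bk (inv x ⊗ hd w) (inv x *v ap tailL w) η) η) B ≡ t
    tangent-at-affine {B} g miss₁ x (y ∷ a) nx mem (φ , ev , e) = conclude (tangent-at-e₀ (good-map M g)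
          (subst (λ v → Missing v B') (M-dir (1f ∷ 0v)) (missing-map M B miss₁))
          (ap (to M) (x ∷ y ∷ a) , ∈-map⁺ _ mem , (x , Mv)) ψ ψe₀
          (trans (∑-map (ap (to M)) B _) (trans (#-cong (λ u → ap ψ (ap (to M) u) ≟v 0v) (λ u → ap φ u ≟v 0v) B (λ u _ z → trans (sym (ψ≡ u)) z) (λ u _ z → trans (ψ≡ u) z)) e)))
      where
        s = inv x ⊗ y
        b = inv x *v a
        w₀ : V (suc (suc k))
        w₀ = -v (s ∷ b)
        M : Iso m
        M = shearI w₀
        B' = map (ap (to M)) B
        M-dir : ∀ (v : V (suc (suc k))) → ap (to M) (0f ∷ v) ≡ 0f ∷ v
        M-dir v = cong (0f ∷_) (trans (cong (v +v_) (0-*v w₀)) (+v-0 v))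
        Mv : ap (to M) (x ∷ y ∷ a) ≡ x *v e₀
        Mv = cong₂ _∷_ (sym (R.*-identityʳ x)) (trans (trans (cong ((y ∷ a) +v_) (trans (*v-comm x (-f 1f) (s ∷ b)) (cong -v_ (*v-inv nx (y ∷ a))))) (-v-inverse (y ∷ a))) (sym (*v-0 x)))
        ψ : Lin m (suc k)
        ψ = φ ∘L from M
        ψ≡ : ∀ u → ap ψ (ap (to M) u) ≡ ap φ u
        ψ≡ u = cong (ap φ) (from-to M u)
        ψe₀ : ap ψ e₀ ≡ 0v
        ψe₀ = trans (cong (ap ψ) (unscale nx {x *v e₀} {e₀} refl)) (trans (ap-* ψ (inv x) (x *v e₀)) (trans (cong (inv x *v_) (trans (cong (ap ψ) (sym Mv)) (trans (ψ≡ (x ∷ y ∷ a)) ev))) (*v-0 (inv x))))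
        sheared : ∀ x' y' a' → ap (to M) (x' ∷ y' ∷ a') ≡ x' ∷ (y' ⊕ (-f (x' ⊗ s))) ∷ (a' +v (-f x') *v b)
        sheared x' y' a' = cong (x' ∷_) (cong₂ _∷_ (cong (y' ⊕_) (trans (cong (x' ⊗_) (trans (sym (-‿distribˡ-* 1f s)) (cong -f_ (R.*-identityˡ s)))) (sym (-‿distribʳ-* x' s))))
          (cong (a' +v_) (trans (⊗-*v x' (-f 1f) b) (cong (_*v b) (trans (sym (-‿distribʳ-* x' 1f)) (cong -f_ (R.*-identityʳ x')))))))
        conclude : (∃ λ η → TangentAt B' 0f η) → ∃ λ η → Missing (0f ∷ 1f ∷ η) B × # (onLine? (bk s b η) η) B ≡ t
        conclude (η , miss' , e') = η , missing-unmap M B (subst (λ v → Missing v B') (sym (M-dir (1f ∷ η))) miss') ,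
            trans (trans (#-cong (onLine? (bk s b η) η) (λ u → onLine? 0v η (ap (to M) u)) B (λ { (x' ∷ y' ∷ a') _ on → onAxis-line⁻ η x' _ _ (fwd x' y' a' on) })
              (λ { (x' ∷ y' ∷ a') _ on → bwd x' y' a' (onAxis-line η x' _ _ on) })) (sym (∑-map (ap (to M)) B _))) e'
          where
            tail-split : ∀ x' y' → (y' ⊕ (-f (x' ⊗ s))) *v η ≡ x' *v ((-f s) *v η) +v y' *v η
            tail-split x' y' = trans (⊕-*v y' _ η) (trans (+v-comm _ _) (cong (_+v y' *v η) (trans (cong (_*v η) (-‿distribʳ-* x' s)) (sym (⊗-*v x' (-f s) η)))))
            fwd : ∀ x' y' a' → OnLine (bk s b η) η (x' ∷ y' ∷ a') → ap tailL (ap tailL (ap (to M) (x' ∷ y' ∷ a'))) ≡ hd (ap tailL (ap (to M) (x' ∷ y' ∷ a'))) *v η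
            fwd x' y' a' on = trans (cong (λ v → ap tailL (ap tailL v)) (sheared x' y' a')) (trans (begin
                a' +v (-f x') *v b ≡⟨ cong (_+v (-f x') *v b) on ⟩
                (x' *v (b +v (-f s) *v η) +v y' *v η) +v (-f x') *v b ≡⟨ cong (λ v → (v +v y' *v η) +v (-f x') *v b) (*v-+v x' b _) ⟩
                ((x' *v b +v x' *v ((-f s) *v η)) +v y' *v η) +v (-f x') *v b ≡⟨ cong (_+v (-f x') *v b) (+v-assoc (x' *v b) _ _) ⟩
                (x' *v b +v (x' *v ((-f s) *v η) +v y' *v η)) +v (-f x') *v b ≡⟨ cong (_+v (-f x') *v b) (+v-comm (x' *v b) _) ⟩
                ((x' *v ((-f s) *v η) +v y' *v η) +v x' *v b) +v (-f x') *v b ≡⟨ trans (+v-assoc _ _ _) (trans (cong ((x' *v ((-f s) *v η) +v y' *v η) +v_) (neg-*v x' b)) (+v-0 _)) ⟩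
                x' *v ((-f s) *v η) +v y' *v η ≡⟨ tail-split x' y' ⟨
                (y' ⊕ (-f (x' ⊗ s))) *v η ∎) (cong (λ v → hd (ap tailL v) *v η) (sym (sheared x' y' a'))))
              where open ≡-Reasoning
            bwd : ∀ x' y' a' → ap tailL (ap tailL (ap (to M) (x' ∷ y' ∷ a'))) ≡ hd (ap tailL (ap (to M) (x' ∷ y' ∷ a'))) *v η → OnLine (bk s b η) η (x' ∷ y' ∷ a')
            bwd x' y' a' on = begin
                a' ≡⟨ trans (sym (+v-0 a')) (cong (a' +v_) (trans (sym (neg-*v x' b)) (+v-comm _ _))) ⟩
                a' +v ((-f x') *v b +v x' *v b) ≡⟨ +v-assoc a' _ _ ⟨
                (a' +v (-f x') *v b) +v x' *v b ≡⟨ cong (_+v x' *v b) (trans (cong (λ v → ap tailL (ap tailL v)) (sym (sheared x' y' a'))) (trans on (cong (λ v → hd (ap tailL v) *v η) (sheared x' y' a')))) ⟩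
                (y' ⊕ (-f (x' ⊗ s))) *v η +v x' *v b ≡⟨ cong (_+v x' *v b) (tail-split x' y') ⟩
                (x' *v ((-f s) *v η) +v y' *v η) +v x' *v b ≡⟨ +v-comm _ _ ⟩
                x' *v b +v (x' *v ((-f s) *v η) +v y' *v η) ≡⟨ +v-assoc (x' *v b) _ _ ⟨
                (x' *v b +v x' *v ((-f s) *v η)) +v y' *v η ≡⟨ cong (_+v y' *v η) (*v-+v x' b _) ⟨
                x' *v (b +v (-f s) *v η) +v y' *v η ∎
              where open ≡-Reasoning

    -- The line `e₀ e₁` is the one with both parameters zero. The missing point `e₁` lies on it and
    -- also guarantees, through `affine-large`, that few elements have `x = 0`.
    axis-congruence : ∀ {B} → Good B → (∀ v → v ∈ B → Essential B v) → Missing e₁ B → ∃ λ j → # (onLine? 0v 0v) B ≡ t + j * p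
    axis-congruence {B} g ess miss₁ = Standard.line-congruence (suc k) B (nz g) t (fold g) (thin g) t<q miss₁ tangents 0v 0v miss₁
      where
        from-aff : ∀ u → u ∈ B → ∀ v → v ∈ toAff u → ∃ λ η → Missing (0f ∷ 1f ∷ η) B × # (onLine? (bk (proj₁ v) (proj₂ v) η) η) B ≡ t
        from-aff (x ∷ y ∷ a) mem v j with x ≟ 0f | j
        ... | no nx | here refl = tangent-at-affine g miss₁ x (y ∷ a) nx mem (ess _ mem)
        tangents : ∀ v → v ∈ Standard.aff (suc k) B (nz g) → ∃ λ η → Missing (0f ∷ 1f ∷ η) B × # (onLine? (bk (proj₁ v) (proj₂ v) η) η) B ≡ t
        tangents v j = let (u , mem , j') = find (∈-concatMap⁻ toAff {xs = B} j) in from-aff u mem v j'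

  -- Lines as spans, and sums over the lines of a plane

  OnSpan : ∀ {m} → V m → V m → V m → Set
  OnSpan P R u = ∃₂ λ a b → u ≡ a *v P +v b *v R

  onSpan? : ∀ {m} (P R u : V m) → Dec (OnSpan P R u)
  onSpan? P R u = ∃𝔽? (λ a → ∃𝔽? (λ b → u ≟v (a *v P +v b *v R)))

  span-iso : ∀ {m} (M : Iso m) {P R u : V m} → OnSpan P R u → OnSpan (ap (to M) P) (ap (to M) R) (ap (to M) u)
  span-iso M (a , b , refl) = a , b , trans (ap-+ (to M) _ _) (cong₂ _+v_ (ap-* (to M) a _) (ap-* (to M) b _))

  span-change : ∀ {m} {P R : V m} {a b} → ¬ (b ≡ 0f) → ∀ u → OnSpan P R u → OnSpan P (a *v P +v b *v R) u
  span-change {P = P} {R} {a} {b} nb u (c , d , refl) = c ⊕ (-f (e ⊗ a)) , e , sym (begin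
      (c ⊕ (-f (e ⊗ a))) *v P +v e *v (a *v P +v b *v R) ≡⟨ cong₂ _+v_ (⊕-*v c _ P) (*v-+v e _ _) ⟩
      (c *v P +v (-f (e ⊗ a)) *v P) +v (e *v (a *v P) +v e *v (b *v R)) ≡⟨ cong₂ (λ x y → (c *v P +v (-f (e ⊗ a)) *v P) +v (x +v y)) (⊗-*v e a P) (⊗-*v e b R) ⟩
      (c *v P +v (-f (e ⊗ a)) *v P) +v ((e ⊗ a) *v P +v (e ⊗ b) *v R) ≡⟨ +v-assoc (c *v P) _ _ ⟩
      c *v P +v ((-f (e ⊗ a)) *v P +v ((e ⊗ a) *v P +v (e ⊗ b) *v R)) ≡⟨ cong (c *v P +v_) (sym (+v-assoc _ _ _)) ⟩
      c *v P +v (((-f (e ⊗ a)) *v P +v (e ⊗ a) *v P) +v (e ⊗ b) *v R) ≡⟨ cong (λ x → c *v P +v (x +v (e ⊗ b) *v R)) (trans (+v-comm _ _) (neg-*v (e ⊗ a) P)) ⟩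
      c *v P +v (0v +v (e ⊗ b) *v R) ≡⟨ cong (c *v P +v_) (trans (0-+v _) (cong (_*v R) (trans (R.*-assoc d (inv b) b) (trans (cong (d ⊗_) (inv-lawˡ nb)) (R.*-identityʳ d))))) ⟩
      c *v P +v d *v R ∎)
    where
      open ≡-Reasoning
      e = d ⊗ inv b

  span-change⁻ : ∀ {m} {P R : V m} {a b} u → OnSpan P (a *v P +v b *v R) u → OnSpan P R u
  span-change⁻ {P = P} {R} {a} {b} u (c , d , refl) = c ⊕ d ⊗ a , d ⊗ b , (begin
      c *v P +v d *v (a *v P +v b *v R) ≡⟨ cong (c *v P +v_) (trans (*v-+v d _ _) (cong₂ _+v_ (⊗-*v d a P) (⊗-*v d b R))) ⟩
      c *v P +v ((d ⊗ a) *v P +v (d ⊗ b) *v R) ≡⟨ +v-assoc (c *v P) _ _ ⟨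
      (c *v P +v (d ⊗ a) *v P) +v (d ⊗ b) *v R ≡⟨ cong (_+v (d ⊗ b) *v R) (sym (⊕-*v c (d ⊗ a) P)) ⟩
      (c ⊕ d ⊗ a) *v P +v (d ⊗ b) *v R ∎)
    where open ≡-Reasoning

  span-swap : ∀ {m} {P R : V m} u → OnSpan P R u → OnSpan R P u
  span-swap u (a , b , refl) = b , a , +v-comm _ _

  Independent : ∀ {m} → V m → V m → Set
  Independent P R = ¬ (P ≡ 0v) × (∀ c → ¬ (R ≡ c *v P))

  private
    module _ {k : ℕ} where
      axis-span : ∀ u → OnLine {k} 0v 0v u → OnSpan e₀ e₁ u
      axis-span (x ∷ y ∷ a) e = x , y , cong₂ _∷_ (sym (trans (cong₂ _⊕_ (R.*-identityʳ x) (R.zeroʳ y)) (R.+-identityʳ x)))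
        (cong₂ _∷_ (sym (trans (cong₂ _⊕_ (R.zeroʳ x) (R.*-identityʳ y)) (R.+-identityˡ y))) e)

      axis-span⁻ : ∀ u → OnSpan e₀ e₁ u → OnLine {k} 0v 0v u
      axis-span⁻ u (x , y , refl) = trans (cong₂ _+v_ (*v-0 x) (*v-0 y)) (sym (cong₂ _+v_ (*v-0 (x ⊗ 1f ⊕ y ⊗ 0f)) (*v-0 (x ⊗ 0f ⊕ y ⊗ 1f))))

  module _ {k : ℕ} {P R : V (suc (suc k))} (ind-PR : Independent P R) where

    span-frame : ∀ B → ∃ λ (M : Iso (suc (suc k))) → ap (to M) P ≡ e₀ × ap (to M) R ≡ e₁ ×
                 # (onSpan? P R) B ≡ # (onLine? 0v 0v) (map (ap (to M)) B)
    span-frame B = build (frame₂ P R (proj₁ ind-PR) (proj₂ ind-PR))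
      where
        build : (∃ λ (M : Iso (suc (suc k))) → ap (to M) P ≡ e₀ × ap (to M) R ≡ e₁) → _
        build (M , eP , eR) = M , eP , eR , trans (#-cong (onSpan? P R) (λ u → onLine? 0v 0v (ap (to M) u)) B
            (λ u _ s → axis-span⁻ (ap (to M) u) (subst (λ w → OnSpan w e₁ (ap (to M) u)) eP (subst (λ w → OnSpan (ap (to M) P) w (ap (to M) u)) eR (span-iso M s))))
            (λ u _ l → subst (OnSpan P R) (from-to M u) (subst (λ w → OnSpan w R (ap (from M) (ap (to M) u))) (trans (cong (ap (from M)) (sym eP)) (from-to M P))
               (subst (λ w → OnSpan (ap (from M) e₀) w (ap (from M) (ap (to M) u))) (trans (cong (ap (from M)) (sym eR)) (from-to M R)) (span-iso (flip M) (axis-span _ l))))))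
          (sym (∑-map (ap (to M)) B _))

    span-fold : ∀ {t} B → Fold k t B → t ≤ # (onSpan? P R) B
    span-fold {t} B fold = build (span-frame B)
      where
        build : (∃ λ (M : Iso (suc (suc k))) → ap (to M) P ≡ e₀ × ap (to M) R ≡ e₁ × # (onSpan? P R) B ≡ # (onLine? 0v 0v) (map (ap (to M)) B)) → t ≤ # (onSpan? P R) B
        build (M , _ , _ , e) = ℕₚ.≤-trans (fold-line {t = t} {B = map (ap (to M)) B} (fold-map (to M) B fold) 0v 0v) (ℕₚ.≤-reflexive (sym e))

  module PlaneSum {m : ℕ} (κ : Emb 3 m) (B : List (V m)) (nz : Nonzero B) (miss : Missing (em κ e₀) B) where

    private
      cone : ∀ {z : V 2} {u} → OnSpan (em κ e₀) (em κ (0f ∷ z)) u → ∃₂ λ x w → em κ (x ∷ w) ≡ u × w ∼ z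
      cone {z} (a , b , e) = a ⊗ 1f ⊕ b ⊗ 0f , _ , trans (ap-+ (lin κ) _ _) (trans (cong₂ _+v_ (ap-* (lin κ) a e₀) (ap-* (lin κ) b (0f ∷ z))) (sym e)) ,
        (b , trans (cong (_+v b *v z) (*v-0 a)) (0-+v _))

      cone⁻ : ∀ {z : V 2} {x w} → w ∼ z → OnSpan (em κ e₀) (em κ (0f ∷ z)) (em κ (x ∷ w))
      cone⁻ {z} {x} (b , refl) = x , b , trans (cong (em κ) (trans (split-vec x (b *v z)) (cong (λ y → x *v e₀ +v (y ∷ b *v z)) (sym (R.zeroʳ b))))) (trans (ap-+ (lin κ) _ _) (cong₂ _+v_ (ap-* (lin κ) x e₀) (ap-* (lin κ) b (0f ∷ z))))

    -- Every element of the plane lies on exactly one line through the missing point.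
    plane-sum : ∑ (points 2) (λ z → # (onSpan? (em κ e₀) (em κ (0f ∷ z))) B) ≡ # (im? κ) B
    plane-sum = trans (∑-swap (points 2) B _) (∑-cong B (λ u j → per u j (im? κ u)))
      where
        per : ∀ u → u ∈ B → (d : Dec (∃ λ y → em κ y ≡ u)) → # (λ z → onSpan? (em κ e₀) (em κ (0f ∷ z)) u) (points 2) ≡ ind d
        per u j (no n) = #-none (λ z → onSpan? (em κ e₀) (em κ (0f ∷ z)) u) (points 2) (λ z _ s → let (x , w , e , _) = cone s in n ((x ∷ w) , e))
        per u j (yes ((x ∷ w) , e)) = trans (#-cong (λ z → onSpan? (em κ e₀) (em κ (0f ∷ z)) u) (w ∼?_) (points 2)
            (λ z _ s → let (x' , w' , e' , s') = cone s in subst (_∼ z) (cong (ap tailL) (em-injective κ {x' ∷ w'} {x ∷ w} (trans e' (sym e)))) s')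
            (λ z _ s → subst (OnSpan (em κ e₀) (em κ (0f ∷ z))) e (cone⁻ s)))
          (point-count w (λ w0 → miss u j (x , trans (sym e) (trans (cong (em κ) (trans (cong (x ∷_) w0) (cong₂ _∷_ (sym (R.*-identityʳ x)) (sym (*v-0 x))))) (ap-* (lin κ) x e₀)))))

    cone-independent : ∀ {z} → z ∈ points 2 → Independent (em κ e₀) (em κ (0f ∷ z))
    cone-independent {z} j = (λ e → 1≢0 (cong hd (injective κ e₀ e))) , λ c e → points-≢0 j (trans (cong (ap tailL) (em-injective κ {0f ∷ z} {c *v e₀} (trans e (sym (ap-* (lin κ) c e₀))))) (*v-0 c))

  Θ-2 : Θ 2 ≡ suc p
  Θ-2 = trans (Θ-suc 1) (trans (cong₂ _+_ (ℕₚ.*-identityʳ p) (trans (Θ-suc 0) (ℕₚ.+-identityʳ 1))) (ℕₚ.+-comm p 1))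

  Θ-≥ : ∀ m → p ^ m ≤ Θ (suc m)
  Θ-≥ m = ℕₚ.≤-trans (ℕₚ.m≤m+n (p ^ m) (Θ m)) (ℕₚ.≤-reflexive (sym (Θ-suc m)))

  all-present-count : ∀ {a m} (κ : Emb a m) (B : List (V m)) → Nonzero B → (∀ y → y ∈ points a → ∃ λ u → u ∈ B × u ∼ em κ y) → Θ a ≤ # (im? κ) B
  all-present-count {a} κ B nz h = begin
    Θ a ≡⟨ length-∑ (points a) ⟩
    ∑ (points a) (λ _ → 1) ≤⟨ ∑-mono (points a) (λ y j → let (u , k , s) = h y j in #-member (_∼? em κ y) k s) ⟩
    ∑ (points a) (λ y → # (_∼? em κ y) B) ≡⟨ ∑-swap (points a) B _ ⟩
    ∑ B (λ u → # (λ y → u ∼? em κ y) (points a)) ≤⟨ ∑-mono B (λ u k → one u (nz u k) (im? κ u)) ⟩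
    # (im? κ) B ∎
    where
      open ℕₚ.≤-Reasoning
      one : ∀ u → ¬ (u ≡ 0v) → (d : Dec (∃ λ y → em κ y ≡ u)) → # (λ y → u ∼? em κ y) (points a) ≤ ind d
      one u nu (yes (y₀ , refl)) = ℕₚ.≤-trans (#-mono (λ y → em κ y₀ ∼? em κ y) (y₀ ∼?_) (points a) (λ y _ s → ∼-em κ s))
        (ℕₚ.≤-reflexive (point-count y₀ (λ e → nu (trans (cong (em κ) e) (ap-0 (lin κ))))))
      one u nu (no n) = ℕₚ.≤-reflexive (#-none (λ y → u ∼? em κ y) (points a) (λ { y _ (c , e) → n (c *v y , trans (ap-* (lin κ) c y) (sym e)) }))

  -- If the plane has a missing point, its `p + 1` lines through that point partition its elements.
  -- Otherwise all `p ^ 2 + p + 1` points are present, which is enough since `t < p`.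
  plane-weight : ∀ {k t} (κ : Emb 3 (suc (suc k))) (B : List (V (suc (suc k)))) → Nonzero B → Fold k t B → t < p → t * suc p ≤ # (im? κ) B
  plane-weight {k} {t} κ B nz fold t<p with any? (λ y → missing? (em κ y) B) (points 3)
  ... | no n = begin
      t * suc p ≤⟨ ℕₚ.*-monoˡ-≤ (suc p) (ℕₚ.<⇒≤ t<p) ⟩
      p * suc p ≡⟨ ℕₚ.*-suc p p ⟩
      p + p * p ≤⟨ ℕₚ.+-monoˡ-≤ (p * p) (ℕₚ.≤-trans (ℕₚ.n≤1+n p) (ℕₚ.≤-reflexive (sym Θ-2))) ⟩
      Θ 2 + p * p ≡⟨ trans (ℕₚ.+-comm (Θ 2) (p * p)) (trans (cong (λ n → p * n + Θ 2) (sym (ℕₚ.*-identityʳ p))) (sym (Θ-suc 2))) ⟩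
      Θ 3 ≤⟨ all-present-count κ B nz (λ y j → present y j) ⟩
      # (im? κ) B ∎
      where
        open ℕₚ.≤-Reasoning
        present : ∀ y → y ∈ points 3 → ∃ λ u → u ∈ B × u ∼ em κ y
        present y j with any? (_∼? em κ y) B
        ... | yes a = find a
        ... | no na = ⊥-elim (n (lose j (λ u k s → na (lose k s))))
  ... | yes a with find a
  ...   | y , j , miss with isoVec y (points-≢0 j)
  ...     | M , e = begin
      t * suc p ≡⟨ ℕₚ.*-comm t (suc p) ⟩
      suc p * t ≡⟨ cong (_* t) Θ-2 ⟨
      Θ 2 * t ≡⟨ ∑-const (points 2) t ⟨
      ∑ (points 2) (λ _ → t) ≤⟨ ∑-mono (points 2) (λ z k → span-fold (PS.cone-independent k) B fold) ⟩
      ∑ (points 2) (λ z → # (onSpan? (em κ' e₀) (em κ' (0f ∷ z))) B) ≡⟨ PS.plane-sum ⟩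
      # (im? κ') B ≤⟨ #-mono (im? κ') (im? κ) B (λ { u _ (z , e') → ap (from M) z , e' }) ⟩
      # (im? κ) B ∎
      where
        open ℕₚ.≤-Reasoning
        κ' = κ ∘E isoE (flip M)
        module PS = PlaneSum κ' B nz (subst (λ w → Missing w B) (cong (em κ) (trans (sym (from-to M y)) (cong (ap (from M)) e))) miss)

  -- Kakeya sets in the affine plane

  module Kakeya (b : 𝔽 → 𝔽) where

    On : 𝔽 → V 2 → Set
    On s (x ∷ y ∷ []) = y ≡ s ⊗ x ⊕ b s

    on? : ∀ s v → Dec (On s v)
    on? s (x ∷ y ∷ []) = y ≟ (s ⊗ x ⊕ b s)

    covered? : ∀ ss v → Dec (Any (λ s → On s v) ss)
    covered? ss v = any? (λ s → on? s v) ss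

    private
      pairs : ∀ (h : V 2 → ℕ) → ∑ (vecs 2) h ≡ ∑ elements (λ x → ∑ elements (λ y → h (x ∷ y ∷ [])))
      pairs h = trans (∑-concatMap (λ x → map (x ∷_) (vecs 1)) elements h) (∑-cong elements (λ x _ → trans (∑-map (x ∷_) (vecs 1) h)
        (trans (∑-concatMap (λ y → map (y ∷_) (vecs 0)) elements _) (∑-cong elements (λ y _ → ℕₚ.+-identityʳ _)))))

      on-count : ∀ s → # (on? s) (vecs 2) ≡ p
      on-count s = trans (pairs _) (trans (∑-cong elements (λ x _ → unique-multiplicity _≟_ elements-unique (elements-complete (s ⊗ x ⊕ b s)))) (sym (length-∑ elements)))

      meet : ∀ s s' → ¬ (s ≡ s') → # (λ v → on? s v ×-dec on? s' v) (vecs 2) ≤ 1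
      meet s s' ne = #-at-most-one (λ v → on? s v ×-dec on? s' v) (vecs-unique 2) same
        where
          ⊕-cancel : ∀ {x y z} → x ⊕ y ≡ x ⊕ z → y ≡ z
          ⊕-cancel {x} {y} {z} = ∙-cancelˡ x y z
            where open import Algebra.Properties.Group R.+-group using (∙-cancelˡ)
          same : ∀ u v → On s u × On s' u → On s v × On s' v → u ≡ v
          same (x ∷ y ∷ []) (x' ∷ y' ∷ []) (e₁ , e₂) (e₃ , e₄) = cong₂ (λ a c → a ∷ c ∷ []) x≡ (trans e₁ (trans (cong (λ a → s ⊗ a ⊕ b s) x≡) (sym e₃)))
            where
              open ≡-Reasoning
              d = s ⊕ (-f s')
              d≢0 : ¬ (d ≡ 0f)
              d≢0 z = ne (trans (sym (R.+-identityʳ s)) (trans (cong (s ⊕_) (sym (R.-‿inverseˡ s'))) (trans (sym (R.+-assoc s _ s')) (trans (cong (_⊕ s') z) (R.+-identityˡ s')))))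
              scaled : ∀ a c → c ≡ s ⊗ a ⊕ b s → c ≡ s' ⊗ a ⊕ b s' → d ⊗ a ⊕ b s ≡ b s'
              scaled a c e e' = begin
                d ⊗ a ⊕ b s ≡⟨ cong (_⊕ b s) (trans (R.distribʳ a s (-f s')) (R.+-comm _ _)) ⟩
                ((-f s') ⊗ a ⊕ s ⊗ a) ⊕ b s ≡⟨ R.+-assoc _ _ _ ⟩
                (-f s') ⊗ a ⊕ (s ⊗ a ⊕ b s) ≡⟨ cong ((-f s') ⊗ a ⊕_) (trans (sym e) e') ⟩
                (-f s') ⊗ a ⊕ (s' ⊗ a ⊕ b s') ≡⟨ R.+-assoc _ _ _ ⟨
                ((-f s') ⊗ a ⊕ s' ⊗ a) ⊕ b s' ≡⟨ cong (_⊕ b s') (trans (cong (_⊕ s' ⊗ a) (sym (-‿distribˡ-* s' a))) (R.-‿inverseˡ _)) ⟩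
                0f ⊕ b s' ≡⟨ R.+-identityˡ _ ⟩
                b s' ∎
              dx : d ⊗ x ≡ d ⊗ x'
              dx = ⊕-cancel (trans (R.+-comm (b s) _) (trans (trans (scaled x y e₁ e₂) (sym (scaled x' y' e₃ e₄))) (R.+-comm _ (b s))))
              x≡ : x ≡ x'
              x≡ = trans (sym (trans (sym (R.*-assoc (inv d) d x)) (trans (cong (_⊗ x) (inv-lawˡ d≢0)) (R.*-identityˡ x))))
                (trans (cong (inv d ⊗_) dx) (trans (sym (R.*-assoc (inv d) d x')) (trans (cong (_⊗ x') (inv-lawˡ d≢0)) (R.*-identityˡ x'))))

    -- A new line has `p` points and shares at most one with each line before it. So `n` lines cover
    -- at least `n p - n (n - 1) / 2` points, stated here without subtraction and halves.
    coverage : ∀ {ss} → Unique ss → 2 * length ss * p + length ss ≤ 2 * # (covered? ss) (vecs 2) + length ss * length ss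
    coverage [] = z≤n
    coverage {s ∷ ss} (s≢ ∷ u) = begin
      2 * suc n * p + suc n ≡⟨ solve 2 (λ n p → con 2 :* (con 1 :+ n) :* p :+ (con 1 :+ n) := (con 2 :* n :* p :+ n) :+ (con 2 :* p :+ con 1)) refl n p ⟩
      (2 * n * p + n) + (2 * p + 1) ≤⟨ ℕₚ.+-mono-≤ (coverage u) (ℕₚ.+-monoˡ-≤ 1 (ℕₚ.*-monoʳ-≤ 2 new)) ⟩
      (2 * C + n * n) + (2 * (N + n) + 1) ≡⟨ solve 3 (λ C n N → (con 2 :* C :+ n :* n) :+ (con 2 :* (N :+ n) :+ con 1) := con 2 :* (C :+ N) :+ (con 1 :+ n) :* (con 1 :+ n)) refl C n N ⟩
      2 * (C + N) + suc n * suc n ≤⟨ ℕₚ.+-monoˡ-≤ (suc n * suc n) (ℕₚ.*-monoʳ-≤ 2 grown) ⟩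
      2 * # (covered? (s ∷ ss)) (vecs 2) + suc n * suc n ∎
      where
        open ℕₚ.≤-Reasoning
        open +-*-Solver
        n = length ss
        C = # (covered? ss) (vecs 2)
        N = # (λ v → on? s v ×-dec ¬? (covered? ss v)) (vecs 2)
        grown : C + N ≤ # (covered? (s ∷ ss)) (vecs 2)
        grown = ℕₚ.≤-trans (ℕₚ.≤-reflexive (sym (∑-+ (vecs 2) _ _))) (∑-mono (vecs 2) (λ v _ → cell v (on? s v) (covered? ss v) (covered? (s ∷ ss) v)))
          where
            cell : ∀ v (o : Dec (On s v)) (c : Dec (Any (λ s → On s v) ss)) (d : Dec (Any (λ s → On s v) (s ∷ ss))) → ind c + ind (o ×-dec ¬? c) ≤ ind d
            cell v (no _) (no _) d = z≤n
            cell v (yes o) (no _) d = ℕₚ.≤-reflexive (sym (ind-yes d (here o)))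
            cell v (no _) (yes c) d = ℕₚ.≤-reflexive (sym (ind-yes d (there c)))
            cell v (yes _) (yes c) d = ℕₚ.≤-reflexive (sym (ind-yes d (there c)))
        new : p ≤ N + n
        new = begin
          p ≡⟨ on-count s ⟨
          # (on? s) (vecs 2) ≤⟨ ∑-mono (vecs 2) (λ v _ → cell v (on? s v) (covered? ss v)) ⟩
          ∑ (vecs 2) (λ v → ind (on? s v ×-dec ¬? (covered? ss v)) + ∑ ss (λ s' → ind (on? s v ×-dec on? s' v))) ≡⟨ ∑-+ (vecs 2) _ _ ⟩
          N + ∑ (vecs 2) (λ v → ∑ ss (λ s' → ind (on? s v ×-dec on? s' v))) ≡⟨ cong (N +_) (∑-swap (vecs 2) ss _) ⟩
          N + ∑ ss (λ s' → # (λ v → on? s v ×-dec on? s' v) (vecs 2)) ≤⟨ ℕₚ.+-monoʳ-≤ N (∑-mono ss (λ s' j → meet s s' (All.lookup s≢ j))) ⟩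
          N + ∑ ss (λ _ → 1) ≡⟨ cong (N +_) (length-∑ ss) ⟨
          N + n ∎
          where
            cell : ∀ v (o : Dec (On s v)) (c : Dec (Any (λ s → On s v) ss)) → ind o ≤ ind (o ×-dec ¬? c) + ∑ ss (λ s' → ind (o ×-dec on? s' v))
            cell v (no _) c = z≤n
            cell v (yes _) (no _) = s≤s z≤n
            cell v (yes o) (yes c) = let (s' , j , o') = find c in ℕₚ.≤-trans (ℕₚ.≤-reflexive (sym (ind-yes (yes o ×-dec on? s' v) (o , o')))) (∑-≤-member ss (λ s' → ind (yes o ×-dec on? s' v)) j)

    half-plane : p * suc p ≤ 2 * # (covered? elements) (vecs 2)
    half-plane = ℕₚ.+-cancelʳ-≤ (p * p) _ _ (ℕₚ.≤-trans (ℕₚ.≤-reflexive (solve 1 (λ p → p :* (con 1 :+ p) :+ p :* p := con 2 :* p :* p :+ p) refl p)) (coverage elements-unique))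
      where open +-*-Solver

  -- The congruence for all lines

  Congruent : ℕ → ℕ → Set
  Congruent t w = ∃ λ j → w ≡ t + j * p

  congruent? : ∀ {t w} → t ≤ w → Dec (Congruent t w)
  congruent? {t} {w} l = map′ (λ { (divides j e) → j , trans (sym (ℕₚ.m+[n∸m]≡n l)) (cong (t +_) e) })
    (λ { (j , e) → divides j (trans (cong (_∸ t) e) (ℕₚ.m+n∸m≡n t (j * p))) }) (p ∣? (w ∸ t))

  congruent-sum : ∀ {A : Set} t (xs : List A) f → (∀ x → x ∈ xs → Congruent t (f x)) → ∃ λ j → ∑ xs f ≡ length xs * t + j * p
  congruent-sum t [] f h = 0 , refl
  congruent-sum t (x ∷ xs) f h with h x (here refl) | congruent-sum t xs f (λ y j → h y (there j))
  ... | i , e | j , e' = i + j , trans (cong₂ _+_ e e') (solve 5 (λ t i p l j → (t :+ i :* p) :+ (l :* t :+ j :* p) := (con 1 :+ l) :* t :+ (i :+ j) :* p) refl t i p (length xs) j)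
    where open +-*-Solver

  module LineCongruence (k : ℕ) (t : ℕ) (t<p : suc (2 * t) ≤ p) where

    open Tangents k t t<p public

    m : ℕ
    m = suc (suc (suc k))

    AllEssential : List (V m) → Set
    AllEssential B = ∀ v → v ∈ B → Essential B v

    essential-map : ∀ M {B} → AllEssential B → AllEssential (map (ap (to M)) B)
    essential-map M {B} ess v j with ∈-map⁻ (ap (to M)) j
    ... | u , k , refl with ess u k
    ...   | φ , e , c = φ ∘L from M , trans (cong (ap φ) (from-to M u)) e ,
            trans (∑-map (ap (to M)) B _) (trans (#-cong (λ u → ap φ (ap (from M) (ap (to M) u)) ≟v 0v) (λ u → ap φ u ≟v 0v) B
              (λ u _ z → trans (sym (cong (ap φ) (from-to M u))) z) (λ u _ z → trans (cong (ap φ) (from-to M u)) z)) c)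

    span-congruent : ∀ {B P R} → Good B → AllEssential B → Independent P R → Missing R B → Congruent t (# (onSpan? P R) B)
    span-congruent {B} {P} {R} g ess ind-PR miss = build (span-frame ind-PR B)
      where
        build : (∃ λ (M : Iso m) → ap (to M) P ≡ e₀ × ap (to M) R ≡ e₁ × # (onSpan? P R) B ≡ # (onLine? 0v 0v) (map (ap (to M)) B)) → Congruent t (# (onSpan? P R) B)
        build (M , _ , eR , e) = subst (Congruent t) (sym e) (axis-congruence (good-map M g) (essential-map M ess)
          (subst (λ v → Missing v (map (ap (to M)) B)) eR (missing-map M B miss)))

    module Plane {B : List (V m)} (g : Good B) (ess : AllEssential B) (c : V (suc k)) (c≢0 : ¬ (c ≡ 0v)) where

      plane : Emb 3 m
      plane .lin = consL headF (consL (headF ∘F tailL) (outer (headF ∘F (tailL ∘L tailL)) c))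
      plane .injective (x ∷ y ∷ l ∷ []) e = cong₂ _∷_ (cong hd e) (cong₂ _∷_ (cong (λ v → hd (ap tailL v)) e) (cong (_∷ [])
        (decidable-stable (l ≟ 0f) (λ nl → *v-≢0 nl c≢0 (cong (λ v → ap tailL (ap tailL v)) e)))))

      -- The points of the plane off the line `e₀ e₁` form an affine plane with coordinates
      -- `(x , y)`.
      Has : V 2 → Set
      Has (x ∷ y ∷ []) = Any (_∼ (x ∷ y ∷ c)) B

      has? : ∀ v → Dec (Has v)
      has? (x ∷ y ∷ []) = any? (_∼? (x ∷ y ∷ c)) B

      Beyond : V m → Set
      Beyond (x ∷ y ∷ a) = ¬ (a ≡ 0v) × a ∼ c

      beyond? : ∀ u → Dec (Beyond u)
      beyond? (x ∷ y ∷ a) = ¬? (a ≟v 0v) ×-dec (a ∼? c)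

      private
        v₃ : V 2 → V m
        v₃ (x ∷ y ∷ []) = x ∷ y ∷ c

        same-scale : ∀ {d d'} → d *v c ≡ d' *v c → d ≡ d'
        same-scale = *v-cancelʳ c≢0

        unscale-≡ : ∀ {d a b} → ¬ (d ≡ 0f) → d ⊗ a ≡ d ⊗ b → a ≡ b
        unscale-≡ {d} {a} {b} nd e = trans (sym (trans (sym (R.*-assoc (inv d) d a)) (trans (cong (_⊗ a) (inv-lawˡ nd)) (R.*-identityˡ a))))
          (trans (cong (inv d ⊗_) e) (trans (sym (R.*-assoc (inv d) d b)) (trans (cong (_⊗ b) (inv-lawˡ nd)) (R.*-identityˡ b))))

        one-has : ∀ u → ¬ (u ≡ 0v) → # (λ v → u ∼? v₃ v) (vecs 2) ≤ ind (beyond? u)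
        one-has (x ∷ y ∷ a) nu with beyond? (x ∷ y ∷ a)
        ... | no nb = ℕₚ.≤-reflexive (#-none (λ v → (x ∷ y ∷ a) ∼? v₃ v) (vecs 2) (λ { (x' ∷ y' ∷ []) _ (d , e) →
                nb ((λ a0 → *v-≢0 (proj₁ (*v-nonzero (λ z → nu (trans e z)))) c≢0 (trans (sym (cong (λ v → ap tailL (ap tailL v)) e)) a0)) , (d , cong (λ v → ap tailL (ap tailL v)) e)) }))
        ... | yes (na , _) = #-at-most-one (λ v → (x ∷ y ∷ a) ∼? v₃ v) (vecs-unique 2) same
          where
            same : ∀ v w → (x ∷ y ∷ a) ∼ v₃ v → (x ∷ y ∷ a) ∼ v₃ w → v ≡ w
            same (x₁ ∷ y₁ ∷ []) (x₂ ∷ y₂ ∷ []) (d , e) (d' , e') = cong₂ (λ a b → a ∷ b ∷ [])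
                (unscale-≡ nd (trans (sym (cong hd e)) (trans (cong hd e') (cong (_⊗ x₂) (sym d≡)))))
                (unscale-≡ nd (trans (sym (cong (λ v → hd (ap tailL v)) e)) (trans (cong (λ v → hd (ap tailL v)) e') (cong (_⊗ y₂) (sym d≡)))))
              where
                d≡ : d ≡ d'
                d≡ = same-scale (trans (sym (cong (λ v → ap tailL (ap tailL v)) e)) (cong (λ v → ap tailL (ap tailL v)) e'))
                nd : ¬ (d ≡ 0f)
                nd z = na (trans (cong (λ v → ap tailL (ap tailL v)) e) (trans (cong (_*v c) z) (0-*v c)))

      has-count : # has? (vecs 2) ≤ # beyond? B
      has-count = begin
        # has? (vecs 2) ≤⟨ ∑-mono (vecs 2) (λ v _ → cell v) ⟩
        ∑ (vecs 2) (λ v → # (_∼? v₃ v) B) ≡⟨ ∑-swap (vecs 2) B _ ⟩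
        ∑ B (λ u → # (λ v → u ∼? v₃ v) (vecs 2)) ≤⟨ ∑-mono B (λ u j → one-has u (nz g u j)) ⟩
        # beyond? B ∎
        where
          open ℕₚ.≤-Reasoning
          cell : ∀ v → ind (has? v) ≤ # (_∼? v₃ v) B
          cell (x ∷ y ∷ []) with any? (_∼? (x ∷ y ∷ c)) B
          ... | no _ = z≤n
          ... | yes h = let (u , j , s) = find h in #-member (_∼? (x ∷ y ∷ c)) j s

      private
        axis = # (onLine? 0v 0v) B

      plane-split : # (im? plane) B ≡ axis + # beyond? B
      plane-split = trans (∑-cong B (λ u _ → cell u (im? plane u) (onLine? 0v 0v u) (beyond? u))) (∑-+ B _ _)
        where
          cell : ∀ u (d : Dec (∃ λ z → em plane z ≡ u)) (o : Dec (OnLine 0v 0v u)) (b : Dec (Beyond u)) → ind d ≡ ind o + ind b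
          cell (x ∷ y ∷ a) d (yes o) (yes (na , _)) = ⊥-elim (na (trans o (trans (cong₂ _+v_ (*v-0 x) (*v-0 y)) (+v-0 0v))))
          cell (x ∷ y ∷ a) d (yes o) (no _) = ind-yes d ((x ∷ y ∷ 0f ∷ []) , cong (λ w → x ∷ y ∷ w) (trans (0-*v c) (sym (trans o (trans (cong₂ _+v_ (*v-0 x) (*v-0 y)) (+v-0 0v))))))
          cell (x ∷ y ∷ a) d (no _) (yes (na , l , e)) = ind-yes d ((x ∷ y ∷ l ∷ []) , cong (λ w → x ∷ y ∷ w) (sym e))
          cell (x ∷ y ∷ a) d (no no') (no nb) = ind-no d (λ { ((x' ∷ y' ∷ l ∷ []) , e) → nb ((λ z → no' (trans z (sym (trans (cong₂ _+v_ (*v-0 x) (*v-0 y)) (+v-0 0v))))) , (l , sym (cong (λ v → ap tailL (ap tailL v)) e))) })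

      -- The points of the line `e₀ e₁` other than `e₁`, as directions of the affine plane;
      -- `intercept b` selects a line of the given direction.
      slope : 𝔽 → V m
      slope s = 1f ∷ s ∷ 0v

      intercept : 𝔽 → V m
      intercept b = 0f ∷ b ∷ c

      slope-independent : ∀ s b → Independent (slope s) (intercept b)
      slope-independent s b = (λ e → 1≢0 (cong hd e)) , λ d e → c≢0 (trans (cong (λ v → ap tailL (ap tailL v)) e) (*v-0 d))

      private
        on-slope : ∀ {s b x y a} → OnSpan (slope s) (intercept b) (x ∷ y ∷ a) → ∃ λ l → a ≡ l *v c × y ≡ x ⊗ s ⊕ l ⊗ b
        on-slope {s} {b} {x} (d , l , e) = l , trans (cong (λ v → ap tailL (ap tailL v)) e) (trans (cong (_+v l *v c) (*v-0 d)) (0-+v _)) ,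
          trans (cong (λ v → hd (ap tailL v)) e) (cong (λ z → z ⊗ s ⊕ l ⊗ b) (sym (trans (cong hd e) (trans (cong₂ _⊕_ (R.*-identityʳ d) (R.zeroʳ l)) (R.+-identityʳ d)))))

        on-slope⁻ : ∀ {s b x y a} l → a ≡ l *v c → y ≡ x ⊗ s ⊕ l ⊗ b → OnSpan (slope s) (intercept b) (x ∷ y ∷ a)
        on-slope⁻ {s} {b} {x} l ea ey = x , l , cong₂ _∷_ (sym (trans (cong₂ _⊕_ (R.*-identityʳ x) (R.zeroʳ l)) (R.+-identityʳ x))) (cong₂ _∷_ ey (trans ea (sym (trans (cong (_+v l *v c) (*v-0 x)) (0-+v _)))))

        per : ∀ s u → # (λ b → onSpan? (slope s) (intercept b) u) elements ≡ ind (beyond? u) + p * ind (u ∼? slope s)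
        per s (x ∷ y ∷ a) with a ≟v 0v | a ∼? c
        ... | yes a0 | _ = trans (∑-cong elements (λ b _ → ind-cong (onSpan? (slope s) (intercept b) (x ∷ y ∷ a)) ((x ∷ y ∷ a) ∼? slope s) (fwd b) (bwd b))) (∑-const elements _)
          where
            fwd : ∀ b → OnSpan (slope s) (intercept b) (x ∷ y ∷ a) → (x ∷ y ∷ a) ∼ slope s
            fwd b o with on-slope o
            ... | l , ea , ey = x , cong₂ _∷_ (sym (R.*-identityʳ x)) (cong₂ _∷_ (trans ey (trans (cong (λ z → x ⊗ s ⊕ z ⊗ b) (decidable-stable (l ≟ 0f) (λ nl → *v-≢0 nl c≢0 (trans (sym ea) a0)))) (trans (cong (x ⊗ s ⊕_) (R.zeroˡ b)) (R.+-identityʳ _)))) (trans a0 (sym (*v-0 x))))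
            bwd : ∀ b → (x ∷ y ∷ a) ∼ slope s → OnSpan (slope s) (intercept b) (x ∷ y ∷ a)
            bwd b (d , e) = d , 0f , trans e (sym (trans (cong (d *v slope s +v_) (0-*v (intercept b))) (+v-0 _)))
        ... | no na | no ns = trans (#-none (λ b → onSpan? (slope s) (intercept b) (x ∷ y ∷ a)) elements (λ b _ o → let (l , ea , _) = on-slope o in ns (l , ea)))
                (sym (trans (cong (p *_) (ind-no ((x ∷ y ∷ a) ∼? slope s) (λ { (d , e) → na (trans (cong (λ v → ap tailL (ap tailL v)) e) (*v-0 d)) }))) (ℕₚ.*-zeroʳ p)))
        ... | no na | yes (l , ea) = trans (trans (∑-cong elements (λ b _ → ind-cong (onSpan? (slope s) (intercept b) (x ∷ y ∷ a)) (b ≟ b₀) (fwd b) (bwd b))) (unique-multiplicity _≟_ elements-unique (elements-complete b₀)))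
                (sym (cong suc (trans (cong (p *_) (ind-no ((x ∷ y ∷ a) ∼? slope s) (λ { (d , e) → na (trans (cong (λ v → ap tailL (ap tailL v)) e) (*v-0 d)) }))) (ℕₚ.*-zeroʳ p))))
          where
            nl : ¬ (l ≡ 0f)
            nl z = na (trans ea (trans (cong (_*v c) z) (0-*v c)))
            b₀ = inv l ⊗ (y ⊕ (-f (x ⊗ s)))
            lb₀ : x ⊗ s ⊕ l ⊗ b₀ ≡ y
            lb₀ = trans (cong (x ⊗ s ⊕_) (trans (sym (R.*-assoc l (inv l) _)) (trans (cong (_⊗ (y ⊕ (-f (x ⊗ s)))) (inv-law nl)) (R.*-identityˡ _))))
              (trans (R.+-comm _ _) (trans (R.+-assoc y _ _) (trans (cong (y ⊕_) (R.-‿inverseˡ _)) (R.+-identityʳ y))))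
            fwd : ∀ b → OnSpan (slope s) (intercept b) (x ∷ y ∷ a) → b ≡ b₀
            fwd b o with on-slope o
            ... | l' , ea' , ey = unscale-≡ nl (∙-cancelˡ (x ⊗ s) _ _ (trans (cong (λ z → x ⊗ s ⊕ z ⊗ b) (same-scale (trans (sym ea) ea'))) (trans (sym ey) (sym lb₀))))
              where open import Algebra.Properties.Group R.+-group using (∙-cancelˡ)
            bwd : ∀ b → b ≡ b₀ → OnSpan (slope s) (intercept b) (x ∷ y ∷ a)
            bwd b refl = on-slope⁻ l ea (sym lb₀)

      -- The `p` parallel lines partition the affine part, and each of them also contains the point
      -- `slope s`.
      slope-sum : ∀ s → ∑ elements (λ b → # (onSpan? (slope s) (intercept b)) B) ≡ # beyond? B + p * # (_∼? slope s) B
      slope-sum s = trans (∑-swap elements B _) (trans (∑-cong B (λ u _ → per s u)) (trans (∑-+ B _ _) (cong (# beyond? B +_) (∑-*ˡ B p _))))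

      -- Summing over the lines of the plane through a missing point.
      plane-congruent : ∀ {v} → ¬ Has v → ∃ λ j → axis + # beyond? B ≡ suc p * t + j * p
      plane-congruent {x ∷ y ∷ []} nh = build (isoVec (x ∷ y ∷ 1f ∷ []) (λ e → 1≢0 (cong (λ v → hd (ap tailL (ap tailL v))) e)))
        where
          build : (∃ λ (M : Iso 3) → ap (to M) (x ∷ y ∷ 1f ∷ []) ≡ e₀) → ∃ λ j → axis + # beyond? B ≡ suc p * t + j * p
          build (M , e) = proj₁ total , trans (trans (sym plane-split) (#-cong (im? plane) (im? κ) B (λ { u _ (z , ez) → ap (to M) z , trans (cong (em plane) (from-to M z)) ez }) (λ { u _ (z , ez) → ap (from M) z , ez })))
              (trans (sym PS.plane-sum) (trans (proj₂ total) (cong (λ n → n * t + proj₁ total * p) Θ-2)))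
            where
              κ = plane ∘E isoE (flip M)
              κe₀ : em κ e₀ ≡ x ∷ y ∷ c
              κe₀ = trans (cong (em plane) (trans (cong (ap (from M)) (sym e)) (from-to M _))) (cong (λ w → x ∷ y ∷ w) (1-*v c))
              miss : Missing (em κ e₀) B
              miss u j s = nh (lose j (subst (u ∼_) κe₀ s))
              module PS = PlaneSum κ B (nz g) miss
              total = congruent-sum t (points 2) (λ z → # (onSpan? (em κ e₀) (em κ (0f ∷ z))) B) (λ z j →
                subst (Congruent t) (#-cong (onSpan? (em κ (0f ∷ z)) (em κ e₀)) (onSpan? (em κ e₀) (em κ (0f ∷ z))) B (λ u _ → span-swap u) (λ u _ → span-swap u))
                  (span-congruent g ess (flip-independent (PS.cone-independent j)) miss))
                where
                  flip-independent : ∀ {P R : V m} → Independent P R → Independent R P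
                  flip-independent (nP , nR) = (λ e → nR 0f (trans e (sym (0-*v _)))) , λ c e → nR (inv c) (unscale (λ z → nP (trans e (trans (cong (_*v _) z) (0-*v _)))) e)

      -- Suppose that some affine point is missing. The lines through it determine the weight of the
      -- plane modulo `p`, so if the line `e₀ e₁` has the wrong residue, the `p` other lines through
      -- any `slope s` cannot all have the right one. A line with the wrong residue has no missing
      -- point, so there is a full line in each direction: a Kakeya set. If no affine point is
      -- missing, there are `p ^ 2` of them.
      half-plane-beyond : ¬ Congruent t axis → p * suc p ≤ 2 * # beyond? B
      half-plane-beyond nc with any? (λ v → ¬? (has? v)) (vecs 2)
      ... | no all = begin
          p * suc p ≤⟨ ℕₚ.*-monoʳ-≤ p (ℕₚ.≤-trans (s≤s (ℕₚ.m≤m+n p 0)) (ℕₚ.+-monoˡ-≤ (p + 0) 0<p)) ⟩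
          p * (2 * p) ≡⟨ solve 1 (λ p → p :* (con 2 :* p) := con 2 :* (p :* (p :* con 1))) refl p ⟩
          2 * p ^ 2 ≡⟨ cong (2 *_) (vecs-length 2) ⟨
          2 * length (vecs 2) ≡⟨ cong (2 *_) (#-all has? (vecs 2) (λ v j → decidable-stable (has? v) (λ n → all (lose j n)))) ⟨
          2 * # has? (vecs 2) ≤⟨ ℕₚ.*-monoʳ-≤ 2 has-count ⟩
          2 * # beyond? B ∎
        where
          open ℕₚ.≤-Reasoning
          open +-*-Solver
      ... | yes some = begin
          p * suc p ≤⟨ Slopes.half-plane ⟩
          2 * # (Slopes.covered? elements) (vecs 2) ≤⟨ ℕₚ.*-monoʳ-≤ 2 (#-mono (Slopes.covered? elements) has? (vecs 2) (λ { (x ∷ y ∷ []) _ cov → let (s , _ , on) = find cov in subst (λ y → Has (x ∷ y ∷ [])) (sym (trans on (cong (_⊕ b s) (R.*-comm s x)))) (full s x) })) ⟩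
          2 * # has? (vecs 2) ≤⟨ ℕₚ.*-monoʳ-≤ 2 has-count ⟩
          2 * # beyond? B ∎
        where
          open ℕₚ.≤-Reasoning
          fold-span : ∀ s b → t ≤ # (onSpan? (slope s) (intercept b)) B
          fold-span s b = span-fold (slope-independent s b) B (fold g)
          incongruent : ∀ s → ∃ λ b → ¬ Congruent t (# (onSpan? (slope s) (intercept b)) B)
          incongruent s with any? (λ b → ¬? (congruent? (fold-span s b))) elements
          ... | yes a = let (b , _ , n) = find a in b , n
          ... | no na = ⊥-elim (nc (conclude (plane-congruent (proj₂ (proj₂ (find some))))
                  (congruent-sum t elements (λ b → # (onSpan? (slope s) (intercept b)) B) (λ b j → decidable-stable (congruent? (fold-span s b)) (λ n → na (lose j n))))))
            where
              conclude : (∃ λ j → axis + # beyond? B ≡ suc p * t + j * p) → (∃ λ j → ∑ elements (λ b → # (onSpan? (slope s) (intercept b)) B) ≡ p * t + j * p) → Congruent t axis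
              -- Both sums contain the affine part. Eliminating it leaves
              -- `axis + i p = t + (j + E) p`, where `E` counts the elements at the point `slope s`.
              conclude (j , e) (i , e') = (j + E) ∸ i , ℕₚ.+-cancelʳ-≡ (i * p) _ _ (begin-equality
                  axis + i * p ≡⟨ sums ⟩
                  t + (j + E) * p ≡⟨ cong (λ n → t + n * p) (sym (ℕₚ.m∸n+n≡m i≤)) ⟩
                  t + ((j + E) ∸ i + i) * p ≡⟨ solve 4 (λ t a i p → t :+ (a :+ i) :* p := (t :+ a :* p) :+ i :* p) refl t ((j + E) ∸ i) i p ⟩
                  (t + ((j + E) ∸ i) * p) + i * p ∎)
                where
                  open +-*-Solver
                  E = # (_∼? slope s) B
                  W = # beyond? B
                  sums : axis + i * p ≡ t + (j + E) * p
                  sums = ℕₚ.+-cancelʳ-≡ (W + p * t) _ _ (begin-equality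
                    (axis + i * p) + (W + p * t) ≡⟨ solve 4 (λ a ip w pt → (a :+ ip) :+ (w :+ pt) := (a :+ w) :+ (pt :+ ip)) refl axis (i * p) W (p * t) ⟩
                    (axis + W) + (p * t + i * p) ≡⟨ cong₂ _+_ e (trans (sym e') (slope-sum s)) ⟩
                    (suc p * t + j * p) + (W + p * E) ≡⟨ solve 5 (λ p t j W E → ((con 1 :+ p) :* t :+ j :* p) :+ (W :+ p :* E) := (t :+ (j :+ E) :* p) :+ (W :+ p :* t)) refl p t j W E ⟩
                    (t + (j + E) * p) + (W + p * t) ∎)
                  i≤ : i ≤ j + E
                  i≤ = ℕₚ.*-cancelʳ-≤ i (j + E) p {{ℕ.>-nonZero 0<p}} (ℕₚ.+-cancelˡ-≤ t _ _ (ℕₚ.≤-trans (ℕₚ.+-monoˡ-≤ (i * p) (fold-line {t = t} {B = B} (fold g) 0v 0v)) (ℕₚ.≤-reflexive sums)))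
          b : 𝔽 → 𝔽
          b s = proj₁ (incongruent s)
          module Slopes = Kakeya b
          full : ∀ s x → Has (x ∷ (x ⊗ s ⊕ b s) ∷ [])
          full s x = decidable-stable (has? (x ∷ (x ⊗ s ⊕ b s) ∷ [])) (λ n → proj₂ (incongruent s) (subst (Congruent t)
              (#-cong (onSpan? (slope s) Q) (onSpan? (slope s) (intercept (b s))) B (λ u _ → span-change⁻ u) (λ u _ → span-change 1≢0 u))
              (span-congruent g ess indep (λ u j sc → n (lose j (subst (u ∼_) Q≡ sc))))))
            where
              Q : V m
              Q = x *v slope s +v 1f *v intercept (b s)
              Q≡ : Q ≡ x ∷ (x ⊗ s ⊕ b s) ∷ c
              Q≡ = cong₂ _∷_ (trans (cong₂ _⊕_ (R.*-identityʳ x) (R.zeroʳ 1f)) (R.+-identityʳ x)) (cong₂ _∷_ (cong (x ⊗ s ⊕_) (R.*-identityˡ (b s))) (trans (cong₂ _+v_ (*v-0 x) (1-*v c)) (0-+v c)))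
              indep : Independent (slope s) Q
              indep = (λ e → 1≢0 (cong hd e)) , λ d e → c≢0 (trans (sym (trans (cong₂ _+v_ (*v-0 x) (1-*v c)) (0-+v c))) (trans (cong (λ v → ap tailL (ap tailL v)) e) (*v-0 d)))

    -- Otherwise each of the `Θ (suc k)` planes through the line has at least `p (p + 1) / 2`
    -- elements off it. These sets are disjoint, so `B` would have at least `p ^ (k + 2) / 2`
    -- elements, whereas `2 t + 1 ≤ p` keeps its size below that.
    axis-always-congruent : ∀ {B} → Good B → AllEssential B → Congruent t (# (onLine? 0v 0v) B)
    axis-always-congruent {B} g ess = decidable-stable (congruent? (fold-line {t = t} {B = B} (fold g) 0v 0v)) (λ nc → ℕₚ.<-irrefl refl (begin-strict
        p * p ^ suc k ≡⟨ solve 2 (λ p q → p :* (p :* q) := q :* (p :* p)) refl p (p ^ k) ⟩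
        p ^ k * (p * p) ≤⟨ ℕₚ.*-mono-≤ (Θ-≥ k) (ℕₚ.*-monoʳ-≤ p (ℕₚ.n≤1+n p)) ⟩
        Θ (suc k) * (p * suc p) ≡⟨ ∑-const (points (suc k)) (p * suc p) ⟨
        ∑ (points (suc k)) (λ _ → p * suc p) ≤⟨ ∑-mono (points (suc k)) (λ c j → ℕₚ.≤-trans (Plane.half-plane-beyond g ess c (points-≢0 j) nc) (ℕₚ.*-monoʳ-≤ 2 (#-mono (Plane.beyond? g ess c (points-≢0 j)) (λ u → ¬? (tl u ≟v 0v) ×-dec (tl u ∼? c)) B (λ { (x ∷ y ∷ a) _ h → h })))) ⟩
        ∑ (points (suc k)) (λ c → 2 * # (λ u → ¬? (tl u ≟v 0v) ×-dec (tl u ∼? c)) B) ≡⟨ ∑-*ˡ (points (suc k)) 2 _ ⟩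
        2 * ∑ (points (suc k)) (λ c → # (λ u → ¬? (tl u ≟v 0v) ×-dec (tl u ∼? c)) B) ≡⟨ cong (2 *_) (∑-swap (points (suc k)) B _) ⟩
        2 * ∑ B (λ u → ∑ (points (suc k)) (λ c → ind (¬? (tl u ≟v 0v) ×-dec (tl u ∼? c)))) ≤⟨ ℕₚ.*-monoʳ-≤ 2 (∑-mono B (λ u _ → one u)) ⟩
        2 * ∑ B (λ _ → 1) ≡⟨ cong (2 *_) (length-∑ B) ⟨
        2 * length B <⟨ thin g ⟩
        suc (2 * t) * p ^ suc k ≤⟨ ℕₚ.*-monoˡ-≤ (p ^ suc k) t<p ⟩
        p * p ^ suc k ∎))
      where
        open ℕₚ.≤-Reasoning
        open +-*-Solver
        tl : V m → V (suc k)
        tl (x ∷ y ∷ a) = a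
        one : ∀ u → ∑ (points (suc k)) (λ c → ind (¬? (tl u ≟v 0v) ×-dec (tl u ∼? c))) ≤ 1
        one u with tl u ≟v 0v
        ... | yes _ = ℕₚ.≤-trans (ℕₚ.≤-reflexive (∑-zero (points (suc k)) (λ _ _ → refl))) z≤n
        ... | no n = ℕₚ.≤-trans (∑-mono (points (suc k)) (λ c _ → ind-mono (yes n ×-dec (tl u ∼? c)) (tl u ∼? c) proj₂)) (ℕₚ.≤-reflexive (point-count (tl u) n))

    every-line-congruent : ∀ {B P R} → Good B → AllEssential B → Independent P R → Congruent t (# (onSpan? P R) B)
    every-line-congruent {B} {P} {R} g ess ind-PR = build (span-frame ind-PR B)
      where
        build : (∃ λ (M : Iso m) → ap (to M) P ≡ e₀ × ap (to M) R ≡ e₁ × # (onSpan? P R) B ≡ # (onLine? 0v 0v) (map (ap (to M)) B)) → Congruent t (# (onSpan? P R) B)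
        build (M , _ , _ , e) = subst (Congruent t) (sym e) (axis-always-congruent (good-map M g) (essential-map M ess))

  -- Functionals as vectors, and sums of hyperplanes

  toDot : ∀ {m} → Fun m → V m
  toDot {zero} f = []
  toDot {suc m} f = fn f e₀ ∷ toDot (f ∘F lin consE)

  toDot-spec : ∀ {m} (f : Fun m) u → fn (dotF (toDot f)) u ≡ fn f u
  toDot-spec {zero} f [] = sym (fn-0 f)
  toDot-spec {suc m} f (x ∷ u) = sym (trans (cong (fn f) (split-vec x u)) (trans (fn-+ f _ _)
    (cong₂ _⊕_ (trans (fn-* f x e₀) (R.*-comm x _)) (sym (toDot-spec (f ∘F lin consE) u)))))

  dotF-* : ∀ {m} c (h : V m) u → fn (dotF (c *v h)) u ≡ c ⊗ fn (dotF h) u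
  dotF-* c [] [] = sym (R.zeroʳ c)
  dotF-* c (x ∷ h) (y ∷ u) = trans (cong₂ _⊕_ (R.*-assoc c x y) (dotF-* c h u)) (sym (R.distribˡ c _ _))

  Nontrivial : ∀ {m} → Fun m → Set
  Nontrivial f = ∃ λ u → ¬ (fn f u ≡ 0f)

  normal-functional : ∀ {m} (f : Fun m) → Nontrivial f → ∃ λ c → c ∈ points m × (∀ u → fn f u ≡ 0f → fn (dotF c) u ≡ 0f) × (∀ u → fn (dotF c) u ≡ 0f → fn f u ≡ 0f)
  normal-functional {m} f (w , nw) = build (normalise (toDot f) (λ z → nw (trans (sym (toDot-spec f w)) (trans (cong (λ h → fn (dotF h) w) z) (dot0 m w)))))
    where
      dot0 : ∀ m (w : V m) → fn (dotF 0v) w ≡ 0f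
      dot0 zero [] = refl
      dot0 (suc m) (x ∷ w) = trans (cong₂ _⊕_ (R.zeroˡ x) (dot0 m w)) (R.+-identityʳ 0f)
      build : (∃ λ P → P ∈ points m × toDot f ∼ P) → _
      build (c , j , d , e) = c , j , (λ u z → to-zero u (trans (sym (scaled u)) z)) , λ u z → trans (scaled u) (trans (cong (d ⊗_) z) (R.zeroʳ d))
        where
          scaled : ∀ u → fn f u ≡ d ⊗ fn (dotF c) u
          scaled u = trans (sym (toDot-spec f u)) (trans (cong (λ h → fn (dotF h) u) e) (dotF-* d c u))
          to-zero : ∀ u → d ⊗ fn (dotF c) u ≡ 0f → fn (dotF c) u ≡ 0f
          to-zero u z with no-zero-divisors d _ z
          ... | inj₂ r = r
          ... | inj₁ d0 = ⊥-elim (nw (trans (scaled w) (trans (cong (_⊗ fn (dotF c) w) d0) (R.zeroˡ _))))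

  dotF-nontrivial : ∀ {m} {c : V m} → ¬ (c ≡ 0v) → Nontrivial (dotF c)
  dotF-nontrivial {c = c} nc with zero-or-not (dotF c)
  ... | inj₁ w = w
  ... | inj₂ z = ⊥-elim (nc (all-zero c z))
    where
      all-zero : ∀ {m} (c : V m) → (∀ u → fn (dotF c) u ≡ 0f) → c ≡ 0v
      all-zero [] z = refl
      all-zero (x ∷ c) z = cong₂ _∷_ (trans (sym (trans (cong₂ _⊕_ (R.*-identityʳ x) (fn-0 (dotF c))) (R.+-identityʳ x))) (z e₀))
        (all-zero c (λ u → trans (sym (trans (cong (_⊕ fn (dotF c) u) (R.zeroʳ x)) (R.+-identityˡ _))) (z (0f ∷ u))))

  Domination : ∀ {m} → List (V m) → List (V m) → Set
  Domination hs B = ∀ P → ¬ (P ≡ 0v) → # (λ h → fn (dotF h) P ≟ 0f) hs ≤ # (_∼? P) B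

  -- A sum of `t` hyperplanes below `B`, not necessarily equal to it: in this form the statement
  -- passes from a subset of `B` to `B`.
  HyperplaneSum : ∀ {m} → ℕ → List (V m) → Set
  HyperplaneSum {m} t B = ∃ λ (hs : List (V m)) → length hs ≡ t × (∀ h → h ∈ hs → h ∈ points m) × Domination hs B

  private
    tl : ∀ {m} → V (suc m) → V m
    tl = ap tailL

    axis-∼ : ∀ {m} (u : V (suc m)) → tl u ≡ 0v → u ∼ e₀
    axis-∼ (x ∷ u) refl = x , cong₂ _∷_ (sym (R.*-identityʳ x)) (sym (*v-0 x))

    axis-∼⁻ : ∀ {m} (u : V (suc m)) → u ∼ e₀ → tl u ≡ 0v
    axis-∼⁻ u (c , refl) = *v-0 c

  kernel-points : ∀ {m} (f : Fun (suc m)) → Nontrivial f → Θ m ≤ # (λ c → fn f c ≟ 0f) (points (suc m))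
  kernel-points {m} f nt = begin
    Θ m ≡⟨ #-all (λ z → fn f (em incl z) ≟ 0f) (points m) (λ z _ → in-kernel z) ⟨
    # (λ z → fn f (em incl z) ≟ 0f) (points m) ≤⟨ image-points incl (λ u → fn f u ≟ 0f) (subspace-invariant (kernel-subspace f)) ⟩
    # (λ P → im? incl P ×-dec (fn f P ≟ 0f)) (points (suc m)) ≤⟨ #-mono (λ P → im? incl P ×-dec (fn f P ≟ 0f)) (λ c → fn f c ≟ 0f) (points (suc m)) (λ _ _ → proj₂) ⟩
    # (λ c → fn f c ≟ 0f) (points (suc m)) ∎
    where
      open ℕₚ.≤-Reasoning
      open Hyperplane (hyperplane f nt)

  point-count′ : ∀ {m} (P : V m) → ¬ (P ≡ 0v) → # (_∼? P) (points m) ≡ 1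
  point-count′ {m} P nP = trans (#-cong (_∼? P) (P ∼?_) (points m) (λ c j s → ∼-sym (points-≢0 j) s) (λ c _ s → ∼-sym nP s)) (point-count P nP)

  -- The quotient by a point and a hyperplane contained in the blocking set

  module Step (k t : ℕ) (t<p : suc (2 * t) ≤ p) where

    open LineCongruence k t t<p public

    private
      Q = p ^ suc k

      t<p' : t < p
      t<p' = ℕₚ.≤-trans (s≤s (ℕₚ.m≤m+n t _)) t<p

    -- The lines through a missing point of the hyperplane f = 0 partition the elements off the hyperplane.
    outside-large : ∀ {B} → Good B → (f : Fun m) → Nontrivial f → ∀ R → ¬ (R ≡ 0v) → fn f R ≡ 0f → Missing R B → t * Q ≤ # (λ u → ¬? (fn f u ≟ 0f)) B
    outside-large {B} g f nt R nR zR miss = build (frame-hyperplane f R nt nR zR)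
      where
        build : (∃ λ (M : Iso m) → (∀ u → hd (ap (to M) u) ≡ fn f u) × ap (to M) R ≡ e₁) → t * Q ≤ # (λ u → ¬? (fn f u ≟ 0f)) B
        build (M , ef , eR) = begin
          t * Q ≡⟨ trans (ℕₚ.*-comm t Q) (cong (_* t) (sym (vecs-length (suc k)))) ⟩
          length (vecs (suc k)) * t ≡⟨ ∑-const (vecs (suc k)) t ⟨
          ∑ (vecs (suc k)) (λ _ → t) ≤⟨ ∑-mono (vecs (suc k)) (λ α _ → fold-line {t = t} {B = B'} (fold-map (to M) B (fold g)) α 0v) ⟩
          ∑ (vecs (suc k)) (λ α → # (onLine? α 0v) B') ≡⟨ ∑-swap (vecs (suc k)) B' _ ⟩
          ∑ B' (λ u → # (λ α → onLine? α 0v u) (vecs (suc k))) ≤⟨ ∑-mono B' (λ u j → per u j) ⟩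
          ∑ B' (λ u → ind (¬? (hd u ≟ 0f))) ≡⟨ ∑-map (ap (to M)) B _ ⟩
          ∑ B (λ u → ind (¬? (hd (ap (to M) u) ≟ 0f))) ≡⟨ ∑-cong B (λ u _ → cong (λ x → ind (¬? (x ≟ 0f))) (ef u)) ⟩
          # (λ u → ¬? (fn f u ≟ 0f)) B ∎
          where
            open ℕₚ.≤-Reasoning
            B' = map (ap (to M)) B
            miss' : Missing e₁ B'
            miss' = subst (λ v → Missing v B') eR (missing-map M B miss)
            per : ∀ u → u ∈ B' → # (λ α → onLine? α 0v u) (vecs (suc k)) ≤ ind (¬? (hd u ≟ 0f))
            per (x ∷ y ∷ a) j with x ≟ 0f
            ... | yes refl = ℕₚ.≤-reflexive (#-none (λ α → onLine? α 0v (0f ∷ y ∷ a)) (vecs (suc k)) (λ α _ o → miss' _ j (y , cong₂ _∷_ (sym (R.zeroʳ y)) (cong₂ _∷_ (sym (R.*-identityʳ y))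
                    (trans o (trans (cong₂ _+v_ (0-*v α) (*v-0 y)) (trans (+v-0 0v) (sym (*v-0 y)))))))))
            ... | no nx = #-at-most-one (λ α → onLine? α 0v (x ∷ y ∷ a)) (vecs-unique (suc k)) (λ α β o o' → trans (sym (inv-*v nx α)) (trans (cong (inv x *v_) (trans (sym (drop α o)) (drop β o'))) (inv-*v nx β)))
              where
                drop : ∀ α → OnLine α 0v (x ∷ y ∷ a) → a ≡ x *v α
                drop α o = trans o (trans (cong (x *v α +v_) (*v-0 y)) (+v-0 (x *v α)))

    Sub : List (V m) → List (V m) → Set
    Sub B' B = ∃ λ rest → B ↭ B' ++ rest

    sub-count : ∀ {B' B} → Sub B' B → ∀ {P : V m → Set} (P? : ∀ u → Dec (P u)) → # P? B' ≤ # P? B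
    sub-count {B'} (rest , perm) P? = ℕₚ.≤-trans (ℕₚ.m≤m+n _ _) (ℕₚ.≤-reflexive (trans (sym (∑-++ B' rest _)) (sym (∑-↭ _ perm))))

    sub-∈ : ∀ {B' B u} → Sub B' B → u ∈ B' → u ∈ B
    sub-∈ (rest , perm) j = ∈-resp-↭ (↭-sym perm) (∈-++⁺ˡ j)

    sub-length : ∀ {B' B} → Sub B' B → length B' ≤ length B
    sub-length {B'} (rest , perm) = ℕₚ.≤-trans (ℕₚ.m≤m+n _ (length rest)) (ℕₚ.≤-reflexive (trans (sym (length-++ B')) (sym (↭-length perm))))

    private
      -- The linear maps into `F ^ b`, listed as tuples of functionals; this makes `Essential`
      -- decidable.
      mats : ∀ b → List (Vec (V m) b)
      mats zero = [] ∷ []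
      mats (suc b) = concatMap (λ r → map (r ∷_) (mats b)) (vecs m)

      mats-complete : ∀ {b} (A : Vec (V m) b) → A ∈ mats b
      mats-complete [] = here refl
      mats-complete (r ∷ A) = ∈-concatMap⁺ (λ r → map (r ∷_) (mats _)) (lose (vecs-complete r) (∈-map⁺ (r ∷_) (mats-complete A)))

      matL : ∀ {b} → Vec (V m) b → Lin m b
      matL [] = zeroL
      matL (r ∷ A) = consL (dotF r) (matL A)

      toMat : ∀ {b} → Lin m b → Vec (V m) b
      toMat {zero} φ = []
      toMat {suc b} φ = toDot (headF ∘F φ) ∷ toMat (tailL ∘L φ)

      toMat-spec : ∀ {b} (φ : Lin m b) u → ap (matL (toMat φ)) u ≡ ap φ u
      toMat-spec {zero} φ u with ap φ u
      ... | [] = refl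
      toMat-spec {suc b} φ u = trans (cong₂ _∷_ (toDot-spec (headF ∘F φ) u) (toMat-spec (tailL ∘L φ) u)) (join (ap φ u))
        where
          join : ∀ {n} (v : V (suc n)) → hd v ∷ tl v ≡ v
          join (x ∷ v) = refl

      essential? : ∀ B v → Dec (Essential B v)
      essential? B v = map′ (λ a → let (A , _ , h) = find a in matL A , h)
        (λ { (φ , e , c) → lose (mats-complete (toMat φ)) (trans (toMat-spec φ v) e ,
             trans (#-cong (λ u → ap (matL (toMat φ)) u ≟v 0v) (λ u → ap φ u ≟v 0v) B (λ u _ z → trans (sym (toMat-spec φ u)) z) (λ u _ z → trans (toMat-spec φ u) z)) c) })
        (any? (λ A → (ap (matL A) v ≟v 0v) ×-dec (# (λ u → ap (matL A) u ≟v 0v) B ℕ.≟ t)) (mats (suc k)))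

    minimal : ∀ n B → length B ≤ n → Fold (suc k) t B → ∃ λ B' → Sub B' B × Fold (suc k) t B' × AllEssential B'
    minimal n B l fold with any? (λ v → ¬? (essential? B v)) B
    ... | no na = B , ([] , ↭.↭-sym (++-identityʳ-↭ B)) , fold , λ v j → decidable-stable (essential? B v) (λ ne → na (lose j ne))
      where
        ++-identityʳ-↭ : ∀ {A : Set} (xs : List A) → xs ++ [] ↭ xs
        ++-identityʳ-↭ xs = ++-comm xs []
    ... | yes a with find a
    ...   | v , j , ne with ∈-split j
    ...     | ys , perm = again n (subst (_≤ n) (↭-length perm) l)
      where
        fold' : Fold (suc k) t ys
        fold' φ = step (ap φ v ≟v 0v)
          where
            total : # (λ u → ap φ u ≟v 0v) B ≡ ind (ap φ v ≟v 0v) + # (λ u → ap φ u ≟v 0v) ys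
            total = ∑-↭ _ perm
            step : Dec (ap φ v ≡ 0v) → t ≤ # (λ u → ap φ u ≟v 0v) ys
            step (no nz) = ℕₚ.≤-trans (fold φ) (ℕₚ.≤-reflexive (trans total (cong (_+ # (λ u → ap φ u ≟v 0v) ys) (ind-no (ap φ v ≟v 0v) nz))))
            step (yes z) = ℕₚ.≤-pred (ℕₚ.≤-trans (ℕₚ.≤∧≢⇒< (fold φ) (λ e → ne (φ , z , sym e)))
              (ℕₚ.≤-reflexive (trans total (cong (_+ # (λ u → ap φ u ≟v 0v) ys) (ind-yes (ap φ v ≟v 0v) z)))))
        again : ∀ n → suc (length ys) ≤ n → ∃ λ B' → Sub B' B × Fold (suc k) t B' × AllEssential B'
        again (suc n) (s≤s l') with minimal n ys l' fold'
        ... | B' , (rest , perm') , f , ess = B' , (v ∷ rest , ↭-trans perm (↭-trans (prep v perm') (↭-sym (shift v B' rest)))) , f , ess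

    -- Lines through e₀ of weight t + m p are the points of weight m of the quotient by e₀.
    module Quotient {B : List (V m)} (g : Good B) (ess : AllEssential B) {u₀} (u₀∈ : u₀ ∈ B) (u₀∼ : u₀ ∼ e₀) where

      e : ℕ
      e = # (_∼? e₀) B

      e≥1 : 1 ≤ e
      e≥1 = #-member (_∼? e₀) u₀∈ u₀∼

      -- The subspace of weight `t` through `u₀` contains all `e` elements at the point `e₀`.
      e≤t : e ≤ t
      e≤t with ess u₀ u₀∈
      ... | φ , z , c = ℕₚ.≤-trans (#-mono (_∼? e₀) (λ u → ap φ u ≟v 0v) B (λ { u _ s → kills (∼-trans s (∼-sym (nz g u₀ u₀∈) u₀∼)) })) (ℕₚ.≤-reflexive c)
        where
          kills : ∀ {u} → u ∼ u₀ → ap φ u ≡ 0v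
          kills (d , refl) = trans (ap-* φ d u₀) (trans (cong (d *v_) z) (*v-0 d))

      -- The weight of the line joining `e₀` to `(0 , v)`; elements at `e₀` have tail zero and are
      -- counted on each such line.
      w : V (suc (suc k)) → ℕ
      w v = # (λ u → tl u ∼? v) B

      private
        instance
          p≢0 : ℕ.NonZero p
          p≢0 = ℕ.>-nonZero 0<p

      mult : V (suc (suc k)) → ℕ
      mult v = (w v ∸ t) / p

      private
        w-span : ∀ v → # (onSpan? e₀ (0f ∷ v)) B ≡ w v
        w-span v = #-cong (onSpan? e₀ (0f ∷ v)) (λ u → tl u ∼? v) B
          (λ { u _ (a , b , refl) → b , trans (cong (_+v b *v v) (*v-0 a)) (0-+v _) })
          (λ { (x ∷ u) _ (b , refl) → x , b , trans (split-vec x (b *v v)) (cong (λ y → x *v e₀ +v (y ∷ b *v v)) (sym (R.zeroʳ b))) })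

      mult-spec : ∀ {v} → ¬ (v ≡ 0v) → w v ≡ t + mult v * p
      mult-spec {v} nv = build (every-line-congruent g ess ((λ z → 1≢0 (cong hd z)) , λ c z → nv (trans (cong tl z) (*v-0 c))))
        where
          build : Congruent t (# (onSpan? e₀ (0f ∷ v)) B) → w v ≡ t + mult v * p
          build (j , c) = trans wj (cong (λ n → t + n * p) (sym (trans (cong (λ n → (n ∸ t) / p) wj) (trans (cong (_/ p) (ℕₚ.m+n∸m≡n t (j * p))) (m*n/n≡m j p)))))
            where
              wj : w v ≡ t + j * p
              wj = trans (sym (w-span v)) c

      mult-∼ : ∀ {v v'} → ¬ (v ≡ 0v) → v ∼ v' → mult v ≡ mult v'
      mult-∼ nv s = cong (λ n → (n ∸ t) / p) (#-cong (λ u → tl u ∼? _) (λ u → tl u ∼? _) B (λ u _ s' → ∼-trans s' s) (λ u _ s' → ∼-trans s' (∼-sym nv s)))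

      Bq : List (V (suc (suc k)))
      Bq = concatMap (λ c → replicate (mult c) c) (points (suc (suc k)))

      Bq-∑ : ∀ f → ∑ Bq f ≡ ∑ (points (suc (suc k))) (λ c → mult c * f c)
      Bq-∑ f = trans (∑-concatMap (λ c → replicate (mult c) c) (points (suc (suc k))) f) (∑-cong (points (suc (suc k))) (λ c _ → ∑-replicate (mult c) c f))

      Bq-∈ : ∀ {v} → v ∈ Bq → v ∈ points (suc (suc k))
      Bq-∈ j with find (∈-concatMap⁻ (λ c → replicate (mult c) c) {xs = points (suc (suc k))} j)
      ... | c , j' , l = subst (_∈ points (suc (suc k))) (sym (in-replicate (mult c) l)) j'
        where
          in-replicate : ∀ {A : Set} {x y : A} n → x ∈ replicate n y → x ≡ y
          in-replicate (suc n) (here e) = e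
          in-replicate (suc n) (there j) = in-replicate n j

      Bq-nonzero : Nonzero Bq
      Bq-nonzero v j = points-≢0 (Bq-∈ j)

      private
        A : V m → ℕ
        A u = ind (u ∼? e₀)

        zero-tail : ∀ u {v : V (suc (suc k))} → tl u ≡ 0v → tl u ∼ v
        zero-tail u {v} z = 0f , trans z (sym (0-*v v))

      -- A line of the quotient is a plane through `e₀`. Its `p + 1` lines through `e₀` have total
      -- weight `W + p e`, where the weight `W` of the plane is at least `t (p + 1)`. So their
      -- surplus over `t (p + 1)` is at least `p e`, and the surplus is `p` times the weight in the
      -- quotient.
      Bq-fold : Fold k e Bq
      Bq-fold ψ = build (kernel-emb′ k (ℕₚ.+-comm 2 k) ψ)
        where
          build : (∃ λ (ι : Emb 2 (suc (suc k))) → ∀ x → ap ψ (em ι x) ≡ 0v) → e ≤ # (λ v → ap ψ v ≟v 0v) Bq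
          build (ι , ker) = ℕₚ.≤-trans e≤ (ℕₚ.≤-trans quotient-sum (ℕₚ.≤-reflexive (sym (Bq-∑ _))))
            where
              open ℕₚ.≤-Reasoning
              pts = points (suc (suc k))
              κ : Emb 3 m
              κ .lin = consL headF (lin ι ∘L tailL)
              κ .injective (x ∷ z) eq = cong₂ _∷_ (cong hd eq) (injective ι z (cong tl eq))
              W = # (im? κ) B
              per : ∀ u → (d : Dec (u ∼ e₀)) (i : Dec (∃ λ z → em κ z ≡ u)) → # (λ z → tl u ∼? em ι z) (points 2) ≡ p * ind d + ind i
              per u (yes s) i = trans (#-all (λ z → tl u ∼? em ι z) (points 2) (λ z _ → zero-tail u (axis-∼⁻ u s)))
                (trans Θ-2 (trans (ℕₚ.+-comm 1 p) (cong₂ _+_ (sym (ℕₚ.*-identityʳ p)) (sym (ind-yes i (hd u ∷ 0v , lift u (axis-∼⁻ u s)))))))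
                where
                  lift : ∀ u → tl u ≡ 0v → em κ (hd u ∷ 0v) ≡ u
                  lift (x ∷ u) z = cong (x ∷_) (trans (ap-0 (lin ι)) (sym z))
              per (x ∷ u) (no ns) (yes ((x' ∷ z₀) , eq)) = trans (trans (#-cong (λ z → u ∼? em ι z) (z₀ ∼?_) (points 2)
                  (λ z _ s → ∼-em ι (subst (_∼ em ι z) (sym (cong tl eq)) s)) (λ z _ s → subst (_∼ em ι z) (cong tl eq) (∼-ap (lin ι) s)))
                  (point-count z₀ (λ z → ns (axis-∼ (x ∷ u) (trans (sym (cong tl eq)) (trans (cong (em ι) z) (ap-0 (lin ι)))))))) (sym (cong (_+ 1) (ℕₚ.*-zeroʳ p)))
              per (x ∷ u) (no ns) (no ni) = trans (#-none (λ z → u ∼? em ι z) (points 2) (λ { z _ (c , eq) → ni ((x ∷ c *v z) , cong (x ∷_) (trans (ap-* (lin ι) c z) (sym eq))) }))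
                (sym (trans (ℕₚ.+-identityʳ _) (ℕₚ.*-zeroʳ p)))
              line-sum : ∑ (points 2) (λ z → w (em ι z)) ≡ p * e + W
              line-sum = trans (∑-swap (points 2) B _) (trans (∑-cong B (λ u _ → per u (u ∼? e₀) (im? κ u))) (trans (∑-+ B _ _) (cong (_+ W) (∑-*ˡ B p _))))
              S = ∑ (points 2) (λ z → mult (em ι z))
              line-sum' : ∑ (points 2) (λ z → w (em ι z)) ≡ suc p * t + S * p
              line-sum' = trans (∑-cong (points 2) (λ z j → mult-spec (λ e → points-≢0 j (injective ι z e)))) (trans (∑-+ (points 2) _ _)
                (cong₂ _+_ (trans (∑-const (points 2) t) (cong (_* t) Θ-2)) (trans (∑-cong (points 2) (λ z _ → ℕₚ.*-comm (mult (em ι z)) p)) (trans (∑-*ˡ (points 2) p _) (ℕₚ.*-comm p S)))))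
              e≤ : e ≤ S
              e≤ = ℕₚ.*-cancelʳ-≤ e S p (ℕₚ.+-cancelˡ-≤ (suc p * t) _ _ (begin
                suc p * t + e * p ≡⟨ ℕₚ.+-comm (suc p * t) _ ⟩
                e * p + suc p * t ≡⟨ cong₂ _+_ (ℕₚ.*-comm e p) (ℕₚ.*-comm (suc p) t) ⟩
                p * e + t * suc p ≤⟨ ℕₚ.+-monoʳ-≤ (p * e) (plane-weight κ B (nz g) (fold g) t<p') ⟩
                p * e + W ≡⟨ trans (sym line-sum) line-sum' ⟩
                suc p * t + S * p ∎))
              quotient-sum : S ≤ ∑ pts (λ c → mult c * ind (ap ψ c ≟v 0v))
              quotient-sum = begin
                S ≡⟨ ∑-cong (points 2) (λ z j → sym (trans (∑-*ˡ pts (mult (em ι z)) _) (trans (cong (mult (em ι z) *_) (point-count (em ι z) (λ e → points-≢0 j (injective ι z e)))) (ℕₚ.*-identityʳ _)))) ⟩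
                ∑ (points 2) (λ z → ∑ pts (λ c → mult (em ι z) * ind (em ι z ∼? c))) ≡⟨ ∑-cong (points 2) (λ z j → ∑-cong pts (λ c _ → move z j c)) ⟩
                ∑ (points 2) (λ z → ∑ pts (λ c → mult c * ind (em ι z ∼? c))) ≡⟨ ∑-swap (points 2) pts _ ⟩
                ∑ pts (λ c → ∑ (points 2) (λ z → mult c * ind (em ι z ∼? c))) ≡⟨ ∑-cong pts (λ c _ → ∑-*ˡ (points 2) (mult c) _) ⟩
                ∑ pts (λ c → mult c * # (λ z → em ι z ∼? c) (points 2)) ≤⟨ ∑-mono pts (λ c j → ℕₚ.*-monoʳ-≤ (mult c) (ℕₚ.≤-trans (dir-count ι c j) (ind-mono (im? ι c) (ap ψ c ≟v 0v) (λ { (z , refl) → ker z })))) ⟩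
                ∑ pts (λ c → mult c * ind (ap ψ c ≟v 0v)) ∎
                where
                  move : ∀ z → z ∈ points 2 → ∀ c → mult (em ι z) * ind (em ι z ∼? c) ≡ mult c * ind (em ι z ∼? c)
                  move z j c with em ι z ∼? c
                  ... | no _ = trans (ℕₚ.*-zeroʳ (mult (em ι z))) (sym (ℕₚ.*-zeroʳ (mult c)))
                  ... | yes s = cong (_* 1) (mult-∼ (λ e → points-≢0 j (injective ι z e)) s)

      private
        Θq = Θ (suc (suc k))

      -- Summing over all lines through `e₀` gives `p |Bq| = |B| - e - Θq (t - e)`. As `Θq` is at
      -- least `p ^ suc k` and `e ≤ t`, the factor `2 t + 1` in the bound for `B` drops to
      -- `2 e + 1`.
      Bq-thin : Thin k e Bq
      Bq-thin = ℕₚ.≰⇒> (λ big → ℕₚ.<-irrefl refl (begin-strict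
          suc (2 * t) * Q + 2 * (Θ' * t) ≤⟨ ℕₚ.+-cancelˡ-≤ (2 * (Q * e) + 2 * e) _ _ (contradictory big) ⟩
          2 * length B + 2 * (Θ' * e) <⟨ ℕₚ.+-monoˡ-≤ (2 * (Θ' * e)) (thin g) ⟩
          suc (2 * t) * Q + 2 * (Θ' * e) ≤⟨ ℕₚ.+-monoʳ-≤ (suc (2 * t) * Q) (ℕₚ.*-monoʳ-≤ 2 (ℕₚ.*-monoʳ-≤ Θ' e≤t)) ⟩
          suc (2 * t) * Q + 2 * (Θ' * t) ∎))
        where
          open ℕₚ.≤-Reasoning
          open +-*-Solver
          pts = points (suc (suc k))
          Θ' = Θ (suc k)
          M = ∑ pts mult
          Bq-length : length Bq ≡ M
          Bq-length = trans (length-∑ Bq) (trans (Bq-∑ _) (∑-cong pts (λ c _ → ℕₚ.*-identityʳ (mult c))))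
          per : ∀ u → (d : Dec (u ∼ e₀)) → # (λ c → tl u ∼? c) pts + ind d ≡ Θq * ind d + 1
          per u (yes s) = trans (cong (_+ 1) (#-all (λ c → tl u ∼? c) pts (λ c _ → zero-tail u (axis-∼⁻ u s)))) (cong (_+ 1) (sym (ℕₚ.*-identityʳ Θq)))
          per u (no ns) = trans (ℕₚ.+-identityʳ _) (trans (point-count (tl u) (λ z → ns (axis-∼ u z))) (sym (cong (_+ 1) (ℕₚ.*-zeroʳ Θq))))
          Σw : ∑ pts w + e ≡ Θq * e + length B
          Σw = trans (cong (_+ e) (∑-swap pts B _)) (trans (sym (∑-+ B _ _)) (trans (∑-cong B (λ u _ → per u (u ∼? e₀))) (trans (∑-+ B _ _) (cong₂ _+_ (∑-*ˡ B Θq _) (sym (length-∑ B))))))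
          Σw' : ∑ pts w ≡ Θq * t + M * p
          Σw' = trans (∑-cong pts (λ c j → mult-spec (points-≢0 j))) (trans (∑-+ pts _ _) (cong₂ _+_ (∑-const pts t) (trans (∑-cong pts (λ c _ → ℕₚ.*-comm (mult c) p)) (trans (∑-*ˡ pts p _) (ℕₚ.*-comm p M)))))
          contradictory : suc (2 * e) * p ^ k ≤ 2 * length Bq → (2 * (Q * e) + 2 * e) + (suc (2 * t) * Q + 2 * (Θ' * t)) ≤ (2 * (Q * e) + 2 * e) + (2 * length B + 2 * (Θ' * e))
          contradictory big = begin
            (2 * (Q * e) + 2 * e) + (suc (2 * t) * Q + 2 * (Θ' * t))
              ≡⟨ solve 5 (λ p q e t h → (con 2 :* ((p :* q) :* e) :+ con 2 :* e) :+ ((con 1 :+ con 2 :* t) :* (p :* q) :+ con 2 :* (h :* t)) :=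
                   con 2 :* (((p :* q) :+ h) :* t :+ e) :+ p :* ((con 1 :+ con 2 :* e) :* q)) refl p (p ^ k) e t Θ' ⟩
            2 * ((Q + Θ') * t + e) + p * (suc (2 * e) * p ^ k) ≤⟨ ℕₚ.+-monoʳ-≤ (2 * ((Q + Θ') * t + e)) (ℕₚ.*-monoʳ-≤ p big) ⟩
            2 * ((Q + Θ') * t + e) + p * (2 * length Bq) ≡⟨ cong₂ (λ a b → 2 * (a * t + e) + p * (2 * b)) (sym (Θ-suc (suc k))) Bq-length ⟩
            2 * (Θq * t + e) + p * (2 * M) ≡⟨ solve 4 (λ h e p M → con 2 :* (h :+ e) :+ p :* (con 2 :* M) := con 2 :* ((h :+ M :* p) :+ e)) refl (Θq * t) e p M ⟩
            2 * ((Θq * t + M * p) + e) ≡⟨ cong (2 *_) (trans (cong (_+ e) (sym Σw')) Σw) ⟩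
            2 * (Θq * e + length B) ≡⟨ cong (λ a → 2 * (a * e + length B)) (Θ-suc (suc k)) ⟩
            2 * ((Q + Θ') * e + length B) ≤⟨ ℕₚ.m≤m+n _ (2 * e) ⟩
            2 * ((Q + Θ') * e + length B) + 2 * e ≡⟨ solve 4 (λ q h e b → con 2 :* ((q :+ h) :* e :+ b) :+ con 2 :* e := (con 2 :* (q :* e) :+ con 2 :* e) :+ (con 2 :* b :+ con 2 :* (h :* e))) refl Q Θ' e (length B) ⟩
            (2 * (Q * e) + 2 * e) + (2 * length B + 2 * (Θ' * e)) ∎

      Full : Fun m → Set
      Full f = ∀ R → ¬ (R ≡ 0v) → fn f R ≡ 0f → ∃ λ u → u ∈ B × u ∼ R

      -- Since `e ≥ 1`, the quotient contains a hyperplane, and the lines through `e₀` above its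
      -- points weigh at least `t + p`. With at most `t` elements at `e₀`, the hyperplane above it
      -- has at least `p ^ suc k` elements. If one of its points were missing, `outside-large` would
      -- add `t p ^ suc k` elements off it, and together these exceed the size of `B`.
      full-hyperplane : HyperplaneSum e Bq → ∃ λ (f : Fun m) → Nontrivial f × Full f
      full-hyperplane (hs , len , hs∈ , dom) = pick hs refl
        where
          pick : ∀ hs' → hs' ≡ hs → ∃ λ (f : Fun m) → Nontrivial f × Full f
          pick [] refl = ⊥-elim (ℕₚ.<⇒≱ e≥1 (ℕₚ.≤-reflexive (sym len)))
          pick (h ∷ _) refl = f , (0f ∷ proj₁ h-nt , proj₂ h-nt) , λ R nR zR → decide R nR zR (any? (_∼? R) B)
            where
              h-nt : Nontrivial (dotF h)
              h-nt = dotF-nontrivial (points-≢0 (hs∈ h (here refl)))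
              f : Fun m
              f = dotF h ∘F tailL
              pts = points (suc (suc k))
              N = # (λ c → fn (dotF h) c ≟ 0f) pts
              mult-positive : ∀ c → c ∈ pts → fn (dotF h) c ≡ 0f → 1 ≤ mult c
              mult-positive c j z = witness (∑-positive pts (λ c' → mult c' * ind (c' ∼? c)) (subst (0 <_) (Bq-∑ _) (ℕₚ.≤-trans (#-member (λ h → fn (dotF h) c ≟ 0f) {hs} (here refl) z) (dom c (points-≢0 j)))))
                where
                  witness : (∃ λ c' → c' ∈ pts × 0 < mult c' * ind (c' ∼? c)) → 1 ≤ mult c
                  witness (c' , j' , pos) with c' ∼? c
                  ... | no _ = ⊥-elim (ℕₚ.<-irrefl refl (subst (0 <_) (ℕₚ.*-zeroʳ (mult c')) pos))
                  ... | yes s = subst (1 ≤_) (trans (ℕₚ.*-identityʳ _) (mult-∼ (points-≢0 j') s)) pos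
              heavy : ∀ c → c ∈ pts → ind (fn (dotF h) c ≟ 0f) * (t + p) ≤ ind (fn (dotF h) c ≟ 0f) * w c
              heavy c j with fn (dotF h) c ≟ 0f
              ... | no _ = z≤n
              ... | yes z = ℕₚ.*-monoʳ-≤ 1 (ℕₚ.≤-trans (ℕₚ.+-monoʳ-≤ t (ℕₚ.≤-trans (ℕₚ.≤-reflexive (sym (ℕₚ.*-identityˡ p))) (ℕₚ.*-monoˡ-≤ p (mult-positive c j z)))) (ℕₚ.≤-reflexive (sym (mult-spec (points-≢0 j)))))
              per : ∀ u → (d : Dec (u ∼ e₀)) → ∑ pts (λ c → ind (fn (dotF h) c ≟ 0f) * ind (tl u ∼? c)) ≤ N * ind d + ind (fn f u ≟ 0f)
              per u (yes s) = ℕₚ.≤-trans (∑-≤1-* pts (λ c → ind (tl u ∼? c)) (λ c → ind (fn (dotF h) c ≟ 0f)) (λ c _ → ind-≤1 (tl u ∼? c))) (ℕₚ.≤-trans (ℕₚ.≤-reflexive (sym (ℕₚ.*-identityʳ N))) (ℕₚ.m≤m+n _ _))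
              per u (no ns) = ℕₚ.≤-trans {j = ind (fn f u ≟ 0f)} (ℕₚ.≤-reflexive (trans (∑-cong pts (λ c _ → move c)) (trans (∑-*ˡ pts (ind (fn f u ≟ 0f)) _)
                  (trans (cong (ind (fn f u ≟ 0f) *_) (point-count (tl u) nt')) (ℕₚ.*-identityʳ _))))) (ℕₚ.m≤n+m (ind (fn f u ≟ 0f)) (N * 0))
                where
                  nt' : ¬ (tl u ≡ 0v)
                  nt' z = ns (axis-∼ u z)
                  move : ∀ c → ind (fn (dotF h) c ≟ 0f) * ind (tl u ∼? c) ≡ ind (fn f u ≟ 0f) * ind (tl u ∼? c)
                  move c with tl u ∼? c
                  ... | no _ = trans (ℕₚ.*-zeroʳ (ind (fn (dotF h) c ≟ 0f))) (sym (ℕₚ.*-zeroʳ (ind (fn f u ≟ 0f))))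
                  ... | yes s = cong (_* 1) (ind-cong (fn (dotF h) c ≟ 0f) (fn f u ≟ 0f) (subspace-invariant (kernel-subspace (dotF h)) nt' s)
                        (subspace-invariant (kernel-subspace (dotF h)) (λ z → nt' (trans (proj₂ s) (trans (cong (proj₁ s *v_) z) (*v-0 (proj₁ s))))) (∼-sym nt' s)))
              hyperplane-weight : N * p ≤ # (λ u → fn f u ≟ 0f) B
              hyperplane-weight = ℕₚ.+-cancelˡ-≤ (N * t) _ _ (begin
                N * t + N * p ≡⟨ ℕₚ.*-distribˡ-+ N t p ⟨
                N * (t + p) ≡⟨ trans (ℕₚ.*-comm N (t + p)) (sym (∑-*ˡ pts (t + p) _)) ⟩
                ∑ pts (λ c → (t + p) * ind (fn (dotF h) c ≟ 0f)) ≡⟨ ∑-cong pts (λ c _ → ℕₚ.*-comm (t + p) _) ⟩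
                ∑ pts (λ c → ind (fn (dotF h) c ≟ 0f) * (t + p)) ≤⟨ ∑-mono pts heavy ⟩
                ∑ pts (λ c → ind (fn (dotF h) c ≟ 0f) * w c) ≡⟨ ∑-cong pts (λ c _ → sym (∑-*ˡ B (ind (fn (dotF h) c ≟ 0f)) (λ u → ind (tl u ∼? c)))) ⟩
                ∑ pts (λ c → ∑ B (λ u → ind (fn (dotF h) c ≟ 0f) * ind (tl u ∼? c))) ≡⟨ ∑-swap pts B _ ⟩
                ∑ B (λ u → ∑ pts (λ c → ind (fn (dotF h) c ≟ 0f) * ind (tl u ∼? c))) ≤⟨ ∑-mono B (λ u _ → per u (u ∼? e₀)) ⟩
                ∑ B (λ u → N * A u + ind (fn f u ≟ 0f)) ≡⟨ trans (∑-+ B _ _) (cong (_+ # (λ u → fn f u ≟ 0f) B) (∑-*ˡ B N _)) ⟩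
                N * e + # (λ u → fn f u ≟ 0f) B ≤⟨ ℕₚ.+-monoˡ-≤ _ (ℕₚ.*-monoʳ-≤ N e≤t) ⟩
                N * t + # (λ u → fn f u ≟ 0f) B ∎)
                where open ℕₚ.≤-Reasoning
              decide : ∀ R → ¬ (R ≡ 0v) → fn f R ≡ 0f → Dec (Any (_∼ R) B) → ∃ λ u → u ∈ B × u ∼ R
              decide R nR zR (yes a) = find a
              decide R nR zR (no n) = ⊥-elim (ℕₚ.<-irrefl refl (begin-strict
                  2 * length B <⟨ thin g ⟩
                  suc (2 * t) * Q ≤⟨ ℕₚ.m≤m+n _ Q ⟩
                  suc (2 * t) * Q + Q ≡⟨ solve 2 (λ t q → (con 1 :+ con 2 :* t) :* q :+ q := con 2 :* (q :+ t :* q)) refl t Q ⟩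
                  2 * (Q + t * Q) ≤⟨ ℕₚ.*-monoʳ-≤ 2 (ℕₚ.+-mono-≤ (ℕₚ.≤-trans (ℕₚ.≤-reflexive (ℕₚ.*-comm p (p ^ k))) (ℕₚ.≤-trans (ℕₚ.*-monoˡ-≤ p (ℕₚ.≤-trans (Θ-≥ k) (kernel-points (dotF h) h-nt))) hyperplane-weight))
                       (outside-large g f (0f ∷ proj₁ h-nt , proj₂ h-nt) R nR zR (λ u j s → n (lose j s)))) ⟩
                  2 * (# (λ u → fn f u ≟ 0f) B + # (λ u → ¬? (fn f u ≟ 0f)) B) ≡⟨ cong (2 *_) (#-compl (λ u → fn f u ≟ 0f) B) ⟩
                  2 * length B ∎))
                where
                  open ℕₚ.≤-Reasoning
                  open +-*-Solver

  -- Removal of a hyperplane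

  -- At most one entry of `cs` belongs to any nonzero vector, so the elements chosen for different
  -- entries are different. Only scale-invariant counts are compared, as the representatives may
  -- differ.
  remove-points : ∀ {m} (cs : List (V m)) (B : List (V m)) → Nonzero B → (∀ u → ¬ (u ≡ 0v) → # (u ∼?_) cs ≤ 1) →
    (∀ c → c ∈ cs → ¬ (c ≡ 0v) × ∃ λ u → u ∈ B × u ∼ c) →
    ∃₂ λ us B' → B ↭ us ++ B' × (∀ {Y : V m → Set} (Y? : ∀ u → Dec (Y u)) → ScaleInvariant Y → # Y? us ≡ # Y? cs)
  remove-points [] B nz d h = [] , B , ↭-refl , λ _ _ → refl
  remove-points {m} (c ∷ cs) B nz d h with proj₂ (h c (here refl))
  ... | u , j , s with ∈-split j
  ...   | ys , perm = build (remove-points cs ys (λ v k → nz v (∈-resp-↭ (↭-sym perm) (there k))) (λ v nv → ℕₚ.≤-trans (ℕₚ.m≤n+m _ (ind (v ∼? c))) (d v nv)) rest)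
    where
      rest : ∀ c' → c' ∈ cs → ¬ (c' ≡ 0v) × ∃ λ v → v ∈ ys × v ∼ c'
      rest c' k with h c' (there k)
      ... | nc' , v , l , s' = nc' , v , not-first (∈-resp-↭ perm l) , s'
        where
          not-first : v ∈ u ∷ ys → v ∈ ys
          not-first (there i) = i
          not-first (here refl) = ⊥-elim (ℕₚ.<⇒≱ (ℕₚ.+-mono-≤ (ℕₚ.≤-reflexive (sym (ind-yes (u ∼? c) s))) (#-member (u ∼?_) k s')) (d u (nz u j)))
      build : (∃₂ λ us B' → ys ↭ us ++ B' × (∀ {Y : V m → Set} (Y? : ∀ u → Dec (Y u)) → ScaleInvariant Y → # Y? us ≡ # Y? cs)) → _
      build (us , B' , perm' , eq) = u ∷ us , B' , ↭-trans perm (prep u perm') , λ {Y} Y? inv-Y → cong₂ _+_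
        (ind-cong (Y? u) (Y? c) (inv-Y (proj₁ (h c (here refl))) (∼-sym (nz u j) s)) (inv-Y (nz u j) s)) (eq {Y} Y? (λ {v} {P} → inv-Y {v} {P}))

  module Removal (k t : ℕ) (t<p : suc (2 * suc t) ≤ p) where

    open Step k (suc t) t<p

    private
      Q = p ^ suc k

    -- A line outside the hyperplane loses at most one element. A line inside has all its `p + 1`
    -- points in `B`, so more than `suc t` elements and by the congruence at least `suc t + p`; it
    -- loses `p + 1`. The hyperplane has at least `p ^ suc k` points, which pays for the decrease of
    -- `t` in the size bound.
    remove-hyperplane : ∀ {B} → Good B → AllEssential B → (f : Fun m) → Nontrivial f →
      (∀ R → ¬ (R ≡ 0v) → fn f R ≡ 0f → ∃ λ u → u ∈ B × u ∼ R) →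
      ∃ λ B' → Nonzero B' × Fold (suc k) t B' × Thin (suc k) t B' × (∀ P → ¬ (P ≡ 0v) → ind (fn f P ≟ 0f) + # (_∼? P) B' ≤ # (_∼? P) B)
    remove-hyperplane {B} g ess f nt full = build (remove-points cs B (nz g) (λ u nu → ℕₚ.≤-trans (cs-≤ (u ∼?_)) (ℕₚ.≤-reflexive (point-count u nu)))
        (λ c j → let (j' , z) = ∈-filter⁻ (λ c → fn f c ≟ 0f) {xs = points m} j in points-≢0 j' , full c (points-≢0 j') z))
      where
        cs = filter (λ c → fn f c ≟ 0f) (points m)
        cs-∑ : ∀ {Y : V m → Set} (Y? : ∀ u → Dec (Y u)) → # Y? cs ≡ ∑ (points m) (λ c → ind (fn f c ≟ 0f) * ind (Y? c))
        cs-∑ Y? = ∑-filter (λ c → fn f c ≟ 0f) (points m) _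
        cs-≤ : ∀ {Y : V m → Set} (Y? : ∀ u → Dec (Y u)) → # Y? cs ≤ # Y? (points m)
        cs-≤ Y? = ℕₚ.≤-trans (ℕₚ.≤-reflexive (trans (cs-∑ Y?) (∑-cong (points m) (λ c _ → ℕₚ.*-comm (ind (fn f c ≟ 0f)) _)))) (∑-≤1-* (points m) (λ c → ind (fn f c ≟ 0f)) (λ c → ind (Y? c)) (λ c _ → ind-≤1 (fn f c ≟ 0f)))
        build : (∃₂ λ us B' → B ↭ us ++ B' × (∀ {Y : V m → Set} (Y? : ∀ u → Dec (Y u)) → ScaleInvariant Y → # Y? us ≡ # Y? cs)) → _
        build (us , B' , perm , eq) = B' , nz' , fold' , thin' , dominated
          where
            open ℕₚ.≤-Reasoning
            count : ∀ {Y : V m → Set} (Y? : ∀ u → Dec (Y u)) → ScaleInvariant Y → # Y? B ≡ # Y? cs + # Y? B'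
            count Y? inv-Y = trans (∑-↭ _ perm) (trans (∑-++ us B' _) (cong (_+ # Y? B') (eq Y? (λ {v} {P} → inv-Y {v} {P}))))
            nz' : Nonzero B'
            nz' u j = nz g u (∈-resp-↭ (↭-sym perm) (∈-++⁺ʳ us j))
            dominated : ∀ P → ¬ (P ≡ 0v) → ind (fn f P ≟ 0f) + # (_∼? P) B' ≤ # (_∼? P) B
            dominated P nP = ℕₚ.≤-trans (ℕₚ.+-monoˡ-≤ (# (_∼? P) B') (point-in (fn f P ≟ 0f))) (ℕₚ.≤-reflexive (sym (count (_∼? P) (λ _ s s' → ∼-trans s s'))))
              where
                point-in : (d : Dec (fn f P ≡ 0f)) → ind d ≤ # (_∼? P) cs
                point-in (no _) = z≤n
                point-in (yes z) = let (c , j , s) = normalise P nP in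
                  #-member (_∼? P) (∈-filter⁺ (λ c → fn f c ≟ 0f) j (subspace-invariant (kernel-subspace f) (points-≢0 j) (∼-sym nP s) z)) (∼-sym nP s)
            lengths : length B ≡ length cs + length B'
            lengths = trans (↭-length perm) (trans (length-++ us) (cong (_+ length B') (trans (sym (#-all ⊤? us (λ _ _ → tt))) (trans (eq ⊤? (λ _ _ _ → tt)) (#-all ⊤? cs (λ _ _ → tt))))))
              where
                ⊤? : ∀ (u : V m) → Dec ⊤
                ⊤? u = yes tt
            thin' : Thin (suc k) t B'
            thin' = ℕₚ.+-cancelʳ-≤ (2 * Q) _ _ (begin
              suc (2 * length B') + 2 * Q ≤⟨ ℕₚ.+-monoʳ-≤ (suc (2 * length B')) (ℕₚ.*-monoʳ-≤ 2 (ℕₚ.≤-trans (Θ-≥ (suc k)) (ℕₚ.≤-trans (kernel-points f nt) (ℕₚ.≤-reflexive (sym (length-filter (λ c → fn f c ≟ 0f) (points m))))))) ⟩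
              suc (2 * length B') + 2 * length cs ≡⟨ solve 2 (λ b c → (con 1 :+ con 2 :* b) :+ con 2 :* c := con 1 :+ con 2 :* (c :+ b)) refl (length B') (length cs) ⟩
              suc (2 * (length cs + length B')) ≡⟨ cong (λ n → suc (2 * n)) lengths ⟨
              suc (2 * length B) ≤⟨ thin g ⟩
              suc (2 * suc t) * Q ≡⟨ solve 2 (λ t q → (con 1 :+ con 2 :* (con 1 :+ t)) :* q := (con 1 :+ con 2 :* t) :* q :+ con 2 :* q) refl t Q ⟩
              suc (2 * t) * Q + 2 * Q ∎)
              where open +-*-Solver
            fold' : Fold (suc k) t B'
            fold' φ = plane (kernel-emb′ (suc k) (cong suc (ℕₚ.+-comm 2 k)) φ)
              where
                plane : (∃ λ (ι : Emb 2 m) → ∀ x → ap φ (em ι x) ≡ 0v) → t ≤ # (λ u → ap φ u ≟v 0v) B'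
                plane (ι , ker) = ℕₚ.≤-trans main (#-mono (im? ι) (λ u → ap φ u ≟v 0v) B' (λ { u _ (z , refl) → ker z }))
                  where
                    P = em ι e₀
                    P' = em ι e₁
                    N = # (λ z → fn f (em ι z) ≟ 0f) (points 2)
                    cs-im : # (im? ι) cs ≤ N
                    cs-im = begin
                      # (im? ι) cs ≡⟨ cs-∑ (im? ι) ⟩
                      ∑ (points m) (λ c → ind (fn f c ≟ 0f) * ind (im? ι c)) ≤⟨ ∑-mono (points m) (λ c j → cell c j (fn f c ≟ 0f) (im? ι c)) ⟩
                      ∑ (points m) (λ c → ∑ (points 2) (λ z → ind (fn f (em ι z) ≟ 0f) * ind (c ∼? em ι z))) ≡⟨ ∑-swap (points m) (points 2) _ ⟩
                      ∑ (points 2) (λ z → ∑ (points m) (λ c → ind (fn f (em ι z) ≟ 0f) * ind (c ∼? em ι z))) ≡⟨ ∑-cong (points 2) (λ z j → trans (∑-*ˡ (points m) (ind (fn f (em ι z) ≟ 0f)) _)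
                        (trans (cong (ind (fn f (em ι z) ≟ 0f) *_) (point-count′ (em ι z) (λ e → points-≢0 j (injective ι z e)))) (ℕₚ.*-identityʳ _))) ⟩
                      N ∎
                      where
                        cell : ∀ c → c ∈ points m → (d : Dec (fn f c ≡ 0f)) (i : Dec (∃ λ z → em ι z ≡ c)) → ind d * ind i ≤ ∑ (points 2) (λ z → ind (fn f (em ι z) ≟ 0f) * ind (c ∼? em ι z))
                        cell c j (no _) i = z≤n
                        cell c j (yes _) (no _) = z≤n
                        cell c j (yes zc) (yes (z₀ , refl)) = let (z , k , s) = normalise z₀ (λ e → points-≢0 j (trans (cong (em ι) e) (ap-0 (lin ι)))) in
                          ℕₚ.≤-trans (ℕₚ.≤-reflexive (sym (cong₂ _*_ (ind-yes (fn f (em ι z) ≟ 0f) (subspace-invariant (kernel-subspace f) (λ e → points-≢0 k (injective ι z e)) (∼-sym (points-≢0 j) (∼-ap (lin ι) s)) zc)) (ind-yes (em ι z₀ ∼? em ι z) (∼-ap (lin ι) s)))))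
                            (∑-≤-member (points 2) (λ z → ind (fn f (em ι z) ≟ 0f) * ind (em ι z₀ ∼? em ι z)) k)
                    im-span : # (onSpan? P P') B ≡ # (im? ι) B
                    im-span = #-cong (onSpan? P P') (im? ι) B
                      (λ { u _ (a , b , e) → a *v e₀ +v b *v e₁ , trans (ap-+ (lin ι) _ _) (trans (cong₂ _+v_ (ap-* (lin ι) a e₀) (ap-* (lin ι) b e₁)) (sym e)) })
                      (λ { u _ ((a ∷ b ∷ []) , e) → a , b , trans (sym e) (trans (cong (em ι) (cong₂ _∷_ (sym (trans (cong₂ _⊕_ (R.*-identityʳ a) (R.zeroʳ b)) (R.+-identityʳ a)))
                          (cong (_∷ []) (sym (trans (cong₂ _⊕_ (R.zeroʳ a) (R.*-identityʳ b)) (R.+-identityˡ b)))))) (trans (ap-+ (lin ι) (a *v e₀) (b *v e₁)) (cong₂ _+v_ (ap-* (lin ι) a e₀) (ap-* (lin ι) b e₁)))) })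
                    indep : Independent P P'
                    indep = (λ e → 1≢0 (cong hd (injective ι e₀ e))) , λ c e → 1≢0 (trans (cong (λ v → hd (ap tailL v)) (em-injective ι {e₁} {c *v e₀} (trans e (sym (ap-* (lin ι) c e₀))))) (R.zeroʳ c))
                    main : t ≤ # (im? ι) B'
                    main = cases (every-line-congruent g ess indep) (zero-or-not (f ∘F lin ι))
                      where
                        total : # (im? ι) B ≡ # (im? ι) cs + # (im? ι) B'
                        total = count (im? ι) (subspace-invariant (image-subspace ι))
                        cases : Congruent (suc t) (# (onSpan? P P') B) → Nontrivial (f ∘F lin ι) ⊎ (∀ z → fn f (em ι z) ≡ 0f) → t ≤ # (im? ι) B'
                        cases _ (inj₁ (z₀ , nz₀)) = ℕₚ.+-cancelˡ-≤ 1 _ _ (begin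
                            suc t ≤⟨ span-fold indep B (fold g) ⟩
                            # (onSpan? P P') B ≡⟨ trans im-span total ⟩
                            # (im? ι) cs + # (im? ι) B' ≤⟨ ℕₚ.+-monoˡ-≤ _ (ℕₚ.≤-trans cs-im one) ⟩
                            1 + # (im? ι) B' ∎)
                          where
                            one : N ≤ 1
                            one = ℕₚ.+-cancelʳ-≤ p _ _ (begin
                              N + p ≤⟨ ℕₚ.+-monoʳ-≤ N (ℕₚ.≤-trans (ℕₚ.≤-reflexive (sym (ℕₚ.*-identityʳ p))) (points-outside (kernel-subspace (f ∘F lin ι)) (λ z → fn f (em ι z) ≟ 0f) nz₀)) ⟩
                              N + # (λ z → ¬? (fn f (em ι z) ≟ 0f)) (points 2) ≡⟨ #-compl (λ z → fn f (em ι z) ≟ 0f) (points 2) ⟩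
                              Θ 2 ≡⟨ Θ-2 ⟩
                              1 + p ∎)
                        cases (j , e) (inj₂ all-zero) = ℕₚ.+-cancelˡ-≤ (suc p) _ _ (begin
                            suc p + t ≡⟨ trans (cong suc (ℕₚ.+-comm p t)) refl ⟩
                            suc t + p ≤⟨ heavy j e ⟩
                            # (onSpan? P P') B ≡⟨ trans im-span total ⟩
                            # (im? ι) cs + # (im? ι) B' ≤⟨ ℕₚ.+-monoˡ-≤ _ (ℕₚ.≤-trans cs-im (ℕₚ.≤-trans (#-≤-length (λ z → fn f (em ι z) ≟ 0f) (points 2)) (ℕₚ.≤-reflexive Θ-2))) ⟩
                            suc p + # (im? ι) B' ∎)
                          where
                            heavy : ∀ j → # (onSpan? P P') B ≡ suc t + j * p → suc t + p ≤ # (onSpan? P P') B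
                            heavy zero e = ⊥-elim (ℕₚ.<-irrefl refl (begin-strict
                              suc p ≡⟨ Θ-2 ⟨
                              Θ 2 ≤⟨ all-present-count ι B (nz g) (λ z j → full (em ι z) (λ e → points-≢0 j (injective ι z e)) (all-zero z)) ⟩
                              # (im? ι) B ≡⟨ trans (sym im-span) e ⟩
                              suc t + 0 ≡⟨ ℕₚ.+-identityʳ (suc t) ⟩
                              suc t <⟨ s≤s (ℕₚ.≤-trans (s≤s (ℕₚ.m≤m+n t _)) (ℕₚ.≤-trans (ℕₚ.n≤1+n _) t<p)) ⟩
                              suc p ∎))
                            heavy (suc j) e = ℕₚ.≤-trans (ℕₚ.+-monoʳ-≤ (suc t) (ℕₚ.m≤m+n p (j * p))) (ℕₚ.≤-reflexive (sym e))

  -- The induction for sums of hyperplanes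

  dual-point : ∀ (u : V 2) → ¬ (u ≡ 0v) → ∃ λ c → c ∈ points 2 × (∀ P → ¬ (P ≡ 0v) → fn (dotF c) P ≡ 0f → u ∼ P)
  dual-point u nu = frame (isoVec u nu)
    where
      axis : ∀ (v : V 2) → hd (ap tailL v) ≡ 0f → v ∼ e₀
      axis (x ∷ y ∷ []) z = x , cong₂ _∷_ (sym (R.*-identityʳ x)) (cong (_∷ []) (trans z (sym (R.zeroʳ x))))
      frame : (∃ λ (M : Iso 2) → ap (to M) u ≡ e₀) → ∃ λ c → c ∈ points 2 × (∀ P → ¬ (P ≡ 0v) → fn (dotF c) P ≡ 0f → u ∼ P)
      frame (M , e) = dual (normal-functional f (ap (from M) e₁ , λ z → 1≢0 (trans (sym (cong (λ v → hd (ap tailL v)) (to-from M e₁))) z)))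
        where
          f : Fun 2
          f = (headF ∘F tailL) ∘F to M
          dual : (∃ λ c → c ∈ points 2 × (∀ P → fn f P ≡ 0f → fn (dotF c) P ≡ 0f) × (∀ P → fn (dotF c) P ≡ 0f → fn f P ≡ 0f)) →
                 ∃ λ c → c ∈ points 2 × (∀ P → ¬ (P ≡ 0v) → fn (dotF c) P ≡ 0f → u ∼ P)
          dual (c , j , _ , back) = c , j , λ P nP z → ∼-sym nP (∼-em (isoE M) (subst (ap (to M) P ∼_) (sym e) (axis (ap (to M) P) (back P z))))

  -- On a projective line the hyperplanes are the points. The two bounds force exactly `t` elements,
  -- and each is its own summand.
  hyperplane-sum-0 : ∀ t (B : List (V 2)) → Nonzero B → Fold 0 t B → Thin 0 t B → HyperplaneSum t B
  hyperplane-sum-0 t B nz fold thin = build (duals B nz)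
    where
      Duals : List (V 2) → Set
      Duals B = ∃ λ (hs : List (V 2)) → length hs ≡ length B × (∀ h → h ∈ hs → h ∈ points 2) × Domination hs B
      add : ∀ u B → (∃ λ c → c ∈ points 2 × (∀ P → ¬ (P ≡ 0v) → fn (dotF c) P ≡ 0f → u ∼ P)) → Duals B → Duals (u ∷ B)
      add u B (c , j , h) (hs , l , hs∈ , dom) = c ∷ hs , cong suc l , (λ { _ (here refl) → j ; v (there i) → hs∈ v i }) ,
            λ P nP → ℕₚ.+-mono-≤ (ind-mono (fn (dotF c) P ≟ 0f) (u ∼? P) (h P nP)) (dom P nP)
      duals : ∀ B → Nonzero B → Duals B
      duals [] nz = [] , refl , (λ _ ()) , λ _ _ → z≤n
      duals (u ∷ B) nz = add u B (dual-point u (nz u (here refl))) (duals B (λ v j → nz v (there j)))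
      size : length B ≡ t
      size = ℕₚ.≤-antisym (ℕₚ.*-cancelˡ-≤ 2 (ℕₚ.≤-pred (ℕₚ.≤-trans thin (ℕₚ.≤-reflexive (ℕₚ.*-identityʳ _))))) (ℕₚ.≤-trans (fold zeroL) (#-≤-length (λ u → ap (zeroL {2} {0}) u ≟v 0v) B))
      build : Duals B → HyperplaneSum t B
      build (hs , l , rest) = hs , trans l size , rest

  Solved : ℕ → ℕ → Set
  Solved k t = suc (2 * t) ≤ p → (B : List (V (suc (suc k)))) → Nonzero B → Fold k t B → Thin k t B → HyperplaneSum t B

  -- The hyperplane is found in, and removed from, a subset `B'` all of whose elements are
  -- essential; domination then passes up to `B`.
  hyperplane-sum-step : ∀ k t → (∀ e → Solved k e) → Solved (suc k) t → Solved (suc k) (suc t)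
  hyperplane-sum-step k t byQuotient byRemoval t<p B nz fold thin = start (S.minimal (length B) B ℕₚ.≤-refl fold)
    where
      module S = Step k (suc t) t<p
      module Rm = Removal k t t<p
      t<p-pred : suc (2 * t) ≤ p
      t<p-pred = ℕₚ.≤-trans (s≤s (ℕₚ.*-monoʳ-≤ 2 (ℕₚ.n≤1+n t))) t<p
      start : (∃ λ B' → S.Sub B' B × Fold (suc k) (suc t) B' × S.AllEssential B') → HyperplaneSum (suc t) B
      start (B' , sub , fold' , ess) = element (ℕₚ.<-≤-trans (s≤s z≤n) (ℕₚ.≤-trans (fold' zeroL) (#-≤-length (λ u → ap (zeroL {_} {suc k}) u ≟v 0v) B'))) B' refl
        where
          good : S.Good B'
          good = record { nz = λ u j → nz u (S.sub-∈ sub j) ; fold = fold'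
                        ; thin = ℕₚ.≤-trans (s≤s (ℕₚ.*-monoʳ-≤ 2 (S.sub-length sub))) thin }
          element : 0 < length B' → ∀ B″ → B″ ≡ B' → HyperplaneSum (suc t) B
          element () [] refl
          element _ (u₀ ∷ B₀) refl = frame (isoVec u₀ (S.Good.nz good u₀ (here refl)))
            where
              frame : (∃ λ (M : Iso _) → ap (to M) u₀ ≡ e₀) → HyperplaneSum (suc t) B
              frame (M , e₀≡) = conclude (Qt.full-hyperplane (byQuotient Qt.e (ℕₚ.≤-trans (s≤s (ℕₚ.*-monoʳ-≤ 2 Qt.e≤t)) t<p) Qt.Bq Qt.Bq-nonzero Qt.Bq-fold Qt.Bq-thin))
                where
                  BM = map (ap (to M)) B'
                  module Qt = S.Quotient {BM} (S.good-map M good) (S.essential-map M ess) {ap (to M) u₀} (here refl) (subst (_∼ e₀) (sym e₀≡) ∼-refl)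
                  conclude : (∃ λ (f : Fun _) → Nontrivial f × Qt.Full f) → HyperplaneSum (suc t) B
                  conclude (f' , (w , nw) , full') = finish (Rm.remove-hyperplane good ess f nt full) (normal-functional f nt)
                    where
                      f = f' ∘F to M
                      nt : Nontrivial f
                      nt = ap (from M) w , λ z → nw (trans (sym (cong (fn f') (to-from M w))) z)
                      full : ∀ R → ¬ (R ≡ 0v) → fn f R ≡ 0f → ∃ λ u → u ∈ B' × u ∼ R
                      full R nR z with full' (ap (to M) R) (iso-≢0 M nR) z
                      ... | v , j , s with ∈-map⁻ (ap (to M)) j
                      ...   | u , j' , refl = u , j' , ∼-em (isoE M) s
                      finish : (∃ λ B₂ → Nonzero B₂ × Fold (suc k) t B₂ × Thin (suc k) t B₂ × (∀ P → ¬ (P ≡ 0v) → ind (fn f P ≟ 0f) + # (_∼? P) B₂ ≤ # (_∼? P) B')) →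
                               (∃ λ c → c ∈ points _ × (∀ u → fn f u ≡ 0f → fn (dotF c) u ≡ 0f) × (∀ u → fn (dotF c) u ≡ 0f → fn f u ≡ 0f)) → HyperplaneSum (suc t) B
                      finish (B₂ , nz₂ , fold₂ , thin₂ , dom₂) (c , jc , _ , c⇒f) = join (byRemoval t<p-pred B₂ nz₂ fold₂ thin₂)
                        where
                          join : HyperplaneSum t B₂ → HyperplaneSum (suc t) B
                          join (hs , l , hs∈ , dom) = c ∷ hs , cong suc l , (λ { _ (here refl) → jc ; v (there i) → hs∈ v i }) ,
                            λ P nP → ℕₚ.≤-trans (ℕₚ.+-mono-≤ (ind-mono (fn (dotF c) P ≟ 0f) (fn f P ≟ 0f) (c⇒f P)) (dom P nP)) (ℕₚ.≤-trans (dom₂ P nP) (S.sub-count sub (_∼? P)))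

  abstract
    hyperplane-sum : ∀ k t → Solved k t
    hyperplane-sum zero t _ = hyperplane-sum-0 t
    hyperplane-sum (suc k) zero t<p B nz fold thin = [] , refl , (λ _ ()) , λ _ _ → z≤n
    hyperplane-sum (suc k) (suc t) = hyperplane-sum-step k t (hyperplane-sum k) (hyperplane-sum (suc k) t)

  -- Multiplicities of summands as integer parts

  module _ {q t i i' w L : ℕ} (lower : i * q ≤ w) (upper : w + i' * q ≤ L) (total : i + i' ≡ t) (thin : suc (2 * L) ≤ suc (2 * t) * q) where

    -- Each of the `i'` summands that do not lie inside takes at least `q` elements away, so the
    -- excess over `i q` inside is no larger than the total excess over `t q`.
    floor-thin : suc (2 * w) ≤ suc (2 * i) * q
    floor-thin = ℕₚ.+-cancelʳ-≤ (2 * (i' * q)) _ _ (begin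
      suc (2 * w) + 2 * (i' * q) ≡⟨ solve 2 (λ w x → (con 1 :+ con 2 :* w) :+ con 2 :* x := con 1 :+ con 2 :* (w :+ x)) refl w (i' * q) ⟩
      suc (2 * (w + i' * q)) ≤⟨ s≤s (ℕₚ.*-monoʳ-≤ 2 upper) ⟩
      suc (2 * L) ≤⟨ thin ⟩
      suc (2 * t) * q ≡⟨ cong (λ n → suc (2 * n) * q) total ⟨
      suc (2 * (i + i')) * q ≡⟨ solve 3 (λ i j q → (con 1 :+ con 2 :* (i :+ j)) :* q := (con 1 :+ con 2 :* i) :* q :+ con 2 :* (j :* q)) refl i i' q ⟩
      suc (2 * i) * q + 2 * (i' * q) ∎)
      where
        open ℕₚ.≤-Reasoning
        open +-*-Solver

    -- Together with `lower` this makes `i` the integer part of `w / q`, a number that does not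
    -- depend on the chosen decomposition.
    floor-max : ∀ j → j * q ≤ w → j ≤ i
    floor-max j h = ℕₚ.≮⇒≥ (λ i<j → ℕₚ.<-irrefl refl (begin-strict
      2 * w <⟨ floor-thin ⟩
      suc (2 * i) * q ≤⟨ ℕₚ.*-monoˡ-≤ q (ℕₚ.≤-trans (ℕₚ.≤-trans (ℕₚ.n≤1+n _) (ℕₚ.≤-reflexive (sym (ℕₚ.*-suc 2 i)))) (ℕₚ.*-monoʳ-≤ 2 i<j)) ⟩
      2 * j * q ≡⟨ ℕₚ.*-assoc 2 j q ⟩
      2 * (j * q) ≤⟨ ℕₚ.*-monoʳ-≤ 2 h ⟩
      2 * w ∎))
      where open ℕₚ.≤-Reasoning

  dotF-+ : ∀ {m} (a b u : V m) → fn (dotF (a +v b)) u ≡ fn (dotF a) u ⊕ fn (dotF b) u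
  dotF-+ [] [] [] = sym (R.+-identityʳ 0f)
  dotF-+ (x ∷ a) (y ∷ b) (z ∷ u) = trans (cong₂ _⊕_ (R.distribʳ z x y) (dotF-+ a b u)) (⊕-exchange (x ⊗ z) (y ⊗ z) (fn (dotF a) u) (fn (dotF b) u))

  dotF-sym : ∀ {m} (a u : V m) → fn (dotF a) u ≡ fn (dotF u) a
  dotF-sym [] [] = refl
  dotF-sym (x ∷ a) (y ∷ u) = cong₂ _⊕_ (R.*-comm x y) (dotF-sym a u)

  points-∼⇒≡ : ∀ {m} {a b : V m} → a ∈ points m → b ∈ points m → a ∼ b → a ≡ b
  points-∼⇒≡ {suc m} ja jb s with ∈-++⁻ (map (1f ∷_) (vecs m)) ja | ∈-++⁻ (map (1f ∷_) (vecs m)) jb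
  ... | inj₁ x | inj₁ y with ∈-map⁻ (1f ∷_) x | ∈-map⁻ (1f ∷_) y
  ...   | v , _ , refl | v' , _ , refl = cong (1f ∷_) (trans (cong (ap tailL) (proj₂ s)) (trans (cong (_*v v') (trans (sym (R.*-identityʳ (proj₁ s))) (sym (cong hd (proj₂ s))))) (1-*v v')))
  points-∼⇒≡ {suc m} ja jb s | inj₁ x | inj₂ y with ∈-map⁻ (1f ∷_) x | ∈-map⁻ (0f ∷_) y
  ...   | v , _ , refl | v' , _ , refl = ⊥-elim (1≢0 (trans (cong hd (proj₂ s)) (R.zeroʳ (proj₁ s))))
  points-∼⇒≡ {suc m} ja jb s | inj₂ x | inj₁ y with ∈-map⁻ (0f ∷_) x | ∈-map⁻ (1f ∷_) y
  ...   | v , j , refl | v' , _ , refl = ⊥-elim (points-≢0 j (trans (cong (ap tailL) (proj₂ s)) (trans (cong (_*v v') (trans (sym (R.*-identityʳ (proj₁ s))) (sym (cong hd (proj₂ s))))) (0-*v v'))))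
  points-∼⇒≡ {suc m} ja jb s | inj₂ x | inj₂ y with ∈-map⁻ (0f ∷_) x | ∈-map⁻ (0f ∷_) y
  ...   | v , j , refl | v' , j' , refl = cong (0f ∷_) (points-∼⇒≡ j j' (proj₁ s , cong (ap tailL) (proj₂ s)))

  -- Subtracting a multiple of `u₀` moves any `u` into the kernel of `h`. So `c` is a multiple of
  -- `h`, and normalised vectors that are proportional are equal.
  vanishing-on-kernel : ∀ {m} {c h : V m} → c ∈ points m → h ∈ points m → (∀ u → fn (dotF h) u ≡ 0f → fn (dotF c) u ≡ 0f) → c ≡ h
  vanishing-on-kernel {m} {c} {h} jc jh van = build (dotF-nontrivial (points-≢0 jh))
    where
      build : Nontrivial (dotF h) → c ≡ h
      build (u₀ , n) = points-∼⇒≡ jc jh (d , difference-zero (decidable-stable ((c +v (-v (d *v h))) ≟v 0v) (λ ne → proj₂ (dotF-nontrivial ne) (zero-everywhere _))))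
        where
          a = fn (dotF h) u₀
          d = inv a ⊗ fn (dotF c) u₀
          zero-everywhere : ∀ u → fn (dotF (c +v (-v (d *v h)))) u ≡ 0f
          zero-everywhere u = begin
            fn (dotF (c +v (-v (d *v h)))) u ≡⟨ trans (dotF-+ c _ u) (cong (fn (dotF c) u ⊕_) (trans (dotF-* (-f 1f) (d *v h) u) (cong ((-f 1f) ⊗_) (dotF-* d h u)))) ⟩
            fn (dotF c) u ⊕ (-f 1f) ⊗ (d ⊗ fn (dotF h) u) ≡⟨ cong (fn (dotF c) u ⊕_) (cong ((-f 1f) ⊗_) (trans (R.*-assoc (inv a) _ _) (trans (cong (inv a ⊗_) (R.*-comm _ _)) (sym (R.*-assoc (inv a) _ _))))) ⟩
            fn (dotF c) u ⊕ (-f 1f) ⊗ (s ⊗ fn (dotF c) u₀) ≡⟨ cong (fn (dotF c) u ⊕_) (sym (trans (fn-* (dotF c) (-f 1f) (s *v u₀)) (cong ((-f 1f) ⊗_) (fn-* (dotF c) s u₀)))) ⟩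
            fn (dotF c) u ⊕ fn (dotF c) (-v (s *v u₀)) ≡⟨ fn-+ (dotF c) u _ ⟨
            fn (dotF c) (u +v (-v (s *v u₀))) ≡⟨ van _ (begin
              fn (dotF h) (u +v (-v (s *v u₀))) ≡⟨ trans (fn-+ (dotF h) u _) (cong (fn (dotF h) u ⊕_) (trans (fn-* (dotF h) (-f 1f) (s *v u₀)) (cong ((-f 1f) ⊗_) (fn-* (dotF h) s u₀)))) ⟩
              fn (dotF h) u ⊕ (-f 1f) ⊗ ((inv a ⊗ fn (dotF h) u) ⊗ a) ≡⟨ cong (λ x → fn (dotF h) u ⊕ (-f 1f) ⊗ x) (trans (R.*-comm _ a) (trans (sym (R.*-assoc a (inv a) _)) (trans (cong (_⊗ fn (dotF h) u) (inv-law n)) (R.*-identityˡ _)))) ⟩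
              fn (dotF h) u ⊕ (-f 1f) ⊗ fn (dotF h) u ≡⟨ cong (fn (dotF h) u ⊕_) (trans (sym (-‿distribˡ-* 1f _)) (cong -f_ (R.*-identityˡ _))) ⟩
              fn (dotF h) u ⊕ (-f fn (dotF h) u) ≡⟨ R.-‿inverseʳ _ ⟩
              0f ∎) ⟩
            0f ∎
            where
              open ≡-Reasoning
              s = inv a ⊗ fn (dotF h) u

  axis : ∀ {m} (v : V (suc m)) → ap tailL v ≡ 0v → v ∼ e₀
  axis (x ∷ v) z = x , cong₂ _∷_ (sym (R.*-identityʳ x)) (trans z (sym (*v-0 x)))

  -- Projections from a point and traces in hyperplanes

  record Projection {n} (Q : V (suc n)) : Set where
    field
      π : Lin (suc n) n
      section : Lin n (suc n)
      π-section : ∀ v → ap π (ap section v) ≡ v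
      π-kernel : ∀ u → ap π u ≡ 0v → u ∼ Q
      π-centre : ap π Q ≡ 0v

    section-π : ∀ u → ∃ λ d → u ≡ ap section (ap π u) +v d *v Q
    section-π u = let (d , e) = π-kernel (u +v (-v (ap section (ap π u)))) (trans (ap-+ π u _) (trans (cong (ap π u +v_) (trans (ap-* π (-f 1f) _) (cong -v_ (π-section _)))) (-v-inverse _)))
      in d , sym (trans (cong (ap section (ap π u) +v_) (sym e)) (trans (+v-comm _ _) (trans (+v-assoc u _ _) (trans (cong (u +v_) (trans (+v-comm _ _) (-v-inverse _))) (+v-0 u)))))

  project : ∀ {n} (Q : V (suc n)) → ¬ (Q ≡ 0v) → Projection Q
  project Q nQ = build (isoVec Q nQ)
    where
      build : (∃ λ (M : Iso _) → ap (to M) Q ≡ e₀) → Projection Q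
      build (M , e) = record
        { π = tailL ∘L to M ; section = from M ∘L lin consE
        ; π-section = λ v → cong (ap tailL) (to-from M (0f ∷ v))
        ; π-kernel = λ u z → ∼-em (isoE M) (subst (ap (to M) u ∼_) (sym e) (axis (ap (to M) u) z))
        ; π-centre = cong (ap tailL) e }

  nonzero-project : ∀ {n} {Q : V (suc n)} (pj : Projection Q) (B : List (V (suc n))) → Missing Q B → Nonzero (map (ap (Projection.π pj)) B)
  nonzero-project pj B miss v j z with ∈-map⁻ (ap (Projection.π pj)) j
  ... | u , j' , refl = miss u j' (Projection.π-kernel pj u z)

  module HyperplaneWeights {k t : ℕ} {B : List (V (suc (suc k)))} (nz : Nonzero B) (thin : Thin k t B) (hsum : HyperplaneSum t B) where

    hs = proj₁ hsum

    i : V (suc (suc k)) → ℕ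
    i c = # (_≟v c) hs

    i' : V (suc (suc k)) → ℕ
    i' c = # (λ h → ¬? (h ≟v c)) hs

    i-total : ∀ c → i c + i' c ≡ t
    i-total c = trans (#-compl (_≟v c) hs) (proj₁ (proj₂ hsum))

    w : V (suc (suc k)) → ℕ
    w c = # (λ u → fn (dotF c) u ≟ 0f) B

    private
      dom : ∀ P → P ∈ points (suc (suc k)) → # (λ h → fn (dotF h) P ≟ 0f) hs ≤ # (_∼? P) B
      dom P j = proj₂ (proj₂ (proj₂ hsum)) P (points-≢0 j)

    w-lower : ∀ {c} → c ∈ points (suc (suc k)) → i c * p ^ k ≤ w c
    w-lower {c} jc = dominated-count B nz (λ u → fn (dotF c) u ≟ 0f) (subspace-invariant (kernel-subspace (dotF c))) hs (λ h P → fn (dotF h) P ≟ 0f) dom (_≟v c) (p ^ k)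
      (λ { h _ refl → ℕₚ.≤-trans (Θ-≥ k) (ℕₚ.≤-trans (kernel-points (dotF c) (dotF-nontrivial (points-≢0 jc)))
        (#-mono (λ P → fn (dotF c) P ≟ 0f) (λ P → (fn (dotF c) P ≟ 0f) ×-dec (fn (dotF c) P ≟ 0f)) (points (suc (suc k))) (λ _ _ z → z , z))) })

    -- A summand other than `c` meets `c` in a proper subspace of itself and so has at least `p ^ k`
    -- points off `c`.
    w-upper : ∀ {c} → c ∈ points (suc (suc k)) → w c + i' c * p ^ k ≤ length B
    w-upper {c} jc = ℕₚ.≤-trans (ℕₚ.+-monoʳ-≤ (w c) (dominated-count B nz (λ u → ¬? (fn (dotF c) u ≟ 0f)) (complement-invariant (kernel-subspace (dotF c))) hs (λ h P → fn (dotF h) P ≟ 0f) dom (λ h → ¬? (h ≟v c)) (p ^ k) outside))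
        (ℕₚ.≤-reflexive (#-compl (λ u → fn (dotF c) u ≟ 0f) B))
      where
        outside : ∀ h → h ∈ hs → ¬ (h ≡ c) → p ^ k ≤ # (λ P → (fn (dotF h) P ≟ 0f) ×-dec ¬? (fn (dotF c) P ≟ 0f)) (points (suc (suc k)))
        outside h jh ne = cases (zero-or-not (dotF c ∘F lin incl))
          where
            jh' = proj₁ (proj₂ (proj₂ hsum)) h jh
            open Hyperplane (hyperplane (dotF h) (dotF-nontrivial (points-≢0 jh')))
            cases : Nontrivial (dotF c ∘F lin incl) ⊎ (∀ z → fn (dotF c) (em incl z) ≡ 0f) → p ^ k ≤ # (λ P → (fn (dotF h) P ≟ 0f) ×-dec ¬? (fn (dotF c) P ≟ 0f)) (points (suc (suc k)))
            cases (inj₁ (z₀ , n₀)) = ℕₚ.≤-trans (points-outside (kernel-subspace (dotF c ∘F lin incl)) (λ z → fn (dotF c) (em incl z) ≟ 0f) n₀)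
              (ℕₚ.≤-trans (image-points incl (λ u → ¬? (fn (dotF c) u ≟ 0f)) (complement-invariant (kernel-subspace (dotF c))))
                (#-mono (λ P → im? incl P ×-dec ¬? (fn (dotF c) P ≟ 0f)) (λ P → (fn (dotF h) P ≟ 0f) ×-dec ¬? (fn (dotF c) P ≟ 0f)) (points (suc (suc k))) (λ { P _ ((z , refl) , n) → in-kernel z , n })))
            cases (inj₂ z) = ⊥-elim (ne (sym (vanishing-on-kernel jc jh' (λ u zu → trans (cong (fn (dotF c)) (sym (incl-retr u zu))) (z (ap retr u))))))

    i-max : ∀ {c} → c ∈ points (suc (suc k)) → ∀ j → j * p ^ k ≤ w c → j ≤ i c
    i-max {c} jc = floor-max {q = p ^ k} {t} {i c} {i' c} {w c} {length B} (w-lower jc) (w-upper jc) (i-total c) thin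

    i-thin : ∀ {c} → c ∈ points (suc (suc k)) → suc (2 * w c) ≤ suc (2 * i c) * p ^ k
    i-thin {c} jc = floor-thin {q = p ^ k} {t} {i c} {i' c} {w c} {length B} (w-lower jc) (w-upper jc) (i-total c) thin

  -- For `r = 0` the hyperplane occurs at least `j` times as a summand, and it meets the kernel of
  -- `φ` in a point, whose weight is at least `j` by domination. For larger `r`, an intersection
  -- with fewer than `j ≤ t < p` elements would have a missing point, and projection from it
  -- preserves both counts.
  hyperplane-fold : ∀ r k t → suc (2 * t) ≤ p → (B : List (V (suc (suc r + k)))) → Nonzero B → Fold k t B → Thin k t B →
    ∀ f → Nontrivial f → ∀ j → j * p ^ k ≤ # (λ u → fn f u ≟ 0f) B → ∀ (φ : Lin (suc (suc r + k)) k) →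
    j ≤ # (λ u → (fn f u ≟ 0f) ×-dec (ap φ u ≟v 0v)) B
  hyperplane-fold zero k t t<p B nz fold thin f nt j h φ = main (normal-functional f nt) (kernel-emb′ {1} (suc k) (cong suc (ℕₚ.+-comm 1 k)) (consL f φ))
    where
      module HW = HyperplaneWeights {k} {t} nz thin (hyperplane-sum k t t<p B nz fold thin)
      main : (∃ λ c → c ∈ points _ × (∀ u → fn f u ≡ 0f → fn (dotF c) u ≡ 0f) × (∀ u → fn (dotF c) u ≡ 0f → fn f u ≡ 0f)) →
             (∃ λ (ι : Emb 1 (suc (suc k))) → ∀ x → ap (consL f φ) (em ι x) ≡ 0v) → j ≤ # (λ u → (fn f u ≟ 0f) ×-dec (ap φ u ≟v 0v)) B
      main (c , jc , f⇒c , c⇒f) (ι , ker) = begin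
        j ≤⟨ HW.i-max jc j (ℕₚ.≤-trans h (#-mono (λ u → fn f u ≟ 0f) (λ u → fn (dotF c) u ≟ 0f) B (λ u _ → f⇒c u))) ⟩
        # (_≟v c) HW.hs ≤⟨ #-mono (_≟v c) (λ h → fn (dotF h) P ≟ 0f) HW.hs (λ { h _ refl → f⇒c P (cong hd (ker e₀)) }) ⟩
        # (λ h → fn (dotF h) P ≟ 0f) HW.hs ≤⟨ proj₂ (proj₂ (proj₂ (hyperplane-sum k t t<p B nz fold thin))) P (λ e → 1≢0 (cong hd (injective ι e₀ e))) ⟩
        # (_∼? P) B ≤⟨ #-mono (_∼? P) (λ u → (fn f u ≟ 0f) ×-dec (ap φ u ≟v 0v)) B (λ u _ s → split (subspace-in s)) ⟩
        # (λ u → (fn f u ≟ 0f) ×-dec (ap φ u ≟v 0v)) B ∎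
        where
          open ℕₚ.≤-Reasoning
          P = em ι e₀
          subspace-in : ∀ {u} → u ∼ P → ap (consL f φ) u ≡ 0v
          subspace-in (d , refl) = trans (ap-* (consL f φ) d P) (trans (cong (d *v_) (ker e₀)) (*v-0 d))
          split : ∀ {u} → ap (consL f φ) u ≡ 0v → fn f u ≡ 0f × ap φ u ≡ 0v
          split z = cong hd z , cong (ap tailL) z
  hyperplane-fold (suc r) k t t<p B nz fold thin f nt j h φ = cases (j ℕ.≤? N)
    where
      N = # (λ u → (fn f u ≟ 0f) ×-dec (ap φ u ≟v 0v)) B
      j≤t : j ≤ t
      j≤t = ℕₚ.≮⇒≥ (λ t<j → ℕₚ.<-irrefl refl (begin-strict
        2 * length B <⟨ thin ⟩
        suc (2 * t) * p ^ k ≤⟨ ℕₚ.*-monoˡ-≤ (p ^ k) (ℕₚ.≤-trans (ℕₚ.≤-trans (ℕₚ.n≤1+n _) (ℕₚ.≤-reflexive (sym (ℕₚ.*-suc 2 t)))) (ℕₚ.*-monoʳ-≤ 2 t<j)) ⟩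
        2 * j * p ^ k ≡⟨ ℕₚ.*-assoc 2 j _ ⟩
        2 * (j * p ^ k) ≤⟨ ℕₚ.*-monoʳ-≤ 2 (ℕₚ.≤-trans h (#-≤-length (λ u → fn f u ≟ 0f) B)) ⟩
        2 * length B ∎))
        where open ℕₚ.≤-Reasoning
      both : ∀ u → ap (consL f φ) u ≡ 0v → fn f u ≡ 0f × ap φ u ≡ 0v
      both u z = cong hd z , cong (ap tailL) z
      cases : Dec (j ≤ N) → j ≤ N
      cases (yes l) = l
      cases (no nl) = centre (missing-in-kernel (suc k) dims (consL f φ) B nz (begin-strict
          # (λ u → ap (consL f φ) u ≟v 0v) B ≤⟨ #-mono (λ u → ap (consL f φ) u ≟v 0v) (λ u → (fn f u ≟ 0f) ×-dec (ap φ u ≟v 0v)) B (λ u _ → both u) ⟩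
          N <⟨ ℕₚ.≰⇒> nl ⟩
          j ≤⟨ j≤t ⟩
          t <⟨ ℕₚ.≤-trans (s≤s (ℕₚ.m≤m+n t _)) t<p ⟩
          p ∎))
        where
          open ℕₚ.≤-Reasoning
          dims : suc (suc (suc r) + k) ≡ suc k + suc (suc r)
          dims = cong suc (ℕₚ.+-comm (suc (suc r)) k)
          centre : (∃ λ Q → ap (consL f φ) Q ≡ 0v × ¬ (Q ≡ 0v) × Missing Q B) → j ≤ N
          centre (Q , zQ , nQ , miss) = begin
            j ≤⟨ hyperplane-fold r k t t<p B' (nonzero-project pj B miss) (fold-map π B fold) (thin-map {k = k} {t = t} (ap π) B thin) f' nt' j
                   (ℕₚ.≤-trans h (ℕₚ.≤-reflexive (trans (∑-cong B (λ u _ → cong (λ x → ind (x ≟ 0f)) (f≡ u))) (sym (∑-map (ap π) B _))))) φ' ⟩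
            # (λ u → (fn f' u ≟ 0f) ×-dec (ap φ' u ≟v 0v)) B' ≡⟨ ∑-map (ap π) B _ ⟩
            # (λ u → (fn f' (ap π u) ≟ 0f) ×-dec (ap φ' (ap π u) ≟v 0v)) B ≡⟨ #-cong (λ u → (fn f' (ap π u) ≟ 0f) ×-dec (ap φ' (ap π u) ≟v 0v)) (λ u → (fn f u ≟ 0f) ×-dec (ap φ u ≟v 0v)) B
                (λ u _ (a , b) → trans (f≡ u) a , trans (φ≡ u) b) (λ u _ (a , b) → trans (sym (f≡ u)) a , trans (sym (φ≡ u)) b) ⟩
            N ∎
            where
              pj = project Q nQ
              open Projection pj
              B' = map (ap π) B
              f' = f ∘F section
              φ' = φ ∘L section
              f≡ : ∀ u → fn f u ≡ fn f' (ap π u)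
              f≡ u = let (d , e) = section-π u in trans (cong (fn f) e) (trans (fn-+ f _ _) (trans (cong (fn f' (ap π u) ⊕_) (trans (fn-* f d Q) (trans (cong (d ⊗_) (proj₁ (both Q zQ))) (R.zeroʳ d)))) (R.+-identityʳ _)))
              φ≡ : ∀ u → ap φ u ≡ ap φ' (ap π u)
              φ≡ u = let (d , e) = section-π u in trans (cong (ap φ) e) (trans (ap-+ φ _ _) (trans (cong (ap φ' (ap π u) +v_) (trans (ap-* φ d Q) (trans (cong (d *v_) (proj₂ (both Q zQ))) (*v-0 d)))) (+v-0 _)))
              nt' : Nontrivial f'
              nt' = ap π (proj₁ nt) , λ z → proj₂ nt (trans (f≡ (proj₁ nt)) z)

  -- Sums of subspaces and their multiplicities

  _⊑_ : ∀ {a b n} → Emb a n → Emb b n → Set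
  S' ⊑ S = ∀ z → ∃ λ y → em S y ≡ em S' z

  _⊑?_ : ∀ {a b n} (S' : Emb a n) (S : Emb b n) → Dec (S' ⊑ S)
  S' ⊑? S = map′ (λ n z → decidable-stable (im? S (em S' z)) (λ ne → n (z , ne))) (λ h (z , ne) → ne (h z)) (¬? (∃V? (λ z → ¬? (im? S (em S' z)))))

  ⊑-trans : ∀ {a b c n} {S : Emb a n} {S' : Emb b n} {S″ : Emb c n} → S ⊑ S' → S' ⊑ S″ → S ⊑ S″
  ⊑-trans h k z = let (y , e) = h z ; (x , e') = k y in x , trans e' e

  image-size : ∀ {a n} (S : Emb a n) → # (im? S) (vecs n) ≡ p ^ a
  image-size {a} {n} S = begin
    # (im? S) (vecs n) ≡⟨ ∑-cong (vecs n) (λ v _ → sym (cell v (im? S v))) ⟩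
    ∑ (vecs n) (λ v → # (λ z → v ≟v em S z) (vecs a)) ≡⟨ ∑-swap (vecs n) (vecs a) _ ⟩
    ∑ (vecs a) (λ z → # (_≟v em S z) (vecs n)) ≡⟨ ∑-cong (vecs a) (λ z _ → vecs-count (em S z)) ⟩
    ∑ (vecs a) (λ _ → 1) ≡⟨ length-∑ (vecs a) ⟨
    length (vecs a) ≡⟨ vecs-length a ⟩
    p ^ a ∎
    where
      open ≡-Reasoning
      cell : ∀ v (d : Dec (∃ λ z → em S z ≡ v)) → # (λ z → v ≟v em S z) (vecs a) ≡ ind d
      cell v (no ne) = #-none (λ z → v ≟v em S z) (vecs a) (λ z _ e → ne (z , sym e))
      cell v (yes (z₀ , refl)) = trans (#-cong (λ z → em S z₀ ≟v em S z) (_≟v z₀) (vecs a) (λ z _ e → sym (em-injective S e)) (λ { z _ refl → refl })) (vecs-count z₀)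

  -- Both images have `p ^ a` vectors.
  ⊑-sym : ∀ {a n} {S' S : Emb a n} → S' ⊑ S → S ⊑ S'
  ⊑-sym {a} {n} {S'} {S} h z = decidable-stable (im? S' (em S z)) (λ ne → ℕₚ.<-irrefl refl (begin-strict
      p ^ a ≡⟨ image-size S' ⟨
      # (im? S') (vecs n) <⟨ ℕₚ.m<m+n _ (ℕₚ.≤-reflexive (sym (vecs-count (em S z)))) ⟩
      # (im? S') (vecs n) + # (_≟v em S z) (vecs n) ≡⟨ ∑-+ (vecs n) _ _ ⟨
      ∑ (vecs n) (λ v → ind (im? S' v) + ind (v ≟v em S z)) ≤⟨ ∑-mono (vecs n) (λ v _ → cell ne v (im? S' v) (v ≟v em S z) (im? S v)) ⟩
      # (im? S) (vecs n) ≡⟨ image-size S ⟩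
      p ^ a ∎))
    where
      open ℕₚ.≤-Reasoning
      cell : ¬ (∃ λ y → em S' y ≡ em S z) → ∀ v (d : Dec (∃ λ y → em S' y ≡ v)) (e : Dec (v ≡ em S z)) (f : Dec (∃ λ y → em S y ≡ v)) → ind d + ind e ≤ ind f
      cell ne v (yes i) (yes refl) f = ⊥-elim (ne i)
      cell ne v (yes (y , e)) (no _) f = ℕₚ.≤-reflexive (sym (ind-yes f (let (x , e') = h y in x , trans e' e)))
      cell ne v (no _) (yes e) f = ℕₚ.≤-reflexive (sym (ind-yes f (z , sym e)))
      cell ne v (no _) (no _) f = z≤n

  SubspaceSum : ∀ {n} → ℕ → ℕ → List (V n) → Set
  SubspaceSum {n} k t B = ∃ λ (Ss : List (Emb (suc k) n)) → length Ss ≡ t × (∀ P → ¬ (P ≡ 0v) → # (λ S → im? S P) Ss ≤ # (_∼? P) B)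

  module SubspaceWeights {n k t : ℕ} {B : List (V n)} (nz : Nonzero B) (thin : Thin k t B) (ssum : SubspaceSum k t B)
                         {X : V n → Set} (sub : Subspace X) (X? : ∀ u → Dec (X u)) where

    Ss = proj₁ ssum

    inside? : ∀ (S : Emb (suc k) n) → Dec (∀ z → X (em S z))
    inside? S = map′ (λ n z → decidable-stable (X? (em S z)) (λ ne → n (z , ne))) (λ h (z , ne) → ne (h z)) (¬? (∃V? (λ z → ¬? (X? (em S z)))))

    private
      dom : ∀ P → P ∈ points n → # (λ S → im? S P) Ss ≤ # (_∼? P) B
      dom P j = proj₂ (proj₂ ssum) P (points-≢0 j)

    inside-lower : # inside? Ss * p ^ k ≤ # X? B
    inside-lower = dominated-count B nz X? (subspace-invariant sub) Ss (λ S P → im? S P) dom inside? (p ^ k)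
      (λ S _ h → ℕₚ.≤-trans (Θ-≥ k) (ℕₚ.≤-trans (ℕₚ.≤-reflexive (sym (#-all (λ z → X? (em S z)) (points (suc k)) (λ z _ → h z)))) (image-points S X? (subspace-invariant sub))))

    inside-upper : # X? B + # (λ S → ¬? (inside? S)) Ss * p ^ k ≤ length B
    inside-upper = ℕₚ.≤-trans (ℕₚ.+-monoʳ-≤ (# X? B) (dominated-count B nz (λ u → ¬? (X? u)) (complement-invariant sub) Ss (λ S P → im? S P) dom (λ S → ¬? (inside? S)) (p ^ k)
        (λ S _ n → let (z₀ , n₀) = outside S n in ℕₚ.≤-trans (points-outside (preimage-subspace (lin S) sub) (λ z → X? (em S z)) n₀) (image-points S (λ u → ¬? (X? u)) (complement-invariant sub)))))
        (ℕₚ.≤-reflexive (#-compl X? B))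
      where
        outside : ∀ S → ¬ (∀ z → X (em S z)) → ∃ λ z → ¬ X (em S z)
        outside S n = decidable-stable (∃V? (λ z → ¬? (X? (em S z)))) (λ ne → n (λ z → decidable-stable (X? (em S z)) (λ nx → ne (z , nx))))

    inside-max : ∀ j → j * p ^ k ≤ # X? B → j ≤ # inside? Ss
    inside-max = floor-max {q = p ^ k} {t} {# inside? Ss} {# (λ S → ¬? (inside? S)) Ss} {# X? B} {length B} inside-lower inside-upper (trans (#-compl inside? Ss) (proj₁ (proj₂ ssum))) thin

  -- Projections that keep a point apart from the rest

  points-unique : ∀ m → Unique (points m)
  points-unique m = multiplicity-unique _≟v_ (points m) (λ x → bnd x (any? (_≟v x) (points m)))
    where
      bnd : ∀ x → Dec (Any (_≡ x) (points m)) → # (_≟v x) (points m) ≤ 1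
      bnd x (no n) = ℕₚ.≤-trans (ℕₚ.≤-reflexive (#-none (_≟v x) (points m) (λ y j e → n (lose j e)))) z≤n
      bnd x (yes a) = let (y , j , e) = find a in
        ℕₚ.≤-trans (#-mono (_≟v x) (x ∼?_) (points m) (λ { z _ refl → ∼-refl })) (ℕₚ.≤-reflexive (point-count x (subst (λ v → ¬ (v ≡ 0v)) e (points-≢0 j))))

  span-size : ∀ {n} (u P : V n) → # (onSpan? u P) (vecs n) ≤ p * p
  span-size {n} u P = begin
    # (onSpan? u P) (vecs n) ≤⟨ ∑-mono (vecs n) (λ v _ → cell v (onSpan? u P v)) ⟩
    ∑ (vecs n) (λ v → ∑ elements (λ a → ∑ elements (λ b → ind (v ≟v (a *v u +v b *v P))))) ≡⟨ ∑-swap (vecs n) elements _ ⟩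
    ∑ elements (λ a → ∑ (vecs n) (λ v → ∑ elements (λ b → ind (v ≟v (a *v u +v b *v P))))) ≡⟨ ∑-cong elements (λ a _ → ∑-swap (vecs n) elements _) ⟩
    ∑ elements (λ a → ∑ elements (λ b → # (_≟v (a *v u +v b *v P)) (vecs n))) ≡⟨ ∑-cong elements (λ a _ → trans (∑-cong elements (λ b _ → vecs-count (a *v u +v b *v P))) (sym (length-∑ elements))) ⟩
    ∑ elements (λ _ → p) ≡⟨ ∑-const elements p ⟩
    p * p ∎
    where
      open ℕₚ.≤-Reasoning
      cell : ∀ v (d : Dec (OnSpan u P v)) → ind d ≤ ∑ elements (λ a → ∑ elements (λ b → ind (v ≟v (a *v u +v b *v P))))
      cell v (no _) = z≤n
      cell v (yes (a , b , e)) = ℕₚ.≤-trans (ℕₚ.≤-reflexive (sym (ind-yes (v ≟v (a *v u +v b *v P)) e)))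
        (ℕₚ.≤-trans (∑-≤-member elements (λ b → ind (v ≟v (a *v u +v b *v P))) (elements-complete b)) (∑-≤-member elements (λ a → ∑ elements (λ b → ind (v ≟v (a *v u +v b *v P)))) (elements-complete a)))

  -- A map onto the dimension where `hyperplane-sum` applies that does not increase the weight of
  -- `P`. The section `lift` shows that it is onto.
  record GoodProjection {n} (k : ℕ) (B : List (V n)) (P : V n) : Set where
    field
      A : Lin n (suc (suc k))
      lift : Lin (suc (suc k)) n
      A-lift : ∀ v → ap A (ap lift v) ≡ v
      A-nonzero : ∀ u → u ∈ B → ¬ (ap A u ≡ 0v)
      P-nonzero : ¬ (ap A P ≡ 0v)
      P-only : ∀ u → u ∈ B → ap A u ∼ ap A P → u ∼ P

  -- A centre off all lines joining `P` to an element of `B` keeps `P` apart from the other points.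
  -- These lines cover at most `(|B| + 1) p ^ 2` vectors, fewer than there are in dimension `k + 3`
  -- or more.
  good-projection : ∀ r k (B : List (V (suc (suc r + k)))) → Nonzero B → ∀ P → ¬ (P ≡ 0v) → suc (suc (length B)) ≤ p ^ suc k → GoodProjection k B P
  good-projection zero k B nz P nP l = record
    { A = idL ; lift = idL ; A-lift = λ _ → refl ; A-nonzero = nz ; P-nonzero = nP ; P-only = λ _ _ s → s }
  good-projection (suc r) k B nz P nP l = centre (#-sequential-avoid (_≟v 0v) (λ u v → onSpan? u P v) (P ∷ B) (vecs n) (p * p) (λ u _ → span-size u P) (begin-strict
      # (_≟v 0v) (vecs n) + suc (length B) * (p * p) ≡⟨ cong (_+ suc (length B) * (p * p)) (vecs-count {n} 0v) ⟩
      1 + suc (length B) * (p * p) <⟨ ℕₚ.+-monoˡ-< (suc (length B) * (p * p)) (ℕₚ.≤-trans 1<p (ℕₚ.≤-trans (ℕₚ.≤-reflexive (sym (ℕₚ.*-identityʳ p))) (ℕₚ.*-monoʳ-≤ p 0<p))) ⟩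
      p * p + suc (length B) * (p * p) ≤⟨ ℕₚ.*-monoˡ-≤ (p * p) l ⟩
      p ^ suc k * (p * p) ≡⟨ solve 2 (λ p q → (p :* q) :* (p :* p) := p :* (p :* (p :* q))) refl p (p ^ k) ⟩
      p ^ (3 + k) ≤⟨ ℕₚ.^-monoʳ-≤ p {{ℕ.>-nonZero 0<p}} {3 + k} {n} (s≤s (s≤s (s≤s (ℕₚ.m≤n+m k r)))) ⟩
      p ^ n ≡⟨ vecs-length n ⟨
      length (vecs n) ∎))
    where
      open ℕₚ.≤-Reasoning
      open +-*-Solver
      n = suc (suc (suc r) + k)
      centre : (∃ λ Q → Q ∈ vecs n × ¬ (Q ≡ 0v) × (∀ u → u ∈ P ∷ B → ¬ OnSpan u P Q)) → GoodProjection k B P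
      centre (Q , _ , nQ , off) = compose (good-projection r k (map (ap π) B) (nonzero-project pj B missQ) (ap π P) πP≢0 (subst (λ x → suc (suc x) ≤ p ^ suc k) (sym (length-map (ap π) B)) l))
        where
          pj = project Q nQ
          open Projection pj
          missQ : Missing Q B
          missQ u j s = let (d , e) = ∼-sym (nz u j) s in off u (there j) (d , 0f , trans e (sym (trans (cong (d *v u +v_) (0-*v P)) (+v-0 _))))
          πP≢0 : ¬ (ap π P ≡ 0v)
          πP≢0 z = let (d , e) = ∼-sym nP (π-kernel P z) in off P (here refl) (d , 0f , trans e (sym (trans (cong (d *v P +v_) (0-*v P)) (+v-0 _))))
          compose : GoodProjection k (map (ap π) B) (ap π P) → GoodProjection k B P
          compose g = record
            { A = G.A ∘L π ; lift = section ∘L G.lift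
            ; A-lift = λ v → trans (cong (ap G.A) (π-section _)) (G.A-lift v)
            ; A-nonzero = λ u j → G.A-nonzero (ap π u) (∈-map⁺ _ j)
            ; P-nonzero = G.P-nonzero
            ; P-only = λ u j s → only u j (G.P-only (ap π u) (∈-map⁺ _ j) s) }
            where
              module G = GoodProjection g
              only : ∀ u → u ∈ B → ap π u ∼ ap π P → u ∼ P
              only u j (c , e) = on-line (π-kernel (u +v (-v (c *v P))) (trans (ap-+ π u _) (trans (cong₂ _+v_ e (trans (ap-* π (-f 1f) _) (cong -v_ (ap-* π c P)))) (-v-inverse _))))
                where
                  on-line : u +v (-v (c *v P)) ∼ Q → u ∼ P
                  on-line (d , e') with d ≟ 0f
                  ... | yes refl = c , difference-zero (trans e' (0-*v Q))
                  ... | no nd = ⊥-elim (off u (there j) (inv d , inv d ⊗ ((-f 1f) ⊗ c) , trans (unscale nd e') (trans (*v-+v (inv d) u _) (cong (inv d *v u +v_) (trans (cong (inv d *v_) (⊗-*v (-f 1f) c P)) (⊗-*v (inv d) _ P))))))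

  Solution : ℕ → ℕ → ℕ → Set
  Solution r k t = suc (2 * t) ≤ p → (B : List (V (suc (r + k)))) → Nonzero B → Fold k t B → Thin k t B → SubspaceSum k t B

  -- A decomposition of the part of `B` in the hyperplane `g = 0`. By the last two fields, a
  -- subspace `S` of this hyperplane occurs as often as the integer part of its weight divided by
  -- `p ^ k`.
  record Component {n} (k i : ℕ) (B : List (V n)) (g : Fun n) (T : List (Emb (suc k) n)) : Set where
    field
      size : length T ≡ i
      inside : ∀ S → S ∈ T → ∀ z → fn g (em S z) ≡ 0f
      full : ∀ S → S ∈ T → ∀ z → ¬ (z ≡ 0v) → ∃ λ u → u ∈ B × u ∼ em S z
      multiplicity-lower : ∀ (S : Emb (suc k) n) → (∀ z → fn g (em S z) ≡ 0f) → # (_⊑? S) T * p ^ k ≤ # (im? S) B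
      multiplicity-max : ∀ (S : Emb (suc k) n) → (∀ z → fn g (em S z) ≡ 0f) → ∀ j → j * p ^ k ≤ # (im? S) B → j ≤ # (_⊑? S) T

  module Trace {m} (B : List (V (suc m))) {g : Fun (suc m)} (H : Hyperplane g) where

    open Hyperplane H

    in? : ∀ u → Dec (fn g u ≡ 0f)
    in? u = fn g u ≟ 0f

    trace : List (V m)
    trace = map (ap retr) (filter in? B)

    trace-# : ∀ {Y : V m → Set} (Y? : ∀ u → Dec (Y u)) → # Y? trace ≡ # (λ u → in? u ×-dec Y? (ap retr u)) B
    trace-# Y? = trans (∑-map (ap retr) (filter in? B) _) (trans (∑-filter in? B _) (∑-cong B (λ u _ → sym (ind-× (in? u) (Y? (ap retr u))))))

    trace-length : length trace ≡ # in? B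
    trace-length = trans (length-map (ap retr) (filter in? B)) (length-filter in? B)

    trace-element : ∀ {v} → v ∈ trace → ∃ λ u → u ∈ B × em incl v ≡ u
    trace-element j with ∈-map⁻ (ap retr) j
    ... | u , j' , refl = let (j″ , zu) = ∈-filter⁻ in? {xs = B} j' in u , j″ , incl-retr u zu

    trace-nonzero : Nonzero B → Nonzero trace
    trace-nonzero nz v j z = let (u , j' , e) = trace-element j in nz u j' (trans (sym e) (trans (cong (em incl) z) (ap-0 (lin incl))))

    module _ {k i} (nz : Nonzero B) (thin : Thin k i trace) (Ss : List (Emb (suc k) m)) (len : length Ss ≡ i) (dom : ∀ P → ¬ (P ≡ 0v) → # (λ S → im? S P) Ss ≤ # (_∼? P) trace) where

      private
        T : List (Emb (suc k) (suc m))
        T = map (incl ∘E_) Ss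

        inside : ∀ S → S ∈ T → ∀ z → fn g (em S z) ≡ 0f
        inside S j z with ∈-map⁻ (incl ∘E_) j
        ... | S' , _ , refl = in-kernel (em S' z)

        full : ∀ S → S ∈ T → ∀ z → ¬ (z ≡ 0v) → ∃ λ u → u ∈ B × u ∼ em S z
        full S j z nz' with ∈-map⁻ (incl ∘E_) j
        ... | S' , j' , refl = found (#-witness (_∼? em S' z) trace (ℕₚ.≤-trans (#-member (λ S → im? S (em S' z)) j' (z , refl)) (dom (em S' z) (λ e → nz' (injective S' z e)))))
          where
            found : (∃ λ v → v ∈ trace × v ∼ em S' z) → ∃ λ u → u ∈ B × u ∼ em incl (em S' z)
            found (v , jv , s) = let (u , ju , e) = trace-element jv in u , ju , subst (_∼ em incl (em S' z)) e (∼-ap (lin incl) s)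

        module SW (S : Emb (suc k) (suc m)) = SubspaceWeights {B = trace} (trace-nonzero nz) thin (Ss , len , dom) (preimage-subspace (lin incl) (image-subspace S)) (λ v → im? S (em incl v))

        inside-count : ∀ (S : Emb (suc k) (suc m)) → # (SW.inside? S) Ss ≡ # (_⊑? S) T
        inside-count S = trans (#-cong (SW.inside? S) (λ S' → (incl ∘E S') ⊑? S) Ss (λ _ _ h → h) (λ _ _ h → h)) (sym (∑-map (incl ∘E_) Ss _))

        image-trace : ∀ (S : Emb (suc k) (suc m)) → (∀ z → fn g (em S z) ≡ 0f) → # (λ v → im? S (em incl v)) trace ≡ # (im? S) B
        image-trace S h = trans (trace-# (λ v → im? S (em incl v))) (#-cong (λ u → in? u ×-dec im? S (em incl (ap retr u))) (im? S) B
          (λ { u _ (zu , z , e) → z , trans e (incl-retr u zu) }) (λ { u _ (z , refl) → h z , z , sym (incl-retr (em S z) (h z)) }))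

      trace-component : Component k i B g T
      trace-component = record
        { size = trans (length-map (incl ∘E_) Ss) len
        ; inside = inside
        ; full = full
        ; multiplicity-lower = λ S h → ℕₚ.≤-trans (ℕₚ.≤-reflexive (cong (_* p ^ k) (sym (inside-count S)))) (ℕₚ.≤-trans (SW.inside-lower S) (ℕₚ.≤-reflexive (image-trace S h)))
        ; multiplicity-max = λ S h j l → ℕₚ.≤-trans (SW.inside-max S j (ℕₚ.≤-trans l (ℕₚ.≤-reflexive (sym (image-trace S h))))) (ℕₚ.≤-reflexive (inside-count S)) }

  -- Assembling the decompositions of hyperplane sections

  module LiftStep (r k : ℕ) (IH : ∀ t → Solution r k t) (t : ℕ) (t<p : suc (2 * t) ≤ p)
                  (B : List (V (suc (suc r + k)))) (nz : Nonzero B) (fold : Fold k t B) (thin : Thin k t B) where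

    private
      n = suc (suc r + k)

    module At {P : V n} (gp : GoodProjection k B P) where

      open GoodProjection gp

      BA : List (V (suc (suc k)))
      BA = map (ap A) B

      nzA : Nonzero BA
      nzA v j z with ∈-map⁻ (ap A) j
      ... | u , j' , refl = A-nonzero u j' z

      thinA : Thin k t BA
      thinA = thin-map {k = k} {t = t} (ap A) B thin

      hsum : HyperplaneSum t BA
      hsum = hyperplane-sum k t t<p BA nzA (fold-map A B fold) thinA

      module HW = HyperplaneWeights {k} {t} nzA thinA hsum

      f : V (suc (suc k)) → Fun n
      f c = dotF c ∘F A

      w-f : ∀ c → # (λ u → fn (f c) u ≟ 0f) B ≡ HW.w c
      w-f c = sym (∑-map (ap A) B _)

      -- The part of `B` above a hyperplane of the image is `i c`-fold by `hyperplane-fold` and thin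
      -- by `i-thin`, so it falls under the induction hypothesis one dimension lower.
      component : ∀ c → c ∈ points (suc (suc k)) → ∃ λ T → Component k (HW.i c) B (f c) T
      component c jc = build (dotF-nontrivial (points-≢0 jc))
        where
          build : Nontrivial (dotF c) → ∃ λ T → Component k (HW.i c) B (f c) T
          build (v₀ , n₀) = solved (IH (HW.i c) (ℕₚ.≤-trans (s≤s (ℕₚ.*-monoʳ-≤ 2 i≤t)) t<p) trace (trace-nonzero nz) fold′ thin′)
            where
              nt : Nontrivial (f c)
              nt = ap lift v₀ , λ z → n₀ (trans (cong (fn (dotF c)) (sym (A-lift v₀))) z)
              open Trace B (hyperplane (f c) nt)
              fold′ : Fold k (HW.i c) trace
              fold′ φ = ℕₚ.≤-trans (hyperplane-fold r k t t<p B nz fold thin (f c) nt (HW.i c) (ℕₚ.≤-trans (HW.w-lower jc) (ℕₚ.≤-reflexive (sym (w-f c)))) (φ ∘L Hyperplane.retr (hyperplane (f c) nt)))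
                (ℕₚ.≤-reflexive (sym (trace-# (λ v → ap φ v ≟v 0v))))
              thin′ : Thin k (HW.i c) trace
              thin′ = ℕₚ.≤-trans (ℕₚ.≤-reflexive (cong (λ x → suc (2 * x)) (trans trace-length (w-f c)))) (HW.i-thin jc)
              i≤t : HW.i c ≤ t
              i≤t = ℕₚ.≤-trans (ℕₚ.m≤m+n _ _) (ℕₚ.≤-reflexive (HW.i-total c))
              solved : SubspaceSum k (HW.i c) trace → ∃ λ T → Component k (HW.i c) B (f c) T
              solved (Ss , len , dom) = map (Hyperplane.incl (hyperplane (f c) nt) ∘E_) Ss , trace-component nz thin′ Ss len dom

      private abstract
        chosen : ∀ c → ∃ λ T → c ∈ points (suc (suc k)) → Component k (HW.i c) B (f c) T
        chosen c = choose (any? (c ≟v_) (points (suc (suc k))))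
          where
            choose : Dec (c ∈ points (suc (suc k))) → ∃ λ T → c ∈ points (suc (suc k)) → Component k (HW.i c) B (f c) T
            choose (yes j) = proj₁ (component c j) , λ _ → proj₂ (component c j)
            -- A default value: the sums below run over points `c` only.
            choose (no n) = [] , λ j → ⊥-elim (n j)

      T : V (suc (suc k)) → List (Emb (suc k) n)
      T c = proj₁ (chosen c)

      comp : ∀ {c} → c ∈ points (suc (suc k)) → Component k (HW.i c) B (f c) (T c)
      comp {c} j = proj₂ (chosen c) j

      private
        pts = points (suc (suc k))

      SS : List (Emb (suc k) n)
      SS = concatMap T pts

      class-sum : ∀ (g : V (suc (suc k)) → ℕ) → ∑ pts (λ c → g c * HW.i c) ≡ ∑ HW.hs g
      class-sum g = begin
        ∑ pts (λ c → g c * HW.i c) ≡⟨ ∑-cong pts (λ c _ → sym (∑-*ˡ HW.hs (g c) _)) ⟩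
        ∑ pts (λ c → ∑ HW.hs (λ h → g c * ind (h ≟v c))) ≡⟨ ∑-swap pts HW.hs _ ⟩
        ∑ HW.hs (λ h → ∑ pts (λ c → g c * ind (h ≟v c))) ≡⟨ ∑-cong HW.hs (λ h j → trans (∑-cong pts (λ c _ → trans (ℕₚ.*-comm (g c) _) (cong (_* g c) (ind-cong (h ≟v c) (c ≟v h) sym sym)))) (∑-point _≟v_ (points-unique (suc (suc k))) g (proj₁ (proj₂ (proj₂ hsum)) h j))) ⟩
        ∑ HW.hs g ∎
        where open ≡-Reasoning

      SS-length : length SS ≡ t
      SS-length = begin
        length SS ≡⟨ length-∑ SS ⟩
        ∑ SS (λ _ → 1) ≡⟨ ∑-concatMap T pts _ ⟩
        ∑ pts (λ c → ∑ (T c) (λ _ → 1)) ≡⟨ ∑-cong pts (λ c j → trans (sym (length-∑ (T c))) (trans (Component.size (comp j)) (sym (ℕₚ.*-identityˡ _)))) ⟩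
        ∑ pts (λ c → 1 * HW.i c) ≡⟨ class-sum (λ _ → 1) ⟩
        ∑ HW.hs (λ _ → 1) ≡⟨ length-∑ HW.hs ⟨
        length HW.hs ≡⟨ proj₁ (proj₂ hsum) ⟩
        t ∎
        where open ≡-Reasoning

      -- Subspaces through `P` come from hyperplanes through its image, at most `i c` from each, and
      -- the image of `P` has no more weight than `P`. Other points may be identified by `A`, hence
      -- the restriction to `P`.
      dominated-at-P : # (λ S → im? S P) SS ≤ # (_∼? P) B
      dominated-at-P = begin
        # (λ S → im? S P) SS ≡⟨ ∑-concatMap T pts _ ⟩
        ∑ pts (λ c → # (λ S → im? S P) (T c)) ≤⟨ ∑-mono pts (λ c j → cell c j (fn (f c) P ≟ 0f)) ⟩
        ∑ pts (λ c → ind (fn (f c) P ≟ 0f) * HW.i c) ≡⟨ class-sum (λ c → ind (fn (f c) P ≟ 0f)) ⟩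
        # (λ h → fn (dotF h) (ap A P) ≟ 0f) HW.hs ≤⟨ proj₂ (proj₂ (proj₂ hsum)) (ap A P) P-nonzero ⟩
        # (_∼? ap A P) BA ≡⟨ ∑-map (ap A) B _ ⟩
        # (λ u → ap A u ∼? ap A P) B ≤⟨ #-mono (λ u → ap A u ∼? ap A P) (_∼? P) B P-only ⟩
        # (_∼? P) B ∎
        where
          open ℕₚ.≤-Reasoning
          cell : ∀ c → c ∈ pts → (d : Dec (fn (f c) P ≡ 0f)) → # (λ S → im? S P) (T c) ≤ ind d * HW.i c
          cell c j (yes _) = ℕₚ.≤-trans (#-≤-length (λ S → im? S P) (T c)) (ℕₚ.≤-reflexive (trans (Component.size (comp j)) (sym (ℕₚ.*-identityˡ _))))
          cell c j (no n) = ℕₚ.≤-reflexive (#-none (λ S → im? S P) (T c) (λ { S k (z , refl) → n (Component.inside (comp j) S k z) }))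

      lies-in : ∀ {S} → S ∈ SS → ∃ λ c → c ∈ pts × S ∈ T c
      lies-in j = find (∈-concatMap⁻ T {xs = pts} j)

      -- A full subspace is skew to the kernel of A, hence lies in only one of the hyperplanes.
      class-upper : ∀ {S} → S ∈ SS → # (_⊑? S) SS * p ^ k ≤ # (im? S) B
      class-upper {S} j = from-component (lies-in j)
        where
          from-component : (∃ λ c → c ∈ pts × S ∈ T c) → # (_⊑? S) SS * p ^ k ≤ # (im? S) B
          from-component (c₀ , j₀ , jS) = ℕₚ.≤-trans (ℕₚ.≤-reflexive (cong (_* p ^ k) only)) (Component.multiplicity-lower (comp j₀) S (Component.inside (comp j₀) S jS))
            where
              skew : Emb (suc k) (suc (suc k))
              skew .lin = A ∘L lin S
              skew .injective z e = decidable-stable (z ≟v 0v) (λ nz' → let (u , ju , d , eu) = Component.full (comp j₀) S jS z nz' in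
                A-nonzero u ju (trans (cong (ap A) eu) (trans (ap-* A d _) (trans (cong (d *v_) e) (*v-0 d)))))
              -- By dimension `A` maps `S` onto the whole hyperplane `c₀`, so a normalised
              -- functional that vanishes on the image is `c₀`.
              unique-c : ∀ c → c ∈ pts → (∀ z → fn (f c) (em S z) ≡ 0f) → c ≡ c₀
              unique-c c jc van = vanishing-on-kernel jc j₀ (λ u zu → let (y , e) = ⊑-sym {S' = skew} {S = incl} (λ z → ap retr (em skew z) , incl-retr (em skew z) (Component.inside (comp j₀) S jS z)) (ap retr u)
                  in trans (cong (fn (dotF c)) (sym (trans e (incl-retr u zu)))) (van y))
                where open Hyperplane (hyperplane (dotF c₀) (dotF-nontrivial (points-≢0 j₀)))
              only : # (_⊑? S) SS ≡ # (_⊑? S) (T c₀)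
              only = begin
                # (_⊑? S) SS ≡⟨ ∑-concatMap T pts _ ⟩
                ∑ pts (λ c → # (_⊑? S) (T c)) ≡⟨ ∑-cong pts (λ c jc → cell c jc (c ≟v c₀)) ⟩
                ∑ pts (λ c → ind (c ≟v c₀) * # (_⊑? S) (T c)) ≡⟨ ∑-point _≟v_ (points-unique (suc (suc k))) (λ c → # (_⊑? S) (T c)) j₀ ⟩
                # (_⊑? S) (T c₀) ∎
                where
                  open ≡-Reasoning
                  cell : ∀ c → c ∈ pts → (d : Dec (c ≡ c₀)) → # (_⊑? S) (T c) ≡ ind d * # (_⊑? S) (T c)
                  cell c jc (yes _) = sym (ℕₚ.*-identityˡ _)
                  cell c jc (no ne) = #-none (_⊑? S) (T c) (λ S' j' sub → ne (unique-c c jc (λ z → let (y , e) = ⊑-sym {S' = S'} {S = S} sub z in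
                    trans (cong (fn (f c)) (sym e)) (Component.inside (comp jc) S' j' y))))

      private
        transpose : ∀ {b} → Lin b (suc (suc k)) → Lin (suc (suc k)) b
        transpose {zero} φ = zeroL
        transpose {suc b} φ = consL (dotF (ap φ e₀)) (transpose (φ ∘L lin consE))

        transpose-zero : ∀ {b} (φ : Lin b (suc (suc k))) c → ap (transpose φ) c ≡ 0v → ∀ z → fn (dotF c) (ap φ z) ≡ 0f
        transpose-zero {zero} φ c e [] = trans (cong (fn (dotF c)) (ap-0 φ)) (fn-0 (dotF c))
        transpose-zero {suc b} φ c e (x ∷ z) = trans (cong (λ v → fn (dotF c) (ap φ v)) (split-vec x z)) (trans (cong (fn (dotF c)) (ap-+ φ _ _)) (trans (fn-+ (dotF c) _ _)
          (trans (cong₂ _⊕_ (trans (cong (fn (dotF c)) (ap-* φ x e₀)) (trans (fn-* (dotF c) x _) (trans (cong (x ⊗_) (trans (dotF-sym c (ap φ e₀)) (cong hd e))) (R.zeroʳ x)))) (transpose-zero (φ ∘L lin consE) c (cong (ap tailL) e) z)) (R.+-identityʳ 0f))))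

      -- The image of `S` under `A` has dimension at most `suc k`, so some hyperplane of the image
      -- space contains it; it is found as a kernel vector of the transposed map. The component of
      -- that hyperplane counts `S`.
      class-lower : ∀ (S : Emb (suc k) n) j → j * p ^ k ≤ # (im? S) B → j ≤ # (_⊑? S) SS
      class-lower S j l = build (kernel-emb′ {1} (suc k) (cong suc (ℕₚ.+-comm 1 k)) (transpose (A ∘L lin S)))
        where
          build : (∃ λ (ι : Emb 1 (suc (suc k))) → ∀ x → ap (transpose (A ∘L lin S)) (em ι x) ≡ 0v) → j ≤ # (_⊑? S) SS
          build (ι , ker) = at-point (normalise c (λ e → 1≢0 (cong hd (injective ι e₀ e))))
            where
              c = em ι e₀
              at-point : (∃ λ c₁ → c₁ ∈ pts × c ∼ c₁) → j ≤ # (_⊑? S) SS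
              at-point (c₁ , j₁ , s) = begin
                j ≤⟨ Component.multiplicity-max (comp j₁) S van j l ⟩
                # (_⊑? S) (T c₁) ≤⟨ ∑-≤-member pts (λ c → # (_⊑? S) (T c)) j₁ ⟩
                ∑ pts (λ c → # (_⊑? S) (T c)) ≡⟨ ∑-concatMap T pts _ ⟨
                # (_⊑? S) SS ∎
                where
                  open ℕₚ.≤-Reasoning
                  van : ∀ z → fn (f c₁) (em S z) ≡ 0f
                  van z = let (d , e) = ∼-sym (λ e → 1≢0 (cong hd (injective ι e₀ e))) s in
                    trans (cong (λ h → fn (dotF h) (ap A (em S z))) e) (trans (dotF-* d c _) (trans (cong (d ⊗_) (transpose-zero (A ∘L lin S) c (ker e₀) z)) (R.zeroʳ d)))

    private
      -- From `2 |B| + 1 ≤ p ^ suc k`; for empty `B` it comes from `2 ≤ p`.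
      short : suc (suc (length B)) ≤ p ^ suc k
      short = cases (length B) (ℕₚ.≤-trans thin (ℕₚ.*-monoˡ-≤ (p ^ k) t<p))
        where
          cases : ∀ L → suc (2 * L) ≤ p ^ suc k → suc (suc L) ≤ p ^ suc k
          cases zero _ = ℕₚ.≤-trans 1<p (ℕₚ.≤-trans (ℕₚ.≤-reflexive (sym (ℕₚ.*-identityʳ p))) (ℕₚ.*-monoʳ-≤ p (ℕₚ.m^n>0 p {{ℕ.>-nonZero 0<p}} k)))
          cases (suc L) h = ℕₚ.≤-trans (s≤s (s≤s (ℕₚ.≤-trans (s≤s (ℕₚ.m≤m+n L (L + 0))) (ℕₚ.≤-reflexive (sym (ℕₚ.+-suc L (L + 0))))))) h

      gp : ∀ P → ¬ (P ≡ 0v) → GoodProjection k B P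
      gp P nP = good-projection r k B nz P nP short

    -- For every projection the multiplicity of a subspace in the list is the integer part of its
    -- weight divided by `p ^ k`. So the list from one fixed projection agrees with the list adapted
    -- to `P`, and domination at `P` carries over.
    subspace-sum : SubspaceSum k t B
    subspace-sum = A₀.SS , A₀.SS-length , λ P nP → ℕₚ.≤-trans
        (#-classwise _⊑?_ (λ {S} z → z , refl) (λ {S} {S'} → ⊑-sym {S' = S} {S = S'}) (λ {S} {S'} {S″} → ⊑-trans {S = S} {S' = S'} {S″ = S″}) (λ S → im? S P)
          (λ { {S} {S'} h (z , e) → let (y , e') = h z in y , trans e' e }) (length A₀.SS) A₀.SS (At.SS (gp P nP)) ℕₚ.≤-refl
          (λ S j → At.class-lower (gp P nP) S (# (_⊑? S) A₀.SS) (A₀.class-upper j)))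
        (At.dominated-at-P (gp P nP))
      where
        module A₀ = At (gp e₀ (λ e → 1≢0 (cong hd e)))

  -- The general decomposition, the trivial lower bound and meeting subspaces

  idE : ∀ {m} → Emb m m
  idE = record { lin = idL ; injective = λ _ e → e }

  fold-point : ∀ k t (B : List (V (suc k))) → Fold k t B → ∀ P → ¬ (P ≡ 0v) → t ≤ # (_∼? P) B
  fold-point k t B fold P nP = at-point (isoVec P nP)
    where
      at-point : (∃ λ (M : Iso (suc k)) → ap (to M) P ≡ e₀) → t ≤ # (_∼? P) B
      at-point (M , e) = ℕₚ.≤-trans (fold (tailL ∘L to M)) (#-mono (λ u → ap (tailL ∘L to M) u ≟v 0v) (_∼? P) B
        (λ u _ z → ∼-em (isoE M) (subst (ap (to M) u ∼_) (sym e) (axis (ap (to M) u) z))))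

  solution : ∀ r k t → Solution r k t
  -- For `r = 0` single points are blocked, and the only subspace of the required dimension is the
  -- whole space.
  solution zero k t t<p B nz fold thin = replicate t idE , length-replicate t , λ P nP →
      ℕₚ.≤-trans (#-≤-length (λ S → im? S P) (replicate t idE)) (ℕₚ.≤-trans (ℕₚ.≤-reflexive (length-replicate t)) (fold-point k t B fold P nP))
  solution (suc r) k t t<p B nz fold thin = LiftStep.subspace-sum r k (solution r k) t t<p B nz fold thin

  -- Project from missing points until points themselves have to be blocked.
  fold-size : ∀ r k t → t ≤ p → (B : List (V (suc (r + k)))) → Nonzero B → Fold k t B → t * Θ (suc k) ≤ length B
  fold-size zero k t t≤p B nz fold = begin
    t * Θ (suc k) ≡⟨ trans (ℕₚ.*-comm t _) (sym (∑-const (points (suc k)) t)) ⟩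
    ∑ (points (suc k)) (λ _ → t) ≤⟨ ∑-mono (points (suc k)) (λ P j → fold-point k t B fold P (points-≢0 j)) ⟩
    ∑ (points (suc k)) (λ P → # (_∼? P) B) ≡⟨ ∑-swap (points (suc k)) B _ ⟩
    ∑ B (λ u → # (u ∼?_) (points (suc k))) ≡⟨ ∑-cong B (λ u j → point-count u (nz u j)) ⟩
    ∑ B (λ _ → 1) ≡⟨ length-∑ B ⟨
    length B ∎
    where
      open ℕₚ.≤-Reasoning
  fold-size (suc r) k t t≤p B nz fold with any? (λ Q → missing? Q B) (points (suc (suc r + k)))
  ... | yes a = from-centre (find a)
    where
      from-centre : (∃ λ Q → Q ∈ points _ × Missing Q B) → t * Θ (suc k) ≤ length B
      from-centre (Q , j , miss) = ℕₚ.≤-trans (fold-size r k t t≤p (map (ap π) B) (nonzero-project pj B miss) (fold-map π B fold)) (ℕₚ.≤-reflexive (length-map (ap π) B))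
        where
          pj = project Q (points-≢0 j)
          open Projection pj
  ... | no none = begin
      t * Θ (suc k) ≤⟨ ℕₚ.*-monoˡ-≤ (Θ (suc k)) t≤p ⟩
      p * Θ (suc k) ≤⟨ Θ-p (suc k) ⟩
      Θ (suc (suc k)) ≤⟨ Θ-mono (s≤s (s≤s (ℕₚ.m≤n+m k r))) ⟩
      Θ (suc (suc r + k)) ≤⟨ all-present-count idE B nz (λ P j → present P j) ⟩
      # (im? idE) B ≤⟨ #-≤-length (im? idE) B ⟩
      length B ∎
    where
      open ℕₚ.≤-Reasoning
      present : ∀ P → P ∈ points (suc (suc r + k)) → ∃ λ u → u ∈ B × u ∼ P
      present P j with any? (_∼? P) B
      ... | yes a = find a
      ... | no na = ⊥-elim (none (lose j (λ u k s → na (lose k s))))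
      Θ-p : ∀ m → p * Θ m ≤ Θ (suc m)
      Θ-p zero = ℕₚ.≤-trans (ℕₚ.≤-reflexive (ℕₚ.*-zeroʳ p)) z≤n
      Θ-p (suc m) = begin
        p * Θ (suc m) ≡⟨ trans (cong (p *_) (Θ-suc m)) (ℕₚ.*-distribˡ-+ p (p ^ m) (Θ m)) ⟩
        p ^ suc m + p * Θ m ≤⟨ ℕₚ.+-monoʳ-≤ (p ^ suc m) (Θ-p m) ⟩
        p ^ suc m + Θ (suc m) ≡⟨ Θ-suc (suc m) ⟨
        Θ (suc (suc m)) ∎
      Θ-mono : ∀ {a b} → a ≤ b → Θ a ≤ Θ b
      Θ-mono {zero} _ = z≤n
      Θ-mono {suc a} {suc b} (s≤s l) = ℕₚ.≤-trans (ℕₚ.≤-reflexive (Θ-suc a)) (ℕₚ.≤-trans (ℕₚ.+-mono-≤ (ℕₚ.^-monoʳ-≤ p {{ℕ.>-nonZero 0<p}} l) (Θ-mono l)) (ℕₚ.≤-reflexive (sym (Θ-suc b))))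

  joinL : ∀ {a b n} → Lin a n → Lin b n → Lin (a + b) n
  joinL {zero} φ ψ = ψ
  joinL {suc a} φ ψ = outer headF (ap φ e₀) +L joinL (φ ∘L lin consE) ψ ∘L tailL

  joinL-split : ∀ {a b n} (φ : Lin a n) (ψ : Lin b n) u → ∃₂ λ z y → ap (joinL φ ψ) u ≡ ap φ z +v ap ψ y × (z ≡ 0v → y ≡ 0v → u ≡ 0v)
  joinL-split {zero} φ ψ u = [] , u , sym (trans (cong (_+v ap ψ u) (ap-0 φ)) (0-+v _)) , λ _ e → e
  joinL-split {suc a} φ ψ (x ∷ u) = extend (joinL-split (φ ∘L lin consE) ψ u)
    where
      extend : (∃₂ λ z y → ap (joinL (φ ∘L lin consE) ψ) u ≡ ap φ (0f ∷ z) +v ap ψ y × (z ≡ 0v → y ≡ 0v → u ≡ 0v)) →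
               ∃₂ λ z y → x *v ap φ e₀ +v ap (joinL (φ ∘L lin consE) ψ) u ≡ ap φ z +v ap ψ y × (z ≡ 0v → y ≡ 0v → x ∷ u ≡ 0v)
      extend (z , y , e , zero⇒) = x ∷ z , y ,
        trans (cong (x *v ap φ e₀ +v_) e) (trans (sym (+v-assoc _ _ _)) (cong (_+v ap ψ y) (sym (trans (cong (ap φ) (split-vec x z)) (trans (ap-+ φ _ _) (cong (_+v ap φ (0f ∷ z)) (ap-* φ x e₀))))))) ,
        λ ez ey → cong₂ _∷_ (cong hd ez) (zero⇒ (cong (ap tailL) ez) ey)

  -- The joint map from dimension `n + 1` to `n` kills a nonzero pair. Its two parts have opposite
  -- images, and by injectivity these are nonzero.
  subspaces-meet : ∀ {a b n} → a + b ≡ n + 1 → (S : Emb a n) (ι : Emb b n) → ∃ λ Q → Q ∈ points n × (∃ λ z → em S z ≡ Q) × (∃ λ y → em ι y ≡ Q)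
  subspaces-meet {a} {b} {n} dims S ι = build (kernel-emb′ {1} n dims (joinL (lin S) (lin ι)))
    where
      build : (∃ λ (κ : Emb 1 (a + b)) → ∀ x → ap (joinL (lin S) (lin ι)) (em κ x) ≡ 0v) → ∃ λ Q → Q ∈ points n × (∃ λ z → em S z ≡ Q) × (∃ λ y → em ι y ≡ Q)
      build (κ , ker) = common (joinL-split (lin S) (lin ι) (em κ e₀))
        where
          common : (∃₂ λ z y → ap (joinL (lin S) (lin ι)) (em κ e₀) ≡ em S z +v em ι y × (z ≡ 0v → y ≡ 0v → em κ e₀ ≡ 0v)) → ∃ λ Q → Q ∈ points n × (∃ λ z → em S z ≡ Q) × (∃ λ y → em ι y ≡ Q)
          common (z , y , e , zero⇒) = point (normalise (em S z) nS)
            where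
              sum≡0 : em S z +v em ι y ≡ 0v
              sum≡0 = trans (sym e) (ker e₀)
              nS : ¬ (em S z ≡ 0v)
              nS eS = 1≢0 (cong hd (injective κ e₀ (zero⇒ (injective S z eS) (injective ι y (trans (sym (0-+v _)) (trans (cong (_+v em ι y) (sym eS)) sum≡0))))))
              opposite : em ι (-v y) ≡ em S z
              opposite = trans (ap-* (lin ι) (-f 1f) y) (+v-cancelˡ (em ι y) (trans (-v-inverse (em ι y)) (sym (trans (+v-comm (em ι y) (em S z)) sum≡0))))
              point : (∃ λ Q → Q ∈ points n × em S z ∼ Q) → ∃ λ Q → Q ∈ points n × (∃ λ z → em S z ≡ Q) × (∃ λ y → em ι y ≡ Q)
              point (Q , j , s) = let (d , e') = ∼-sym nS s in
                Q , j , (d *v z , trans (ap-* (lin S) d z) (sym e')) , (d *v (-v y) , trans (ap-* (lin ι) d (-v y)) (trans (cong (d *v_) opposite) (sym e')))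

  -- Weighted point sets and minimality

  module Weighted {n : ℕ} (w : V n → ℕ) where

    elementsOf : List (V n)
    elementsOf = concatMap (λ P → replicate (w P) P) (points n)

    ∑-elementsOf : ∀ f → ∑ elementsOf f ≡ ∑ (points n) (λ P → w P * f P)
    ∑-elementsOf f = trans (∑-concatMap (λ P → replicate (w P) P) (points n) f) (∑-cong (points n) (λ P _ → ∑-replicate (w P) P f))

    size≡ : length elementsOf ≡ ∑ (points n) w
    size≡ = trans (length-∑ elementsOf) (trans (∑-elementsOf (λ _ → 1)) (∑-cong (points n) (λ P _ → ℕₚ.*-identityʳ (w P))))

    nonzero : Nonzero elementsOf
    nonzero u j = at-point (find (∈-concatMap⁻ (λ P → replicate (w P) P) {xs = points n} j))
      where
        ∈-replicate : ∀ {P : V n} a → u ∈ replicate a P → u ≡ P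
        ∈-replicate (suc a) (here e) = e
        ∈-replicate (suc a) (there j) = ∈-replicate a j
        at-point : (∃ λ P → P ∈ points n × u ∈ replicate (w P) P) → ¬ (u ≡ 0v)
        at-point (P , jP , jr) = subst (λ v → ¬ (v ≡ 0v)) (sym (∈-replicate (w P) jr)) (points-≢0 jP)

    weight≡ : ∀ {P} → P ∈ points n → # (_∼? P) elementsOf ≡ w P
    weight≡ {P} j = begin
      # (_∼? P) elementsOf ≡⟨ ∑-elementsOf (λ Q → ind (Q ∼? P)) ⟩
      ∑ (points n) (λ Q → w Q * ind (Q ∼? P)) ≡⟨ ∑-cong (points n) (λ Q jQ → trans (ℕₚ.*-comm (w Q) _) (cong (_* w Q) (ind-cong (Q ∼? P) (Q ≟v P) (points-∼⇒≡ jQ j) (λ { refl → ∼-refl })))) ⟩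
      ∑ (points n) (λ Q → ind (Q ≟v P) * w Q) ≡⟨ ∑-point _≟v_ (points-unique n) w j ⟩
      w P ∎
      where open ≡-Reasoning

  Blocks : ∀ {n} → ℕ → ℕ → (V n → ℕ) → Set
  Blocks {n} s t w = ∀ (U : Emb s n) → t ≤ ∑ (points n) (λ P → ind (im? U P) * w P)

  blocks-fold : ∀ {s n} k t → n ≡ k + s → (w : V n → ℕ) → Blocks s t w → Fold k t (Weighted.elementsOf w)
  blocks-fold {s} {n} k t dims w blocks φ = build (kernel-emb′ {s} k dims φ)
    where
      open ℕₚ.≤-Reasoning
      build : (∃ λ (U : Emb s n) → ∀ x → ap φ (em U x) ≡ 0v) → t ≤ # (λ u → ap φ u ≟v 0v) (Weighted.elementsOf w)
      build (U , ker) = begin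
        t ≤⟨ blocks U ⟩
        ∑ (points n) (λ P → ind (im? U P) * w P) ≤⟨ ∑-mono (points n) (λ P _ → ℕₚ.≤-trans (ℕₚ.*-monoˡ-≤ (w P) (ind-mono (im? U P) (ap φ P ≟v 0v) (λ (x , e) → trans (cong (ap φ) (sym e)) (ker x)))) (ℕₚ.≤-reflexive (ℕₚ.*-comm _ (w P)))) ⟩
        ∑ (points n) (λ P → w P * ind (ap φ P ≟v 0v)) ≡⟨ Weighted.∑-elementsOf w (λ u → ind (ap φ u ≟v 0v)) ⟨
        # (λ u → ap φ u ≟v 0v) (Weighted.elementsOf w) ∎

  -- With Θ(k+1) = p^k + Θ k, the trivial lower bound turns the upper bound on the size into 2 t Θ k < p^k ≤ p Θ k.
  small-multiplicity : ∀ k t L → t * Θ (suc (suc k)) ≤ L → suc (2 * L) ≤ suc (2 * t) * p ^ suc k → suc (2 * t) ≤ p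
  small-multiplicity k t L lower upper = ℕₚ.*-cancelʳ-< (p ^ k) (2 * t) p (ℕₚ.+-cancelˡ-< (2 * (t * p ^ suc k)) _ _ (begin-strict
    2 * (t * p ^ suc k) + 2 * t * p ^ k ≡⟨ solve 3 (λ t a b → con 2 :* (t :* a) :+ con 2 :* t :* b := con 2 :* (t :* (a :+ b))) refl t (p ^ suc k) (p ^ k) ⟩
    2 * (t * (p ^ suc k + p ^ k)) ≤⟨ ℕₚ.*-monoʳ-≤ 2 (ℕₚ.*-monoʳ-≤ t (ℕₚ.+-monoʳ-≤ (p ^ suc k) (Θ-≥ k))) ⟩
    2 * (t * (p ^ suc k + Θ (suc k))) ≡⟨ cong (λ x → 2 * (t * x)) (Θ-suc (suc k)) ⟨
    2 * (t * Θ (suc (suc k))) ≤⟨ ℕₚ.*-monoʳ-≤ 2 lower ⟩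
    2 * L <⟨ upper ⟩
    suc (2 * t) * p ^ suc k ≡⟨ solve 2 (λ t a → (con 1 :+ con 2 :* t) :* a := con 2 :* (t :* a) :+ a) refl t (p ^ suc k) ⟩
    2 * (t * p ^ suc k) + p ^ suc k ∎))
    where
      open ℕₚ.≤-Reasoning
      open +-*-Solver

  module _ (r k t : ℕ) (t≤p : t ≤ p) (w : V (suc (r + suc k)) → ℕ) (blocks : Blocks (suc r) t w)
           (thin : suc (2 * ∑ (points (suc (r + suc k))) w) ≤ suc (2 * t) * p ^ suc k) where

    private
      n = suc (r + suc k)
      open Weighted w

    dominated-sum : SubspaceSum (suc k) t elementsOf
    dominated-sum = solution r (suc k) t (small-multiplicity k t (length elementsOf) (fold-size r (suc k) t t≤p elementsOf nonzero fold) thin′) elementsOf nonzero fold thin′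
      where
        fold : Fold (suc k) t elementsOf
        fold = blocks-fold (suc k) t (ℕₚ.+-comm (suc r) (suc k)) w blocks
        thin′ : Thin (suc k) t elementsOf
        thin′ = ℕₚ.≤-trans (ℕₚ.≤-reflexive (cong (λ x → suc (2 * x)) size≡)) thin

    -- A point heavier in `w` than in the sum of subspaces could be decreased, since that sum alone
    -- already blocks: each summand meets each `U`. The decreased weights enter only through their
    -- values at `P` and elsewhere.
    subspace-union : (dec : V n → V n → ℕ) → (∀ P Q → ¬ (P ≡ Q) → dec P Q ≡ w Q) → (∀ P → dec P P ≡ w P ∸ 1) →
      (∀ P → P ∈ points n → 0 < w P → ¬ Blocks (suc r) t (dec P)) →
      ∃ λ (Ss : List (Emb (suc (suc k)) n)) → length Ss ≡ t × (∀ P → P ∈ points n → w P ≡ # (λ S → im? S P) Ss)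
    subspace-union dec dec-≢ dec-≡ minimal = build dominated-sum
      where
        build : SubspaceSum (suc k) t elementsOf → ∃ λ (Ss : List (Emb (suc (suc k)) n)) → length Ss ≡ t × (∀ P → P ∈ points n → w P ≡ # (λ S → im? S P) Ss)
        build (Ss , len , dom) = Ss , len , λ P j → ℕₚ.≤-antisym (ℕₚ.≮⇒≥ (λ l → minimal P j (ℕₚ.≤-trans (s≤s z≤n) l) (still-blocks P l))) (below P j)
          where
            m : V n → ℕ
            m P = # (λ S → im? S P) Ss
            below : ∀ P → P ∈ points n → m P ≤ w P
            below P j = ℕₚ.≤-trans (dom P (points-≢0 j)) (ℕₚ.≤-reflexive (weight≡ j))
            sub : ∀ P → m P < w P → ∀ Q → Q ∈ points n → Dec (P ≡ Q) → m Q ≤ dec P Q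
            sub P l Q j (yes refl) = ℕₚ.≤-trans (ℕₚ.∸-monoˡ-≤ 1 l) (ℕₚ.≤-reflexive (sym (dec-≡ P)))
            sub P l Q j (no ne) = ℕₚ.≤-trans (below Q j) (ℕₚ.≤-reflexive (sym (dec-≢ P Q ne)))
            still-blocks : ∀ P → m P < w P → Blocks (suc r) t (dec P)
            still-blocks P l U = begin
              t ≡⟨ trans (sym len) (length-∑ Ss) ⟩
              ∑ Ss (λ _ → 1) ≤⟨ ∑-mono Ss (λ S _ → meet S (subspaces-meet (cong suc (trans (ℕₚ.+-comm (suc k) (suc r)) (sym (ℕₚ.+-comm (r + suc k) 1)))) S U)) ⟩
              ∑ Ss (λ S → ∑ (points n) (λ Q → ind (im? U Q) * ind (im? S Q))) ≡⟨ ∑-swap Ss (points n) _ ⟩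
              ∑ (points n) (λ Q → ∑ Ss (λ S → ind (im? U Q) * ind (im? S Q))) ≡⟨ ∑-cong (points n) (λ Q _ → ∑-*ˡ Ss (ind (im? U Q)) _) ⟩
              ∑ (points n) (λ Q → ind (im? U Q) * m Q) ≤⟨ ∑-mono (points n) (λ Q j → ℕₚ.*-monoʳ-≤ (ind (im? U Q)) (sub P l Q j (P ≟v Q))) ⟩
              ∑ (points n) (λ Q → ind (im? U Q) * dec P Q) ∎
              where
                open ℕₚ.≤-Reasoning
                meet : ∀ S → (∃ λ Q → Q ∈ points n × (∃ λ z → em S z ≡ Q) × (∃ λ y → em U y ≡ Q)) → 1 ≤ ∑ (points n) (λ Q → ind (im? U Q) * ind (im? S Q))
                meet S (Q , j , inS , inU) = ℕₚ.≤-trans (ℕₚ.≤-reflexive (sym (cong₂ _*_ (ind-yes (im? U Q) inU) (ind-yes (im? S Q) inS)))) (∑-≤-member (points n) (λ Q → ind (im? U Q) * ind (im? S Q)) j)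

  comb : ∀ {d m} → Vec (V m) d → V d → V m
  comb [] [] = 0v
  comb (g ∷ gs) (c ∷ cs) = c *v g +v comb gs cs

  combL : ∀ {d m} → Vec (V m) d → Lin d m
  combL gs .ap = comb gs
  combL [] .ap-+ [] [] = sym (+v-0 0v)
  combL (g ∷ gs) .ap-+ (c ∷ u) (d ∷ v) = trans (cong₂ _+v_ (⊕-*v c d g) (ap-+ (combL gs) u v)) (+v-exchange _ _ _ _)
  combL [] .ap-* c [] = sym (*v-0 c)
  combL (g ∷ gs) .ap-* c (d ∷ u) = trans (cong₂ _+v_ (sym (⊗-*v c d g)) (ap-* (combL gs) c u)) (sym (*v-+v c _ _))

  columns : ∀ {d m} → Lin d m → Vec (V m) d
  columns {zero} φ = []
  columns {suc d} φ = ap φ e₀ ∷ columns (φ ∘L lin consE)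

  comb-columns : ∀ {d m} (φ : Lin d m) u → comb (columns φ) u ≡ ap φ u
  comb-columns {zero} φ [] = sym (ap-0 φ)
  comb-columns {suc d} φ (x ∷ u) = sym (trans (cong (ap φ) (split-vec x u)) (trans (ap-+ φ _ _) (cong₂ _+v_ (ap-* φ x e₀) (sym (comb-columns (φ ∘L lin consE) u)))))

-- Translation to the coordinates of PG(n,p)

sum-map : ∀ {A : Set} (f : A → ℕ) xs → sum (map f xs) ≡ ∑ xs f
sum-map f [] = refl
sum-map f (x ∷ xs) = cong (f x +_) (sum-map f xs)

if-does : ∀ {X Y : Set} (d : Dec X) (e : Dec Y) → (X → Y) → (Y → X) → ∀ x → (if does d then x else 0) ≡ ind e * x
if-does (yes a) e f g x = sym (trans (cong (_* x) (ind-yes e (f a))) (ℕₚ.*-identityˡ x))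
if-does (no n) e f g x = sym (cong (_* x) (ind-no e (λ y → n (g y))))

module ProjectiveSpace (p : ℕ) .{{nz : NonZero p}} (pr : Prime p) where

  open FiniteGeometry (PrimeFieldOf.primeField p pr) renaming (p to q)

  q≡p : q ≡ p
  q≡p = length-tabulate (λ i → i)

  vadd≡ : ∀ {m} (u v : V m) → D.vadd p u v ≡ u +v v
  vadd≡ [] [] = refl
  vadd≡ (x ∷ u) (y ∷ v) = cong (_ ∷_) (vadd≡ u v)

  vscale≡ : ∀ {m} c (u : V m) → D.vscale p c u ≡ c *v u
  vscale≡ c [] = refl
  vscale≡ c (x ∷ u) = cong (_ ∷_) (vscale≡ c u)

  lincomb≡ : ∀ {m d} (gs : Vec (V m) d) c → D.lincomb p gs c ≡ comb gs c
  lincomb≡ [] [] = refl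
  lincomb≡ (g ∷ gs) (c ∷ cs) = trans (vadd≡ _ _) (cong₂ _+v_ (vscale≡ c g) (lincomb≡ gs cs))

  allVecs≡ : ∀ m → D.allVecs p m ≡ vecs m
  allVecs≡ zero = refl
  allVecs≡ (suc m) = cong (λ vs → concatMap (λ x → map (x ∷_) vs) (List.allFin p)) (allVecs≡ m)

  points≡ : ∀ m → D.points p m ≡ points m
  points≡ zero = refl
  points≡ (suc m) = cong₂ (λ vs ps → map (1f ∷_) vs ++ map (0f ∷_) ps) (allVecs≡ m) (points≡ m)

  normalised⇒∈ : ∀ {m} (P : V m) → D.Normalised p P → P ∈ points m
  normalised⇒∈ (x ∷ v) (inj₁ refl) = ∈-++⁺ˡ (∈-map⁺ _ (vecs-complete v))
  normalised⇒∈ {suc m} (x ∷ v) (inj₂ (refl , h)) = ∈-++⁺ʳ (map (1f ∷_) (vecs m)) (∈-map⁺ _ (normalised⇒∈ v h))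

  ∈⇒normalised : ∀ {m} (P : V m) → P ∈ points m → D.Normalised p P
  ∈⇒normalised {suc m} P j = cases (∈-++⁻ (map (1f ∷_) (vecs m)) j)
    where
      cases : _ → D.Normalised p P
      cases (inj₁ a) with ∈-map⁻ (1f ∷_) a
      ... | v , _ , refl = inj₁ refl
      cases (inj₂ b) with ∈-map⁻ (0f ∷_) b
      ... | v , j' , refl = inj₂ (refl , ∈⇒normalised v j')

  span⇒image : ∀ {m d} (U : Emb d m) {gs} → (∀ c → comb gs c ≡ em U c) → ∀ {P} → D.InSpan p gs P → ∃ λ c → em U c ≡ P
  span⇒image U {gs} e a = let (c , _ , h) = find a in c , trans (sym (e c)) (trans (sym (lincomb≡ gs c)) h)

  image⇒span : ∀ {m d} (U : Emb d m) {gs} → (∀ c → comb gs c ≡ em U c) → ∀ {P} → (∃ λ c → em U c ≡ P) → D.InSpan p gs P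
  image⇒span {d = d} U {gs} e (c , h) = lose (subst (c ∈_) (sym (allVecs≡ d)) (vecs-complete c)) (trans (lincomb≡ gs c) (trans (e c) h))

  basis : ∀ {m d} → Emb d m → Vec (V m) d
  basis U = columns (lin U)

  basis-independent : ∀ {m d} (U : Emb d m) → D.LinIndep p (basis U)
  basis-independent U c e = injective U c (trans (sym (comb-columns (lin U) c)) (trans (sym (lincomb≡ (basis U) c)) e))

  spanE : ∀ {m d} (gs : Vec (V m) d) → D.LinIndep p gs → Emb d m
  spanE gs independent = record { lin = combL gs ; injective = λ c e → independent c (trans (lincomb≡ gs c) e) }

  weightIn≡ : ∀ {n d} (w : V (suc n) → ℕ) (U : Emb d (suc n)) gs → (∀ c → comb gs c ≡ em U c) →
    D.weightIn p n w gs ≡ ∑ (points (suc n)) (λ P → ind (im? U P) * w P)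
  weightIn≡ {n} w U gs e = begin
    D.weightIn p n w gs ≡⟨ sum-map _ (D.points p (suc n)) ⟩
    ∑ (D.points p (suc n)) (λ P → if does (D.inSpan? p gs P) then w P else 0) ≡⟨ cong (λ xs → ∑ xs _) (points≡ (suc n)) ⟩
    ∑ (points (suc n)) (λ P → if does (D.inSpan? p gs P) then w P else 0) ≡⟨ ∑-cong (points (suc n)) (λ P _ → if-does (D.inSpan? p gs P) (im? U P) (span⇒image U {gs} e) (image⇒span U {gs} e) (w P)) ⟩
    ∑ (points (suc n)) (λ P → ind (im? U P) * w P) ∎
    where open ≡-Reasoning

  blocking⇒blocks : ∀ {n k s t} (w : V (suc n) → ℕ) → n ∸ k ≡ s → D.IsBlocking p n k t w → Blocks (suc s) t w
  blocking⇒blocks w refl blocking U = ℕₚ.≤-trans (blocking (basis U) (basis-independent U)) (ℕₚ.≤-reflexive (weightIn≡ w U (basis U) (comb-columns (lin U))))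

  blocks⇒blocking : ∀ {n k s t} (w : V (suc n) → ℕ) → n ∸ k ≡ s → Blocks (suc s) t w → D.IsBlocking p n k t w
  blocks⇒blocking w refl blocks gs independent = ℕₚ.≤-trans (blocks (spanE gs independent)) (ℕₚ.≤-reflexive (sym (weightIn≡ w (spanE gs independent) gs (λ _ → refl))))

  decrease-≢ : ∀ {n} w P Q → ¬ (P ≡ Q) → D.decrease p n w P Q ≡ w Q
  decrease-≢ w P Q ne with ≡-dec _≟ᶠ_ P Q
  ... | yes e = ⊥-elim (ne e)
  ... | no _ = refl

  decrease-≡ : ∀ {n} w P → D.decrease p n w P P ≡ w P ∸ 1
  decrease-≡ w P with ≡-dec _≟ᶠ_ P P
  ... | yes _ = refl
  ... | no ne = ⊥-elim (ne refl)

  multiplicity≡ : ∀ {m d} (Ss : List (Emb d m)) P → D.multiplicity p (Vec.map basis (Vec.fromList Ss)) P ≡ # (λ S → im? S P) Ss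
  multiplicity≡ [] P = refl
  multiplicity≡ (S ∷ Ss) P = cong₂ _+_ (trans (if-does (D.inSpan? p (basis S) P) (im? S P) (span⇒image S {basis S} (comb-columns (lin S))) (image⇒span S {basis S} (comb-columns (lin S))) 1) (ℕₚ.*-identityʳ _)) (multiplicity≡ Ss P)

  bases-independent : ∀ {m d} (Ss : List (Emb d m)) → VAll (D.LinIndep p) (Vec.map basis (Vec.fromList Ss))
  bases-independent [] = []
  bases-independent (S ∷ Ss) = basis-independent S ∷ bases-independent Ss

  -- From `3 p + 8 < 8 (p + 1)`. This is the hypothesis of `fold-size`, from which the sharper
  -- `2 t + 1 ≤ p` is derived.
  t≤p : ∀ t → 8 * t ≤ 3 * p + 8 → t ≤ p
  t≤p t l = ℕₚ.≮⇒≥ (λ p<t → ℕₚ.<-irrefl refl (begin-strict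
    3 * p + 8 <⟨ ℕₚ.+-monoˡ-< 8 (ℕₚ.*-monoˡ-< p {3} {8} (s≤s (s≤s (s≤s (s≤s z≤n))))) ⟩
    8 * p + 8 ≡⟨ trans (ℕₚ.+-comm (8 * p) 8) (sym (ℕₚ.*-suc 8 p)) ⟩
    8 * suc p ≤⟨ ℕₚ.*-monoʳ-≤ 8 p<t ⟩
    8 * t ≤⟨ l ⟩
    3 * p + 8 ∎))
    where open ℕₚ.≤-Reasoning

  decomposition : ∀ r k t n → n ≡ r + suc k → 8 * t ≤ 3 * p + 8 → (w : D.WPS p n) → D.IsMinimalBlocking p n (suc k) t w →
    2 * D.size p n w ≤ (2 * t + 1) * p ^ suc k ∸ 1 →
    ∃ λ (S : Vec (Vec (V (suc n)) (suc (suc k))) t) → VAll (D.LinIndep p) S × (∀ P → D.Normalised p P → w P ≡ D.multiplicity p S P)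
  decomposition r k t n refl small w (blocking , minimal) bound =
      convert (subspace-union r k t (subst (t ≤_) (sym q≡p) (t≤p t small)) w (blocking⇒blocks {k = suc k} w n∸k blocking) thin
        (D.decrease p n w) (decrease-≢ w) (decrease-≡ w) (λ P j l blocks → minimal P (∈⇒normalised P j) l (blocks⇒blocking {k = suc k} (D.decrease p n w P) n∸k blocks)))
    where
      n∸k : n ∸ suc k ≡ r
      n∸k = ℕₚ.m+n∸n≡m r (suc k)
      thin : suc (2 * ∑ (points (suc n)) w) ≤ suc (2 * t) * q ^ suc k
      thin = begin
        suc (2 * ∑ (points (suc n)) w) ≡⟨ cong (λ xs → suc (2 * ∑ xs w)) (points≡ (suc n)) ⟨
        suc (2 * ∑ (D.points p (suc n)) w) ≡⟨ cong (λ x → suc (2 * x)) (sum-map w (D.points p (suc n))) ⟨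
        suc (2 * D.size p n w) ≤⟨ s≤s bound ⟩
        -- The product is positive, so the truncated subtraction loses nothing.
        suc ((2 * t + 1) * p ^ suc k ∸ 1) ≡⟨ ℕₚ.m+[n∸m]≡n {1} (ℕₚ.*-mono-≤ (ℕₚ.m≤n+m 1 (2 * t)) (ℕₚ.m^n>0 p (suc k))) ⟩
        (2 * t + 1) * p ^ suc k ≡⟨ cong₂ (λ a b → a * b ^ suc k) (ℕₚ.+-comm (2 * t) 1) (sym q≡p) ⟩
        suc (2 * t) * q ^ suc k ∎
        where open ℕₚ.≤-Reasoning
      convert : (∃ λ (Ss : List (Emb (suc (suc k)) (suc n))) → length Ss ≡ t × (∀ P → P ∈ points (suc n) → w P ≡ # (λ S → im? S P) Ss)) →
        ∃ λ (S : Vec (Vec (V (suc n)) (suc (suc k))) t) → VAll (D.LinIndep p) S × (∀ P → D.Normalised p P → w P ≡ D.multiplicity p S P)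
      convert (Ss , refl , equal) = Vec.map basis (Vec.fromList Ss) , bases-independent Ss , λ P h → trans (equal P (normalised⇒∈ P h)) (sym (multiplicity≡ Ss P))

open import Defs
open import Data.Nat using (ℕ; suc; _+_; _*_; _∸_; _^_; _≤_; NonZero)
open import Data.Nat.Primality using (Prime)
open import Data.Vec using (Vec)
open import Data.Vec.Relation.Unary.All using (All)
open import Data.Product using (Σ; _×_)
open import Relation.Binary.PropositionalEquality using (_≡_)

theorem1p9 : (p : ℕ) .{{_ : NonZero p}} → Prime p →
    (n k t : ℕ) → 2 ≤ n → 1 ≤ k → k ≤ n ∸ 1 → 1 ≤ t → 8 * t ≤ 3 * p + 8 →
    (w : WPS p n) → IsMinimalBlocking p n k t w →
    2 * size p n w ≤ (2 * t + 1) * p ^ k ∸ 1 →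
    Σ (Vec (Vec (Vec (F p) (suc n)) (suc k)) t) λ S →
    All (LinIndep p) S ×
    (∀ P → Normalised p P → w P ≡ multiplicity p S P)
theorem1p9 p pr n (suc k) t _ _ k≤n-1 _ =
  ProjectiveSpace.decomposition p pr (n ∸ suc k) k t n (sym (ℕₚ.m∸n+n≡m (ℕₚ.≤-trans k≤n-1 (ℕₚ.m∸n≤m n 1))))
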